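{- Let $\mathcal P$ be a path in $G_\lambda$ starting at the root, containing no fall, and ending at the vertex $(\mathbb T,\zeta,v,\sigma)$. Then $P_{\mathcal P}$ is a simultaneous eigenfunction of $\Xi_1,\dots,\Xi_N$ with $P_{\mathcal P}\Xi_i=\zeta_iP_{\mathcal P}$ for $1\le i\le N$. Consequently $P_{\mathcal P}$ depends only on the end point, and is denoted $P_{v,\mathbb T}$; the family $(P_{v,\mathbb T})$, $(\mathbb T,v)\in\mathrm{Tab}_\lambda\times\mathbb N_0^N$, is a basis of $\mathcal M_\lambda$ consisting of simultaneous eigenfunctions of the $\Xi_i$.
   Context: $N\ge2$, $q,s$ indeterminates, $K=\mathbb C(q,s)$. Operators act on the right, composed left to right. $\mathcal H_N(s)$ is generated by $T_1,\dots,T_{N-1}$ with $(T_i+1)(T_i-s)=0$ and braid relations. $\lambda$ is a partition of $N$ (French convention, rows numbered bottom to top); $\mathrm{Tab}_\lambda$ = reverse standard tableaux (bijective fillings by $1,\dots,N$ strictly decreasing left to right in rows and bottom to top in columns); $\mathrm{CT}_{\mathbb T}[i]$ = column minus row of the cell of $i$; $\mathbb T^{(i,j)}$ is the filling with $i,j$ exchanged. $V_\lambda$ has basis $\mathrm{Tab}_\lambda$ with right action $\mathbb TT_i=s\mathbb T$ if $i,i+1$ share a row, $-\mathbb T$ if they share a column, and if $i$ is in a higher row than $i+1$, with $m=\mathrm{CT}_{\mathbb T}[i+1]-\mathrm{CT}_{\mathbb T}[i]>0$, $\mathbb TT_i=\frac{s-1}{1-s^m}\mathbb T+\frac{s(1-s^{m+1})(1-s^{m-1})}{(1-s^m)^2}\mathbb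 T^{(i,i+1)}$; the remaining case is determined by this formula for $\mathbb T^{(i,i+1)}$ and the quadratic relation. $\mathcal M_\lambda=K[x_1,\dots,x_N]\otimes V_\lambda$; with $p^{s_i}$ = $p$ with $x_i,x_{i+1}$ exchanged: $(p\otimes u)\mathbf T_i=(1-s)\frac{x_{i+1}(p-p^{s_i})}{x_i-x_{i+1}}\otimes u+p^{s_i}\otimes uT_i$, $(p\otimes u)\mathbf w=p(qx_N,x_1,\dots,x_{N-1})\otimes uT_1\cdots T_{N-1}$, $\mathbf T_i^{ -1}=s^{ -1}(\mathbf T_i+1-s)$, $\Xi_i=s^{i-N}\mathbf T_{i-1}^{ -1}\cdots\mathbf T_1^{ -1}\mathbf w\mathbf T_{N-1}\cdots\mathbf T_i$, and $\boldsymbol\Phi:=\mathbf T_1^{ -1}\cdots\mathbf T_{N-1}^{ -1}x_N$ (apply the inverses, then multiply by $x_N$). Tableaux are identified with constants $1\otimes\mathbb T$. Yang–Baxter graph $G_\lambda$. $\mathbb T_\lambda\in\mathrm{Tab}_\lambda$ is obtained by writing $N,N-1,\dots,1$ row by row, starting with the bottom row, left to right in each row. For a vector $u$, $us_i$ is $u$ with entries $i,i+1$ exchanged. For a datum $X=(\mathbb T,\zeta,v,\sigma)$ ($\mathbb T\in\mathrm{Tab}_\lambda$, $\zeta\in K^N$, $v\in\mathbb N_0^N$, $\sigma=(\sigma_1,\dots,\sigma_N)$ a permutation word) set $Xs_i=(\mathbb T,\zeta s_i,vs_i,\sigma s_i)$ if $v_i\ne v_{i+1}$; $Xs_i=(\mathbb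 T^{(\sigma_i,\sigma_{i+1})},\zeta s_i,v,\sigma)$ if $v_i=v_{i+1}$ and $\mathbb T^{(\sigma_i,\sigma_{i+1})}\in\mathrm{Tab}_\lambda$; $Xs_i=X$ otherwise; and $X\Psi=(\mathbb T,(\zeta_2,\dots,\zeta_N,q\zeta_1),(v_2,\dots,v_N,v_1+1),(\sigma_2,\dots,\sigma_N,\sigma_1))$. The root is $(\mathbb T_\lambda,(s^{\mathrm{CT}_{\mathbb T_\lambda}[1]},\dots,s^{\mathrm{CT}_{\mathbb T_\lambda}[N]}),(0,\dots,0),(1,\dots,N))$; $G_\lambda$ consists of the data reachable from the root by the following arrows, plus a vertex $\emptyset$. From $X=(\mathbb T,\zeta,v,\sigma)$: an arrow labelled $\Psi$ to $X\Psi$; an arrow labelled $s_i$ to $Xs_i$ if $v_i<v_{i+1}$, or if $v_i=v_{i+1}$, $\mathbb T^{(\sigma_i,\sigma_{i+1})}\in\mathrm{Tab}_\lambda$ and $\mathrm{CT}_{\mathbb T}[\sigma_i]-\mathrm{CT}_{\mathbb T}[\sigma_{i+1}]\ge2$; and an arrow labelled $s_i$ to $\emptyset$ (a fall) if $Xs_i=X$. A path is a finite sequence of consecutive arrows starting at the root. It is known that each $(\mathbb T,v)\in\mathrm{Tab}_\lambda\times\mathbb N_0^N$ occurs as first and third components of exactly one vertex, whose spectral vector is $\zeta_i=q^{v_i}s^{\mathrm{CT}_{\mathbb T}[r_v[i]]}$, where $r_v[i]=\#\{j\le i:v_j\ge v_i\}+\#\{j>i:v_j>v_i\}$. Polynomials: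 $P_{[\,]}=\mathbb T_\lambda$; if $\mathcal P=[a_1,\dots,a_{k-1},s_i]$ and $[a_1,\dots,a_{k-1}]$ ends at a vertex with second component $\zeta$, then $P_{\mathcal P}=P_{[a_1,\dots,a_{k-1}]}\bigl(\mathbf T_i+\frac{1-s}{1-\zeta_{i+1}/\zeta_i}\bigr)$; if $\mathcal P=[a_1,\dots,a_{k-1},\Psi]$ then $P_{\mathcal P}=P_{[a_1,\dots,a_{k-1}]}\boldsymbol\Phi$.
   Formalization: With the row-by-row root no arrow ever changes the tableau (e.g. λ=(2,1)), so most P_{v,T} would be undefined; eigenfunction and end-point claims are proved for every root tableau, and each (T,v) is reached from the root filled column by column. ℂ is any field. -}

module Defs where

open import Algebra.Bundles using (CommutativeRing)
open import Algebra.Morphism.Structures using (module RingMorphisms)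
open import Data.Empty using (⊥)
open import Data.Fin.Base as Fin using (Fin; inject₁; toℕ; fromℕ)
import Data.Fin.Properties as Fin
open import Data.Fin.Permutation.Components using (transpose; transpose-inverse)
open import Data.Integer.Base as ℤ using (ℤ; +_; -[1+_])
open import Data.List.Base as List using (List; []; _∷_; _++_; concatMap; foldl; allFin; upTo; filter; reverse)
open import Data.List.Relation.Unary.All using (All)
open import Data.List.Relation.Unary.Linked using (Linked)
open import Data.Nat.Base as ℕ using (ℕ; zero; suc; _∸_)
import Data.Nat.Properties as ℕ
open import Data.Product.Base using (_×_; _,_; proj₁; proj₂; ∃; map₁; map₂)
import Data.Product.Properties as Product
open import Data.Sum.Base using (_⊎_; inj₁; inj₂)
open import Data.Unit.Base using (⊤)
open import Data.Vec.Base as Vec using (Vec; lookup; tabulate; replicate; head; tail; _∷ʳ_; _[_]≔_; updateAt)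
import Data.Vec.Properties as Vec
open import Function.Base using (_∘_)
open import Level using (Level; _⊔_) renaming (suc to lsuc)
open import Relation.Binary.Definitions using (DecidableEquality)
open import Relation.Binary.PropositionalEquality using (_≡_; _≢_; refl; sym; trans; cong; cong₂; subst; subst₂)
open import Relation.Nullary using (¬_; Dec; yes; no; contradiction)
open import Relation.Nullary.Decidable using (_×-dec_; _→-dec_; map′)

private variable
  a b d : Level
  A : Set a
  B : Set b
  D : Set d
  N n : ℕ

-- As usual in formalised algebra the inverse is total: 0# ⁻¹ is an
-- unspecified element.
record Field c ℓ : Set (lsuc (c ⊔ ℓ)) where
  infix 9 _⁻¹
  field
    commutativeRing : CommutativeRing c ℓ
  open CommutativeRing commutativeRing public
  field
    _⁻¹        : Carrier → Carrier
    ⁻¹-cong    : ∀ {x y} → x ≈ y → x ⁻¹ ≈ y ⁻¹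
    ⁻¹-inverse : ∀ {x} → ¬ (x ≈ 0#) → x * x ⁻¹ ≈ 1#
    1≉0        : ¬ (1# ≈ 0#)

  open import Algebra.Properties.Semiring.Exp semiring public using (_^_)

  infixr 8 _^ᶻ_
  _^ᶻ_ : Carrier → ℤ → Carrier
  x ^ᶻ (+ m)    = x ^ m
  x ^ᶻ -[1+ m ] = (x ⁻¹) ^ suc m

-- Finite formal linear combinations of elements of B, i.e. the free module on
-- B. A basis element may be listed several times, so equality compares the
-- total coefficients.
module Combinations {c ℓ} (R : CommutativeRing c ℓ) where
  open CommutativeRing R

  Comb : Set a → Set (c ⊔ a)
  Comb B = List (Carrier × B)

  ⟨_⟩ : B → Comb B
  ⟨ b ⟩ = (1# , b) ∷ []

  infixl 6 _⊕_
  _⊕_ : Comb B → Comb B → Comb B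
  _⊕_ = _++_

  infixr 7 _•_
  _•_ : Carrier → Comb B → Comb B
  k • f = List.map (map₁ (k *_)) f

  coeff : DecidableEquality B → Comb B → B → Carrier
  coeff _≟_ []            b = 0#
  coeff _≟_ ((k , b′) ∷ f) b with b ≟ b′
  ... | yes _ = k + coeff _≟_ f b
  ... | no  _ = coeff _≟_ f b

  linear : (B → Comb D) → Comb B → Comb D
  linear φ = concatMap λ (k , b) → k • φ b

  evaluate : (B → Carrier) → Comb B → Carrier
  evaluate φ []            = 0#
  evaluate φ ((k , b) ∷ f) = k * φ b + evaluate φ f

-- K = C(q,s), with an arbitrary field C in the role of ℂ: an extension field of
-- C generated by two elements that are algebraically independent over C. A
-- polynomial in q, s is a combination of pairs (i , j) standing for q ^ i * s ^ j.
record RationalFunctionField {c ℓ} (C : Field c ℓ) k ℓk : Set (lsuc (k ⊔ ℓk) ⊔ c ⊔ ℓ) where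
  field
    K : Field k ℓk
  private
    module C = Field C
  open Field K
  open RingMorphisms C.rawRing rawRing using (IsRingHomomorphism)
  open Combinations C.commutativeRing using (Comb; coeff)
  field
    ι                  : C.Carrier → Carrier
    ι-isRingHomomorphism : IsRingHomomorphism ι
    q s                : Carrier

  at-qs : Comb (ℕ × ℕ) → Carrier
  at-qs p = Combinations.evaluate commutativeRing (λ (i , j) → q ^ i * s ^ j)
              (List.map (map₁ ι) p)

  field
    independent : ∀ p → at-qs p ≈ 0# →
                  ∀ ij → coeff (Product.≡-dec ℕ._≟_ ℕ._≟_) p ij C.≈ C.0#
    generated   : ∀ z → ∃ λ p → ∃ λ r → ¬ (at-qs r ≈ 0#) × z * at-qs r ≈ at-qs p

exchange : Fin N → Fin N → Vec A N → Vec A N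
exchange i j u = tabulate (lookup u ∘ transpose i j)

infixl 8 _s[_]
_s[_] : Vec A (suc n) → Fin n → Vec A (suc n)
u s[ i ] = exchange (inject₁ i) (Fin.suc i) u

rotate : Vec A (suc n) → (A → A) → Vec A (suc n)
rotate u f = tail u ∷ʳ f (head u)

-- parts lists the row lengths from the bottom row to the top row.
record Partition (N : ℕ) : Set where
  field
    parts      : List ℕ
    decreasing : Linked ℕ._≥_ parts
    positive   : All (ℕ._> 0) parts
    size       : List.sum parts ≡ N

-- (column , row), both counted from 0.
Cell : Set
Cell = ℕ × ℕ

rowLength : List ℕ → ℕ → ℕ
rowLength []       r       = 0
rowLength (l ∷ ls) zero    = l
rowLength (l ∷ ls) (suc r) = rowLength ls r

_∈ᶜ_ : Cell → Partition N → Set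
(c , r) ∈ᶜ lam = c ℕ.< rowLength (Partition.parts lam) r

-- A bijective filling is recorded by the position of each entry; the element k
-- of Fin N stands for the entry toℕ k + 1. The proofs are irrelevant, so that
-- two fillings are equal as soon as their positions agree.
record Filling {N} (lam : Partition N) : Set where
  constructor mkFilling
  field
    cell        : Vec Cell N
    .inShape    : ∀ k → lookup cell k ∈ᶜ lam
    .injective  : ∀ j k → lookup cell j ≡ lookup cell k → j ≡ k
    .surjective : ∀ x → x ∈ᶜ lam → ∃ λ k → lookup cell k ≡ x

  col row : Fin N → ℕ
  col k = proj₁ (lookup cell k)
  row k = proj₂ (lookup cell k)

  CT : Fin N → ℤ
  CT k = col k ℤ.⊖ row k

open Filling public using (cell; col; row; CT)

IsReverseStandard : {lam : Partition N} → Filling lam → Set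
IsReverseStandard {N} T =
    (∀ (j k : Fin N) → row T j ≡ row T k → col T j ℕ.< col T k → k Fin.< j)
  × (∀ (j k : Fin N) → col T j ≡ col T k → row T j ℕ.< row T k → k Fin.< j)

isReverseStandard? : {lam : Partition N} (T : Filling lam) → Dec (IsReverseStandard T)
isReverseStandard? T =
  (Fin.all? λ j → Fin.all? λ k → (row T j ℕ.≟ row T k) →-dec ((col T j ℕ.<? col T k) →-dec (k Fin.<? j)))
  ×-dec
  (Fin.all? λ j → Fin.all? λ k → (col T j ℕ.≟ col T k) →-dec ((row T j ℕ.<? row T k) →-dec (k Fin.<? j)))

transpose-injective : (i j : Fin N) {k l : Fin N} → transpose i j k ≡ transpose i j l → k ≡ l
transpose-injective i j eq =
  trans (sym (transpose-inverse j i)) (trans (cong (transpose j i) eq) (transpose-inverse j i))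

exchangeᶠ : {lam : Partition N} → Fin N → Fin N → Filling lam → Filling lam
exchangeᶠ {N} {lam} i j (mkFilling p inS inj sur) = mkFilling p′
    (λ k → subst (_∈ᶜ lam) (sym (look k)) (inS (transpose i j k)))
    (λ k l eq → transpose-injective i j (inj _ _ (trans (sym (look k)) (trans eq (look l)))))
    (λ x x∈ → let (k , eq) = sur x x∈ in transpose j i k ,
       trans (look (transpose j i k)) (trans (cong (lookup p) (transpose-inverse i j)) eq))
  where
  p′ : Vec Cell N
  p′ = exchange i j p
  look : ∀ k → lookup p′ k ≡ lookup p (transpose i j k)
  look = Vec.lookup∘tabulate (lookup p ∘ transpose i j)

record Tab {N} (lam : Partition N) : Set where
  constructor mkTab
  field
    filling            : Filling lam
    .isReverseStandard : IsReverseStandard filling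

open Tab public using (filling)

_≟ᵀ_ : {lam : Partition N} → DecidableEquality (Tab lam)
T ≟ᵀ T′ = map′ (ext T T′) (cong (cell ∘ filling))
               (Vec.≡-dec (Product.≡-dec ℕ._≟_ ℕ._≟_) (cell (filling T)) (cell (filling T′)))
  where
  ext : ∀ T T′ → cell (filling T) ≡ cell (filling T′) → T ≡ T′
  ext (mkTab (mkFilling _ _ _ _) _) (mkTab (mkFilling _ _ _ _) _) refl = refl

-- N, N-1, …, 1 are written column by column, starting with the leftmost column,
-- from bottom to top in each column. This is the root from which every tableau
-- is reached: a jump below requires σ_i to be in a lower row than σ_{i+1}, and
-- in the row-by-row tableau no jump is ever available.
ColumnByColumn : {lam : Partition N} → Tab lam → Set
ColumnByColumn {N} T = ∀ (j k : Fin N) → k Fin.< j →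
    col (filling T) j ℕ.< col (filling T) k
  ⊎ (col (filling T) j ≡ col (filling T) k × row (filling T) j ℕ.< row (filling T) k)

transpose-cases : (i j k : Fin N) → (k ≡ i × transpose i j k ≡ j)
                                 ⊎ (k ≡ j × transpose i j k ≡ i)
                                 ⊎ (k ≢ i × k ≢ j × transpose i j k ≡ k)
transpose-cases i j k with k Fin.≟ i
... | yes k≡i = inj₁ (k≡i , refl)
... | no  k≢i with k Fin.≟ j
...   | yes k≡j = inj₂ (inj₁ (k≡j , refl))
...   | no  k≢j = inj₂ (inj₂ (k≢i , k≢j , refl))

transpose-adjacent : (i : Fin n) (k j : Fin (suc n)) →
  let τ = transpose (inject₁ i) (Fin.suc i) in
  τ k Fin.< τ j → k Fin.< j ⊎ (τ k ≡ inject₁ i × τ j ≡ Fin.suc i)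
transpose-adjacent i k j lt
  with transpose-cases (inject₁ i) (Fin.suc i) k | transpose-cases (inject₁ i) (Fin.suc i) j
... | inj₁ (_ , p)                   | inj₁ (_ , p′) rewrite p | p′ = contradiction lt (ℕ.<-irrefl refl)
... | inj₁ (_ , p)                   | inj₂ (inj₁ (_ , p′)) rewrite p | p′ | Fin.toℕ-inject₁ i =
        contradiction lt (ℕ.<-asym (ℕ.n<1+n _))
... | inj₁ (refl , p)                | inj₂ (inj₂ (_ , _ , p′)) rewrite p | p′ | Fin.toℕ-inject₁ i =
        inj₁ (ℕ.<-trans (ℕ.n<1+n _) lt)
... | inj₂ (inj₁ (_ , p))            | inj₁ (_ , p′) = inj₂ (p , p′)
... | inj₂ (inj₁ (_ , p))            | inj₂ (inj₁ (_ , p′)) rewrite p | p′ = contradiction lt (ℕ.<-irrefl refl)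
... | inj₂ (inj₁ (refl , p))         | inj₂ (inj₂ (_ , j≢ , p′)) rewrite p | p′ | Fin.toℕ-inject₁ i =
        inj₁ (ℕ.≤∧≢⇒< lt (λ eq → j≢ (sym (Fin.toℕ-injective eq))))
... | inj₂ (inj₂ (k≢ , _ , p))       | inj₁ (refl , p′) rewrite p | p′ =
        inj₁ (ℕ.≤∧≢⇒< (subst (toℕ k ℕ.≤_) (sym (Fin.toℕ-inject₁ i)) (ℕ.≤-pred lt))
                     (λ eq → k≢ (Fin.toℕ-injective eq)))
... | inj₂ (inj₂ (_ , _ , p))        | inj₂ (inj₁ (refl , p′)) rewrite p | p′ | Fin.toℕ-inject₁ i =
        inj₁ (ℕ.<-trans lt (ℕ.n<1+n _))
... | inj₂ (inj₂ (_ , _ , p))        | inj₂ (inj₂ (_ , _ , p′)) rewrite p | p′ = inj₁ lt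

exchange-reverseStandard : {lam : Partition (suc n)} (T : Filling lam) (i : Fin n) →
  row T (inject₁ i) ≢ row T (Fin.suc i) → col T (inject₁ i) ≢ col T (Fin.suc i) →
  IsReverseStandard T → IsReverseStandard (exchangeᶠ (inject₁ i) (Fin.suc i) T)
exchange-reverseStandard {n} {lam} T i row≢ col≢ (inRows , inCols) =
    (λ j k eq lt → order row row≢ (subst₂ _≡_ (look proj₂ j) (look proj₂ k) eq)
       (inRows (τ j) (τ k) (subst₂ _≡_ (look proj₂ j) (look proj₂ k) eq)
                           (subst₂ ℕ._<_ (look proj₁ j) (look proj₁ k) lt)))
  , (λ j k eq lt → order col col≢ (subst₂ _≡_ (look proj₁ j) (look proj₁ k) eq)
       (inCols (τ j) (τ k) (subst₂ _≡_ (look proj₁ j) (look proj₁ k) eq)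
                           (subst₂ ℕ._<_ (look proj₂ j) (look proj₂ k) lt)))
  where
  τ : Fin (suc n) → Fin (suc n)
  τ = transpose (inject₁ i) (Fin.suc i)
  look : (f : Cell → ℕ) → ∀ k → f (lookup (tabulate (lookup (cell T) ∘ τ)) k) ≡ f (lookup (cell T) (τ k))
  look f k = cong f (Vec.lookup∘tabulate (lookup (cell T) ∘ τ) k)
  order : (f : Filling lam → Fin (suc n) → ℕ) → f T (inject₁ i) ≢ f T (Fin.suc i) →
          ∀ {j k} → f T (τ j) ≡ f T (τ k) → τ k Fin.< τ j → k Fin.< j
  order f f≢ {j} {k} eq lt with transpose-adjacent i k j lt
  ... | inj₁ k<j     = k<j
  ... | inj₂ (p , r) = contradiction (trans (cong (f T) (sym p)) (trans (sym eq) (cong (f T) r))) f≢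

module Macdonald {c ℓ k ℓk} {C : Field c ℓ} (𝕂 : RationalFunctionField C k ℓk)
                 {n : ℕ} (lam : Partition (suc n)) where

  open RationalFunctionField 𝕂 using (K; q; s)
  open Field K
  open Combinations commutativeRing public

  Tab-lam : Set
  Tab-lam = Tab lam

  -- The exponents of x₁, …, x_N.
  Monomial : Set
  Monomial = Vec ℕ (suc n)

  Poly : Set k
  Poly = Comb Monomial

  V : Set k
  V = Comb Tab-lam

  -- K[x₁,…,x_N] ⊗ V_λ, with basis the x^a ⊗ 𝕋.
  M : Set k
  M = Comb (Monomial × Tab-lam)

  infixl 8 _⊗_
  _⊗_ : Poly → V → M
  p ⊗ u = linear (λ a → linear (λ T → ⟨ a , T ⟩) u) p

  infix 4 _≈ᴹ_
  _≈ᴹ_ : M → M → Set ℓk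
  f ≈ᴹ g = ∀ b → coeff _≟ᴮ_ f b ≈ coeff _≟ᴮ_ g b
    where
    _≟ᴮ_ : DecidableEquality (Monomial × Tab-lam)
    _≟ᴮ_ = Product.≡-dec (Vec.≡-dec ℕ._≟_) _≟ᵀ_

  IsBasis : (Monomial × Tab-lam → M) → Set (k ⊔ ℓk)
  IsBasis b = (∀ f → linear b f ≈ᴹ [] → f ≈ᴹ [])
            × (∀ g → ∃ λ f → linear b f ≈ᴹ g)

  -- Operators act on the right and a product is applied from its first factor
  -- on, hence the left folds below. For i : Fin n, T[ i ] is T_{toℕ i + 1}.

  -- m is CT[i+1] - CT[i]. If T T_i = α T + γ T′ and T′ T_i = α′ T′ + γ′ T, where
  -- T′ is T with i, i+1 exchanged, then (T_i + 1)(T_i - s) = 0 amounts to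
  -- α + α′ = s - 1 and γ γ′ = s + α α′. With i higher in T, α and γ as
  -- given, this leaves α′ = (s - 1)/(1 - s^-m) and γ′ = 1.
  _T[_] : Tab-lam → Fin n → V
  T@(mkTab F rs) T[ i ] with row F (inject₁ i) ℕ.≟ row F (Fin.suc i)
  ... | yes _ = s • ⟨ T ⟩
  ... | no row≢ with col F (inject₁ i) ℕ.≟ col F (Fin.suc i)
  ...   | yes _   = (- 1#) • ⟨ T ⟩
  ...   | no col≢ = ((s - 1#) * (1# - s ^ᶻ m) ⁻¹) • ⟨ T ⟩ ⊕ γ • ⟨ T′ ⟩
    where
    m : ℤ
    m = CT F (Fin.suc i) ℤ.- CT F (inject₁ i)
    T′ : Tab-lam
    T′ = mkTab (exchangeᶠ (inject₁ i) (Fin.suc i) F) (exchange-reverseStandard F i row≢ col≢ rs)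
    γ : Carrier
    γ with row F (Fin.suc i) ℕ.<? row F (inject₁ i)
    ... | yes _ = s * (1# - s ^ᶻ (m ℤ.+ + 1)) * (1# - s ^ᶻ (m ℤ.- + 1)) * ((1# - s ^ᶻ m) ^ 2) ⁻¹
    ... | no  _ = 1#

  x[_]·_ : Fin (suc n) → Poly → Poly
  x[ j ]· p = List.map (map₂ λ a → updateAt a j suc) p

  -- (x^a - x^(a s_i)) / (x_i - x_{i+1}): with α = a_i and β = a_{i+1}, the quotient of
  -- x^α y^β - x^β y^α by x - y is the sum over k < α - β of x^(α-1-k) y^(β+k) if
  -- α ≥ β, and minus the sum over k < β - α of x^(β-1-k) y^(α+k) if α ≤ β.
  ∂[_] : Fin n → Monomial → Poly
  ∂[ i ] a = List.map (λ k →   1# , at (α ∸ 1 ∸ k) (β ℕ.+ k)) (upTo (α ∸ β))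
           ⊕ List.map (λ k → - 1# , at (β ∸ 1 ∸ k) (α ℕ.+ k)) (upTo (β ∸ α))
    where
    α β : ℕ
    α = lookup a (inject₁ i)
    β = lookup a (Fin.suc i)
    at : ℕ → ℕ → Monomial
    at d e = a [ inject₁ i ]≔ d [ Fin.suc i ]≔ e

  𝐓 : Fin n → M → M
  𝐓 i = linear λ (a , T) →
    (1# - s) • (x[ Fin.suc i ]· ∂[ i ] a ⊗ ⟨ T ⟩) ⊕ ⟨ a s[ i ] ⟩ ⊗ (T T[ i ])

  𝐓⁻¹ : Fin n → M → M
  𝐓⁻¹ i f = s ⁻¹ • (𝐓 i f ⊕ (1# - s) • f)

  -- p(q x_N, x₁, …, x_{N-1}) for p = x^a is q^a₁ x₁^a₂ ⋯ x_{N-1}^a_N x_N^a₁.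
  𝐰 : M → M
  𝐰 = linear λ (a , T) →
    q ^ head a • ⟨ rotate a (λ e → e) ⟩ ⊗ foldl (λ u i → linear (_T[ i ]) u) ⟨ T ⟩ (allFin n)

  -- Here toℕ i + 1 is the index of Ξ, so that the exponent of s is toℕ i - n.
  Ξ : Fin (suc n) → M → M
  Ξ i f = s ^ᶻ (toℕ i ℤ.⊖ n) •
          foldl (λ g j → 𝐓 j g) (𝐰 (foldl (λ g j → 𝐓⁻¹ j g) f below)) notBelow
    where
    below notBelow : List (Fin n)
    below    = reverse (filter (λ j → toℕ j ℕ.<? toℕ i) (allFin n))
    notBelow = reverse (filter (λ j → toℕ i ℕ.≤? toℕ j) (allFin n))

  Φ : M → M
  Φ f = List.map (map₂ (map₁ λ a → updateAt a (fromℕ n) suc))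
                 (foldl (λ g j → 𝐓⁻¹ j g) f (allFin n))

  IsSimultaneousEigenfunction : Vec Carrier (suc n) → M → Set ℓk
  IsSimultaneousEigenfunction ζ f = ¬ (f ≈ᴹ []) × (∀ i → Ξ i f ≈ᴹ lookup ζ i • f)

  record Datum : Set k where
    constructor mkDatum
    field
      tab : Tab-lam
      ζ   : Vec Carrier (suc n)
      v   : Vec ℕ (suc n)
      σ   : Vec (Fin (suc n)) (suc n)

    tab^ : Fin n → Filling lam
    tab^ i = exchangeᶠ (lookup σ (inject₁ i)) (lookup σ (Fin.suc i)) (filling tab)

  open Datum public

  _·s[_] : Datum → Fin n → Datum
  X ·s[ i ] with lookup (v X) (inject₁ i) ℕ.≟ lookup (v X) (Fin.suc i) | isReverseStandard? (tab^ X i)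
  ... | no  _ | _      = mkDatum (tab X) (ζ X s[ i ]) (v X s[ i ]) (σ X s[ i ])
  ... | yes _ | yes rs = mkDatum (mkTab (tab^ X i) rs) (ζ X s[ i ]) (v X) (σ X)
  ... | yes _ | no  _  = X

  _·Ψ : Datum → Datum
  X ·Ψ = mkDatum (tab X) (rotate (ζ X) (q *_)) (rotate (v X) suc) (rotate (σ X) (λ j → j))

  infix 4 _≈ᴰ_
  _≈ᴰ_ : Datum → Datum → Set ℓk
  X ≈ᴰ Y = tab X ≡ tab Y × (∀ j → lookup (ζ X) j ≈ lookup (ζ Y) j) × v X ≡ v Y × σ X ≡ σ Y

  -- Any tableau may serve as the root; Path T below consists of the paths starting
  -- at rootAt T.
  rootAt : Tab-lam → Datum
  rootAt T = mkDatum T (tabulate λ j → s ^ᶻ CT (filling T) j) (replicate (suc n) 0) (Vec.allFin (suc n))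

  data Vertex : Set k where
    datum : Datum → Vertex
    ∅     : Vertex

  data Label : Set where
    𝐬 : Fin n → Label
    Ψ : Label

  data Arrow (X : Datum) : Label → Vertex → Set (k ⊔ ℓk) where
    affine : Arrow X Ψ (datum (X ·Ψ))
    step   : ∀ {i} → lookup (v X) (inject₁ i) ℕ.< lookup (v X) (Fin.suc i) →
             Arrow X (𝐬 i) (datum (X ·s[ i ]))
    jump   : ∀ {i} → lookup (v X) (inject₁ i) ≡ lookup (v X) (Fin.suc i) →
             IsReverseStandard (tab^ X i) →
             + 2 ℤ.≤ CT (filling (tab X)) (lookup (σ X) (inject₁ i))
                       ℤ.- CT (filling (tab X)) (lookup (σ X) (Fin.suc i)) →
             Arrow X (𝐬 i) (datum (X ·s[ i ]))
    fall   : ∀ {i} → X ·s[ i ] ≈ᴰ X → Arrow X (𝐬 i) ∅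

  infixl 5 _▷_
  data Path (T : Tab-lam) : Vertex → Set (k ⊔ ℓk) where
    []  : Path T (datum (rootAt T))
    _▷_ : ∀ {X l Y} → Path T (datum X) → Arrow X l Y → Path T Y

  NoFall : ∀ {T Y} → Path T Y → Set
  NoFall []           = ⊤
  NoFall (p ▷ fall _) = ⊥
  NoFall (p ▷ affine) = NoFall p
  NoFall (p ▷ step _) = NoFall p
  NoFall (p ▷ jump _ _ _) = NoFall p

  𝐏 : ∀ {T Y} → Path T Y → M
  𝐏 {T} []                  = ⟨ replicate (suc n) 0 , T ⟩
  𝐏 (_▷_ {l = Ψ} p _)       = Φ (𝐏 p)
  𝐏 (_▷_ {X} {l = 𝐬 i} p _) =
    𝐓 i (𝐏 p) ⊕ ((1# - s) * (1# - lookup (ζ X) (Fin.suc i) * lookup (ζ X) (inject₁ i) ⁻¹) ⁻¹) • 𝐏 p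

-- Each arrow multiplies by Φ or by an intertwiner T_i + ratio ζ_i ζ_{i+1}. In the double
-- affine Hecke algebra generated by the T_i, w and x_N, ΦΞ_i = Ξ_{i+1}Φ for i < N and
-- ΦΞ_N = qΞ_1Φ, and the intertwiner exchanges ζ_i and ζ_{i+1}, so eigenfunctions go to
-- eigenfunctions. One canonical path to every (v, T) defines P v T, which is nonzero because
-- Φ is injective and the intertwiners with v_i ≠ v_{i+1} are invertible. That the other
-- paths give the same polynomial is shown by induction on |v| and then on a potential
-- lowered by swaps: every step applied to P v T yields a multiple of the canonical
-- polynomial at its end, with factor 1 along the arrows of the graph. This takes the far
-- commutations, the Yang–Baxter equation, ΦT_i = T_{i+1}Φ and ΦΦT_{N-1} = T_1ΦΦ.
-- The P v T are independent because contents determine a tableau, so that their spectral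
-- vectors differ. Their span contains the constants and is stable under the T_i and Φ,
-- hence under multiplication by x_N and then by every x_i, so it is everything.
module Submission where

open import Algebra.Bundles using (CommutativeRing; Monoid)
open import Algebra.Morphism.Structures using (module RingMorphisms)
import Algebra.Properties.Ring as RingProperties
import Algebra.Properties.Semiring.Exp as SemiringExp
import Algebra.Properties.Semiring.Mult.TCOptimised as SemiringMult
import Algebra.Solver.Monoid as MonoidSolver
import Algebra.Solver.Ring as RingSolver
open import Algebra.Solver.Ring.AlmostCommutativeRing using (fromCommutativeRing; _-Raw-AlmostCommutative⟶_)
open import Data.Empty using (⊥; ⊥-elim)
open import Data.Fin.Base as Fin using (Fin; inject₁; toℕ; fromℕ; fromℕ<)
open import Data.Fin.Induction using (<-weakInduction; >-weakInduction; >-wellFounded)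
open import Data.Fin.Patterns using (0F; 1F; 2F; 3F; 4F; 5F)
open import Data.Fin.Permutation.Components using (transpose)
import Data.Fin.Properties as Fin
open import Data.Fin.Relation.Unary.Top using (view; ‵inject₁; ‵fromℕ)
open import Data.Integer.Base as ℤ using (ℤ; +_; -[1+_])
import Data.Integer.Properties as ℤ
import Data.Integer.Solver as ℤ
open import Data.List.Base as List using (List; []; _∷_; _++_; applyUpTo; foldl; reverse; filter; allFin)
open import Data.List.Membership.Propositional using (_∈_)
import Data.List.Properties as List
open import Data.List.Relation.Unary.Any using (here; there)
open import Data.List.Relation.Unary.Linked as Linked using (Linked)
import Data.Maybe.Base
open import Data.Nat.Base as ℕ using (ℕ; zero; suc; _∸_)
import Data.Nat.Properties as ℕ
import Data.Nat.Solver as ℕ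
open import Data.Product.Base using (_×_; _,_; proj₁; proj₂; ∃; map₁; map₂)
import Data.Product.Properties as Product
open import Data.Sum.Base using (_⊎_; inj₁; inj₂)
open import Data.Unit.Polymorphic.Base using (⊤)
open import Data.Vec.Base as Vec using (Vec; []; _∷_; lookup; head; tail; replicate; _∷ʳ_; updateAt; _[_]≔_)
import Data.Vec.Properties as Vec
open import Defs
open import Function.Base using (_∘_; id)
open import Induction.WellFounded as WF using ()
open import Level using (Level; _⊔_)
open import Relation.Binary.Bundles using (Setoid)
open import Relation.Binary.Definitions using (DecidableEquality; tri<; tri≈; tri>)
open import Relation.Binary.PropositionalEquality as ≡ using (_≡_; _≢_)
import Relation.Binary.Reasoning.Setoid as SetoidReasoning
open import Relation.Nullary using (¬_; Dec; yes; no; contradiction; recompute)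
open import Relation.Nullary.Decidable using (_×-dec_; dec⇒maybe)

-- The Hecke relations for the T_i are not part of the definitions. On V_λ they are obtained
-- backwards: T_i + ratio only exchanges two cells up to a scalar, so the Yang-Baxter equation can
-- be read off from cells, and the braid relation follows from it. On M a relation is carried from f
-- to f x_k. Moving x_k through a word in T_i, T_{i+1} replaces some letters T by T + (1 - s), which
-- is again an instance of Yang-Baxter, now with parameters 0 and 1 - s. Swaps of equal entries
-- force multiples into the induction on canonical polynomials. The exchanged filling may fail to be
-- standard, and then the coefficient is 0; or it may lie against the direction of the arrows, and
-- then the coefficient is not 1. Arguments that pass through several swaps therefore carry a
-- coefficient and never divide by it. Equality of scalars is undecidable. Hence "f is nonzero" is
-- strengthened to "a f = 0 forces a = 0", which is what the proof of independence consumes.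

-- The ring solver with integer coefficients, so that it sees cancellations in a
-- ring whose equality is undecidable.
module IntegerSolver {c ℓ} (R : CommutativeRing c ℓ) where
  open CommutativeRing R
  open RingProperties ring
  open SemiringMult semiring using (×-homo-+; ×1-homo-*; 1+×) renaming (_×_ to _·ⁿ_)
  open SetoidReasoning setoid

  private
    ⟦_⟧ᶻ : ℤ → Carrier
    ⟦ + m ⟧ᶻ      = m ·ⁿ 1#
    ⟦ -[1+ m ] ⟧ᶻ = - (suc m ·ⁿ 1#)

    cancel-1 : ∀ x y → (1# + x) - (1# + y) ≈ x - y
    cancel-1 x y = begin
      (1# + x) - (1# + y)       ≈⟨ +-cong (+-comm 1# x) (sym (-‿+-comm 1# y)) ⟩
      (x + 1#) + (- 1# + - y)   ≈⟨ +-assoc x 1# _ ⟩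
      x + (1# + (- 1# + - y))   ≈⟨ +-congˡ (sym (+-assoc 1# _ _)) ⟩
      x + ((1# + - 1#) + - y)   ≈⟨ +-congˡ (+-congʳ (-‿inverseʳ 1#)) ⟩
      x + (0# + - y)            ≈⟨ +-congˡ (+-identityˡ _) ⟩
      x - y                     ∎

    ⊖-homo : ∀ m n → ⟦ m ℤ.⊖ n ⟧ᶻ ≈ m ·ⁿ 1# - n ·ⁿ 1#
    ⊖-homo m       zero    = sym (trans (+-congˡ -0#≈0#) (+-identityʳ _))
    ⊖-homo zero    (suc n) = sym (+-identityˡ _)
    ⊖-homo (suc m) (suc n) = begin
      ⟦ suc m ℤ.⊖ suc n ⟧ᶻ         ≡⟨ ≡.cong ⟦_⟧ᶻ (ℤ.[1+m]⊖[1+n]≡m⊖n m n) ⟩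
      ⟦ m ℤ.⊖ n ⟧ᶻ                 ≈⟨ ⊖-homo m n ⟩
      m ·ⁿ 1# - n ·ⁿ 1#            ≈⟨ cancel-1 _ _ ⟨
      (1# + m ·ⁿ 1#) - (1# + n ·ⁿ 1#)  ≈⟨ +-cong (1+× m 1#) (-‿cong (1+× n 1#)) ⟨
      suc m ·ⁿ 1# - suc n ·ⁿ 1#    ∎

    neg-homo : ∀ i → ⟦ ℤ.- i ⟧ᶻ ≈ - ⟦ i ⟧ᶻ
    neg-homo (+ zero)  = sym -0#≈0#
    neg-homo (+ suc m) = refl
    neg-homo -[1+ m ]  = sym (-‿involutive _)

    add-homo : ∀ i j → ⟦ i ℤ.+ j ⟧ᶻ ≈ ⟦ i ⟧ᶻ + ⟦ j ⟧ᶻ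
    add-homo (+ m)    (+ n)    = ×-homo-+ 1# m n
    add-homo (+ m)    -[1+ n ] = ⊖-homo m (suc n)
    add-homo -[1+ m ] (+ n)    = trans (⊖-homo n (suc m)) (+-comm _ _)
    add-homo -[1+ m ] -[1+ n ] = trans
      (-‿cong (trans (reflexive (≡.cong (_·ⁿ 1#) (≡.sym (ℕ.+-suc (suc m) n)))) (×-homo-+ 1# (suc m) (suc n))))
      (sym (-‿+-comm _ _))

    ⁺*-homo : ∀ m j → ⟦ + m ℤ.* j ⟧ᶻ ≈ ⟦ + m ⟧ᶻ * ⟦ j ⟧ᶻ
    ⁺*-homo m (+ n)    = trans (reflexive (≡.cong ⟦_⟧ᶻ (≡.sym (ℤ.pos-* m n)))) (×1-homo-* m n)
    ⁺*-homo m -[1+ n ] = begin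
      ⟦ + m ℤ.* -[1+ n ] ⟧ᶻ            ≡⟨ ≡.cong ⟦_⟧ᶻ (≡.sym (ℤ.neg-distribʳ-* (+ m) (+ suc n))) ⟩
      ⟦ ℤ.- (+ m ℤ.* + suc n) ⟧ᶻ       ≈⟨ neg-homo (+ m ℤ.* + suc n) ⟩
      - ⟦ + m ℤ.* + suc n ⟧ᶻ           ≈⟨ -‿cong (⁺*-homo m (+ suc n)) ⟩
      - (⟦ + m ⟧ᶻ * ⟦ + suc n ⟧ᶻ)      ≈⟨ -‿distribʳ-* _ _ ⟩
      ⟦ + m ⟧ᶻ * ⟦ -[1+ n ] ⟧ᶻ         ∎

    mul-homo : ∀ i j → ⟦ i ℤ.* j ⟧ᶻ ≈ ⟦ i ⟧ᶻ * ⟦ j ⟧ᶻ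
    mul-homo (+ m)    j = ⁺*-homo m j
    mul-homo -[1+ m ] j = begin
      ⟦ -[1+ m ] ℤ.* j ⟧ᶻ              ≡⟨ ≡.cong ⟦_⟧ᶻ (≡.sym (ℤ.neg-distribˡ-* (+ suc m) j)) ⟩
      ⟦ ℤ.- (+ suc m ℤ.* j) ⟧ᶻ         ≈⟨ neg-homo (+ suc m ℤ.* j) ⟩
      - ⟦ + suc m ℤ.* j ⟧ᶻ             ≈⟨ -‿cong (⁺*-homo (suc m) j) ⟩
      - (⟦ + suc m ⟧ᶻ * ⟦ j ⟧ᶻ)        ≈⟨ -‿distribˡ-* _ _ ⟩
      ⟦ -[1+ m ] ⟧ᶻ * ⟦ j ⟧ᶻ           ∎

    morphism : ℤ.+-*-rawRing -Raw-AlmostCommutative⟶ fromCommutativeRing R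
    morphism = record
      { ⟦_⟧ = ⟦_⟧ᶻ ; +-homo = add-homo ; *-homo = mul-homo ; -‿homo = neg-homo
      ; 0-homo = refl ; 1-homo = refl }

  open RingSolver ℤ.+-*-rawRing (fromCommutativeRing R) morphism
    (λ i j → Data.Maybe.Base.map (λ eq → reflexive (≡.cong ⟦_⟧ᶻ eq)) (dec⇒maybe (i ℤ.≟ j)))
    public using (solve; Polynomial; _:=_; _:+_; _:*_; _:-_; :-_; con; var)

  :1 :0 : ∀ {m} → Polynomial m
  :1 = con (+ 1)
  :0 = con (+ 0)

-- Finite combinations up to equality of coefficients, and linear maps between them.

record DecEq (B : Set) : Set where
  field _≟_ : DecidableEquality B

module LinearMaps {c ℓ} (R : CommutativeRing c ℓ) where
  open CommutativeRing R
  open Combinations R using (Comb; ⟨_⟩; coeff; linear; evaluate)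
  open IntegerSolver R
  open DecEq ⦃ ... ⦄

  private variable
    A B D : Set

  private module Lists = Combinations R

  -- Opaque, so that the arguments can be inferred from a sum or a multiple.
  infixl 6 _⊕_
  infixr 7 _•_
  opaque
    _⊕_ : Comb B → Comb B → Comb B
    _⊕_ = Lists._⊕_

    _•_ : Carrier → Comb B → Comb B
    _•_ = Lists._•_

  coeffᵈ : ⦃ DecEq B ⦄ → Comb B → B → Carrier
  coeffᵈ = coeff _≟_

  infix 4 _≋_
  -- A record instead of a function type, so that `f` and `g` can be recovered by unification from
  -- `f ≋ g`.
  record _≋_ ⦃ _ : DecEq B ⦄ (f g : Comb B) : Set ℓ where
    constructor pointwise
    field at : ∀ b → coeffᵈ f b ≈ coeffᵈ g b
  open _≋_ public

  ≋-setoid : (B : Set) ⦃ _ : DecEq B ⦄ → Setoid c ℓ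
  ≋-setoid B = record
    { Carrier = Comb B ; _≈_ = _≋_
    ; isEquivalence = record
      { refl  = pointwise λ b → refl
      ; sym   = λ p → pointwise λ b → sym (at p b)
      ; trans = λ p r → pointwise λ b → trans (at p b) (at r b) } }

  module _ ⦃ _ : DecEq B ⦄ where
    open Setoid (≋-setoid B) public using ()
      renaming (refl to ≋-refl; sym to ≋-sym; trans to ≋-trans; reflexive to ≋-reflexive)

    opaque
      unfolding _⊕_
      coeff-⊕ : ∀ (f g : Comb B) b → coeffᵈ (f ⊕ g) b ≈ coeffᵈ f b + coeffᵈ g b
      coeff-⊕ []             g b = sym (+-identityˡ _)
      coeff-⊕ ((k , b′) ∷ f) g b with b ≟ b′
      ... | yes _ = trans (+-congˡ (coeff-⊕ f g b)) (sym (+-assoc k _ _))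
      ... | no  _ = coeff-⊕ f g b

      coeff-• : ∀ k (f : Comb B) b → coeffᵈ (k • f) b ≈ k * coeffᵈ f b
      coeff-• k []              b = sym (zeroʳ k)
      coeff-• k ((k′ , b′) ∷ f) b with b ≟ b′
      ... | yes _ = trans (+-congˡ (coeff-• k f b)) (sym (distribˡ k k′ _))
      ... | no  _ = coeff-• k f b

    coeff-here : ∀ k b (f : Comb B) → coeffᵈ ((k , b) ∷ f) b ≈ k + coeffᵈ f b
    coeff-here k b f with b ≟ b
    ... | yes _  = refl
    ... | no  b≢ = contradiction ≡.refl b≢

    coeff-there : ∀ k {b b′} (f : Comb B) → b ≢ b′ → coeffᵈ ((k , b′) ∷ f) b ≈ coeffᵈ f b
    coeff-there k {b} {b′} f ≢ with b ≟ b′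
    ... | yes b≡ = contradiction b≡ ≢
    ... | no  _  = refl

    ⊕-cong : ∀ {f f′ g g′ : Comb B} → f ≋ f′ → g ≋ g′ → f ⊕ g ≋ f′ ⊕ g′
    ⊕-cong {f} {f′} {g} {g′} p r = pointwise λ b →
      trans (coeff-⊕ f g b) (trans (+-cong (at p b) (at r b)) (sym (coeff-⊕ f′ g′ b)))

    •-cong : ∀ {k k′} {f f′ : Comb B} → k ≈ k′ → f ≋ f′ → k • f ≋ k′ • f′
    •-cong {k} {k′} {f} {f′} p r = pointwise λ b →
      trans (coeff-• k f b) (trans (*-cong p (at r b)) (sym (coeff-• k′ f′ b)))

    opaque
      unfolding _⊕_
      -- The bridge from the list operations of the definitions to their opaque copies.
      ⊕-lists : ∀ {f f′ g g′ : Comb B} → f ≋ f′ → g ≋ g′ → f Lists.⊕ g ≋ f′ ⊕ g′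
      ⊕-lists = ⊕-cong

      •-lists : ∀ {k k′} {f f′ : Comb B} → k ≈ k′ → f ≋ f′ → k Lists.• f ≋ k′ • f′
      •-lists = •-cong

    ∷-⊕ : ∀ k (b : B) f → (k , b) ∷ f ≋ k • ⟨ b ⟩ ⊕ f
    ∷-⊕ k b f = ≋-trans (pointwise same) (⊕-lists (•-lists refl ≋-refl) ≋-refl)
      where
      same : ∀ b′ → coeffᵈ ((k , b) ∷ f) b′ ≈ coeffᵈ ((k * 1# , b) ∷ f) b′
      same b′ with b′ ≟ b
      ... | yes _ = +-congʳ (sym (*-identityʳ k))
      ... | no  _ = refl

    -- Collecting the occurrences of a basis element makes a list shorter.
    remove : B → Comb B → Comb B
    remove b []             = []
    remove b ((k , b′) ∷ f) with b ≟ b′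
    ... | yes _ = remove b f
    ... | no  _ = (k , b′) ∷ remove b f

    remove-length : ∀ b f → List.length (remove b f) ℕ.≤ List.length f
    remove-length b []             = ℕ.z≤n
    remove-length b ((k , b′) ∷ f) with b ≟ b′
    ... | yes _ = ℕ.m≤n⇒m≤1+n (remove-length b f)
    ... | no  _ = ℕ.s≤s (remove-length b f)

    coeff-remove-≡ : ∀ b f → coeffᵈ (remove b f) b ≈ 0#
    coeff-remove-≡ b []             = refl
    coeff-remove-≡ b ((k , b′) ∷ f) with b ≟ b′
    ... | yes _ = coeff-remove-≡ b f
    ... | no b≢ with b ≟ b′
    ...   | yes b≡ = contradiction b≡ b≢
    ...   | no  _  = coeff-remove-≡ b f

    coeff-remove-≢ : ∀ b f b″ → b″ ≢ b → coeffᵈ (remove b f) b″ ≈ coeffᵈ f b″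
    coeff-remove-≢ b []             b″ ≢ = refl
    coeff-remove-≢ b ((k , b′) ∷ f) b″ ≢ with b ≟ b′ | b″ ≟ b′ in eq
    ... | yes ≡.refl | yes b≡ = contradiction b≡ ≢
    ... | yes _      | no  _  = coeff-remove-≢ b f b″ ≢
    ... | no  _      | yes p  rewrite eq = +-congˡ (coeff-remove-≢ b f b″ ≢)
    ... | no  _      | no  p  rewrite eq = coeff-remove-≢ b f b″ ≢

    evaluate-remove : ∀ (φ : B → Carrier) b f →
      evaluate φ f ≈ coeffᵈ f b * φ b + evaluate φ (remove b f)
    evaluate-remove φ b []             = sym (trans (+-identityʳ _) (zeroˡ _))
    evaluate-remove φ b ((k , b′) ∷ f) with b ≟ b′
    ... | yes ≡.refl = trans (+-congˡ (evaluate-remove φ b f))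
           (solve 4 (λ k x y z → (k :* x) :+ (y :* x :+ z) := (k :+ y) :* x :+ z) refl k (φ b) _ _)
    ... | no  _      = trans (+-congˡ (evaluate-remove φ b f))
           (solve 3 (λ x y z → x :+ (y :+ z) := y :+ (x :+ z)) refl _ _ _)

    -- Zero coefficients do not make the list empty, so the induction is on a bound `m` for its
    -- length: each round splits off all occurrences of the first basis element, whose total
    -- coefficient is zero.
    evaluate-zero : ∀ (φ : B → Carrier) m f → List.length f ℕ.≤ m →
      (∀ b → coeffᵈ f b ≈ 0#) → evaluate φ f ≈ 0#
    evaluate-zero φ m       []                le z = refl
    evaluate-zero φ (suc m) g@((k , b) ∷ f) (ℕ.s≤s le) z = begin
      evaluate φ g                                 ≈⟨ evaluate-remove φ b g ⟩
      coeffᵈ g b * φ b + evaluate φ (remove b g)   ≈⟨ +-cong (trans (*-congʳ (z b)) (zeroˡ _)) rest ⟩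
      0# + 0#                                      ≈⟨ +-identityˡ 0# ⟩
      0#                                           ∎
      where
      open SetoidReasoning setoid
      short : List.length (remove b g) ℕ.≤ m
      short with b ≟ b
      ... | yes _  = ℕ.≤-trans (remove-length b f) le
      ... | no  b≢ = contradiction ≡.refl b≢
      zeros : ∀ b′ → coeffᵈ (remove b g) b′ ≈ 0#
      zeros b′ with b′ ≟ b
      ... | yes ≡.refl = coeff-remove-≡ b g
      ... | no  ≢      = trans (coeff-remove-≢ b g b′ ≢) (z b′)
      rest : evaluate φ (remove b g) ≈ 0#
      rest = evaluate-zero φ m (remove b g) short zeros

  opaque
    unfolding _⊕_
    evaluate-⊕ : ∀ (φ : B → Carrier) f g → evaluate φ (f ⊕ g) ≈ evaluate φ f + evaluate φ g
    evaluate-⊕ φ []            g = sym (+-identityˡ _)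
    evaluate-⊕ φ ((k , b) ∷ f) g = trans (+-congˡ (evaluate-⊕ φ f g)) (sym (+-assoc _ _ _))

    evaluate-• : ∀ (φ : B → Carrier) k f → evaluate φ (k • f) ≈ k * evaluate φ f
    evaluate-• φ k []             = sym (zeroʳ k)
    evaluate-• φ k ((k′ , b) ∷ f) = trans (+-cong (*-assoc _ _ _) (evaluate-• φ k f)) (sym (distribˡ _ _ _))

  -- Reduces to `evaluate-zero` for the difference of `f` and `g`.
  evaluate-cong : ⦃ _ : DecEq B ⦄ → ∀ (φ : B → Carrier) {f g} → f ≋ g → evaluate φ f ≈ evaluate φ g
  evaluate-cong φ {f} {g} p = begin
    evaluate φ f                                        ≈⟨ solve 2 (λ x y → x := (x :+ :- :1 :* y) :+ y) refl _ _ ⟩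
    (evaluate φ f + - 1# * evaluate φ g) + evaluate φ g ≈⟨ +-congʳ (+-congˡ (evaluate-• φ (- 1#) g)) ⟨
    (evaluate φ f + evaluate φ (- 1# • g)) + evaluate φ g ≈⟨ +-congʳ (evaluate-⊕ φ f _) ⟨
    evaluate φ (f ⊕ - 1# • g) + evaluate φ g           ≈⟨ +-congʳ (evaluate-zero φ _ (f ⊕ - 1# • g) ℕ.≤-refl zeros) ⟩
    0# + evaluate φ g                                  ≈⟨ +-identityˡ _ ⟩
    evaluate φ g                                       ∎
    where
    open SetoidReasoning setoid
    zeros : ∀ b → coeffᵈ (f ⊕ - 1# • g) b ≈ 0#
    zeros b = trans (coeff-⊕ f _ b) (trans (+-cong (at p b) (coeff-• (- 1#) g b))
      (solve 1 (λ x → x :+ :- :1 :* x := :0) refl _))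

  opaque
    unfolding _⊕_
    -- Each coefficient of a linear extension is a scalar functional of the argument, so congruence
    -- and linearity come down to those of `evaluate`.
    coeff-linear : ⦃ _ : DecEq D ⦄ → ∀ (φ : B → Comb D) f d →
      coeffᵈ (linear φ f) d ≈ evaluate (λ b → coeffᵈ (φ b) d) f
    coeff-linear φ []            d = refl
    coeff-linear φ ((k , b) ∷ f) d =
      trans (coeff-⊕ (k • φ b) (linear φ f) d) (+-cong (coeff-• k (φ b) d) (coeff-linear φ f d))

  -- Operators act on the right, f ◁ F, and F ∙ G is F followed by G.
  record Lin (B D : Set) ⦃ _ : DecEq B ⦄ ⦃ _ : DecEq D ⦄ : Set (c ⊔ ℓ) where
    no-eta-equality
    field
      fun   : Comb B → Comb D
      cong  : ∀ {f g} → f ≋ g → fun f ≋ fun g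
      map-⊕ : ∀ f g → fun (f ⊕ g) ≋ fun f ⊕ fun g
      map-• : ∀ k f → fun (k • f) ≋ k • fun f
  open Lin public

  infixl 8 _◁_
  _◁_ : ⦃ _ : DecEq B ⦄ ⦃ _ : DecEq D ⦄ → Comb B → Lin B D → Comb D
  f ◁ F = fun F f

  module _ ⦃ _ : DecEq B ⦄ ⦃ _ : DecEq D ⦄ where

    opaque
      linear-cong : ∀ (φ : B → Comb D) {f g} → f ≋ g → linear φ f ≋ linear φ g
      linear-cong φ {f} {g} p = pointwise λ d →
        trans (coeff-linear φ f d) (trans (evaluate-cong _ p) (sym (coeff-linear φ g d)))

      linear-⊕ : ∀ (φ : B → Comb D) f g → linear φ (f ⊕ g) ≋ linear φ f ⊕ linear φ g
      linear-⊕ φ f g = pointwise λ d → trans (coeff-linear φ (f ⊕ g) d) (trans (evaluate-⊕ _ f g)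
        (sym (trans (coeff-⊕ (linear φ f) _ d) (+-cong (coeff-linear φ f d) (coeff-linear φ g d)))))

      linear-• : ∀ (φ : B → Comb D) k f → linear φ (k • f) ≋ k • linear φ f
      linear-• φ k f = pointwise λ d → trans (coeff-linear φ (k • f) d) (trans (evaluate-• _ k f)
        (sym (trans (coeff-• k (linear φ f) d) (*-congˡ (coeff-linear φ f d)))))

    linearᴸ : (B → Comb D) → Lin B D
    linearᴸ φ = record { fun = linear φ ; cong = linear-cong φ ; map-⊕ = linear-⊕ φ ; map-• = linear-• φ }

    linear-⟨⟩ : ∀ (φ : B → Comb D) b → linear φ ⟨ b ⟩ ≋ φ b
    linear-⟨⟩ φ b = pointwise λ d → trans (coeff-linear φ ⟨ b ⟩ d) (trans (+-identityʳ _) (*-identityˡ _))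

    infix 4 _≐_
    record _≐_ (F G : Lin B D) : Set (c ⊔ ℓ) where
      constructor everywhere
      field on : ∀ f → f ◁ F ≋ f ◁ G
    open _≐_ public

    map-[] : ∀ (F : Lin B D) → [] ◁ F ≋ []
    map-[] F = pointwise λ d → trans (at (cong F (•-lists {f = []} refl ≋-refl)) d) (trans (at (map-• F 0# []) d) (trans (coeff-• 0# ([] ◁ F) d) (zeroˡ _)))

    basis-ext : ∀ {F G : Lin B D} → (∀ b → ⟨ b ⟩ ◁ F ≋ ⟨ b ⟩ ◁ G) → F ≐ G
    basis-ext {F} {G} h = everywhere go
      where
      open SetoidReasoning (≋-setoid D)
      go : ∀ f → f ◁ F ≋ f ◁ G
      go []            = ≋-trans (map-[] F) (≋-sym (map-[] G))
      go ((k , b) ∷ f) = begin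
        ((k , b) ∷ f) ◁ F            ≈⟨ cong F (∷-⊕ k b f) ⟩
        (k • ⟨ b ⟩ ⊕ f) ◁ F          ≈⟨ map-⊕ F _ f ⟩
        (k • ⟨ b ⟩) ◁ F ⊕ f ◁ F      ≈⟨ ⊕-cong (map-• F k _) (go f) ⟩
        k • ⟨ b ⟩ ◁ F ⊕ f ◁ G        ≈⟨ ⊕-cong (•-cong refl (h b)) ≋-refl ⟩
        k • ⟨ b ⟩ ◁ G ⊕ f ◁ G        ≈⟨ ⊕-cong (map-• G k _) ≋-refl ⟨
        (k • ⟨ b ⟩) ◁ G ⊕ f ◁ G      ≈⟨ map-⊕ G _ f ⟨
        (k • ⟨ b ⟩ ⊕ f) ◁ G          ≈⟨ cong G (∷-⊕ k b f) ⟨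
        ((k , b) ∷ f) ◁ G            ∎

  module _ ⦃ _ : DecEq A ⦄ ⦃ _ : DecEq B ⦄ ⦃ _ : DecEq D ⦄ where
    -- Opaque laws keep the comparison of two composites away from their proofs.
    opaque
      ⨾-cong : ∀ (F : Lin A B) (G : Lin B D) {f g} → f ≋ g → f ◁ F ◁ G ≋ g ◁ F ◁ G
      ⨾-cong F G p = cong G (cong F p)

      ⨾-⊕ : ∀ (F : Lin A B) (G : Lin B D) f g → (f ⊕ g) ◁ F ◁ G ≋ f ◁ F ◁ G ⊕ g ◁ F ◁ G
      ⨾-⊕ F G f g = ≋-trans (cong G (map-⊕ F f g)) (map-⊕ G _ _)

      ⨾-• : ∀ (F : Lin A B) (G : Lin B D) k f → (k • f) ◁ F ◁ G ≋ k • f ◁ F ◁ G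
      ⨾-• F G k f = ≋-trans (cong G (map-• F k f)) (map-• G k _)

    infixl 9 _⨾_
    _⨾_ : Lin A B → Lin B D → Lin A D
    F ⨾ G = record { fun = λ f → f ◁ F ◁ G ; cong = ⨾-cong F G ; map-⊕ = ⨾-⊕ F G ; map-• = ⨾-• F G }

  module _ ⦃ _ : DecEq B ⦄ where
    idᴸ : Lin B B
    idᴸ = record { fun = id ; cong = id ; map-⊕ = λ _ _ → ≋-refl ; map-• = λ _ _ → ≋-refl }

  End : (B : Set) ⦃ _ : DecEq B ⦄ → Monoid (c ⊔ ℓ) (c ⊔ ℓ)
  End B = record
    { Carrier = Lin B B ; _≈_ = _≐_ ; _∙_ = _⨾_ ; ε = idᴸ
    ; isMonoid = record
      { isSemigroup = record
        { isMagma = record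
          { isEquivalence = record
            { refl  = everywhere λ f → ≋-refl
            ; sym   = λ p → everywhere λ f → ≋-sym (on p f)
            ; trans = λ p r → everywhere λ f → ≋-trans (on p f) (on r f) }
          ; ∙-cong = λ {F} {F′} {G} p r → everywhere λ f → ≋-trans (cong G (on p f)) (on r _) }
        ; assoc = λ F G H → everywhere λ f → ≋-refl }
      ; identity = (λ F → everywhere λ f → ≋-refl) , (λ F → everywhere λ f → ≋-refl) } }

  -- An identity between linear combinations of m vectors follows from the same
  -- identity for arbitrary scalars in place of the vectors.
  infixl 6 _⊞_
  infixr 7 _⊡_
  data Expr (m : ℕ) : Set c where
    ν   : Fin m → Expr m
    _⊞_ : Expr m → Expr m → Expr m
    _⊡_ : Carrier → Expr m → Expr m
    𝟘   : Expr m

  vectors : ∀ {m} → Expr m → Vec (Comb B) m → Comb B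
  vectors (ν i)     ρ = lookup ρ i
  vectors (e ⊞ e′)  ρ = vectors e ρ ⊕ vectors e′ ρ
  vectors (k ⊡ e)   ρ = k • vectors e ρ
  vectors 𝟘         ρ = []

  scalars : ∀ {m} → Expr m → Vec Carrier m → Carrier
  scalars (ν i)     ρ = lookup ρ i
  scalars (e ⊞ e′)  ρ = scalars e ρ + scalars e′ ρ
  scalars (k ⊡ e)   ρ = k * scalars e ρ
  scalars 𝟘         ρ = 0#

  module _ ⦃ _ : DecEq B ⦄ where
    coeff-vectors : ∀ {m} e (ρ : Vec (Comb B) m) b →
      coeffᵈ (vectors e ρ) b ≈ scalars e (Vec.map (λ f → coeffᵈ f b) ρ)
    coeff-vectors (ν i)    ρ b = reflexive (≡.sym (Vec.lookup-map i _ ρ))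
    coeff-vectors (e ⊞ e′) ρ b =
      trans (coeff-⊕ (vectors e ρ) _ b) (+-cong (coeff-vectors e ρ b) (coeff-vectors e′ ρ b))
    coeff-vectors (k ⊡ e)  ρ b = trans (coeff-• k (vectors e ρ) b) (*-congˡ (coeff-vectors e ρ b))
    coeff-vectors 𝟘        ρ b = refl

    byScalars : ∀ {m} (e e′ : Expr m) (ρ : Vec (Comb B) m) →
      (∀ κ → scalars e κ ≈ scalars e′ κ) → vectors e ρ ≋ vectors e′ ρ
    byScalars e e′ ρ h = pointwise λ b →
      trans (coeff-vectors e ρ b) (trans (h _) (sym (coeff-vectors e′ ρ b)))

-- Intertwining relations, ordered products and braid families in a monoid.

module Intertwining {c ℓ} (Mon : Monoid c ℓ) where
  open Monoid Mon
  open SetoidReasoning setoid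
  open MonoidSolver Mon using (solve; _⊜_; _⊕_)

  infix 4 _~[_]_
  _~[_]_ : Carrier → Carrier → Carrier → Set ℓ
  x ~[ u ] y = x ∙ u ≈ u ∙ y

  ~-ε : ∀ {x} → x ~[ ε ] x
  ~-ε = trans (identityʳ _) (sym (identityˡ _))

  ~-∙ : ∀ {x y z u u′} → x ~[ u ] y → y ~[ u′ ] z → x ~[ u ∙ u′ ] z
  ~-∙ {x} {y} {z} {u} {u′} p r = begin
    x ∙ (u ∙ u′)   ≈⟨ assoc _ _ _ ⟨
    (x ∙ u) ∙ u′   ≈⟨ ∙-congʳ p ⟩
    (u ∙ y) ∙ u′   ≈⟨ assoc _ _ _ ⟩
    u ∙ (y ∙ u′)   ≈⟨ ∙-congˡ r ⟩
    u ∙ (u′ ∙ z)   ≈⟨ assoc _ _ _ ⟨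
    (u ∙ u′) ∙ z   ∎

  ~-mul : ∀ {x x′ y y′ u} → x ~[ u ] y → x′ ~[ u ] y′ → x ∙ x′ ~[ u ] y ∙ y′
  ~-mul {x} {x′} {y} {y′} {u} p r = begin
    (x ∙ x′) ∙ u   ≈⟨ assoc _ _ _ ⟩
    x ∙ (x′ ∙ u)   ≈⟨ ∙-congˡ r ⟩
    x ∙ (u ∙ y′)   ≈⟨ assoc _ _ _ ⟨
    (x ∙ u) ∙ y′   ≈⟨ ∙-congʳ p ⟩
    (u ∙ y) ∙ y′   ≈⟨ assoc _ _ _ ⟩
    u ∙ (y ∙ y′)   ∎

  -- Insert `y ∙ y′` on the right, move `u` across, and cancel `x′ ∙ x`.
  ~-inv : ∀ {x x′ y y′ u} → x′ ∙ x ≈ ε → y ∙ y′ ≈ ε → x ~[ u ] y → x′ ~[ u ] y′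
  ~-inv {x} {x′} {y} {y′} {u} p r h = begin
    x′ ∙ u                ≈⟨ identityʳ _ ⟨
    (x′ ∙ u) ∙ ε          ≈⟨ ∙-congˡ r ⟨
    (x′ ∙ u) ∙ (y ∙ y′)   ≈⟨ solve 4 (λ a b c d → (a ⊕ b) ⊕ (c ⊕ d) ⊜ a ⊕ ((b ⊕ c) ⊕ d)) refl _ _ _ _ ⟩
    x′ ∙ ((u ∙ y) ∙ y′)   ≈⟨ ∙-congˡ (∙-congʳ h) ⟨
    x′ ∙ ((x ∙ u) ∙ y′)   ≈⟨ solve 4 (λ a b c d → a ⊕ ((b ⊕ c) ⊕ d) ⊜ (a ⊕ b) ⊕ (c ⊕ d)) refl _ _ _ _ ⟩
    (x′ ∙ x) ∙ (u ∙ y′)   ≈⟨ ∙-congʳ p ⟩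
    ε ∙ (u ∙ y′)          ≈⟨ identityˡ _ ⟩
    u ∙ y′                ∎

  inverse-unique : ∀ {x x′ y y′} → x′ ∙ x ≈ ε → y ∙ y′ ≈ ε → x ≈ y → x′ ≈ y′
  inverse-unique p r h =
    trans (sym (identityʳ _)) (trans (~-inv p r (trans (identityʳ _) (trans h (sym (identityˡ _))))) (identityˡ _))

  inverse-∙ : ∀ {x x′ y y′} → x ∙ x′ ≈ ε → y ∙ y′ ≈ ε → (x ∙ y) ∙ (y′ ∙ x′) ≈ ε
  inverse-∙ {x} {x′} {y} {y′} p r = begin
    (x ∙ y) ∙ (y′ ∙ x′)   ≈⟨ solve 4 (λ a b c d → (a ⊕ b) ⊕ (c ⊕ d) ⊜ a ⊕ ((b ⊕ c) ⊕ d)) refl _ _ _ _ ⟩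
    x ∙ ((y ∙ y′) ∙ x′)   ≈⟨ ∙-congˡ (trans (∙-congʳ r) (identityˡ _)) ⟩
    x ∙ x′                ≈⟨ p ⟩
    ε                     ∎

  -- up t a m = t a ⋯ t (a + m - 1) and down t a m is the reversed product.
  up down : (ℕ → Carrier) → ℕ → ℕ → Carrier
  up   t a zero    = ε
  up   t a (suc m) = t a ∙ up t (suc a) m
  down t a zero    = ε
  down t a (suc m) = down t (suc a) m ∙ t a

  up-snoc : ∀ t a m → up t a (suc m) ≈ up t a m ∙ t (a ℕ.+ m)
  up-snoc t a zero    = trans (identityʳ _) (trans (reflexive (≡.cong t (≡.sym (ℕ.+-identityʳ a)))) (sym (identityˡ _)))
  up-snoc t a (suc m) = begin
    t a ∙ up t (suc a) (suc m)                    ≈⟨ ∙-congˡ (up-snoc t (suc a) m) ⟩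
    t a ∙ (up t (suc a) m ∙ t (suc a ℕ.+ m))      ≈⟨ assoc _ _ _ ⟨
    (t a ∙ up t (suc a) m) ∙ t (suc a ℕ.+ m)      ≡⟨ ≡.cong (λ b → (t a ∙ up t (suc a) m) ∙ t b) (≡.sym (ℕ.+-suc a m)) ⟩
    (t a ∙ up t (suc a) m) ∙ t (a ℕ.+ suc m)      ∎

  down-cons : ∀ t a m → down t a (suc m) ≈ t (a ℕ.+ m) ∙ down t a m
  down-cons t a zero    = trans (identityˡ _) (trans (reflexive (≡.cong t (≡.sym (ℕ.+-identityʳ a)))) (sym (identityʳ _)))
  down-cons t a (suc m) = begin
    down t (suc a) (suc m) ∙ t a                  ≈⟨ ∙-congʳ (down-cons t (suc a) m) ⟩
    (t (suc a ℕ.+ m) ∙ down t (suc a) m) ∙ t a    ≈⟨ assoc _ _ _ ⟩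
    t (suc a ℕ.+ m) ∙ (down t (suc a) m ∙ t a)    ≡⟨ ≡.cong (λ b → t b ∙ (down t (suc a) m ∙ t a)) (≡.sym (ℕ.+-suc a m)) ⟩
    t (a ℕ.+ suc m) ∙ (down t (suc a) m ∙ t a)    ∎

  down-up-inverse : ∀ {t t′ : ℕ → Carrier} → (∀ k → t k ∙ t′ k ≈ ε) → ∀ a m → down t a m ∙ up t′ a m ≈ ε
  down-up-inverse inv a zero    = identityˡ ε
  down-up-inverse inv a (suc m) = begin
    (down _ (suc a) m ∙ _) ∙ (_ ∙ up _ (suc a) m)  ≈⟨ inverse-∙ {x = down _ (suc a) m} (down-up-inverse inv (suc a) m) (inv a) ⟩
    ε                                              ∎

  up-down-inverse : ∀ {t t′ : ℕ → Carrier} → (∀ k → t k ∙ t′ k ≈ ε) → ∀ a m → up t a m ∙ down t′ a m ≈ ε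
  up-down-inverse inv a zero    = identityˡ ε
  up-down-inverse inv a (suc m) = inverse-∙ (inv a) (up-down-inverse inv (suc a) m)

  up-far : ∀ t x a m → (∀ k → a ℕ.≤ k → k ℕ.< a ℕ.+ m → x ~[ t k ] x) → x ~[ up t a m ] x
  up-far t x a zero    h = ~-ε
  up-far t x a (suc m) h = ~-∙ (h a ℕ.≤-refl (ℕ.m<m+n a (ℕ.s≤s ℕ.z≤n)))
    (up-far t x (suc a) m λ k le lt → h k (ℕ.<⇒≤ le) (≡.subst (k ℕ.<_) (≡.sym (ℕ.+-suc a m)) lt))

  down-far : ∀ t x a m → (∀ k → a ℕ.≤ k → k ℕ.< a ℕ.+ m → x ~[ t k ] x) → x ~[ down t a m ] x
  down-far t x a zero    h = ~-ε
  down-far t x a (suc m) h = ~-∙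
    (down-far t x (suc a) m λ k le lt → h k (ℕ.<⇒≤ le) (≡.subst (k ℕ.<_) (≡.sym (ℕ.+-suc a m)) lt))
    (h a ℕ.≤-refl (ℕ.m<m+n a (ℕ.s≤s ℕ.z≤n)))

  down-intertwine : ∀ t u a b m → (∀ k → k ℕ.< m → t (a ℕ.+ k) ~[ u ] t (b ℕ.+ k)) → down t a m ~[ u ] down t b m
  down-intertwine t u a b zero    h = trans (identityˡ u) (sym (identityʳ u))
  down-intertwine t u a b (suc m) h = ~-mul
    (down-intertwine t u (suc a) (suc b) m λ k lt →
      ≡.subst₂ (λ i j → t i ~[ u ] t j) (ℕ.+-suc a k) (ℕ.+-suc b k) (h (suc k) (ℕ.s≤s lt)))
    (≡.subst₂ (λ i j → t i ~[ u ] t j) (ℕ.+-identityʳ a) (ℕ.+-identityʳ b) (h 0 (ℕ.s≤s ℕ.z≤n)))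

  up-intertwine : ∀ t u a b m → (∀ k → k ℕ.< m → t (a ℕ.+ k) ~[ u ] t (b ℕ.+ k)) → up t a m ~[ u ] up t b m
  up-intertwine t u a b zero    h = trans (identityˡ u) (sym (identityʳ u))
  up-intertwine t u a b (suc m) h = ~-mul
    (≡.subst₂ (λ i j → t i ~[ u ] t j) (ℕ.+-identityʳ a) (ℕ.+-identityʳ b) (h 0 (ℕ.s≤s ℕ.z≤n)))
    (up-intertwine t u (suc a) (suc b) m λ k lt →
      ≡.subst₂ (λ i j → t i ~[ u ] t j) (ℕ.+-suc a k) (ℕ.+-suc b k) (h (suc k) (ℕ.s≤s lt)))

  record IsBraidFamily (n : ℕ) (t : ℕ → Carrier) : Set ℓ where
    field
      far   : ∀ i j → suc i ℕ.< j → t i ∙ t j ≈ t j ∙ t i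
      braid : ∀ i → suc i ℕ.< n → t i ∙ (t (suc i) ∙ t i) ≈ t (suc i) ∙ (t i ∙ t (suc i))

    -- The generator commutes with the factors before `t i`; there the braid relation lowers its
    -- index by one, and `t i` commutes with all later factors. This is conjugation by a Coxeter
    -- word.
    up-shift : ∀ i a m → a ℕ.≤ i → suc i ℕ.< a ℕ.+ m → a ℕ.+ m ℕ.≤ n → t (suc i) ~[ up t a m ] t i
    up-shift i a zero    le lt _   =
      contradiction (≡.subst (suc i ℕ.<_) (ℕ.+-identityʳ a) lt) (ℕ.<-asym (ℕ.s≤s le))
    up-shift i a (suc m) le lt le′ with ℕ.m≤n⇒m<n∨m≡n le
    ... | inj₁ a<i   = ~-∙ (sym (far a (suc i) (ℕ.s≤s a<i)))
          (up-shift i (suc a) m a<i (≡.subst (suc i ℕ.<_) (ℕ.+-suc a m) lt) (≡.subst (ℕ._≤ n) (ℕ.+-suc a m) le′))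
    up-shift i a (suc zero)    le lt le′ | inj₂ ≡.refl =
      contradiction (≡.subst (suc a ℕ.<_) (ℕ.+-comm a 1) lt) (ℕ.<-irrefl ≡.refl)
    up-shift i a (suc (suc m)) le lt le′ | inj₂ ≡.refl = begin
      t (suc a) ∙ (t a ∙ (t (suc a) ∙ u))   ≈⟨ solve 4 (λ x y z u → x ⊕ (y ⊕ (z ⊕ u)) ⊜ (x ⊕ (y ⊕ z)) ⊕ u) refl _ _ _ _ ⟩
      (t (suc a) ∙ (t a ∙ t (suc a))) ∙ u   ≈⟨ ∙-congʳ (braid a (ℕ.<-≤-trans lt le′)) ⟨
      (t a ∙ (t (suc a) ∙ t a)) ∙ u         ≈⟨ solve 4 (λ x y z u → (x ⊕ (y ⊕ z)) ⊕ u ⊜ x ⊕ (y ⊕ (z ⊕ u))) refl _ _ _ _ ⟩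
      t a ∙ (t (suc a) ∙ (t a ∙ u))         ≈⟨ ∙-congˡ (∙-congˡ (up-far t (t a) _ m λ k p _ → far a k p)) ⟩
      t a ∙ (t (suc a) ∙ (u ∙ t a))         ≈⟨ solve 4 (λ x y z u → x ⊕ (y ⊕ (u ⊕ z)) ⊜ (x ⊕ (y ⊕ u)) ⊕ z) refl _ _ _ _ ⟩
      (t a ∙ (t (suc a) ∙ u)) ∙ t a         ∎
      where u = up t (suc (suc a)) m

    -- The mirror image of `up-shift`: the braid relation now raises the index.
    down-shift : ∀ i a m → a ℕ.≤ i → suc i ℕ.< a ℕ.+ m → a ℕ.+ m ℕ.≤ n → t i ~[ down t a m ] t (suc i)
    down-shift i a zero    le lt _   =
      contradiction (≡.subst (suc i ℕ.<_) (ℕ.+-identityʳ a) lt) (ℕ.<-asym (ℕ.s≤s le))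
    down-shift i a (suc m) le lt le′ with ℕ.m≤n⇒m<n∨m≡n le
    ... | inj₁ a<i   = ~-∙ (down-shift i (suc a) m a<i (≡.subst (suc i ℕ.<_) (ℕ.+-suc a m) lt) (≡.subst (ℕ._≤ n) (ℕ.+-suc a m) le′))
                           (sym (far a (suc i) (ℕ.s≤s a<i)))
    down-shift i a (suc zero)    le lt le′ | inj₂ ≡.refl =
      contradiction (≡.subst (suc a ℕ.<_) (ℕ.+-comm a 1) lt) (ℕ.<-irrefl ≡.refl)
    down-shift i a (suc (suc m)) le lt le′ | inj₂ ≡.refl = begin
      t a ∙ ((d ∙ t (suc a)) ∙ t a)         ≈⟨ solve 4 (λ x d y z → x ⊕ ((d ⊕ y) ⊕ z) ⊜ (x ⊕ d) ⊕ (y ⊕ z)) refl _ _ _ _ ⟩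
      (t a ∙ d) ∙ (t (suc a) ∙ t a)         ≈⟨ ∙-congʳ (down-far t (t a) _ m λ k p _ → far a k p) ⟩
      (d ∙ t a) ∙ (t (suc a) ∙ t a)         ≈⟨ assoc _ _ _ ⟩
      d ∙ (t a ∙ (t (suc a) ∙ t a))         ≈⟨ ∙-congˡ (braid a (ℕ.<-≤-trans lt le′)) ⟩
      d ∙ (t (suc a) ∙ (t a ∙ t (suc a)))   ≈⟨ solve 4 (λ d x y z → d ⊕ (x ⊕ (y ⊕ z)) ⊜ ((d ⊕ x) ⊕ y) ⊕ z) refl _ _ _ _ ⟩
      ((d ∙ t (suc a)) ∙ t a) ∙ t (suc a)   ∎
      where d = down t (suc (suc a)) m

-- Consequences of the double affine Hecke relations.

-- The relations of the double affine Hecke algebra among T_k = t k, its inverse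
-- t′ k, x_k = x k (all counted from 0) and w, where σ, σ′, κ stand for s, 1/s, q.
module DoubleAffine {c ℓ} (Mon : Monoid c ℓ) where
  open Monoid Mon
  open SetoidReasoning setoid
  open MonoidSolver Mon using (solve; _⊜_; _⊕_) renaming (id to :ε)
  open Intertwining Mon

  record Relations (n : ℕ) (t t′ x : ℕ → Carrier) (w σ σ′ κ : Carrier) : Set (c ⊔ ℓ) where
    field
      t-family  : IsBraidFamily n t
      t∙t′      : ∀ k → t k ∙ t′ k ≈ ε
      t′∙t      : ∀ k → t′ k ∙ t k ≈ ε
      σ-central : ∀ y → σ ∙ y ≈ y ∙ σ
      σ∙σ′      : σ ∙ σ′ ≈ ε
      κ-central : ∀ y → κ ∙ y ≈ y ∙ κ
      x-t       : ∀ k → k ℕ.< n → x k ∙ t k ≈ σ ∙ (t′ k ∙ x (suc k))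
      x-far     : ∀ i j → i ≢ j → suc i ≢ j → x j ∙ t i ≈ t i ∙ x j
      x-x       : ∀ i j → x i ∙ x j ≈ x j ∙ x i
      w-t       : ∀ k → suc k ℕ.< n → t (suc k) ~[ w ] t k
      w-x       : ∀ k → k ℕ.< n → x (suc k) ~[ w ] x k
      w-x₀      : x 0 ∙ w ≈ κ ∙ (w ∙ x n)

    σ′-central : ∀ y → σ′ ∙ y ≈ y ∙ σ′
    σ′-central y = ~-inv (trans (sym (σ-central σ′)) σ∙σ′) σ∙σ′ (σ-central y)

    private module t = IsBraidFamily t-family

    -- A braid word is a palindrome, so inverting both sides gives the same relation for the
    -- inverses.
    t′-family : IsBraidFamily n t′
    t′-family = record
      { far   = λ i j lt → ~-inv (t′∙t i) (t∙t′ i) (sym (~-inv (t′∙t j) (t∙t′ j) (sym (t.far i j lt))))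
      ; braid = λ i lt → inverse-unique
          (inverse₃ (t′∙t i) (t′∙t (suc i)) (t′∙t i))
          (inverse₃ (t∙t′ (suc i)) (t∙t′ i) (t∙t′ (suc i)))
          (t.braid i lt) }
      where
      inverse₃ : ∀ {x x′ y y′ z z′} → x ∙ x′ ≈ ε → y ∙ y′ ≈ ε → z ∙ z′ ≈ ε →
                 (x ∙ (y ∙ z)) ∙ (z′ ∙ (y′ ∙ x′)) ≈ ε
      inverse₃ p r h = trans (∙-congˡ (sym (assoc _ _ _))) (inverse-∙ p (inverse-∙ r h))

    private module t′ = IsBraidFamily t′-family

    Φ : Carrier
    Φ = up t′ 0 n ∙ x n

    -- s^(n - i) Ξ_i, provided that i + r ≡ n.
    e : ℕ → ℕ → Carrier
    e i r = down t′ 0 i ∙ (w ∙ down t i r)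

    -- The product of inverses in Φ lowers the index by `up-shift`, and `x n` commutes with `t k`
    -- because k + 1 < n.
    Φ-t : ∀ k → suc k ℕ.< n → t (suc k) ~[ Φ ] t k
    Φ-t k lt = ~-∙ (~-inv (t∙t′ (suc k)) (t′∙t k) (t′.up-shift k 0 n ℕ.z≤n lt ℕ.≤-refl))
      (sym (x-far k n (ℕ.<⇒≢ (ℕ.<-trans (ℕ.n<1+n k) lt)) (ℕ.<⇒≢ lt)))

    Φ-t′ : ∀ k → suc k ℕ.< n → t′ (suc k) ~[ Φ ] t′ k
    Φ-t′ k lt = ~-inv (t′∙t (suc k)) (t∙t′ k) (Φ-t k lt)

    w-t′ : ∀ k → suc k ℕ.< n → t′ (suc k) ~[ w ] t′ k
    w-t′ k lt = ~-inv (t′∙t (suc k)) (t∙t′ k) (w-t k lt)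

    -- For i + 1 < j the factors `t′` raise the index i by one, `w` lowers it again and the rest is
    -- far away. For i > j the factors `t′` are far away, `w` lowers the index and the factors `t`
    -- raise it again.
    t-e : ∀ i j r → j ℕ.+ r ≡ n → i ℕ.< n → i ≢ j → suc i ≢ j → t i ~[ e j r ] t i
    t-e i j r j+r≡n i<n i≢j si≢j with ℕ.<-cmp (suc i) j
    ... | tri≈ _ eq _ = contradiction eq si≢j
    ... | tri< lt _ _ = ~-∙ (~-inv (t∙t′ i) (t′∙t (suc i)) (t′.down-shift i 0 j ℕ.z≤n lt j≤n))
          (~-∙ (w-t i (ℕ.<-≤-trans lt j≤n)) (down-far t (t i) j r λ k le _ → t.far i k (ℕ.<-≤-trans lt le)))
      where j≤n : j ℕ.≤ n
            j≤n = ≡.subst (j ℕ.≤_) j+r≡n (ℕ.m≤m+n j r)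
    ... | tri> _ _ (ℕ.s≤s j≤i) with i | ℕ.≤∧≢⇒< j≤i (λ eq → i≢j (≡.sym eq))
    ...   | suc i′ | ℕ.s≤s j≤i′ = ~-∙
            (down-far t′ (t (suc i′)) 0 j λ k _ lt → ~-inv (t∙t′ _) (t′∙t _)
              (sym (t′.far k (suc i′) (ℕ.s≤s (ℕ.<-≤-trans lt j≤i′)))))
            (~-∙ (w-t i′ i<n)
              (t.down-shift i′ j r j≤i′ (≡.subst (suc i′ ℕ.<_) (≡.sym j+r≡n) i<n) (ℕ.≤-reflexive j+r≡n)))

    t-e-t : ∀ i r → t i ∙ (e (suc i) r ∙ t i) ≈ e i (suc r)
    t-e-t i r = begin
      t i ∙ ((down t′ 0 (suc i) ∙ (w ∙ d)) ∙ t i)            ≈⟨ ∙-congˡ (∙-congʳ (∙-congʳ (down-cons t′ 0 i))) ⟩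
      t i ∙ (((t′ i ∙ down t′ 0 i) ∙ (w ∙ d)) ∙ t i)         ≈⟨ solve 6 (λ a b c d e f → a ⊕ (((b ⊕ c) ⊕ (d ⊕ e)) ⊕ f) ⊜ (a ⊕ b) ⊕ (c ⊕ (d ⊕ (e ⊕ f)))) refl _ _ _ _ _ _ ⟩
      (t i ∙ t′ i) ∙ (down t′ 0 i ∙ (w ∙ (d ∙ t i)))         ≈⟨ trans (∙-congʳ (t∙t′ i)) (identityˡ _) ⟩
      down t′ 0 i ∙ (w ∙ (d ∙ t i))                          ∎
      where d = down t (suc i) r

    t′-x-t′ : ∀ k → k ℕ.< n → t′ k ∙ (x (suc k) ∙ t′ k) ≈ σ′ ∙ x k
    t′-x-t′ k lt = begin
      t′ k ∙ (x (suc k) ∙ t′ k)              ≈⟨ identityˡ _ ⟨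
      ε ∙ (t′ k ∙ (x (suc k) ∙ t′ k))        ≈⟨ ∙-congʳ (trans (sym (σ-central σ′)) σ∙σ′) ⟨
      (σ′ ∙ σ) ∙ (t′ k ∙ (x (suc k) ∙ t′ k)) ≈⟨ solve 5 (λ a b c d e → (a ⊕ b) ⊕ (c ⊕ (d ⊕ e)) ⊜ a ⊕ ((b ⊕ (c ⊕ d)) ⊕ e)) refl _ _ _ _ _ ⟩
      σ′ ∙ ((σ ∙ (t′ k ∙ x (suc k))) ∙ t′ k) ≈⟨ ∙-congˡ (∙-congʳ (x-t k lt)) ⟨
      σ′ ∙ ((x k ∙ t k) ∙ t′ k)              ≈⟨ ∙-congˡ (trans (assoc _ _ _) (trans (∙-congˡ (t∙t′ k)) (identityʳ _))) ⟩
      σ′ ∙ x k                               ∎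

    x-t′ : ∀ k → k ℕ.< n → x (suc k) ∙ t′ k ≈ σ′ ∙ (t k ∙ x k)
    x-t′ k lt = begin
      x (suc k) ∙ t′ k                         ≈⟨ trans (∙-congʳ (t∙t′ k)) (identityˡ _) ⟨
      (t k ∙ t′ k) ∙ (x (suc k) ∙ t′ k)        ≈⟨ assoc _ _ _ ⟩
      t k ∙ (t′ k ∙ (x (suc k) ∙ t′ k))        ≈⟨ ∙-congˡ (t′-x-t′ k lt) ⟩
      t k ∙ (σ′ ∙ x k)                         ≈⟨ assoc _ _ _ ⟨
      (t k ∙ σ′) ∙ x k                         ≈⟨ ∙-congʳ (σ′-central (t k)) ⟨
      (σ′ ∙ t k) ∙ x k                         ≈⟨ assoc _ _ _ ⟩
      σ′ ∙ (t k ∙ x k)                         ∎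

    -- The product of the two variables is symmetric in them: both exchange relations are used once,
    -- and their factors `σ` and `σ′` cancel.
    x-x-t : ∀ k → k ℕ.< n → t k ~[ x k ∙ x (suc k) ] t k
    x-x-t k lt = sym (begin
      (x k ∙ x (suc k)) ∙ t k                  ≈⟨ ∙-congʳ (x-x k (suc k)) ⟩
      (x (suc k) ∙ x k) ∙ t k                  ≈⟨ assoc _ _ _ ⟩
      x (suc k) ∙ (x k ∙ t k)                  ≈⟨ ∙-congˡ (x-t k lt) ⟩
      x (suc k) ∙ (σ ∙ (t′ k ∙ x (suc k)))     ≈⟨ solve 4 (λ a b c d → a ⊕ (b ⊕ (c ⊕ d)) ⊜ (a ⊕ b) ⊕ (c ⊕ d)) refl _ _ _ _ ⟩
      (x (suc k) ∙ σ) ∙ (t′ k ∙ x (suc k))     ≈⟨ ∙-congʳ (σ-central _) ⟨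
      (σ ∙ x (suc k)) ∙ (t′ k ∙ x (suc k))     ≈⟨ solve 4 (λ a b c d → (a ⊕ b) ⊕ (c ⊕ d) ⊜ a ⊕ ((b ⊕ c) ⊕ d)) refl _ _ _ _ ⟩
      σ ∙ ((x (suc k) ∙ t′ k) ∙ x (suc k))     ≈⟨ ∙-congˡ (∙-congʳ (x-t′ k lt)) ⟩
      σ ∙ ((σ′ ∙ (t k ∙ x k)) ∙ x (suc k))     ≈⟨ solve 5 (λ a b c d e → a ⊕ ((b ⊕ (c ⊕ d)) ⊕ e) ⊜ (a ⊕ b) ⊕ (c ⊕ (d ⊕ e))) refl _ _ _ _ _ ⟩
      (σ ∙ σ′) ∙ (t k ∙ (x k ∙ x (suc k)))     ≈⟨ trans (∙-congʳ σ∙σ′) (identityˡ _) ⟩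
      t k ∙ (x k ∙ x (suc k))                  ∎)

    σ′^_ : ℕ → Carrier
    σ′^ zero  = ε
    σ′^ suc m = σ′ ∙ σ′^ m

    -- Each innermost pair of inverses lowers the index of the variable by one at the cost of one
    -- factor `σ′`.
    up-x-down : ∀ m → m ℕ.≤ n → up t′ 0 m ∙ (x m ∙ down t′ 0 m) ≈ σ′^ m ∙ x 0
    up-x-down zero    le = ∙-congˡ (identityʳ _)
    up-x-down (suc m) le = begin
      up t′ 0 (suc m) ∙ (x (suc m) ∙ down t′ 0 (suc m))                ≈⟨ ∙-cong (up-snoc t′ 0 m) (∙-congˡ (down-cons t′ 0 m)) ⟩
      (up t′ 0 m ∙ t′ m) ∙ (x (suc m) ∙ (t′ m ∙ down t′ 0 m))          ≈⟨ solve 5 (λ a b c b′ d → (a ⊕ b) ⊕ (c ⊕ (b′ ⊕ d)) ⊜ a ⊕ ((b ⊕ (c ⊕ b′)) ⊕ d)) refl _ _ _ _ _ ⟩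
      up t′ 0 m ∙ ((t′ m ∙ (x (suc m) ∙ t′ m)) ∙ down t′ 0 m)          ≈⟨ ∙-congˡ (∙-congʳ (t′-x-t′ m le)) ⟩
      up t′ 0 m ∙ ((σ′ ∙ x m) ∙ down t′ 0 m)                           ≈⟨ solve 4 (λ a b c d → a ⊕ ((b ⊕ c) ⊕ d) ⊜ (a ⊕ b) ⊕ (c ⊕ d)) refl _ _ _ _ ⟩
      (up t′ 0 m ∙ σ′) ∙ (x m ∙ down t′ 0 m)                           ≈⟨ ∙-congʳ (σ′-central _) ⟨
      (σ′ ∙ up t′ 0 m) ∙ (x m ∙ down t′ 0 m)                           ≈⟨ assoc _ _ _ ⟩
      σ′ ∙ (up t′ 0 m ∙ (x m ∙ down t′ 0 m))                           ≈⟨ ∙-congˡ (up-x-down m (ℕ.<⇒≤ le)) ⟩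
      σ′ ∙ (σ′^ m ∙ x 0)                                               ≈⟨ assoc _ _ _ ⟨
      (σ′ ∙ σ′^ m) ∙ x 0                                               ∎

    Φ-e-last : Φ ∙ e n 0 ≈ σ′^ n ∙ (κ ∙ (e 0 n ∙ Φ))
    Φ-e-last = begin
      (up t′ 0 n ∙ x n) ∙ (down t′ 0 n ∙ (w ∙ ε))      ≈⟨ solve 4 (λ a b c d → (a ⊕ b) ⊕ (c ⊕ (d ⊕ :ε)) ⊜ (a ⊕ (b ⊕ c)) ⊕ d) refl _ _ _ _ ⟩
      (up t′ 0 n ∙ (x n ∙ down t′ 0 n)) ∙ w            ≈⟨ ∙-congʳ (up-x-down n ℕ.≤-refl) ⟩
      (σ′^ n ∙ x 0) ∙ w                                ≈⟨ assoc _ _ _ ⟩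
      σ′^ n ∙ (x 0 ∙ w)                                ≈⟨ ∙-congˡ w-x₀ ⟩
      -- Inserting `down t 0 n ∙ up t′ 0 n` after `w` produces both `e 0 n` and Φ.
      σ′^ n ∙ (κ ∙ (w ∙ x n))                          ≈⟨ ∙-congˡ (∙-congˡ (∙-congˡ (trans (∙-congʳ (down-up-inverse t∙t′ 0 n)) (identityˡ _)))) ⟨
      σ′^ n ∙ (κ ∙ (w ∙ ((down t 0 n ∙ up t′ 0 n) ∙ x n)))
        ≈⟨ ∙-congˡ (∙-congˡ (solve 4 (λ a b c d → a ⊕ ((b ⊕ c) ⊕ d) ⊜ (:ε ⊕ (a ⊕ b)) ⊕ (c ⊕ d)) refl _ _ _ _)) ⟩
      σ′^ n ∙ (κ ∙ (e 0 n ∙ Φ))                        ∎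

  module _ {n t t′ x w σ σ′ κ} (relations : Relations (suc n) t t′ x w σ σ′ κ) where
    open Relations relations

    -- The core of the commutation of Φ with Ξ. The last variable drops by one index past `w` and
    -- then exchanges with `t n`; the first factor `t′ 0` stays in front, the others are shifted by
    -- `w`, and the new factor `t′ n` completes them to Φ.
    Φ-w-t : Φ ∙ (w ∙ t n) ≈ σ ∙ (t′ 0 ∙ (w ∙ Φ))
    Φ-w-t = begin
      (u ∙ x (suc n)) ∙ (w ∙ t n)                  ≈⟨ solve 4 (λ a b c d → (a ⊕ b) ⊕ (c ⊕ d) ⊜ a ⊕ ((b ⊕ c) ⊕ d)) refl _ _ _ _ ⟩
      u ∙ ((x (suc n) ∙ w) ∙ t n)                  ≈⟨ ∙-congˡ (∙-congʳ (w-x n ℕ.≤-refl)) ⟩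
      u ∙ ((w ∙ x n) ∙ t n)                        ≈⟨ ∙-congˡ (assoc _ _ _) ⟩
      u ∙ (w ∙ (x n ∙ t n))                        ≈⟨ ∙-congˡ (∙-congˡ (x-t n ℕ.≤-refl)) ⟩
      u ∙ (w ∙ (σ ∙ (t′ n ∙ x (suc n))))           ≈⟨ solve 5 (λ a b c d e → a ⊕ (b ⊕ (c ⊕ (d ⊕ e))) ⊜ ((a ⊕ b) ⊕ c) ⊕ (d ⊕ e)) refl _ _ _ _ _ ⟩
      ((u ∙ w) ∙ σ) ∙ (t′ n ∙ x (suc n))           ≈⟨ ∙-congʳ (σ-central _) ⟨
      (σ ∙ (u ∙ w)) ∙ (t′ n ∙ x (suc n))           ≈⟨ ∙-congʳ (∙-congˡ (∙-congʳ refl)) ⟩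
      (σ ∙ ((t′ 0 ∙ up t′ 1 n) ∙ w)) ∙ (t′ n ∙ x (suc n))
        ≈⟨ solve 6 (λ s a b c d e → (s ⊕ ((a ⊕ b) ⊕ c)) ⊕ (d ⊕ e) ⊜ s ⊕ (a ⊕ ((b ⊕ c) ⊕ (d ⊕ e)))) refl _ _ _ _ _ _ ⟩
      σ ∙ (t′ 0 ∙ ((up t′ 1 n ∙ w) ∙ (t′ n ∙ x (suc n))))
        ≈⟨ ∙-congˡ (∙-congˡ (∙-congʳ (up-intertwine t′ w 1 0 n λ k lt → w-t′ k (ℕ.s≤s lt)))) ⟩
      σ ∙ (t′ 0 ∙ ((w ∙ up t′ 0 n) ∙ (t′ n ∙ x (suc n))))
        ≈⟨ solve 6 (λ s a b c d e → s ⊕ (a ⊕ ((b ⊕ c) ⊕ (d ⊕ e))) ⊜ s ⊕ (a ⊕ (b ⊕ ((c ⊕ d) ⊕ e)))) refl _ _ _ _ _ _ ⟩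
      σ ∙ (t′ 0 ∙ (w ∙ ((up t′ 0 n ∙ t′ n) ∙ x (suc n))))
        ≈⟨ ∙-congˡ (∙-congˡ (∙-congˡ (∙-congʳ (up-snoc t′ 0 n)))) ⟨
      σ ∙ (t′ 0 ∙ (w ∙ Φ))                         ∎
      where u = up t′ 0 (suc n)

    -- Φ raises every index in the two descending products by one as they pass to its left. In the
    -- middle, `Φ-w-t` supplies the missing factor `t′ 0` and absorbs the surplus `t n`.
    Φ-e : ∀ i r → i ℕ.+ r ≡ n → Φ ∙ e i (suc r) ≈ σ ∙ (e (suc i) r ∙ Φ)
    Φ-e i r i+r≡n = begin
      Φ ∙ (down t′ 0 i ∙ (w ∙ down t i (suc r)))          ≈⟨ ∙-congˡ (∙-congˡ (∙-congˡ (down-cons t i r))) ⟩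
      Φ ∙ (down t′ 0 i ∙ (w ∙ (t (i ℕ.+ r) ∙ d)))         ≡⟨ ≡.cong (λ j → Φ ∙ (down t′ 0 i ∙ (w ∙ (t j ∙ d)))) i+r≡n ⟩
      Φ ∙ (down t′ 0 i ∙ (w ∙ (t n ∙ d)))                 ≈⟨ assoc _ _ _ ⟨
      (Φ ∙ down t′ 0 i) ∙ (w ∙ (t n ∙ d))                 ≈⟨ ∙-congʳ (down-intertwine t′ Φ 1 0 i λ k lt → Φ-t′ k (ℕ.s≤s (ℕ.<-≤-trans lt i≤n))) ⟨
      (down t′ 1 i ∙ Φ) ∙ (w ∙ (t n ∙ d))                 ≈⟨ solve 5 (λ a b c d e → (a ⊕ b) ⊕ (c ⊕ (d ⊕ e)) ⊜ a ⊕ ((b ⊕ (c ⊕ d)) ⊕ e)) refl _ _ _ _ _ ⟩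
      down t′ 1 i ∙ ((Φ ∙ (w ∙ t n)) ∙ d)                 ≈⟨ ∙-congˡ (∙-congʳ Φ-w-t) ⟩
      down t′ 1 i ∙ ((σ ∙ (t′ 0 ∙ (w ∙ Φ))) ∙ d)          ≈⟨ solve 6 (λ a b c d e f → a ⊕ ((b ⊕ (c ⊕ (d ⊕ e))) ⊕ f) ⊜ (a ⊕ b) ⊕ (c ⊕ (d ⊕ (e ⊕ f)))) refl _ _ _ _ _ _ ⟩
      (down t′ 1 i ∙ σ) ∙ (t′ 0 ∙ (w ∙ (Φ ∙ d)))          ≈⟨ ∙-congʳ (σ-central _) ⟨
      (σ ∙ down t′ 1 i) ∙ (t′ 0 ∙ (w ∙ (Φ ∙ d)))          ≈⟨ ∙-congˡ (∙-congˡ (∙-congˡ Φ-d)) ⟩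
      (σ ∙ down t′ 1 i) ∙ (t′ 0 ∙ (w ∙ (down t (suc i) r ∙ Φ)))
        ≈⟨ solve 6 (λ a b c d e f → (a ⊕ b) ⊕ (c ⊕ (d ⊕ (e ⊕ f))) ⊜ a ⊕ (((b ⊕ c) ⊕ (d ⊕ e)) ⊕ f)) refl _ _ _ _ _ _ ⟩
      σ ∙ (e (suc i) r ∙ Φ)                               ∎
      where
      d = down t i r
      i≤n : i ℕ.≤ n
      i≤n = ≡.subst (i ℕ.≤_) i+r≡n (ℕ.m≤m+n i r)
      Φ-d : Φ ∙ d ≈ down t (suc i) r ∙ Φ
      Φ-d = sym (down-intertwine t Φ (suc i) i r λ k lt →
        Φ-t (i ℕ.+ k) (ℕ.s≤s (≡.subst (suc (i ℕ.+ k) ℕ.≤_) i+r≡n (ℕ.+-monoʳ-< i lt))))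

    -- `Φ ∙ Φ` is split into inverses `u ∙ u₀` and a part containing the variables. The first part
    -- turns `t 0` into `t n`; the second is a multiple of `t n` times a symmetric product of
    -- variables and commutes with `t n`.
    Φ-Φ-t : t 0 ~[ Φ ∙ Φ ] t n
    Φ-Φ-t = begin
      t 0 ∙ (Φ ∙ Φ)                      ≈⟨ ∙-congˡ Φ∙Φ ⟩
      t 0 ∙ ((u ∙ u₀) ∙ (z ∙ (t′ n ∙ z)))  ≈⟨ assoc _ _ _ ⟨
      (t 0 ∙ (u ∙ u₀)) ∙ (z ∙ (t′ n ∙ z))  ≈⟨ ∙-congʳ u-u₀ ⟩
      ((u ∙ u₀) ∙ t n) ∙ (z ∙ (t′ n ∙ z))  ≈⟨ assoc _ _ _ ⟩
      (u ∙ u₀) ∙ (t n ∙ (z ∙ (t′ n ∙ z)))  ≈⟨ ∙-congˡ z-z ⟩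
      (u ∙ u₀) ∙ ((z ∙ (t′ n ∙ z)) ∙ t n)  ≈⟨ assoc _ _ _ ⟨
      ((u ∙ u₀) ∙ (z ∙ (t′ n ∙ z))) ∙ t n  ≈⟨ ∙-congʳ Φ∙Φ ⟨
      (Φ ∙ Φ) ∙ t n                      ∎
      where
      u u₀ z : Carrier
      u  = up t′ 0 (suc n)
      u₀ = up t′ 0 n
      z  = x (suc n)
      Φ∙Φ : Φ ∙ Φ ≈ (u ∙ u₀) ∙ (z ∙ (t′ n ∙ z))
      Φ∙Φ = begin
        (u ∙ z) ∙ (u ∙ z)              ≈⟨ ∙-congˡ (∙-congʳ (up-snoc t′ 0 n)) ⟩
        (u ∙ z) ∙ ((u₀ ∙ t′ n) ∙ z)    ≈⟨ solve 5 (λ a b c d e → (a ⊕ b) ⊕ ((c ⊕ d) ⊕ e) ⊜ a ⊕ ((b ⊕ c) ⊕ (d ⊕ e))) refl _ _ _ _ _ ⟩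
        u ∙ ((z ∙ u₀) ∙ (t′ n ∙ z))    ≈⟨ ∙-congˡ (∙-congʳ (up-far t′ z 0 n λ k _ lt →
                                            sym (~-inv (t′∙t k) (t∙t′ k) (sym (x-far k (suc n) (ℕ.<⇒≢ (ℕ.m<n⇒m<1+n lt)) (ℕ.<⇒≢ (ℕ.s≤s lt))))))) ⟩
        u ∙ ((u₀ ∙ z) ∙ (t′ n ∙ z))    ≈⟨ solve 5 (λ a b c d e → a ⊕ ((c ⊕ b) ⊕ (d ⊕ e)) ⊜ (a ⊕ c) ⊕ (b ⊕ (d ⊕ e))) refl _ _ _ _ _ ⟩
        (u ∙ u₀) ∙ (z ∙ (t′ n ∙ z))    ∎
      u~ : up t′ 1 n ~[ u ] u₀
      u~ = up-intertwine t′ u 1 0 n λ k lt → IsBraidFamily.up-shift t′-family k 0 (suc n) ℕ.z≤n (ℕ.s≤s lt) ℕ.≤-refl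
      u-u₀ : t 0 ∙ (u ∙ u₀) ≈ (u ∙ u₀) ∙ t n
      u-u₀ = begin
        t 0 ∙ ((t′ 0 ∙ up t′ 1 n) ∙ u₀)         ≈⟨ solve 4 (λ a b c d → a ⊕ ((b ⊕ c) ⊕ d) ⊜ (a ⊕ b) ⊕ (c ⊕ d)) refl _ _ _ _ ⟩
        (t 0 ∙ t′ 0) ∙ (up t′ 1 n ∙ u₀)         ≈⟨ trans (∙-congʳ (t∙t′ 0)) (identityˡ _) ⟩
        -- The inserted `t′ n ∙ t n` completes `u₀` to `u`, past which the indices of `up t′ 1 n`
        -- drop by one.
        up t′ 1 n ∙ u₀                          ≈⟨ ∙-congˡ (trans (∙-congˡ (t′∙t n)) (identityʳ _)) ⟨
        up t′ 1 n ∙ (u₀ ∙ (t′ n ∙ t n))         ≈⟨ solve 4 (λ a b c d → a ⊕ (b ⊕ (c ⊕ d)) ⊜ (a ⊕ (b ⊕ c)) ⊕ d) refl _ _ _ _ ⟩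
        (up t′ 1 n ∙ (u₀ ∙ t′ n)) ∙ t n         ≈⟨ ∙-congʳ (∙-congˡ (up-snoc t′ 0 n)) ⟨
        (up t′ 1 n ∙ u) ∙ t n                   ≈⟨ ∙-congʳ u~ ⟩
        (u ∙ u₀) ∙ t n                          ∎
      z-t′ : z ∙ (t′ n ∙ z) ≈ σ′ ∙ (t n ∙ (x n ∙ z))
      z-t′ = begin
        z ∙ (t′ n ∙ z)               ≈⟨ assoc _ _ _ ⟨
        (z ∙ t′ n) ∙ z               ≈⟨ ∙-congʳ (x-t′ n ℕ.≤-refl) ⟩
        (σ′ ∙ (t n ∙ x n)) ∙ z       ≈⟨ solve 4 (λ a b c d → (a ⊕ (b ⊕ c)) ⊕ d ⊜ a ⊕ (b ⊕ (c ⊕ d))) refl _ _ _ _ ⟩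
        σ′ ∙ (t n ∙ (x n ∙ z))       ∎
      z-z : t n ~[ z ∙ (t′ n ∙ z) ] t n
      z-z = begin
        t n ∙ (z ∙ (t′ n ∙ z))               ≈⟨ ∙-congˡ z-t′ ⟩
        t n ∙ (σ′ ∙ (t n ∙ (x n ∙ z)))       ≈⟨ ~-∙ (sym (σ′-central (t n))) (~-∙ refl (x-x-t n ℕ.≤-refl)) ⟩
        (σ′ ∙ (t n ∙ (x n ∙ z))) ∙ t n       ≈⟨ ∙-congʳ z-t′ ⟨
        (z ∙ (t′ n ∙ z)) ∙ t n               ∎

-- Field arithmetic, integer powers and the coefficient of the intertwiner.

module FieldFacts {c ℓ} (F : Field c ℓ) where
  open Field F
  open IntegerSolver commutativeRing
  open SemiringExp semiring using (^-homo-*)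
  open SetoidReasoning setoid

  ≉-sym : ∀ {x y} → ¬ x ≈ y → ¬ y ≈ x
  ≉-sym x≉y y≈x = x≉y (sym y≈x)

  difference : ∀ {x y} → x - y ≈ 0# → x ≈ y
  difference {x} {y} eq = begin
    x              ≈⟨ solve 2 (λ x y → x := (x :- y) :+ y) refl x y ⟩
    (x - y) + y    ≈⟨ +-congʳ eq ⟩
    0# + y         ≈⟨ +-identityˡ y ⟩
    y              ∎

  x-y≉0 : ∀ {x y} → ¬ x ≈ y → ¬ x - y ≈ 0#
  x-y≉0 x≉y eq = x≉y (difference eq)

  *-cancelˡ-0 : ∀ {x y} → ¬ x ≈ 0# → x * y ≈ 0# → y ≈ 0#
  *-cancelˡ-0 {x} {y} x≉0 eq = begin
    y                 ≈⟨ *-identityˡ y ⟨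
    1# * y            ≈⟨ *-congʳ (⁻¹-inverse x≉0) ⟨
    (x * x ⁻¹) * y    ≈⟨ solve 3 (λ x x′ y → (x :* x′) :* y := x′ :* (x :* y)) refl x (x ⁻¹) y ⟩
    x ⁻¹ * (x * y)    ≈⟨ *-congˡ eq ⟩
    x ⁻¹ * 0#         ≈⟨ zeroʳ _ ⟩
    0#                ∎

  *-cancelˡ : ∀ {x y z} → ¬ x ≈ 0# → x * y ≈ x * z → y ≈ z
  *-cancelˡ {x} {y} {z} x≉0 eq = difference (*-cancelˡ-0 x≉0 (begin
    x * (y - z)      ≈⟨ solve 3 (λ x y z → x :* (y :- z) := x :* y :- x :* z) refl x y z ⟩
    x * y - x * z    ≈⟨ +-congʳ eq ⟩
    x * z - x * z    ≈⟨ -‿inverseʳ _ ⟩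
    0#               ∎))

  *-≉0 : ∀ {x y} → ¬ x ≈ 0# → ¬ y ≈ 0# → ¬ x * y ≈ 0#
  *-≉0 x≉0 y≉0 eq = y≉0 (*-cancelˡ-0 x≉0 eq)

  ⁻¹-≉0 : ∀ {x} → ¬ x ≈ 0# → ¬ x ⁻¹ ≈ 0#
  ⁻¹-≉0 x≉0 eq = 1≉0 (trans (sym (⁻¹-inverse x≉0)) (trans (*-congˡ eq) (zeroʳ _)))

  ^-≉0 : ∀ {x} → ¬ x ≈ 0# → ∀ m → ¬ x ^ m ≈ 0#
  ^-≉0 x≉0 zero    = 1≉0
  ^-≉0 x≉0 (suc m) = *-≉0 x≉0 (^-≉0 x≉0 m)

  ^ᶻ-≉0 : ∀ {x} → ¬ x ≈ 0# → ∀ i → ¬ x ^ᶻ i ≈ 0#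
  ^ᶻ-≉0 x≉0 (+ m)    = ^-≉0 x≉0 m
  ^ᶻ-≉0 x≉0 -[1+ m ] = ^-≉0 (⁻¹-≉0 x≉0) (suc m)

  module Power {x} (x≉0 : ¬ x ≈ 0#) where

    ^ᶻ-⊖ : ∀ m n → x ^ᶻ (m ℤ.⊖ n) * x ^ n ≈ x ^ m
    ^ᶻ-⊖ m       zero    = *-identityʳ _
    ^ᶻ-⊖ zero    (suc n) = inverse-^ (suc n)
      where
      inverse-^ : ∀ n → (x ⁻¹) ^ n * x ^ n ≈ 1#
      inverse-^ zero    = *-identityˡ 1#
      inverse-^ (suc n) = begin
        (x ⁻¹ * (x ⁻¹) ^ n) * (x * x ^ n)   ≈⟨ solve 4 (λ a b c d → (a :* b) :* (c :* d) := (c :* a) :* (b :* d)) refl _ _ _ _ ⟩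
        (x * x ⁻¹) * ((x ⁻¹) ^ n * x ^ n)   ≈⟨ *-cong (⁻¹-inverse x≉0) (inverse-^ n) ⟩
        1# * 1#                             ≈⟨ *-identityˡ 1# ⟩
        1#                                  ∎
    ^ᶻ-⊖ (suc m) (suc n) = begin
      x ^ᶻ (suc m ℤ.⊖ suc n) * (x * x ^ n)  ≡⟨ ≡.cong (λ i → x ^ᶻ i * (x * x ^ n)) (ℤ.[1+m]⊖[1+n]≡m⊖n m n) ⟩
      x ^ᶻ (m ℤ.⊖ n) * (x * x ^ n)          ≈⟨ solve 3 (λ a b c → a :* (b :* c) := b :* (a :* c)) refl _ _ _ ⟩
      x * (x ^ᶻ (m ℤ.⊖ n) * x ^ n)          ≈⟨ *-congˡ (^ᶻ-⊖ m n) ⟩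
      x * x ^ m                             ∎

    as-⊖ : ∀ i → ∃ λ m → ∃ λ n → i ≡ m ℤ.⊖ n
    as-⊖ (+ m)    = m , 0 , ≡.refl
    as-⊖ -[1+ n ] = 0 , suc n , ≡.refl

    ⊖-+-⊖ : ∀ m n m′ n′ → (m ℤ.⊖ n) ℤ.+ (m′ ℤ.⊖ n′) ≡ (m ℕ.+ m′) ℤ.⊖ (n ℕ.+ n′)
    ⊖-+-⊖ m n m′ n′ = ≡.trans (≡.cong₂ ℤ._+_ (≡.sym (ℤ.[+m]-[+n]≡m⊖n m n)) (≡.sym (ℤ.[+m]-[+n]≡m⊖n m′ n′)))
      (≡.trans (ℤsolve 4 (λ a b c d → (a ℤ:- b) ℤ:+ (c ℤ:- d) ℤ:= (a ℤ:+ c) ℤ:- (b ℤ:+ d)) ≡.refl (+ m) (+ n) (+ m′) (+ n′))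
        (ℤ.[+m]-[+n]≡m⊖n (m ℕ.+ m′) (n ℕ.+ n′)))
      where open ℤ.+-*-Solver using () renaming (solve to ℤsolve; _:+_ to _ℤ:+_; _:-_ to _ℤ:-_; _:=_ to _ℤ:=_)

    -- Both exponents are written as differences of naturals, and the denominators are cleared by a
    -- natural power.
    ^ᶻ-+ : ∀ i j → x ^ᶻ (i ℤ.+ j) ≈ x ^ᶻ i * x ^ᶻ j
    ^ᶻ-+ i j with as-⊖ i | as-⊖ j
    ... | m , n , ≡.refl | m′ , n′ , ≡.refl = *-cancelˡ (^-≉0 x≉0 (n ℕ.+ n′)) (begin
      x ^ (n ℕ.+ n′) * x ^ᶻ ((m ℤ.⊖ n) ℤ.+ (m′ ℤ.⊖ n′))   ≡⟨ ≡.cong (λ k → x ^ (n ℕ.+ n′) * x ^ᶻ k) (⊖-+-⊖ m n m′ n′) ⟩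
      x ^ (n ℕ.+ n′) * x ^ᶻ ((m ℕ.+ m′) ℤ.⊖ (n ℕ.+ n′))   ≈⟨ trans (*-comm _ _) (^ᶻ-⊖ (m ℕ.+ m′) (n ℕ.+ n′)) ⟩
      x ^ (m ℕ.+ m′)                                      ≈⟨ ^-homo-* x m m′ ⟩
      x ^ m * x ^ m′                                      ≈⟨ *-cong (^ᶻ-⊖ m n) (^ᶻ-⊖ m′ n′) ⟨
      (x ^ᶻ (m ℤ.⊖ n) * x ^ n) * (x ^ᶻ (m′ ℤ.⊖ n′) * x ^ n′)
        ≈⟨ solve 4 (λ a b c d → (a :* b) :* (c :* d) := (b :* d) :* (a :* c)) refl _ _ _ _ ⟩
      (x ^ n * x ^ n′) * (x ^ᶻ (m ℤ.⊖ n) * x ^ᶻ (m′ ℤ.⊖ n′))  ≈⟨ *-congʳ (^-homo-* x n n′) ⟨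
      x ^ (n ℕ.+ n′) * (x ^ᶻ (m ℤ.⊖ n) * x ^ᶻ (m′ ℤ.⊖ n′))    ∎)

    ^ᶻ-sub : ∀ i j → x ^ᶻ (i ℤ.- j) ≈ x ^ᶻ i * (x ^ᶻ j) ⁻¹
    ^ᶻ-sub i j = *-cancelˡ xʲ≉0 (begin
      x ^ᶻ j * x ^ᶻ (i ℤ.- j)            ≈⟨ ^ᶻ-+ j (i ℤ.- j) ⟨
      x ^ᶻ (j ℤ.+ (i ℤ.- j))             ≡⟨ ≡.cong (x ^ᶻ_) (ℤsolve 2 (λ a b → b ℤ:+ (a ℤ:- b) ℤ:= a) ≡.refl i j) ⟩
      x ^ᶻ i                             ≈⟨ *-identityˡ _ ⟨
      1# * x ^ᶻ i                        ≈⟨ *-congʳ (⁻¹-inverse xʲ≉0) ⟨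
      (x ^ᶻ j * (x ^ᶻ j) ⁻¹) * x ^ᶻ i    ≈⟨ solve 3 (λ a b c → (a :* b) :* c := a :* (c :* b)) refl _ _ _ ⟩
      x ^ᶻ j * (x ^ᶻ i * (x ^ᶻ j) ⁻¹)    ∎)
      where
      open ℤ.+-*-Solver using () renaming (solve to ℤsolve; _:+_ to _ℤ:+_; _:-_ to _ℤ:-_; _:=_ to _ℤ:=_)
      xʲ≉0 = ^ᶻ-≉0 x≉0 j

  -- The coefficient that turns T_i into the intertwiner T_i + ratio ζ_i ζ_{i+1}.
  module Ratio (s : Carrier) where

    ratio : Carrier → Carrier → Carrier
    ratio z z′ = (1# - s) * (1# - z′ * z ⁻¹) ⁻¹

    ratio-cong : ∀ {z y z′ y′} → z ≈ y → z′ ≈ y′ → ratio z z′ ≈ ratio y y′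
    ratio-cong p r = *-congˡ (⁻¹-cong (+-congˡ (-‿cong (*-cong r (⁻¹-cong p)))))

    -- The division-free form of the definition, from which the other identities for `ratio` are
    -- derived.
    ratio-* : ∀ {z z′} → ¬ z ≈ 0# → ¬ z ≈ z′ → ratio z z′ * (z - z′) ≈ (1# - s) * z
    ratio-* {z} {z′} z≉0 z≉z′ = begin
      ((1# - s) * u) * (z - z′)                   ≈⟨ *-congˡ (+-congˡ (-‿cong (trans (*-congˡ (⁻¹-inverse z≉0)) (*-identityʳ _)))) ⟨
      ((1# - s) * u) * (z - z′ * (z * z ⁻¹))      ≈⟨ solve 5 (λ s u z z′ y → ((:1 :- s) :* u) :* (z :- z′ :* (z :* y)) := ((:1 :- s) :* z) :* ((:1 :- z′ :* y) :* u)) refl s u z z′ (z ⁻¹) ⟩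
      ((1# - s) * z) * ((1# - z′ * z ⁻¹) * u)     ≈⟨ *-congˡ (⁻¹-inverse nonzero) ⟩
      ((1# - s) * z) * 1#                         ≈⟨ *-identityʳ _ ⟩
      (1# - s) * z                                ∎
      where
      u = (1# - z′ * z ⁻¹) ⁻¹
      nonzero : ¬ 1# - z′ * z ⁻¹ ≈ 0#
      nonzero eq = z≉z′ (begin
        z                  ≈⟨ *-identityˡ z ⟨
        1# * z             ≈⟨ *-congʳ (difference eq) ⟩
        (z′ * z ⁻¹) * z    ≈⟨ solve 3 (λ a b c → (a :* b) :* c := (c :* b) :* a) refl _ _ _ ⟩
        (z * z ⁻¹) * z′    ≈⟨ *-congʳ (⁻¹-inverse z≉0) ⟩
        1# * z′            ≈⟨ *-identityˡ z′ ⟩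
        z′                 ∎)

    ratio-unique : ∀ {z z′ k} → ¬ z ≈ 0# → ¬ z ≈ z′ → k * (z - z′) ≈ (1# - s) * z → ratio z z′ ≈ k
    ratio-unique z≉0 z≉z′ eq = *-cancelˡ (x-y≉0 z≉z′)
      (trans (*-comm _ _) (trans (ratio-* z≉0 z≉z′) (trans (sym eq) (*-comm _ _))))

    ratio-+ : ∀ {z z′} → ¬ z ≈ 0# → ¬ z′ ≈ 0# → ¬ z ≈ z′ → ratio z z′ + ratio z′ z ≈ 1# - s
    ratio-+ {z} {z′} z≉0 z′≉0 z≉z′ = *-cancelˡ (x-y≉0 z≉z′) (begin
      (z - z′) * (a + b)                       ≈⟨ solve 4 (λ z z′ a b → (z :- z′) :* (a :+ b) := a :* (z :- z′) :- b :* (z′ :- z)) refl z z′ a b ⟩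
      a * (z - z′) - b * (z′ - z)              ≈⟨ +-cong (ratio-* z≉0 z≉z′) (-‿cong (ratio-* z′≉0 (≉-sym z≉z′))) ⟩
      (1# - s) * z - (1# - s) * z′             ≈⟨ solve 3 (λ p z z′ → p :* z :- p :* z′ := (z :- z′) :* p) refl _ z z′ ⟩
      (z - z′) * (1# - s)                      ∎)
      where a = ratio z z′
            b = ratio z′ z

    -- The scalar condition under which the braid relation and the Yang-Baxter equation are
    -- equivalent, checked after clearing the three denominators.
    ratio-yb : ∀ {x y z} → ¬ x ≈ 0# → ¬ y ≈ 0# → ¬ x ≈ y → ¬ x ≈ z → ¬ y ≈ z →
      ratio x z * (s - 1#) + ratio x y * ratio x z + ratio x z * ratio y z ≈ ratio x y * ratio y z
    ratio-yb {x} {y} {z} x≉0 y≉0 x≉y x≉z y≉z = *-cancelˡ (*-≉0 (x-y≉0 x≉y) (*-≉0 (x-y≉0 x≉z) (x-y≉0 y≉z))) (begin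
      ((x - y) * ((x - z) * (y - z))) * (b * (s - 1#) + a * b + b * d)
        ≈⟨ solve 7 (λ x y z a b d s′ →
             ((x :- y) :* ((x :- z) :* (y :- z))) :* (b :* s′ :+ a :* b :+ b :* d) :=
             (b :* (x :- z)) :* s′ :* (x :- y) :* (y :- z)
               :+ (a :* (x :- y)) :* (b :* (x :- z)) :* (y :- z) :+ (b :* (x :- z)) :* (d :* (y :- z)) :* (x :- y))
             refl x y z a b d (s - 1#) ⟩
      (b * (x - z)) * (s - 1#) * (x - y) * (y - z)
        + (a * (x - y)) * (b * (x - z)) * (y - z) + (b * (x - z)) * (d * (y - z)) * (x - y)
        ≈⟨ +-cong (+-cong (*-congʳ (*-congʳ (*-congʳ B))) (*-congʳ (*-cong A B))) (*-congʳ (*-cong B D)) ⟩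
      ((1# - s) * x) * (s - 1#) * (x - y) * (y - z)
        + ((1# - s) * x) * ((1# - s) * x) * (y - z) + ((1# - s) * x) * ((1# - s) * y) * (x - y)
        ≈⟨ solve 4 (λ x y z s →
             let p = :1 :- s in
             (p :* x) :* (s :- :1) :* (x :- y) :* (y :- z) :+ (p :* x) :* (p :* x) :* (y :- z)
               :+ (p :* x) :* (p :* y) :* (x :- y)
             := (p :* x) :* (p :* y) :* (x :- z))
             refl x y z s ⟩
      ((1# - s) * x) * ((1# - s) * y) * (x - z)
        ≈⟨ *-congʳ (*-cong A D) ⟨
      (a * (x - y)) * (d * (y - z)) * (x - z)
        ≈⟨ solve 5 (λ p r t a d → (a :* p) :* (d :* t) :* r := (p :* (r :* t)) :* (a :* d)) refl (x - y) (x - z) (y - z) a d ⟩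
      ((x - y) * ((x - z) * (y - z))) * (a * d) ∎)
      where
      a = ratio x y
      b = ratio x z
      d = ratio y z
      A = ratio-* x≉0 x≉y
      B = ratio-* x≉0 x≉z
      D = ratio-* y≉0 y≉z

    -- The left factor is the scalar by which two opposite intertwiners multiply. The factorisation
    -- shows when it vanishes: only if `z` and `z′` differ by a factor `s`.
    ratio-product : ∀ {z z′} → ¬ z ≈ 0# → ¬ z′ ≈ 0# → ¬ z ≈ z′ →
      (s + ratio z z′ * ratio z′ z) * ((z - z′) * (z - z′)) ≈ (s * z - z′) * (z - s * z′)
    ratio-product {z} {z′} z≉0 z′≉0 z≉z′ = begin
      (s + a * b) * ((z - z′) * (z - z′))
        ≈⟨ solve 5 (λ s z z′ a b → (s :+ a :* b) :* ((z :- z′) :* (z :- z′)) :=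
             s :* (z :- z′) :* (z :- z′) :- (a :* (z :- z′)) :* (b :* (z′ :- z))) refl s z z′ a b ⟩
      s * (z - z′) * (z - z′) - (a * (z - z′)) * (b * (z′ - z))
        ≈⟨ +-congˡ (-‿cong (*-cong (ratio-* z≉0 z≉z′) (ratio-* z′≉0 (≉-sym z≉z′)))) ⟩
      s * (z - z′) * (z - z′) - ((1# - s) * z) * ((1# - s) * z′)
        ≈⟨ solve 3 (λ s z z′ → s :* (z :- z′) :* (z :- z′) :- ((:1 :- s) :* z) :* ((:1 :- s) :* z′) :=
             (s :* z :- z′) :* (z :- s :* z′)) refl s z z′ ⟩
      (s * z - z′) * (z - s * z′) ∎
      where a = ratio z z′
            b = ratio z′ z

    ratio-product-≉0 : ∀ {z z′} → ¬ z ≈ 0# → ¬ z′ ≈ 0# → ¬ z ≈ z′ → ¬ s * z ≈ z′ → ¬ z ≈ s * z′ →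
      ¬ s + ratio z z′ * ratio z′ z ≈ 0#
    ratio-product-≉0 z≉0 z′≉0 z≉z′ sz≉z′ z≉sz′ eq = *-≉0 (x-y≉0 sz≉z′) (x-y≉0 z≉sz′)
      (trans (sym (ratio-product z≉0 z′≉0 z≉z′)) (trans (*-congʳ eq) (zeroˡ _)))

-- Quadratic, braid and Yang-Baxter relations at a vector.

module HeckeOperators {c ℓ} (F : Field c ℓ) (s : Field.Carrier F) {B : Set} ⦃ _ : DecEq B ⦄ where
  open Field F
  open Combinations commutativeRing using (Comb)
  open LinearMaps commutativeRing
  open FieldFacts F
  open IntegerSolver commutativeRing
  open SetoidReasoning (≋-setoid B)

  opaque
    ⊹-congruent : ∀ (X : Lin B B) a {f g} → f ≋ g → f ◁ X ⊕ a • f ≋ g ◁ X ⊕ a • g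
    ⊹-congruent X a p = ⊕-cong (cong X p) (•-cong refl p)

    ⊹-⊕ : ∀ (X : Lin B B) a f g → (f ⊕ g) ◁ X ⊕ a • (f ⊕ g) ≋ (f ◁ X ⊕ a • f) ⊕ (g ◁ X ⊕ a • g)
    ⊹-⊕ X a f g = ≋-trans (⊕-cong (map-⊕ X f g) ≋-refl)
      (byScalars (ν 0F ⊞ ν 1F ⊞ a ⊡ (ν 2F ⊞ ν 3F)) (ν 0F ⊞ a ⊡ ν 2F ⊞ (ν 1F ⊞ a ⊡ ν 3F))
        (f ◁ X ∷ g ◁ X ∷ f ∷ g ∷ [])
        λ where (x ∷ y ∷ z ∷ w ∷ []) → solve 5 (λ a x y z w → x :+ y :+ a :* (z :+ w) := x :+ a :* z :+ (y :+ a :* w)) refl a x y z w)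

    ⊹-• : ∀ (X : Lin B B) a k f → (k • f) ◁ X ⊕ a • k • f ≋ k • (f ◁ X ⊕ a • f)
    ⊹-• X a k f = ≋-trans (⊕-cong (map-• X k f) ≋-refl)
      (byScalars (k ⊡ ν 0F ⊞ a ⊡ k ⊡ ν 1F) (k ⊡ (ν 0F ⊞ a ⊡ ν 1F)) (f ◁ X ∷ f ∷ [])
        λ where (x ∷ y ∷ []) → solve 4 (λ a k x y → k :* x :+ a :* (k :* y) := k :* (x :+ a :* y)) refl a k x y)

  infixl 9 _⊹_
  _⊹_ : Lin B B → Carrier → Lin B B
  X ⊹ a = record { fun = λ f → f ◁ X ⊕ a • f ; cong = ⊹-congruent X a ; map-⊕ = ⊹-⊕ X a ; map-• = ⊹-• X a }

  map-⊕• : ∀ (X : Lin B B) f k g → (f ⊕ k • g) ◁ X ≋ f ◁ X ⊕ k • g ◁ X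
  map-⊕• X f k g = ≋-trans (map-⊕ X f _) (⊕-cong ≋-refl (map-• X k g))

  ⊹-cong : ∀ X {a b} → a ≈ b → ∀ f → f ◁ (X ⊹ a) ≋ f ◁ (X ⊹ b)
  ⊹-cong X p f = ⊕-cong ≋-refl (•-cong p ≋-refl)

  -- Stated at a single vector, because relations are proved on constants first and then carried
  -- from `f` to `f` times a variable.
  QuadraticAt : Lin B B → Comb B → Set _
  QuadraticAt X f = f ◁ X ◁ X ≋ (s - 1#) • f ◁ X ⊕ s • f

  BraidAt : Lin B B → Lin B B → Comb B → Set _
  BraidAt X Y f = f ◁ X ◁ Y ◁ X ≋ f ◁ Y ◁ X ◁ Y

  private
    remainder : Lin B B → Lin B B → Carrier → Carrier → Carrier → Comb B → Comb B
    remainder X Y a b d f =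
      a • f ◁ Y ◁ X ⊕ d • f ◁ X ◁ Y ⊕ (a * d) • f ◁ X ⊕ (a * d) • f ◁ Y ⊕ (b * s + a * b * d) • f

    remainder-swap : ∀ X Y a b d f → remainder X Y a b d f ≋ remainder Y X d b a f
    remainder-swap X Y a b d f = byScalars
      (a ⊡ ν 0F ⊞ d ⊡ ν 1F ⊞ (a * d) ⊡ ν 2F ⊞ (a * d) ⊡ ν 3F ⊞ (b * s + a * b * d) ⊡ ν 4F)
      (d ⊡ ν 1F ⊞ a ⊡ ν 0F ⊞ (d * a) ⊡ ν 3F ⊞ (d * a) ⊡ ν 2F ⊞ (b * s + d * b * a) ⊡ ν 4F)
      (f ◁ Y ◁ X ∷ f ◁ X ◁ Y ∷ f ◁ X ∷ f ◁ Y ∷ f ∷ [])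
      λ where (x ∷ y ∷ z ∷ u ∷ t ∷ []) → solve 9 (λ a b d s x y z u t →
                a :* x :+ d :* y :+ (a :* d) :* z :+ (a :* d) :* u :+ (b :* s :+ a :* b :* d) :* t :=
                d :* y :+ a :* x :+ (d :* a) :* u :+ (d :* a) :* z :+ (b :* s :+ d :* b :* a) :* t) refl a b d s x y z u t

    -- The quadratic relation reduces the square of `X` that arises from the middle summand `b`; the
    -- hypothesis on the scalars then gives `f ◁ X` the same coefficient as `f ◁ Y`.
    expand : ∀ X Y a b d f → QuadraticAt X f → b * (s - 1#) + a * b + b * d ≈ a * d →
      f ◁ (X ⊹ a) ◁ (Y ⊹ b) ◁ (X ⊹ d) ≋ f ◁ X ◁ Y ◁ X ⊕ remainder X Y a b d f
    expand X Y a b d f quad yb = begin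
      f ◁ (X ⊹ a) ◁ (Y ⊹ b) ◁ (X ⊹ d)
        ≈⟨ cong (X ⊹ d) (⊕-cong (map-⊕• Y (f ◁ X) a f) ≋-refl) ⟩
      (g ⊕ b • h) ◁ (X ⊹ d)
        ≈⟨ ⊕-cong (≋-trans (map-⊕• X g b h) (⊕-cong (map-⊕• X (f ◁ X ◁ Y) a (f ◁ Y)) (•-cong refl (map-⊕• X (f ◁ X) a f)))) ≋-refl ⟩
      (f ◁ X ◁ Y ◁ X ⊕ a • f ◁ Y ◁ X) ⊕ b • (f ◁ X ◁ X ⊕ a • f ◁ X) ⊕ d • (g ⊕ b • h)
        ≈⟨ ⊕-cong (⊕-cong ≋-refl (•-cong refl (⊕-cong quad ≋-refl))) ≋-refl ⟩
      (f ◁ X ◁ Y ◁ X ⊕ a • f ◁ Y ◁ X) ⊕ b • (((s - 1#) • f ◁ X ⊕ s • f) ⊕ a • f ◁ X) ⊕ d • (g ⊕ b • h)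
        ≈⟨ byScalars
             ((ν 0F ⊞ a ⊡ ν 1F) ⊞ b ⊡ (((s - 1#) ⊡ ν 2F ⊞ s ⊡ ν 5F) ⊞ a ⊡ ν 2F)
               ⊞ d ⊡ ((ν 3F ⊞ a ⊡ ν 4F) ⊞ b ⊡ (ν 2F ⊞ a ⊡ ν 5F)))
             (ν 0F ⊞ (a ⊡ ν 1F ⊞ d ⊡ ν 3F ⊞ (b * (s - 1#) + a * b + b * d) ⊡ ν 2F ⊞ (a * d) ⊡ ν 4F ⊞ (b * s + a * b * d) ⊡ ν 5F))
             (f ◁ X ◁ Y ◁ X ∷ f ◁ Y ◁ X ∷ f ◁ X ∷ f ◁ X ◁ Y ∷ f ◁ Y ∷ f ∷ [])
             (λ where (x ∷ y ∷ z ∷ u ∷ v ∷ w ∷ []) → solve 10 (λ a b d s x y z u v w →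
                        (x :+ a :* y) :+ b :* (((s :- :1) :* z :+ s :* w) :+ a :* z)
                          :+ d :* ((u :+ a :* v) :+ b :* (z :+ a :* w)) :=
                        x :+ (a :* y :+ d :* u :+ (b :* (s :- :1) :+ a :* b :+ b :* d) :* z :+ (a :* d) :* v
                          :+ (b :* s :+ a :* b :* d) :* w)) refl a b d s x y z u v w) ⟩
      f ◁ X ◁ Y ◁ X ⊕ (a • f ◁ Y ◁ X ⊕ d • f ◁ X ◁ Y ⊕ (b * (s - 1#) + a * b + b * d) • f ◁ X
        ⊕ (a * d) • f ◁ Y ⊕ (b * s + a * b * d) • f)
        ≈⟨ ⊕-cong ≋-refl (⊕-cong (⊕-cong (⊕-cong ≋-refl (•-cong yb ≋-refl)) ≋-refl) ≋-refl) ⟩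
      f ◁ X ◁ Y ◁ X ⊕ remainder X Y a b d f ∎
      where
      g = f ◁ X ◁ Y ⊕ a • f ◁ Y
      h = f ◁ X ⊕ a • f

  ⊕-cancelʳ : ∀ {g h r} → g ⊕ r ≋ h ⊕ r → g ≋ h
  ⊕-cancelʳ {g} {h} {r} eq = begin
    g                       ≈⟨ byScalars (ν 0F) ((ν 0F ⊞ ν 1F) ⊞ (- 1#) ⊡ ν 1F) (g ∷ r ∷ [])
                                 (λ where (x ∷ y ∷ []) → solve 2 (λ x y → x := (x :+ y) :+ (:- :1) :* y) refl x y) ⟩
    (g ⊕ r) ⊕ (- 1#) • r    ≈⟨ ⊕-cong eq ≋-refl ⟩
    (h ⊕ r) ⊕ (- 1#) • r    ≈⟨ byScalars (ν 0F) ((ν 0F ⊞ ν 1F) ⊞ (- 1#) ⊡ ν 1F) (h ∷ r ∷ [])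
                                 (λ where (x ∷ y ∷ []) → solve 2 (λ x y → x := (x :+ y) :+ (:- :1) :* y) refl x y) ⟨
    h                       ∎

  ⊹-intertwine : ∀ {X Y W : Lin B B} a {f} → f ◁ X ◁ W ≋ f ◁ W ◁ Y → f ◁ (X ⊹ a) ◁ W ≋ f ◁ W ◁ (Y ⊹ a)
  ⊹-intertwine {X} {Y} {W} a {f} eq = ≋-trans (map-⊕• W (f ◁ X) a f) (⊕-cong eq ≋-refl)

  ⊹-intertwine⁻¹ : ∀ {X Y W : Lin B B} a {f} → f ◁ (X ⊹ a) ◁ W ≋ f ◁ W ◁ (Y ⊹ a) → f ◁ X ◁ W ≋ f ◁ W ◁ Y
  ⊹-intertwine⁻¹ {X} {Y} {W} a {f} eq = ⊕-cancelʳ (≋-trans (≋-sym (map-⊕• W (f ◁ X) a f)) eq)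

  ⊹-0 : ∀ X f → f ◁ (X ⊹ 0#) ≋ f ◁ X
  ⊹-0 X f = byScalars (ν 0F ⊞ 0# ⊡ ν 1F) (ν 0F) (f ◁ X ∷ f ∷ [])
    λ where (x ∷ y ∷ []) → solve 2 (λ x y → x :+ :0 :* y := x) refl x y

  -- Both sides of the Yang–Baxter equation differ from those of the braid relation
  -- by the same vector, so that either equation implies the other.
  module YangBaxter (X Y : Lin B B) {a b d} (yb : b * (s - 1#) + a * b + b * d ≈ a * d)
    f (quadX : QuadraticAt X f) (quadY : QuadraticAt Y f) where

    private
      yb′ : b * (s - 1#) + d * b + b * a ≈ d * a
      yb′ = trans (solve 4 (λ a b d t → b :* t :+ d :* b :+ b :* a := b :* t :+ a :* b :+ b :* d) refl a b d (s - 1#))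
        (trans yb (*-comm a d))
      left  = expand X Y a b d f quadX yb
      right = ≋-trans (expand Y X d b a f quadY yb′) (⊕-cong ≋-refl (remainder-swap Y X d b a f))

    braid⇒yb : BraidAt X Y f → f ◁ (X ⊹ a) ◁ (Y ⊹ b) ◁ (X ⊹ d) ≋ f ◁ (Y ⊹ d) ◁ (X ⊹ b) ◁ (Y ⊹ a)
    braid⇒yb p = ≋-trans left (≋-trans (⊕-cong p ≋-refl) (≋-sym right))

    yb⇒braid : f ◁ (X ⊹ a) ◁ (Y ⊹ b) ◁ (X ⊹ d) ≋ f ◁ (Y ⊹ d) ◁ (X ⊹ b) ◁ (Y ⊹ a) → BraidAt X Y f
    yb⇒braid p = ⊕-cancelʳ (≋-trans (≋-sym left) (≋-trans p right))

  -- The term `f ◁ X` cancels because the two parameters add up to 1 - s.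
  ⊹-⊹ : ∀ X {a a′} f → a + a′ ≈ 1# - s → QuadraticAt X f → f ◁ (X ⊹ a) ◁ (X ⊹ a′) ≋ (s + a * a′) • f
  ⊹-⊹ X {a} {a′} f a+a′ quad = begin
    (f ◁ X ⊕ a • f) ◁ X ⊕ a′ • (f ◁ X ⊕ a • f)
      ≈⟨ ⊕-cong (≋-trans (map-⊕• X (f ◁ X) a f) (⊕-cong quad ≋-refl)) ≋-refl ⟩
    (((s - 1#) • f ◁ X ⊕ s • f) ⊕ a • f ◁ X) ⊕ a′ • (f ◁ X ⊕ a • f)
      ≈⟨ byScalars ((((s - 1#) ⊡ ν 0F ⊞ s ⊡ ν 1F) ⊞ a ⊡ ν 0F) ⊞ a′ ⊡ (ν 0F ⊞ a ⊡ ν 1F))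
                   ((s - 1# + (a + a′)) ⊡ ν 0F ⊞ (s + a * a′) ⊡ ν 1F) (f ◁ X ∷ f ∷ [])
           (λ where (x ∷ y ∷ []) → solve 5 (λ s a a′ x y → (((s :- :1) :* x :+ s :* y) :+ a :* x) :+ a′ :* (x :+ a :* y) :=
                      (s :- :1 :+ (a :+ a′)) :* x :+ (s :+ a :* a′) :* y) refl s a a′ x y) ⟩
    (s - 1# + (a + a′)) • f ◁ X ⊕ (s + a * a′) • f
      ≈⟨ ⊕-cong (•-cong vanishes ≋-refl) ≋-refl ⟩
    0# • f ◁ X ⊕ (s + a * a′) • f
      ≈⟨ byScalars (0# ⊡ ν 0F ⊞ (s + a * a′) ⊡ ν 1F) ((s + a * a′) ⊡ ν 1F) (f ◁ X ∷ f ∷ [])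
           (λ where (x ∷ y ∷ []) → solve 3 (λ t x y → :0 :* x :+ t :* y := t :* y) refl (s + a * a′) x y) ⟩
    (s + a * a′) • f ∎
    where
    vanishes : s - 1# + (a + a′) ≈ 0#
    vanishes = trans (+-congˡ a+a′) (solve 1 (λ s → s :- :1 :+ (:1 :- s) := :0) refl s)

-- Reverse standard tableaux: positions of consecutive entries, and contents.

module Tableaux {N} (lam : Partition N) where

  rowLength-antitone : ∀ {ls} → Linked ℕ._≥_ ls → ∀ {r r′} → r ℕ.≤ r′ → rowLength ls r′ ℕ.≤ rowLength ls r
  rowLength-antitone {[]}        _  _                   = ℕ.z≤n
  rowLength-antitone {l ∷ ls}    ds {zero} {zero} _     = ℕ.≤-refl
  rowLength-antitone {l ∷ []}    ds {zero} {suc r′} _   = ℕ.z≤n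
  rowLength-antitone {l ∷ _ ∷ _} (l≥ Linked.∷ ds) {zero} {suc r′} _ =
    ℕ.≤-trans (rowLength-antitone ds {zero} {r′} ℕ.z≤n) l≥
  rowLength-antitone {l ∷ ls}    ds {suc r} {suc r′} (ℕ.s≤s le) = rowLength-antitone (Linked.tail ds) le

  southwest-closed : ∀ {c r c′ r′} → (c , r) ∈ᶜ lam → c′ ℕ.≤ c → r′ ℕ.≤ r → (c′ , r′) ∈ᶜ lam
  southwest-closed c<len c′≤c r′≤r =
    ℕ.≤-<-trans c′≤c (ℕ.<-≤-trans c<len (rowLength-antitone (Partition.decreasing lam) r′≤r))

  pos : Tab lam → Fin N → Cell
  pos T = lookup (cell (filling T))

  colᵀ rowᵀ : Tab lam → Fin N → ℕ
  colᵀ T = col (filling T)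
  rowᵀ T = row (filling T)

  -- The proofs stored in a filling are irrelevant; the statement is decidable, so a usable proof
  -- can be recomputed. The same device serves the other stored properties.
  pos-inShape : ∀ T k → pos T k ∈ᶜ lam
  pos-inShape (mkTab (mkFilling p inS _ _) _) k = recompute (_ ℕ.<? _) (inS k)

  pos-injective : ∀ T {j k} → pos T j ≡ pos T k → j ≡ k
  pos-injective (mkTab (mkFilling p _ inj _) _) {j} {k} eq = recompute (j Fin.≟ k) (inj j k eq)

  pos-surjective : ∀ T {x} → x ∈ᶜ lam → ∃ λ k → pos T k ≡ x
  pos-surjective (mkTab (mkFilling p _ _ sur) _) {x} x∈ =
    recompute (Fin.any? λ k → Product.≡-dec ℕ._≟_ ℕ._≟_ (lookup p k) x) (sur x x∈)

  reverseStandard : ∀ (T : Tab lam) → IsReverseStandard (filling T)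
  reverseStandard (mkTab F rs) = recompute (isReverseStandard? F) rs

  Tab-≡ : ∀ {T T′ : Tab lam} → (∀ k → pos T k ≡ pos T′ k) → T ≡ T′
  Tab-≡ {mkTab (mkFilling p _ _ _) _} {mkTab (mkFilling p′ _ _ _) _} h
    with ≡.trans (≡.sym (Vec.tabulate∘lookup p)) (≡.trans (Vec.tabulate-cong h) (Vec.tabulate∘lookup p′))
  ... | ≡.refl = ≡.refl

  module _ (T : Tab lam) where
    private
      inRows : ∀ j k → rowᵀ T j ≡ rowᵀ T k → colᵀ T j ℕ.< colᵀ T k → k Fin.< j
      inRows = proj₁ (reverseStandard T)
      inCols : ∀ j k → colᵀ T j ≡ colᵀ T k → rowᵀ T j ℕ.< rowᵀ T k → k Fin.< j
      inCols = proj₂ (reverseStandard T)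

    pos-≡ : ∀ {j k} → colᵀ T j ≡ colᵀ T k → rowᵀ T j ≡ rowᵀ T k → j ≡ k
    pos-≡ p r = pos-injective T (≡.cong₂ _,_ p r)

    -- Going from j to k first along a row and then up a column.
    southwest : ∀ {j k} → colᵀ T j ℕ.≤ colᵀ T k → rowᵀ T j ℕ.≤ rowᵀ T k → j ≢ k → k Fin.< j
    southwest {j} {k} c≤ r≤ j≢k
      with pos-surjective T (southwest-closed (pos-inShape T k) ℕ.≤-refl r≤)
    ... | m , eq = combine (ℕ.m≤n⇒m<n∨m≡n c≤) (ℕ.m≤n⇒m<n∨m≡n r≤)
      where
      colm : colᵀ T m ≡ colᵀ T k
      colm = ≡.cong proj₁ eq
      rowm : rowᵀ T m ≡ rowᵀ T j
      rowm = ≡.cong proj₂ eq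
      combine : colᵀ T j ℕ.< colᵀ T k ⊎ colᵀ T j ≡ colᵀ T k → rowᵀ T j ℕ.< rowᵀ T k ⊎ rowᵀ T j ≡ rowᵀ T k → k Fin.< j
      combine (inj₁ c<) (inj₁ r<) = Fin.<-trans {i = k} {m} {j}
        (inCols m k colm (≡.subst (ℕ._< rowᵀ T k) (≡.sym rowm) r<))
        (inRows j m (≡.sym rowm) (≡.subst (colᵀ T j ℕ.<_) (≡.sym colm) c<))
      combine (inj₁ c<) (inj₂ r≡) = inRows j k r≡ c<
      combine (inj₂ c≡) (inj₁ r<) = inCols j k c≡ r<
      combine (inj₂ c≡) (inj₂ r≡) = contradiction (pos-≡ c≡ r≡) j≢k

    nothing-between : ∀ {a b m : Fin N} → toℕ b ≡ suc (toℕ a) → m Fin.< b → a Fin.< m → ⊥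
    nothing-between {a} {b} {m} b≡ m<b a<m = ℕ.<-irrefl ≡.refl (ℕ.<-≤-trans a<m (ℕ.≤-pred (≡.subst (toℕ m ℕ.<_) b≡ m<b)))

    data Adjacent (a b : Fin N) : Set where
      sameRow : rowᵀ T a ≡ rowᵀ T b → colᵀ T a ≡ suc (colᵀ T b) → Adjacent a b
      sameCol : colᵀ T a ≡ colᵀ T b → rowᵀ T a ≡ suc (rowᵀ T b) → Adjacent a b
      higher  : rowᵀ T b ℕ.< rowᵀ T a → colᵀ T a ℕ.< colᵀ T b → Adjacent a b
      lower   : rowᵀ T a ℕ.< rowᵀ T b → colᵀ T b ℕ.< colᵀ T a → Adjacent a b

    -- There is no entry strictly between a and a + 1, hence no cell whose position would force one.
    adjacent : ∀ {a b} → toℕ b ≡ suc (toℕ a) → Adjacent a b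
    adjacent {a} {b} b≡ = go (ℕ.<-cmp (rowᵀ T a) (rowᵀ T b)) (ℕ.<-cmp (colᵀ T a) (colᵀ T b))
      where
      a<b : a Fin.< b
      a<b = ≡.subst (toℕ a ℕ.<_) (≡.sym b≡) (ℕ.n<1+n _)
      a≢b : a ≢ b
      a≢b a≡b = ℕ.<-irrefl (≡.cong toℕ a≡b) a<b
      absurd : colᵀ T a ℕ.≤ colᵀ T b → rowᵀ T a ℕ.≤ rowᵀ T b → ⊥
      absurd c r = ℕ.<-asym a<b (southwest c r a≢b)
      -- the entry of a cell strictly between those of a and b lies strictly between a and b
      corner : ∀ c r → (c , r) ∈ᶜ lam → colᵀ T b ℕ.≤ c → rowᵀ T b ℕ.≤ r → c ℕ.≤ colᵀ T a → r ℕ.≤ rowᵀ T a →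
               (c , r) ≢ pos T a → (c , r) ≢ pos T b → ⊥
      corner c r x∈ cb rb ca ra ≢a ≢b with pos-surjective T x∈
      ... | m , ≡.refl = nothing-between b≡
            (southwest cb rb λ b≡m → ≢b (≡.cong (pos T) (≡.sym b≡m)))
            (southwest ca ra λ m≡a → ≢a (≡.cong (pos T) m≡a))
      go : _ → _ → Adjacent a b
      go (tri< r< _ _) (tri< c< _ _) = ⊥-elim (absurd (ℕ.<⇒≤ c<) (ℕ.<⇒≤ r<))
      go (tri< r< _ _) (tri≈ _ c≡ _) = ⊥-elim (absurd (ℕ.≤-reflexive c≡) (ℕ.<⇒≤ r<))
      go (tri< r< _ _) (tri> _ _ c>) = lower r< c>
      go (tri≈ _ r≡ _) (tri< c< _ _) = ⊥-elim (absurd (ℕ.<⇒≤ c<) (ℕ.≤-reflexive r≡))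
      go (tri≈ _ r≡ _) (tri≈ _ c≡ _) = ⊥-elim (absurd (ℕ.≤-reflexive c≡) (ℕ.≤-reflexive r≡))
      go (tri> _ _ r>) (tri< c< _ _) = higher r> c<
      -- If the two cells were not neighbours, the cell just right of `b` would hold an entry
      -- strictly between them.
      go (tri≈ _ r≡ _) (tri> _ _ c>) = sameRow r≡ (≡.sym (ℕ.≤∧≮⇒≡ c> λ gap →
        corner (suc (colᵀ T b)) (rowᵀ T b) (southwest-closed (pos-inShape T a) (ℕ.<⇒≤ gap) (ℕ.≤-reflexive (≡.sym r≡)))
          (ℕ.n≤1+n _) ℕ.≤-refl (ℕ.<⇒≤ gap) (ℕ.≤-reflexive (≡.sym r≡))
          (λ eq → ℕ.<⇒≢ gap (≡.cong proj₁ eq)) (λ eq → ℕ.1+n≢n (≡.cong proj₁ eq))))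
      go (tri> _ _ r>) (tri≈ _ c≡ _) = sameCol c≡ (≡.sym (ℕ.≤∧≮⇒≡ r> λ gap →
        corner (colᵀ T b) (suc (rowᵀ T b)) (southwest-closed (pos-inShape T a) (ℕ.≤-reflexive (≡.sym c≡)) (ℕ.<⇒≤ gap))
          ℕ.≤-refl (ℕ.n≤1+n _) (ℕ.≤-reflexive (≡.sym c≡)) (ℕ.<⇒≤ gap)
          (λ eq → ℕ.<⇒≢ gap (≡.cong proj₂ eq)) (λ eq → ℕ.1+n≢n (≡.cong proj₂ eq))))
      -- The cell in the column of `a` and the row of `b` would hold an entry strictly between them.
      go (tri> _ _ r>) (tri> _ _ c>) = ⊥-elim
        (corner (colᵀ T a) (rowᵀ T b) (southwest-closed (pos-inShape T a) ℕ.≤-refl (ℕ.<⇒≤ r>))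
          (ℕ.<⇒≤ c>) ℕ.≤-refl ℕ.≤-refl (ℕ.<⇒≤ r>)
          (λ eq → ℕ.<⇒≢ r> (≡.cong proj₂ eq)) (λ eq → ℕ.<⇒≢ c> (≡.sym (≡.cong proj₁ eq))))

  ct : Cell → ℤ
  ct (c , r) = c ℤ.⊖ r

  CTᵀ : Tab lam → Fin N → ℤ
  CTᵀ T k = CT (filling T) k

  ⊖-≡ : ∀ {c r c′ r′} → c ℤ.⊖ r ≡ c′ ℤ.⊖ r′ → c ℕ.+ r′ ≡ c′ ℕ.+ r
  ⊖-≡ {c} {r} {c′} {r′} eq = ℤ.+-injective
    (≡.trans (solve 2 (λ c r′ → c :+ r′ := c :+ r′) ≡.refl (+ c) (+ r′))
      (≡.trans (expand c r r′) (≡.trans (≡.cong (λ i → i ℤ.+ (+ r ℤ.+ + r′)) eq) (≡.sym (expand′ c′ r′ r)))))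
    where
    open ℤ.+-*-Solver using (solve; _:+_; _:-_; _:=_)
    expand : ∀ c r r′ → + c ℤ.+ + r′ ≡ (c ℤ.⊖ r) ℤ.+ (+ r ℤ.+ + r′)
    expand c r r′ = ≡.trans (solve 3 (λ c r r′ → c :+ r′ := (c :- r) :+ (r :+ r′)) ≡.refl (+ c) (+ r) (+ r′))
      (≡.cong (ℤ._+ (+ r ℤ.+ + r′)) (ℤ.[+m]-[+n]≡m⊖n c r))
    expand′ : ∀ c r r′ → + c ℤ.+ + r′ ≡ (c ℤ.⊖ r) ℤ.+ (+ r′ ℤ.+ + r)
    expand′ c r r′ = ≡.trans (expand c r r′) (≡.cong (ℤ._+_ (c ℤ.⊖ r)) (ℤ.+-comm (+ r) (+ r′)))

  -- Along a diagonal the column and the row grow together.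
  diagonal : ∀ {c r c′ r′} → c ℕ.+ r′ ≡ c′ ℕ.+ r → (c , r) ≢ (c′ , r′) →
             (c ℕ.< c′ × r ℕ.< r′) ⊎ (c′ ℕ.< c × r′ ℕ.< r)
  diagonal {c} {r} {c′} {r′} eq ≢ with ℕ.<-cmp c c′ | ℕ.<-cmp r r′
  ... | tri< c< _ _ | tri< r< _ _ = inj₁ (c< , r<)
  ... | tri> _ _ c> | tri> _ _ r> = inj₂ (c> , r>)
  ... | tri< c< _ _ | tri≈ _ r≡ _ = contradiction eq (ℕ.<⇒≢ (ℕ.+-mono-<-≤ c< (ℕ.≤-reflexive (≡.sym r≡))))
  ... | tri< c< _ _ | tri> _ _ r> = contradiction eq (ℕ.<⇒≢ (ℕ.+-mono-< c< r>))
  ... | tri≈ _ c≡ _ | tri< r< _ _ = contradiction (≡.sym eq) (ℕ.<⇒≢ (ℕ.+-mono-≤-< (ℕ.≤-reflexive (≡.sym c≡)) r<))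
  ... | tri≈ _ c≡ _ | tri≈ _ r≡ _ = contradiction (≡.cong₂ _,_ c≡ r≡) ≢
  ... | tri≈ _ c≡ _ | tri> _ _ r> = contradiction eq (ℕ.<⇒≢ (ℕ.+-mono-≤-< (ℕ.≤-reflexive c≡) r>))
  ... | tri> _ _ c> | tri< r< _ _ = contradiction (≡.sym eq) (ℕ.<⇒≢ (ℕ.+-mono-< c> r<))
  ... | tri> _ _ c> | tri≈ _ r≡ _ = contradiction (≡.sym eq) (ℕ.<⇒≢ (ℕ.+-mono-<-≤ c> (ℕ.≤-reflexive r≡)))

  -- This keeps the denominator of `ratio` nonzero at consecutive entries. Each of the four relative
  -- positions contradicts equality of contents.
  adjacent-CT-≢ : ∀ T {a b} → toℕ b ≡ suc (toℕ a) → CTᵀ T a ≢ CTᵀ T b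
  adjacent-CT-≢ T {a} {b} b≡ eq with ⊖-≡ {colᵀ T a} {rowᵀ T a} {colᵀ T b} {rowᵀ T b} eq | adjacent T b≡
  ... | e | sameRow r≡ c≡ = ℕ.<⇒≢ (ℕ.+-mono-<-≤ (ℕ.≤-reflexive (≡.sym c≡)) (ℕ.≤-reflexive r≡)) (≡.sym e)
  ... | e | sameCol c≡ r≡ = ℕ.<⇒≢ (ℕ.+-mono-≤-< (ℕ.≤-reflexive c≡) (ℕ.≤-reflexive (≡.sym r≡))) e
  ... | e | higher r< c<  = ℕ.<⇒≢ (ℕ.+-mono-< c< r<) e
  ... | e | lower r< c<   = ℕ.<⇒≢ (ℕ.+-mono-< c< r<) (≡.sym e)

  -- If a and a + 2 lay on one diagonal, the two other corners of their rectangle would both hold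
  -- the only entry in between. This is the third inequality required by the Yang-Baxter equation.
  next-adjacent-CT-≢ : ∀ T {a b d} → toℕ b ≡ suc (toℕ a) → toℕ d ≡ suc (toℕ b) → CTᵀ T a ≢ CTᵀ T d
  next-adjacent-CT-≢ T {a} {b} {d} b≡ d≡ eq
    with diagonal (⊖-≡ {colᵀ T a} {rowᵀ T a} {colᵀ T d} {rowᵀ T d} eq) (λ p → a≢d (pos-injective T p))
    where
    a<d : a Fin.< d
    a<d = ℕ.<-trans (≡.subst (toℕ a ℕ.<_) (≡.sym b≡) (ℕ.n<1+n _)) (≡.subst (toℕ b ℕ.<_) (≡.sym d≡) (ℕ.n<1+n _))
    a≢d : a ≢ d
    a≢d p = ℕ.<-irrefl (≡.cong toℕ p) a<d
  ... | inj₁ (c< , r<) = ℕ.<-asym a<d (southwest T (ℕ.<⇒≤ c<) (ℕ.<⇒≤ r<) λ p → ℕ.<⇒≢ c< (≡.cong (colᵀ T) p))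
    where
    a<d : a Fin.< d
    a<d = ℕ.<-trans (≡.subst (toℕ a ℕ.<_) (≡.sym b≡) (ℕ.n<1+n _)) (≡.subst (toℕ b ℕ.<_) (≡.sym d≡) (ℕ.n<1+n _))
  ... | inj₂ (c< , r<) = ℕ.<⇒≢ c< (≡.cong proj₁ (≡.trans (≡.sym (is-b (pos-surjective T x∈) c< r<))
                                                         (is-b′ (pos-surjective T y∈) c< r<)))
    where
    x∈ : (colᵀ T d , rowᵀ T a) ∈ᶜ lam
    x∈ = southwest-closed (pos-inShape T a) (ℕ.<⇒≤ c<) ℕ.≤-refl
    y∈ : (colᵀ T a , rowᵀ T d) ∈ᶜ lam
    y∈ = southwest-closed (pos-inShape T a) ℕ.≤-refl (ℕ.<⇒≤ r<)
    between : ∀ {m} → m Fin.< d → a Fin.< m → m ≡ b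
    between {m} m<d a<m = Fin.toℕ-injective (ℕ.≤-antisym
      (ℕ.≤-pred (≡.subst (toℕ m ℕ.<_) d≡ m<d)) (≡.subst (ℕ._≤ toℕ m) (≡.sym b≡) a<m))
    is-b : (∃ λ k → pos T k ≡ (colᵀ T d , rowᵀ T a)) → colᵀ T d ℕ.< colᵀ T a → rowᵀ T d ℕ.< rowᵀ T a →
           pos T b ≡ (colᵀ T d , rowᵀ T a)
    is-b (m , eq) c< r< = ≡.trans (≡.cong (pos T) (≡.sym (between
      (southwest T (ℕ.≤-reflexive (≡.sym (≡.cong proj₁ eq))) (ℕ.≤-trans (ℕ.<⇒≤ r<) (ℕ.≤-reflexive (≡.sym (≡.cong proj₂ eq))))
        λ { ≡.refl → ℕ.<⇒≢ r< (≡.cong proj₂ eq) })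
      (southwest T (ℕ.≤-trans (ℕ.≤-reflexive (≡.cong proj₁ eq)) (ℕ.<⇒≤ c<)) (ℕ.≤-reflexive (≡.cong proj₂ eq))
        λ { ≡.refl → ℕ.<⇒≢ c< (≡.sym (≡.cong proj₁ eq)) })))) eq
    is-b′ : (∃ λ k → pos T k ≡ (colᵀ T a , rowᵀ T d)) → colᵀ T d ℕ.< colᵀ T a → rowᵀ T d ℕ.< rowᵀ T a →
           pos T b ≡ (colᵀ T a , rowᵀ T d)
    is-b′ (m , eq) c< r< = ≡.trans (≡.cong (pos T) (≡.sym (between
      (southwest T (ℕ.≤-trans (ℕ.<⇒≤ c<) (ℕ.≤-reflexive (≡.sym (≡.cong proj₁ eq)))) (ℕ.≤-reflexive (≡.sym (≡.cong proj₂ eq)))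
        λ { ≡.refl → ℕ.<⇒≢ c< (≡.cong proj₁ eq) })
      (southwest T (ℕ.≤-reflexive (≡.cong proj₁ eq)) (ℕ.≤-trans (ℕ.≤-reflexive (≡.cong proj₂ eq)) (ℕ.<⇒≤ r<))
        λ { ≡.refl → ℕ.<⇒≢ r< (≡.sym (≡.cong proj₂ eq)) })))) eq

  -- If T and T′ first differ, counting down, at the entry k, then the cell of k in
  -- one of them holds a larger entry of the other, where they agree.
  content-determines : ∀ T T′ → (∀ k → CTᵀ T k ≡ CTᵀ T′ k) → T ≡ T′
  content-determines T T′ same = Tab-≡ λ k → from-above N k (ℕ.m≤n⇒m≤o+n (toℕ k) ℕ.≤-refl)
    where
    clash : ∀ T T′ k → (∀ j → k Fin.< j → pos T j ≡ pos T′ j) →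
            colᵀ T k ℕ.< colᵀ T′ k → rowᵀ T k ℕ.< rowᵀ T′ k → ⊥
    clash T T′ k agree c< r< with pos-surjective T′ (southwest-closed (pos-inShape T′ k) (ℕ.<⇒≤ c<) (ℕ.<⇒≤ r<))
    ... | j , eq = ℕ.<-irrefl (≡.cong toℕ (≡.sym j≡k)) k<j
      where
      k<j : k Fin.< j
      k<j = southwest T′ (ℕ.≤-trans (ℕ.≤-reflexive (≡.cong proj₁ eq)) (ℕ.<⇒≤ c<))
                         (ℕ.≤-trans (ℕ.≤-reflexive (≡.cong proj₂ eq)) (ℕ.<⇒≤ r<))
                         λ { ≡.refl → ℕ.<⇒≢ c< (≡.sym (≡.cong proj₁ eq)) }
      j≡k : j ≡ k
      j≡k = pos-injective T (≡.trans (agree j k<j) eq)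
    -- `m` bounds the number of entries from `k` upwards, so `m` = 0 is impossible.
    from-above : ∀ m k → N ℕ.≤ toℕ k ℕ.+ m → pos T k ≡ pos T′ k
    from-above zero    k le = contradiction (Fin.toℕ<n k) (ℕ.≤⇒≯ (≡.subst (N ℕ.≤_) (ℕ.+-identityʳ _) le))
    from-above (suc m) k le with Product.≡-dec ℕ._≟_ ℕ._≟_ (pos T k) (pos T′ k)
    ... | yes eq = eq
    ... | no  ≢  = ⊥-elim (differ (diagonal (⊖-≡ {colᵀ T k} {rowᵀ T k} {colᵀ T′ k} {rowᵀ T′ k} (same k)) ≢))
      where
      above : ∀ j → k Fin.< j → pos T j ≡ pos T′ j
      above j k<j = from-above m j (ℕ.≤-trans le (ℕ.≤-trans (ℕ.≤-reflexive (ℕ.+-suc (toℕ k) m)) (ℕ.+-monoˡ-≤ m k<j)))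
      differ : _ → ⊥
      differ (inj₁ (c< , r<)) = clash T T′ k above c< r<
      differ (inj₂ (c< , r<)) = clash T′ T k (λ j lt → ≡.sym (above j lt)) c< r<

-- Adjacent swaps, the cyclic shift, and increments of vectors.

module Swaps where
  private variable
    a : Level
    A : Set a
    n : ℕ

  -- The structural form of `_s[_]`, for which the Coxeter relations hold by pattern matching.
  swap : Fin n → Vec A (suc n) → Vec A (suc n)
  swap Fin.zero    (x ∷ y ∷ u) = y ∷ x ∷ u
  swap (Fin.suc i) (x ∷ u)     = x ∷ swap i u

  lookup-swap-inject₁ : ∀ i (u : Vec A (suc n)) → lookup (swap i u) (inject₁ i) ≡ lookup u (Fin.suc i)
  lookup-swap-inject₁ Fin.zero    (x ∷ y ∷ u) = ≡.refl
  lookup-swap-inject₁ (Fin.suc i) (x ∷ u)     = lookup-swap-inject₁ i u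

  lookup-swap-suc : ∀ i (u : Vec A (suc n)) → lookup (swap i u) (Fin.suc i) ≡ lookup u (inject₁ i)
  lookup-swap-suc Fin.zero    (x ∷ y ∷ u) = ≡.refl
  lookup-swap-suc (Fin.suc i) (x ∷ u)     = lookup-swap-suc i u

  lookup-swap-other : ∀ i (u : Vec A (suc n)) {k} → k ≢ inject₁ i → k ≢ Fin.suc i → lookup (swap i u) k ≡ lookup u k
  lookup-swap-other Fin.zero    (x ∷ y ∷ u) {Fin.zero}            p r = contradiction ≡.refl p
  lookup-swap-other Fin.zero    (x ∷ y ∷ u) {Fin.suc Fin.zero}    p r = contradiction ≡.refl r
  lookup-swap-other Fin.zero    (x ∷ y ∷ u) {Fin.suc (Fin.suc k)} p r = ≡.refl
  lookup-swap-other (Fin.suc i) (x ∷ u)     {Fin.zero}            p r = ≡.refl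
  lookup-swap-other (Fin.suc i) (x ∷ u)     {Fin.suc k}           p r =
    lookup-swap-other i u (p ∘ ≡.cong Fin.suc) (r ∘ ≡.cong Fin.suc)

  lookup-≡ : ∀ {u u′ : Vec A n} → (∀ k → lookup u k ≡ lookup u′ k) → u ≡ u′
  lookup-≡ {u = u} {u′} h =
    ≡.trans (≡.sym (Vec.tabulate∘lookup u)) (≡.trans (Vec.tabulate-cong h) (Vec.tabulate∘lookup u′))

  lookup-swap : ∀ i (u : Vec A (suc n)) k → lookup (swap i u) k ≡ lookup u (transpose (inject₁ i) (Fin.suc i) k)
  lookup-swap i u k with transpose-cases (inject₁ i) (Fin.suc i) k
  ... | inj₁ (≡.refl , p)              = ≡.trans (lookup-swap-inject₁ i u) (≡.cong (lookup u) (≡.sym p))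
  ... | inj₂ (inj₁ (≡.refl , p))       = ≡.trans (lookup-swap-suc i u) (≡.cong (lookup u) (≡.sym p))
  ... | inj₂ (inj₂ (k≢ , k≢′ , p)) = ≡.trans (lookup-swap-other i u k≢ k≢′) (≡.cong (lookup u) (≡.sym p))

  s[]-swap : ∀ i (u : Vec A (suc n)) → u s[ i ] ≡ swap i u
  s[]-swap i u = lookup-≡ λ k → ≡.trans (Vec.lookup∘tabulate (lookup u ∘ transpose (inject₁ i) (Fin.suc i)) k)
                                      (≡.sym (lookup-swap i u k))

  swap-involutive : ∀ i (u : Vec A (suc n)) → swap i (swap i u) ≡ u
  swap-involutive Fin.zero    (x ∷ y ∷ u) = ≡.refl
  swap-involutive (Fin.suc i) (x ∷ u)     = ≡.cong (x ∷_) (swap-involutive i u)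

  swap-far : ∀ i j (u : Vec A (suc n)) → suc (toℕ i) ℕ.< toℕ j → swap i (swap j u) ≡ swap j (swap i u)
  swap-far Fin.zero    (Fin.suc (Fin.suc j)) (x ∷ y ∷ u) lt = ≡.refl
  swap-far Fin.zero    (Fin.suc Fin.zero)    u lt = contradiction lt (ℕ.<-irrefl ≡.refl)
  swap-far (Fin.suc i) (Fin.suc j)           (x ∷ u) lt = ≡.cong (x ∷_) (swap-far i j u (ℕ.≤-pred lt))

  swap-braid : ∀ i j (u : Vec A (suc n)) → toℕ j ≡ suc (toℕ i) →
               swap i (swap j (swap i u)) ≡ swap j (swap i (swap j u))
  swap-braid Fin.zero    (Fin.suc Fin.zero) (x ∷ y ∷ z ∷ u) eq = ≡.refl
  swap-braid (Fin.suc i) (Fin.suc j)        (x ∷ u)         eq = ≡.cong (x ∷_) (swap-braid i j u (ℕ.suc-injective eq))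

  adjacent-inject₁ : ∀ (i j : Fin n) → toℕ j ≡ suc (toℕ i) → inject₁ j ≡ Fin.suc i
  adjacent-inject₁ i j eq = Fin.toℕ-injective (≡.trans (Fin.toℕ-inject₁ j) eq)

  inject₁≢suc : ∀ {i : Fin n} → inject₁ i ≢ Fin.suc i
  inject₁≢suc {i = i} eq = ℕ.1+n≢n (≡.sym (≡.trans (≡.sym (Fin.toℕ-inject₁ i)) (≡.cong toℕ eq)))

  far-≢ : ∀ (i j : Fin n) → suc (toℕ i) ℕ.< toℕ j →
          (inject₁ i ≢ inject₁ j × inject₁ i ≢ Fin.suc j) × (Fin.suc i ≢ inject₁ j × Fin.suc i ≢ Fin.suc j)
  far-≢ i j lt = (apart (≡.subst (toℕ (inject₁ i) ℕ.<_) (≡.sym (Fin.toℕ-inject₁ j)) i<) , apart (ℕ.m<n⇒m<1+n i<))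
               , (apart (≡.subst (suc (toℕ i) ℕ.<_) (≡.sym (Fin.toℕ-inject₁ j)) lt) , apart (ℕ.m<n⇒m<1+n lt))
    where
    apart : ∀ {m} {a b : Fin m} → toℕ a ℕ.< toℕ b → a ≢ b
    apart lt eq = ℕ.<⇒≢ lt (≡.cong toℕ eq)
    i< : toℕ (inject₁ i) ℕ.< toℕ j
    i< = ≡.subst (ℕ._< toℕ j) (≡.sym (Fin.toℕ-inject₁ i)) (ℕ.<-trans (ℕ.n<1+n _) lt)

  rotate-injective : ∀ {u u′ : Vec ℕ (suc n)} → rotate u suc ≡ rotate u′ suc → u ≡ u′
  rotate-injective {u = x ∷ u} {x′ ∷ u′} eq with Vec.∷ʳ-injective u u′ eq
  ... | ≡.refl , p = ≡.cong (_∷ u) (ℕ.suc-injective p)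

  lookup-∷ʳ-inject₁ : ∀ (u : Vec A n) z i → lookup (u ∷ʳ z) (inject₁ i) ≡ lookup u i
  lookup-∷ʳ-inject₁ (x ∷ u) z Fin.zero    = ≡.refl
  lookup-∷ʳ-inject₁ (x ∷ u) z (Fin.suc i) = lookup-∷ʳ-inject₁ u z i

  lookup-∷ʳ-fromℕ : ∀ (u : Vec A n) z → lookup (u ∷ʳ z) (fromℕ n) ≡ z
  lookup-∷ʳ-fromℕ []      z = ≡.refl
  lookup-∷ʳ-fromℕ (x ∷ u) z = lookup-∷ʳ-fromℕ u z

  lookup-rotate-inject₁ : ∀ (u : Vec A (suc n)) f i → lookup (rotate u f) (inject₁ i) ≡ lookup u (Fin.suc i)
  lookup-rotate-inject₁ (x ∷ u) f i = lookup-∷ʳ-inject₁ u (f x) i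

  lookup-rotate-fromℕ : ∀ (u : Vec A (suc n)) f → lookup (rotate u f) (fromℕ n) ≡ f (lookup u Fin.zero)
  lookup-rotate-fromℕ (x ∷ u) f = lookup-∷ʳ-fromℕ u (f x)

  swap-∷ʳ : ∀ i (u : Vec A (suc n)) z → swap (inject₁ i) (u ∷ʳ z) ≡ swap i u ∷ʳ z
  swap-∷ʳ Fin.zero    (x ∷ y ∷ u) z = ≡.refl
  swap-∷ʳ (Fin.suc i) (x ∷ u)     z = ≡.cong (x ∷_) (swap-∷ʳ i u z)

  swap-fromℕ : ∀ (u : Vec A n) y z → swap (fromℕ n) (u ∷ʳ y ∷ʳ z) ≡ u ∷ʳ z ∷ʳ y
  swap-fromℕ []      y z = ≡.refl
  swap-fromℕ (x ∷ u) y z = ≡.cong (x ∷_) (swap-fromℕ u y z)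

  swap-rotate : ∀ i (u : Vec A (suc (suc n))) f → swap (inject₁ i) (rotate u f) ≡ rotate (swap (Fin.suc i) u) f
  swap-rotate i (x ∷ u) f = swap-∷ʳ i u (f x)

  -- The shadow on vectors of ΦΦT_{N-1} = T_1ΦΦ, as `swap-rotate` is that of ΦT_i = T_{i+1}Φ.
  swap-rotate-rotate : ∀ (u : Vec A (suc (suc n))) f →
    swap (fromℕ n) (rotate (rotate u f) f) ≡ rotate (rotate (swap Fin.zero u) f) f
  swap-rotate-rotate (x ∷ y ∷ u) f = swap-fromℕ u (f x) (f y)

  module Neighbours (i j : Fin n) (j≡ : toℕ j ≡ suc (toℕ i)) where
    mid : inject₁ j ≡ Fin.suc i
    mid = adjacent-inject₁ i j j≡

    last≢ : Fin.suc j ≢ inject₁ i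
    last≢ eq = ℕ.<⇒≢ (ℕ.m<n⇒m<1+n (ℕ.≤-reflexive (≡.sym j≡)))
      (≡.sym (≡.trans (≡.cong toℕ eq) (Fin.toℕ-inject₁ i)))

    last≢′ : Fin.suc j ≢ Fin.suc i
    last≢′ eq = ℕ.1+n≢n (≡.trans (≡.sym j≡) (ℕ.suc-injective (≡.cong toℕ eq)))

    first≢ : inject₁ i ≢ inject₁ j
    first≢ eq = inject₁≢suc (≡.trans eq mid)

    first≢′ : inject₁ i ≢ Fin.suc j
    first≢′ eq = last≢ (≡.sym eq)

  -- The three places are `inject₁ i`, `Fin.suc i` = `inject₁ j` and `Fin.suc j`. A prefix lists
  -- swaps in the order in which they are made: `ij-` concerns `swap j (swap i u)`.
  module ThreeCells (i j : Fin n) (j≡ : toℕ j ≡ suc (toℕ i)) (u : Vec A (suc n)) where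
    private
      open Neighbours i j j≡

      x = lookup u (inject₁ i)
      y = lookup u (Fin.suc i)
      w = lookup u (Fin.suc j)

    i-first : lookup (swap i u) (inject₁ i) ≡ y
    i-first = lookup-swap-inject₁ i u
    i-mid : lookup (swap i u) (inject₁ j) ≡ x
    i-mid = ≡.trans (≡.cong (lookup (swap i u)) mid) (lookup-swap-suc i u)
    i-last : lookup (swap i u) (Fin.suc j) ≡ w
    i-last = lookup-swap-other i u last≢ last≢′

    j-first : lookup (swap j u) (inject₁ i) ≡ x
    j-first = lookup-swap-other j u first≢ first≢′
    j-mid : lookup (swap j u) (Fin.suc i) ≡ w
    j-mid = ≡.trans (≡.cong (lookup (swap j u)) (≡.sym mid)) (lookup-swap-inject₁ j u)
    j-last : lookup (swap j u) (Fin.suc j) ≡ y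
    j-last = ≡.trans (lookup-swap-suc j u) (≡.cong (lookup u) mid)

    ij-first : lookup (swap j (swap i u)) (inject₁ i) ≡ y
    ij-first = ≡.trans (lookup-swap-other j (swap i u) first≢ first≢′) i-first
    ij-mid : lookup (swap j (swap i u)) (Fin.suc i) ≡ w
    ij-mid = ≡.trans (≡.trans (≡.cong (lookup (swap j (swap i u))) (≡.sym mid)) (lookup-swap-inject₁ j (swap i u))) i-last

    ij-last : lookup (swap j (swap i u)) (Fin.suc j) ≡ x
    ij-last = ≡.trans (lookup-swap-suc j (swap i u)) i-mid

    ji-first : lookup (swap i (swap j u)) (inject₁ i) ≡ w
    ji-first = ≡.trans (lookup-swap-inject₁ i (swap j u)) j-mid
    ji-mid : lookup (swap i (swap j u)) (inject₁ j) ≡ x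
    ji-mid = ≡.trans (≡.trans (≡.cong (lookup (swap i (swap j u))) mid) (lookup-swap-suc i (swap j u))) j-first
    ji-last : lookup (swap i (swap j u)) (Fin.suc j) ≡ y
    ji-last = ≡.trans (lookup-swap-other i (swap j u) last≢ last≢′) j-last

module Increments where
  open Swaps
  private variable
    n : ℕ

  inc : Fin n → Vec ℕ n → Vec ℕ n
  inc j a = updateAt a j suc

  swap-inc-inject₁ : ∀ i (a : Vec ℕ (suc n)) → swap i (inc (inject₁ i) a) ≡ inc (Fin.suc i) (swap i a)
  swap-inc-inject₁ Fin.zero    (x ∷ y ∷ a) = ≡.refl
  swap-inc-inject₁ (Fin.suc i) (x ∷ a)     = ≡.cong (x ∷_) (swap-inc-inject₁ i a)

  swap-inc-suc : ∀ i (a : Vec ℕ (suc n)) → swap i (inc (Fin.suc i) a) ≡ inc (inject₁ i) (swap i a)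
  swap-inc-suc Fin.zero    (x ∷ y ∷ a) = ≡.refl
  swap-inc-suc (Fin.suc i) (x ∷ a)     = ≡.cong (x ∷_) (swap-inc-suc i a)

  swap-inc-other : ∀ i j (a : Vec ℕ (suc n)) → j ≢ inject₁ i → j ≢ Fin.suc i → swap i (inc j a) ≡ inc j (swap i a)
  swap-inc-other Fin.zero    Fin.zero              (x ∷ y ∷ a) p r = contradiction ≡.refl p
  swap-inc-other Fin.zero    (Fin.suc Fin.zero)    (x ∷ y ∷ a) p r = contradiction ≡.refl r
  swap-inc-other Fin.zero    (Fin.suc (Fin.suc j)) (x ∷ y ∷ a) p r = ≡.refl
  swap-inc-other (Fin.suc i) Fin.zero              (x ∷ a)     p r = ≡.refl
  swap-inc-other (Fin.suc i) (Fin.suc j)           (x ∷ a)     p r =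
    ≡.cong (x ∷_) (swap-inc-other i j a (p ∘ ≡.cong Fin.suc) (r ∘ ≡.cong Fin.suc))

  inc-comm : ∀ i j (a : Vec ℕ n) → inc i (inc j a) ≡ inc j (inc i a)
  inc-comm i j a with i Fin.≟ j
  ... | yes ≡.refl = ≡.refl
  ... | no  i≢j    = Vec.updateAt-commutes i j i≢j a

  module Replace (p p′ : Fin n) (p≢p′ : p ≢ p′) where
    -- The local function `at` from the definition of `∂[_]`, for two arbitrary distinct places.
    at₂ : Vec ℕ n → ℕ → ℕ → Vec ℕ n
    at₂ a d e = a [ p ]≔ d [ p′ ]≔ e

    at-inc-fst : ∀ a d e → at₂ (inc p a) d e ≡ at₂ a d e
    at-inc-fst a d e = ≡.cong (_[ p′ ]≔ e) (Vec.updateAt-updateAt p a)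

    at-inc-snd : ∀ a d e → at₂ (inc p′ a) d e ≡ at₂ a d e
    at-inc-snd a d e = ≡.trans (≡.cong (_[ p′ ]≔ e) (Vec.updateAt-commutes p p′ p≢p′ a))
                               (Vec.updateAt-updateAt p′ (a [ p ]≔ d))

    at-inc-other : ∀ j a d e → j ≢ p → j ≢ p′ → at₂ (inc j a) d e ≡ inc j (at₂ a d e)
    at-inc-other j a d e j≢p j≢p′ = ≡.trans (≡.cong (_[ p′ ]≔ e) (Vec.updateAt-commutes p j (≡.≢-sym j≢p) a))
                                            (Vec.updateAt-commutes p′ j (≡.≢-sym j≢p′) (a [ p ]≔ d))

    inc-fst-at : ∀ a d e → inc p (at₂ a d e) ≡ at₂ a (suc d) e
    inc-fst-at a d e = ≡.trans (Vec.updateAt-commutes p p′ p≢p′ (a [ p ]≔ d))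
                               (≡.cong (_[ p′ ]≔ e) (Vec.updateAt-updateAt p a))

    inc-snd-at : ∀ a d e → inc p′ (at₂ a d e) ≡ at₂ a d (suc e)
    inc-snd-at a d e = Vec.updateAt-updateAt p′ (a [ p ]≔ d)

    at-lookup : ∀ a → at₂ a (lookup a p) (lookup a p′) ≡ a
    at-lookup a = ≡.trans (≡.cong (_[ p′ ]≔ lookup a p′) (Vec.[]≔-lookup a p)) (Vec.[]≔-lookup a p′)

  inc-∷ʳ : ∀ k (a : Vec ℕ n) z → inc k a ∷ʳ z ≡ inc (inject₁ k) (a ∷ʳ z)
  inc-∷ʳ Fin.zero    (x ∷ a) z = ≡.refl
  inc-∷ʳ (Fin.suc k) (x ∷ a) z = ≡.cong (x ∷_) (inc-∷ʳ k a z)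

  ∷ʳ-suc : ∀ (a : Vec ℕ n) z → a ∷ʳ suc z ≡ inc (fromℕ n) (a ∷ʳ z)
  ∷ʳ-suc []      z = ≡.refl
  ∷ʳ-suc (x ∷ a) z = ≡.cong (x ∷_) (∷ʳ-suc a z)

  replicate-∷ʳ : ∀ n → replicate n 0 ∷ʳ 0 ≡ replicate (suc n) 0
  replicate-∷ʳ zero    = ≡.refl
  replicate-∷ʳ (suc n) = ≡.cong (0 ∷_) (replicate-∷ʳ n)

-- Consequences of the algebraic independence of q and s.

module Scalars {c ℓ k ℓk} {C : Field c ℓ} (𝕂 : RationalFunctionField C k ℓk) where
  open RationalFunctionField 𝕂
  open Field K
  open IntegerSolver commutativeRing
  open FieldFacts K
  open SetoidReasoning setoid
  private
    module C = Field C
    open RingMorphisms C.rawRing rawRing using (module IsRingHomomorphism)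
    open IsRingHomomorphism ι-isRingHomomorphism using (1#-homo; -‿homo)

  -- Otherwise the difference of the two monomials would be a polynomial relation whose coefficient
  -- at `(a , b)` is 1.
  monomials-distinct : ∀ {a b a′ b′} → q ^ a * s ^ b ≈ q ^ a′ * s ^ b′ → a ≡ a′ × b ≡ b′
  monomials-distinct {a} {b} {a′} {b′} eq with Product.≡-dec ℕ._≟_ ℕ._≟_ (a , b) (a′ , b′)
  ... | yes ≡.refl = ≡.refl , ≡.refl
  ... | no ≢ = contradiction (C.trans (C.sym one) (independent difference-poly vanishes (a , b))) C.1≉0
    where
    difference-poly : List (C.Carrier × (ℕ × ℕ))
    difference-poly = (C.1# , (a , b)) ∷ (C.- C.1# , (a′ , b′)) ∷ []
    vanishes : at-qs difference-poly ≈ 0#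
    vanishes = begin
      ι C.1# * x + (ι (C.- C.1#) * y + 0#)   ≈⟨ +-cong (*-congʳ 1#-homo) (+-congʳ (*-congʳ (trans (-‿homo C.1#) (-‿cong 1#-homo)))) ⟩
      1# * x + (- 1# * y + 0#)               ≈⟨ +-congʳ (*-congˡ eq) ⟩
      1# * y + (- 1# * y + 0#)               ≈⟨ solve 1 (λ y → :1 :* y :+ ((:- :1) :* y :+ :0) := :0) refl y ⟩
      0#                                     ∎
      where x = q ^ a * s ^ b
            y = q ^ a′ * s ^ b′
    one : Combinations.coeff C.commutativeRing (Product.≡-dec ℕ._≟_ ℕ._≟_) difference-poly (a , b) C.≈ C.1#
    one = C.trans (coeff-here C.1# (a , b) ((C.- C.1# , (a′ , b′)) ∷ []))
      (C.trans (C.+-congˡ (coeff-there (C.- C.1#) {a , b} {a′ , b′} [] ≢)) (C.+-identityʳ _))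
      where
      open LinearMaps C.commutativeRing
      instance
        DecEq-ℕ×ℕ : DecEq (ℕ × ℕ)
        DecEq-ℕ×ℕ = record { _≟_ = Product.≡-dec ℕ._≟_ ℕ._≟_ }

  -- A vanishing q would make q and its square equal monomials.
  q≉0 : ¬ q ≈ 0#
  q≉0 q≈0 with monomials-distinct {1} {0} {2} {0} (trans (power 0) (sym (power 1)))
    where
    power : ∀ m → q ^ suc m * 1# ≈ 0#
    power m = trans (*-congʳ (*-congʳ q≈0)) (trans (*-identityʳ _) (zeroˡ _))
  ... | () , _

  s≉0 : ¬ s ≈ 0#
  s≉0 s≈0 with monomials-distinct {0} {1} {0} {2} (trans (power 0) (sym (power 1)))
    where
    power : ∀ m → 1# * s ^ suc m ≈ 0#
    power m = trans (*-identityˡ _) (trans (*-congʳ s≈0) (zeroˡ _))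
  ... | _ , ()

  open Power s≉0 public

  -- The shape of every entry of a spectral vector: `v` is an exponent and `c` a content.
  char : ℕ → ℤ → Carrier
  char v c = q ^ v * s ^ᶻ c

  char-≉0 : ∀ v c → ¬ char v c ≈ 0#
  char-≉0 v c = *-≉0 (^-≉0 q≉0 v) (^ᶻ-≉0 s≉0 c)

  char-suc : ∀ v c → s * char v c ≈ char v (+ 1 ℤ.+ c)
  char-suc v c = trans (solve 3 (λ s x y → s :* (x :* y) := x :* (s :* y)) refl _ _ _)
    (*-congˡ (trans (*-congʳ (sym (*-identityʳ s))) (sym (^ᶻ-+ (+ 1) c))))

  -- Multiplying by a power of s turns both sides into monomials with natural exponents.
  char-⊖-injective : ∀ {v v′} m n m′ n′ → char v (m ℤ.⊖ n) ≈ char v′ (m′ ℤ.⊖ n′) → v ≡ v′ × m ℤ.⊖ n ≡ m′ ℤ.⊖ n′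
  char-⊖-injective {v} {v′} m n m′ n′ eq = proj₁ distinct ,
    ≡.trans (≡.sym (cancelʳ m n n′)) (≡.trans (≡.cong₂ ℤ._⊖_ (proj₂ distinct) (ℕ.+-comm n n′)) (cancelʳ m′ n′ n))
    where
    open SemiringExp semiring using (^-homo-*)
    clear : ∀ v m n n′ → q ^ v * s ^ (m ℕ.+ n′) ≈ char v (m ℤ.⊖ n) * (s ^ n * s ^ n′)
    clear v m n n′ = begin
      q ^ v * s ^ (m ℕ.+ n′)                         ≈⟨ *-congˡ (trans (^-homo-* s m n′) (*-congʳ (sym (^ᶻ-⊖ m n)))) ⟩
      q ^ v * ((s ^ᶻ (m ℤ.⊖ n) * s ^ n) * s ^ n′)    ≈⟨ solve 4 (λ a b c d → a :* ((b :* c) :* d) := (a :* b) :* (c :* d)) refl (q ^ v) (s ^ᶻ (m ℤ.⊖ n)) (s ^ n) (s ^ n′) ⟩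
      char v (m ℤ.⊖ n) * (s ^ n * s ^ n′)            ∎
    distinct : v ≡ v′ × m ℕ.+ n′ ≡ m′ ℕ.+ n
    distinct = monomials-distinct {v} {m ℕ.+ n′} {v′} {m′ ℕ.+ n} (begin
      q ^ v * s ^ (m ℕ.+ n′)                       ≈⟨ clear v m n n′ ⟩
      char v (m ℤ.⊖ n) * (s ^ n * s ^ n′)          ≈⟨ *-congʳ eq ⟩
      char v′ (m′ ℤ.⊖ n′) * (s ^ n * s ^ n′)       ≈⟨ *-congˡ (*-comm (s ^ n) (s ^ n′)) ⟩
      char v′ (m′ ℤ.⊖ n′) * (s ^ n′ * s ^ n)       ≈⟨ clear v′ m′ n′ n ⟨
      q ^ v′ * s ^ (m′ ℕ.+ n)                      ∎)
    cancelʳ : ∀ a b d → (a ℕ.+ d) ℤ.⊖ (b ℕ.+ d) ≡ a ℤ.⊖ b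
    cancelʳ a b d = ≡.trans (≡.cong₂ ℤ._⊖_ (ℕ.+-comm a d) (ℕ.+-comm b d)) (ℤ.+-cancelˡ-⊖ d a b)

  char-injective : ∀ {v c v′ c′} → char v c ≈ char v′ c′ → v ≡ v′ × c ≡ c′
  char-injective {v} {c} {v′} {c′} = by-differences (as-⊖ c) (as-⊖ c′)
    where
    by-differences : (∃ λ m → ∃ λ n → c ≡ m ℤ.⊖ n) → (∃ λ m → ∃ λ n → c′ ≡ m ℤ.⊖ n) → char v c ≈ char v′ c′ → v ≡ v′ × c ≡ c′
    by-differences (m , n , ≡.refl) (m′ , n′ , ≡.refl) = char-⊖-injective {v} {v′} m n m′ n′

-- The seminormal action of the Hecke algebra on V_λ.

module Seminormal {c ℓ k ℓk} {C : Field c ℓ} (𝕂 : RationalFunctionField C k ℓk)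
                  {n : ℕ} (lam : Partition (suc n)) where
  open RationalFunctionField 𝕂 using (K; q; s)
  open Field K
  open Macdonald 𝕂 lam hiding (_⊕_; _•_)
  open IntegerSolver commutativeRing
  open FieldFacts K
  open Ratio s
  open Scalars 𝕂
  open Tableaux lam
  open Swaps
  private module Lists = Combinations commutativeRing

  instance
    DecEq-Tab : DecEq (Tab lam)
    DecEq-Tab = record { _≟_ = _≟ᵀ_ }
    DecEq-Monomial : DecEq Monomial
    DecEq-Monomial = record { _≟_ = Vec.≡-dec ℕ._≟_ }
    DecEq-𝕄 : DecEq (Monomial × Tab lam)
    DecEq-𝕄 = record { _≟_ = Product.≡-dec (Vec.≡-dec ℕ._≟_) _≟ᵀ_ }

  cells : Tab lam → Vec Cell (suc n)
  cells T = cell (filling T)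

  zᶜ : Cell → Carrier
  zᶜ x = s ^ᶻ ct x

  zᶜ-≉0 : ∀ x → ¬ zᶜ x ≈ 0#
  zᶜ-≉0 x = ^ᶻ-≉0 s≉0 (ct x)

  zᶜ-injective : ∀ {x y} → zᶜ x ≈ zᶜ y → ct x ≡ ct y
  zᶜ-injective {x} {y} eq = proj₂ (char-injective {0} {ct x} {0} {ct y} (*-congˡ eq))

  -- The coefficient of the exchanged tableau in the action of T_i, as a function of the cells of i
  -- and i + 1, and 0 where the exchange is not standard. Depending on cells alone, it can be
  -- compared along different words.
  γᶜ : Cell → Cell → Carrier
  γᶜ x y with proj₂ x ℕ.≟ proj₂ y
  ... | yes _ = 0#
  ... | no  _ with proj₁ x ℕ.≟ proj₁ y
  ...   | yes _ = 0#
  ...   | no  _ with proj₂ y ℕ.<? proj₂ x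
  ...     | yes _ = s * (1# - s ^ᶻ (m ℤ.+ + 1)) * (1# - s ^ᶻ (m ℤ.- + 1)) * ((1# - s ^ᶻ m) ^ 2) ⁻¹
    where m = ct y ℤ.- ct x
  ...     | no  _ = 1#

  -- The tableau with i, i+1 exchanged, or T itself if that is not standard.
  exchanged : Fin n → Tab lam → Tab lam
  exchanged i T@(mkTab F rs) with row F (inject₁ i) ℕ.≟ row F (Fin.suc i)
  ... | yes _ = T
  ... | no row≢ with col F (inject₁ i) ℕ.≟ col F (Fin.suc i)
  ...   | yes _   = T
  ...   | no col≢ = mkTab (exchangeᶠ (inject₁ i) (Fin.suc i) F) (exchange-reverseStandard F i row≢ col≢ rs)

  -- When the cells are aligned, `exchanged i T` is only a placeholder, and what counts is that its
  -- coefficient vanishes.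
  data Exchange (i : Fin n) (T : Tab lam) : Set ℓk where
    aligned : rowᵀ T (inject₁ i) ≡ rowᵀ T (Fin.suc i) ⊎ colᵀ T (inject₁ i) ≡ colᵀ T (Fin.suc i) →
              γᶜ (pos T (inject₁ i)) (pos T (Fin.suc i)) ≈ 0# → Exchange i T
    swaps   : rowᵀ T (inject₁ i) ≢ rowᵀ T (Fin.suc i) → colᵀ T (inject₁ i) ≢ colᵀ T (Fin.suc i) →
              cells (exchanged i T) ≡ swap i (cells T) → Exchange i T

  exchange-cases : ∀ i T → Exchange i T
  exchange-cases i T@(mkTab F rs) with row F (inject₁ i) ℕ.≟ row F (Fin.suc i) in req
  ... | yes r≡ = aligned (inj₁ r≡) γ≈0
    where
    γ≈0 : γᶜ (pos T (inject₁ i)) (pos T (Fin.suc i)) ≈ 0#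
    γ≈0 rewrite req = refl
  ... | no row≢ with col F (inject₁ i) ℕ.≟ col F (Fin.suc i) in ceq
  ...   | yes c≡   = aligned (inj₂ c≡) γ≈0
    where
    γ≈0 : γᶜ (pos T (inject₁ i)) (pos T (Fin.suc i)) ≈ 0#
    γ≈0 rewrite req | ceq = refl
  ...   | no col≢ = swaps row≢ col≢ unfolds
    where
    unfolds : cells (exchanged i T) ≡ swap i (cells T)
    unfolds rewrite req | ceq = s[]-swap i (cell F)

  module _ (T : Tab lam) (i : Fin n) where
    private
      x = pos T (inject₁ i)
      y = pos T (Fin.suc i)
      z = zᶜ x
      z′ = zᶜ y

    toℕ-suc-inject₁ : toℕ (Fin.suc i) ≡ suc (toℕ (inject₁ i))
    toℕ-suc-inject₁ = ≡.cong suc (≡.sym (Fin.toℕ-inject₁ i))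

    z-distinct : ¬ z ≈ z′
    z-distinct eq = adjacent-CT-≢ T toℕ-suc-inject₁ (zᶜ-injective {x} {y} eq)

    -- The diagonal coefficient in the definition of T_i is minus the ratio of the content powers,
    -- so adding `ratio` removes the diagonal term.
    ratio-content : - ratio z z′ ≈ (s - 1#) * (1# - s ^ᶻ (ct y ℤ.- ct x)) ⁻¹
    ratio-content = trans (solve 2 (λ s u → :- ((:1 :- s) :* u) := (s :- :1) :* u) refl s _)
      (*-congˡ (⁻¹-cong (+-congˡ (-‿cong (sym (^ᶻ-sub (ct y) (ct x)))))))

    z-sameRow : rowᵀ T (inject₁ i) ≡ rowᵀ T (Fin.suc i) → z ≈ s * z′
    z-sameRow r≡ with adjacent T toℕ-suc-inject₁
    ... | sameRow _ c≡ = trans (reflexive (≡.cong (s ^ᶻ_) (≡.trans (≡.cong₂ ℤ._⊖_ c≡ r≡) (⊖-suc (colᵀ T (Fin.suc i)) (rowᵀ T (Fin.suc i))))))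
                          (trans (^ᶻ-+ (+ 1) (ct y)) (*-congʳ (*-identityʳ s)))
      where
      ⊖-suc : ∀ c r → suc c ℤ.⊖ r ≡ + 1 ℤ.+ (c ℤ.⊖ r)
      ⊖-suc c r = ≡.sym (ℤ.distribʳ-⊖-+-pos 1 c r)
    ... | sameCol _ r≡′ = contradiction (≡.trans (≡.sym r≡′) r≡) ℕ.1+n≢n
    ... | higher r< _   = contradiction (≡.sym r≡) (ℕ.<⇒≢ r<)
    ... | lower r< _    = contradiction r≡ (ℕ.<⇒≢ r<)

    z-sameCol : colᵀ T (inject₁ i) ≡ colᵀ T (Fin.suc i) → z′ ≈ s * z
    z-sameCol c≡ with adjacent T toℕ-suc-inject₁
    ... | sameCol _ r≡ = trans (reflexive (≡.cong (s ^ᶻ_) (≡.trans (⊖-pred (colᵀ T (Fin.suc i)) (rowᵀ T (Fin.suc i)))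
                           (≡.cong (λ i → + 1 ℤ.+ i) (≡.sym (≡.cong₂ ℤ._⊖_ c≡ r≡))))))
                          (trans (^ᶻ-+ (+ 1) (ct x)) (*-congʳ (*-identityʳ s)))
      where
      ⊖-pred : ∀ c r → c ℤ.⊖ r ≡ + 1 ℤ.+ (c ℤ.⊖ suc r)
      ⊖-pred c r = ≡.trans (≡.sym (ℤ.[1+m]⊖[1+n]≡m⊖n c r)) (≡.sym (ℤ.distribʳ-⊖-+-pos 1 c (suc r)))
    ... | sameRow _ c≡′ = contradiction (≡.trans (≡.sym c≡′) c≡) ℕ.1+n≢n
    ... | higher _ c<   = contradiction c≡ (ℕ.<⇒≢ c<)
    ... | lower _ c<    = contradiction (≡.sym c≡) (ℕ.<⇒≢ c<)

    ratio-sameRow : rowᵀ T (inject₁ i) ≡ rowᵀ T (Fin.suc i) → ratio z z′ ≈ - s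
    ratio-sameRow r≡ = ratio-unique (zᶜ-≉0 x) z-distinct (begin
      (- s) * (z - z′)              ≈⟨ *-congˡ (+-congʳ (z-sameRow r≡)) ⟩
      (- s) * (s * z′ - z′)         ≈⟨ solve 2 (λ s z → (:- s) :* (s :* z :- z) := (:1 :- s) :* (s :* z)) refl s z′ ⟩
      (1# - s) * (s * z′)           ≈⟨ *-congˡ (z-sameRow r≡) ⟨
      (1# - s) * z                  ∎)
      where open SetoidReasoning setoid

    ratio-sameCol : colᵀ T (inject₁ i) ≡ colᵀ T (Fin.suc i) → ratio z z′ ≈ 1#
    ratio-sameCol c≡ = ratio-unique (zᶜ-≉0 x) z-distinct (begin
      1# * (z - z′)                 ≈⟨ *-congˡ (+-congˡ (-‿cong (z-sameCol c≡))) ⟩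
      1# * (z - s * z)              ≈⟨ solve 2 (λ s z → :1 :* (z :- s :* z) := (:1 :- s) :* z) refl s z ⟩
      (1# - s) * z                  ∎)
      where open SetoidReasoning setoid

    -- Aligned consecutive entries occupy neighbouring cells, whose contents differ by one; this
    -- kills a factor in `ratio-product`.
    aligned-product : rowᵀ T (inject₁ i) ≡ rowᵀ T (Fin.suc i) ⊎ colᵀ T (inject₁ i) ≡ colᵀ T (Fin.suc i) →
      s + ratio z z′ * ratio z′ z ≈ 0#
    aligned-product al = *-cancelˡ-0 (*-≉0 (x-y≉0 z-distinct) (x-y≉0 z-distinct))
      (trans (*-comm _ _) (trans (ratio-product (zᶜ-≉0 x) (zᶜ-≉0 y) z-distinct) (zero-factor al)))
      where
      zero-factor : _ → (s * z - z′) * (z - s * z′) ≈ 0#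
      zero-factor (inj₁ r≡) = trans (*-congˡ (trans (+-congʳ (z-sameRow r≡)) (-‿inverseʳ _))) (zeroʳ _)
      zero-factor (inj₂ c≡) = trans (*-congʳ (trans (+-congˡ (-‿cong (z-sameCol c≡))) (-‿inverseʳ _))) (zeroˡ _)

    γ-lower : rowᵀ T (inject₁ i) ℕ.< rowᵀ T (Fin.suc i) → colᵀ T (inject₁ i) ≢ colᵀ T (Fin.suc i) → γᶜ x y ≈ 1#
    γ-lower r< c≢ with rowᵀ T (inject₁ i) ℕ.≟ rowᵀ T (Fin.suc i)
    ... | yes r≡ = contradiction r≡ (ℕ.<⇒≢ r<)
    ... | no  _  with colᵀ T (inject₁ i) ℕ.≟ colᵀ T (Fin.suc i)
    ...   | yes c≡ = contradiction c≡ c≢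
    ...   | no  _  with rowᵀ T (Fin.suc i) ℕ.<? rowᵀ T (inject₁ i)
    ...     | yes r> = contradiction r> (ℕ.<-asym r<)
    ...     | no  _  = refl

    -- The normalisation puts the whole product of the two opposite intertwiners on the move that
    -- starts with i in the higher row, and 1 on the move back. The identity is checked after
    -- multiplying by the square of z - z′, with z′ = z s^m.
    γ-higher : rowᵀ T (Fin.suc i) ℕ.< rowᵀ T (inject₁ i) → colᵀ T (inject₁ i) ≢ colᵀ T (Fin.suc i) →
      γᶜ x y ≈ s + ratio z z′ * ratio z′ z
    γ-higher r> c≢ with rowᵀ T (inject₁ i) ℕ.≟ rowᵀ T (Fin.suc i)
    ... | yes r≡ = contradiction (≡.sym r≡) (ℕ.<⇒≢ r>)
    ... | no  _  with colᵀ T (inject₁ i) ℕ.≟ colᵀ T (Fin.suc i)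
    ...   | yes c≡ = contradiction c≡ c≢
    ...   | no  _  with rowᵀ T (Fin.suc i) ℕ.<? rowᵀ T (inject₁ i)
    ...     | no  r≯ = contradiction r> r≯
    ...     | yes _  = *-cancelˡ (*-≉0 (x-y≉0 z-distinct) (x-y≉0 z-distinct)) (begin
      ((z - z′) * (z - z′)) * (s * (1# - s ^ᶻ (m ℤ.+ + 1)) * (1# - s ^ᶻ (m ℤ.- + 1)) * u)
        ≈⟨ *-congʳ (*-cong z-z′ z-z′) ⟩
      ((z * (1# - r)) * (z * (1# - r))) * (s * (1# - s ^ᶻ (m ℤ.+ + 1)) * (1# - s ^ᶻ (m ℤ.- + 1)) * u)
        ≈⟨ solve 6 (λ z r s a b u → ((z :* (:1 :- r)) :* (z :* (:1 :- r))) :* (s :* a :* b :* u) :=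
             (z :* a) :* (z :* (s :* b)) :* (((:1 :- r) :* ((:1 :- r) :* :1)) :* u)) refl z r s _ _ u ⟩
      (z * (1# - s ^ᶻ (m ℤ.+ + 1))) * (z * (s * (1# - s ^ᶻ (m ℤ.- + 1)))) * (((1# - r) ^ 2) * u)
        ≈⟨ *-cong (*-cong up down) (⁻¹-inverse (^-≉0 1-r≉0 2)) ⟩
      (z - s * z′) * (s * z - z′) * 1#
        ≈⟨ solve 2 (λ a b → a :* b :* :1 := b :* a) refl _ _ ⟩
      (s * z - z′) * (z - s * z′)
        ≈⟨ ratio-product (zᶜ-≉0 x) (zᶜ-≉0 y) z-distinct ⟨
      (s + ratio z z′ * ratio z′ z) * ((z - z′) * (z - z′))
        ≈⟨ *-comm _ _ ⟩
      ((z - z′) * (z - z′)) * (s + ratio z z′ * ratio z′ z) ∎)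
      where
      open SetoidReasoning setoid
      m = ct y ℤ.- ct x
      r = s ^ᶻ m
      u = ((1# - r) ^ 2) ⁻¹
      zr : z * r ≈ z′
      zr = trans (sym (^ᶻ-+ (ct x) m)) (reflexive (≡.cong (s ^ᶻ_)
        (ℤ.+-*-Solver.solve 2 (λ a b → b ℤ.+-*-Solver.:+ (a ℤ.+-*-Solver.:- b) ℤ.+-*-Solver.:= a) ≡.refl (ct y) (ct x))))
      z-z′ : z - z′ ≈ z * (1# - r)
      z-z′ = trans (+-congˡ (-‿cong (sym zr))) (solve 2 (λ z r → z :- z :* r := z :* (:1 :- r)) refl z r)
      1-r≉0 : ¬ 1# - r ≈ 0#
      1-r≉0 eq = x-y≉0 z-distinct (trans z-z′ (trans (*-congˡ eq) (zeroʳ _)))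
      up : z * (1# - s ^ᶻ (m ℤ.+ + 1)) ≈ z - s * z′
      up = begin
        z * (1# - s ^ᶻ (m ℤ.+ + 1))   ≈⟨ *-congˡ (+-congˡ (-‿cong (trans (^ᶻ-+ m (+ 1)) (*-congˡ (*-identityʳ s))))) ⟩
        z * (1# - r * s)              ≈⟨ solve 3 (λ z r s → z :* (:1 :- r :* s) := z :- s :* (z :* r)) refl z r s ⟩
        z - s * (z * r)               ≈⟨ +-congˡ (-‿cong (*-congˡ zr)) ⟩
        z - s * z′                    ∎
      down : z * (s * (1# - s ^ᶻ (m ℤ.- + 1))) ≈ s * z - z′
      down = begin
        z * (s * (1# - s ^ᶻ (m ℤ.- + 1)))     ≈⟨ solve 3 (λ z s t → z :* (s :* (:1 :- t)) := s :* z :- z :* (t :* s)) refl z s _ ⟩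
        s * z - z * (s ^ᶻ (m ℤ.- + 1) * s)    ≈⟨ +-congˡ (-‿cong (*-congˡ (trans (*-congˡ (sym (*-identityʳ s))) (sym (^ᶻ-+ (m ℤ.- + 1) (+ 1)))))) ⟩
        s * z - z * s ^ᶻ (m ℤ.- + 1 ℤ.+ + 1)  ≡⟨ ≡.cong (λ i → s * z - z * s ^ᶻ i)
          (ℤ.+-*-Solver.solve 1 (λ a → a ℤ.+-*-Solver.:- ℤ.+-*-Solver.con (+ 1) ℤ.+-*-Solver.:+ ℤ.+-*-Solver.con (+ 1) ℤ.+-*-Solver.:= a) ≡.refl m) ⟩
        s * z - z * r                         ≈⟨ +-congˡ (-‿cong zr) ⟩
        s * z - z′                            ∎

module SeminormalRelations {c ℓ k ℓk} {C : Field c ℓ} (𝕂 : RationalFunctionField C k ℓk)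
                           {n : ℕ} (lam : Partition (suc n)) where
  open RationalFunctionField 𝕂 using (K; s)
  open Field K
  open Macdonald 𝕂 lam hiding (_⊕_; _•_)
  open LinearMaps commutativeRing
  open IntegerSolver commutativeRing
  open FieldFacts K
  open Ratio s
  open Tableaux lam
  open Swaps
  open HeckeOperators K s
  open Seminormal 𝕂 lam

  opaque
    𝐭 : Fin n → Lin (Tab lam) (Tab lam)
    𝐭 i = linearᴸ _T[ i ]

    𝐭-⟨⟩ : ∀ i T → ⟨ T ⟩ ◁ 𝐭 i ≋ T T[ i ]
    𝐭-⟨⟩ i T = linear-⟨⟩ _T[ i ] T

  zero-multiple : ∀ {B : Set} ⦃ _ : DecEq B ⦄ {k} {f g : Comb B} → k ≈ 0# → g ≋ k • f → g ≋ []
  zero-multiple {f = f} k≈0 eq = ≋-trans eq (≋-trans (•-cong k≈0 ≋-refl)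
    (byScalars (0# ⊡ ν 0F) 𝟘 (f ∷ []) λ where (x ∷ []) → zeroˡ x))

  private module Lists = Combinations commutativeRing

  private
    T[]-row : ∀ T i → rowᵀ T (inject₁ i) ≡ rowᵀ T (Fin.suc i) → T T[ i ] ≡ s Lists.• ⟨ T ⟩
    T[]-row T@(mkTab F rs) i r≡ with row F (inject₁ i) ℕ.≟ row F (Fin.suc i)
    ... | yes _ = ≡.refl
    ... | no r≢ = contradiction r≡ r≢

    T[]-col : ∀ T i → rowᵀ T (inject₁ i) ≢ rowᵀ T (Fin.suc i) → colᵀ T (inject₁ i) ≡ colᵀ T (Fin.suc i) →
              T T[ i ] ≡ (- 1#) Lists.• ⟨ T ⟩
    T[]-col T@(mkTab F rs) i r≢ c≡ with row F (inject₁ i) ℕ.≟ row F (Fin.suc i)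
    ... | yes r≡ = contradiction r≡ r≢
    ... | no _ with col F (inject₁ i) ℕ.≟ col F (Fin.suc i)
    ...   | yes _ = ≡.refl
    ...   | no c≢ = contradiction c≡ c≢

    T[]-swaps : ∀ T i → rowᵀ T (inject₁ i) ≢ rowᵀ T (Fin.suc i) → colᵀ T (inject₁ i) ≢ colᵀ T (Fin.suc i) →
      let x = pos T (inject₁ i) ; y = pos T (Fin.suc i) in
      T T[ i ] ≡ ((s - 1#) * (1# - s ^ᶻ (ct y ℤ.- ct x)) ⁻¹) Lists.• ⟨ T ⟩ Lists.⊕ γᶜ x y Lists.• ⟨ exchanged i T ⟩
    T[]-swaps T@(mkTab F rs) i r≢ c≢ with row F (inject₁ i) ℕ.≟ row F (Fin.suc i)
    ... | yes r≡ = contradiction r≡ r≢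
    ... | no _ with col F (inject₁ i) ℕ.≟ col F (Fin.suc i)
    ...   | yes c≡ = contradiction c≡ c≢
    ...   | no _ with row F (Fin.suc i) ℕ.<? row F (inject₁ i)
    ...     | yes _ = ≡.refl
    ...     | no  _ = ≡.refl

  -- One formula for the three clauses of `_T[_]`: in the aligned cases minus the ratio is s or -1,
  -- and `γᶜ` vanishes.
  expansion : ∀ T i → T T[ i ] ≋
    (- ratio (zᶜ (pos T (inject₁ i))) (zᶜ (pos T (Fin.suc i)))) • ⟨ T ⟩
      ⊕ γᶜ (pos T (inject₁ i)) (pos T (Fin.suc i)) • ⟨ exchanged i T ⟩
  expansion T i = by-cases (exchange-cases i T)
    where
    x y : Cell
    x = pos T (inject₁ i)
    y = pos T (Fin.suc i)
    a g : Carrier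
    a = ratio (zᶜ x) (zᶜ y)
    g = γᶜ x y
    scalar : ∀ {k} → - a ≈ k → g ≈ 0# → T T[ i ] ≡ k Lists.• ⟨ T ⟩ → T T[ i ] ≋ (- a) • ⟨ T ⟩ ⊕ g • ⟨ exchanged i T ⟩
    scalar {k} -a≈k g≈0 eq = begin
      T T[ i ]                                        ≡⟨ eq ⟩
      k Lists.• ⟨ T ⟩                                 ≈⟨ •-lists (sym -a≈k) ≋-refl ⟩
      (- a) • ⟨ T ⟩                                   ≈⟨ byScalars ((- a) ⊡ ν 0F) ((- a) ⊡ ν 0F ⊞ 0# ⊡ ν 1F) (⟨ T ⟩ ∷ ⟨ exchanged i T ⟩ ∷ [])
        (λ where (x ∷ y ∷ []) → solve 3 (λ a x y → a :* x := a :* x :+ :0 :* y) refl (- a) x y) ⟩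
      (- a) • ⟨ T ⟩ ⊕ 0# • ⟨ exchanged i T ⟩          ≈⟨ ⊕-cong ≋-refl (•-cong (sym g≈0) ≋-refl) ⟩
      (- a) • ⟨ T ⟩ ⊕ g • ⟨ exchanged i T ⟩           ∎
      where open SetoidReasoning (≋-setoid (Tab lam))
    by-cases : Exchange i T → T T[ i ] ≋ (- a) • ⟨ T ⟩ ⊕ g • ⟨ exchanged i T ⟩
    by-cases (aligned (inj₁ r≡) g≈0) = scalar
      (trans (-‿cong (ratio-sameRow T i r≡)) (solve 1 (λ s → :- (:- s) := s) refl s)) g≈0 (T[]-row T i r≡)
    by-cases (aligned (inj₂ c≡) g≈0) = scalar (-‿cong (ratio-sameCol T i c≡)) g≈0 (T[]-col T i r≢ c≡)
      where
      r≢ : rowᵀ T (inject₁ i) ≢ rowᵀ T (Fin.suc i)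
      r≢ r≡ = inject₁≢suc (pos-≡ T c≡ r≡)
    by-cases (swaps r≢ c≢ _) = ≋-trans (≋-reflexive (T[]-swaps T i r≢ c≢))
      (⊕-lists (•-lists (sym (ratio-content T i)) ≋-refl) (•-lists refl ≋-refl))

  intertwine : ∀ T i → ⟨ T ⟩ ◁ (𝐭 i ⊹ ratio (zᶜ (pos T (inject₁ i))) (zᶜ (pos T (Fin.suc i)))) ≋
    γᶜ (pos T (inject₁ i)) (pos T (Fin.suc i)) • ⟨ exchanged i T ⟩
  intertwine T i = ≋-trans (⊕-cong (≋-trans (𝐭-⟨⟩ i T) (expansion T i)) ≋-refl)
    (byScalars ((- a) ⊡ ν 0F ⊞ g ⊡ ν 1F ⊞ a ⊡ ν 0F) (g ⊡ ν 1F) (⟨ T ⟩ ∷ ⟨ exchanged i T ⟩ ∷ [])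
      λ where (x ∷ y ∷ []) → solve 4 (λ a g x y → (:- a) :* x :+ g :* y :+ a :* x := g :* y) refl a g x y)
    where
    a = ratio (zᶜ (pos T (inject₁ i))) (zᶜ (pos T (Fin.suc i)))
    g = γᶜ (pos T (inject₁ i)) (pos T (Fin.suc i))

  -- The state k • T, where T is known to have the cells u unless k vanishes.
  State : Carrier → Tab lam → Vec Cell (suc n) → Set ℓk
  State k T u = k ≈ 0# ⊎ cells T ≡ u

  -- Recording `swap i u` even after the coefficient has vanished allows words in intertwiners to be
  -- followed on vectors of cells, without asking at each letter whether the tableau is standard.
  walk : ∀ {k T u} i → State k T u →
    let x = lookup u (inject₁ i) ; y = lookup u (Fin.suc i) in
    (k • ⟨ T ⟩) ◁ (𝐭 i ⊹ ratio (zᶜ x) (zᶜ y)) ≋ (k * γᶜ x y) • ⟨ exchanged i T ⟩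
      × State (k * γᶜ x y) (exchanged i T) (swap i u)
  walk {k} {T} {u} i (inj₁ k≈0) =
      ≋-trans (zero-multiple k≈0 (map-• (𝐭 i ⊹ _) k ⟨ T ⟩)) (≋-sym (zero-multiple kγ≈0 ≋-refl)) , inj₁ kγ≈0
    where
    kγ≈0 : k * γᶜ (lookup u (inject₁ i)) (lookup u (Fin.suc i)) ≈ 0#
    kγ≈0 = trans (*-congʳ k≈0) (zeroˡ _)
  walk {k} {T} i (inj₂ ≡.refl) =
      ≋-trans (map-• (𝐭 i ⊹ _) k ⟨ T ⟩) (≋-trans (•-cong refl (intertwine T i))
        (byScalars (k ⊡ g ⊡ ν 0F) ((k * g) ⊡ ν 0F) (⟨ exchanged i T ⟩ ∷ []) λ where (x ∷ []) → sym (*-assoc k g x)))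
    , state (exchange-cases i T)
    where
    g = γᶜ (pos T (inject₁ i)) (pos T (Fin.suc i))
    state : Exchange i T → State (k * g) (exchanged i T) (swap i (cells T))
    state (aligned _ g≈0) = inj₁ (trans (*-congˡ g≈0) (zeroʳ k))
    state (swaps _ _ eq)  = inj₂ eq

  -- If one coefficient vanishes, so does the other, and the tableaux are irrelevant; otherwise the
  -- cells determine the tableau.
  same-state : ∀ {k k′ T T′ u u′} → State k T u → State k′ T′ u′ → k ≈ k′ → u ≡ u′ → k • ⟨ T ⟩ ≋ k′ • ⟨ T′ ⟩
  same-state (inj₁ k≈0) _          k≈k′ _ =
    ≋-trans (zero-multiple k≈0 ≋-refl) (≋-sym (zero-multiple (trans (sym k≈k′) k≈0) ≋-refl))
  same-state (inj₂ _)   (inj₁ k≈0) k≈k′ _ =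
    ≋-trans (zero-multiple (trans k≈k′ k≈0) ≋-refl) (≋-sym (zero-multiple k≈0 ≋-refl))
  same-state {T = T} {T′} (inj₂ p) (inj₂ p′) k≈k′ ≡.refl
    with Tab-≡ {T} {T′} (λ j → ≡.cong (λ u → lookup u j) (≡.trans p (≡.sym p′)))
  ... | ≡.refl = •-cong k≈k′ ≋-refl

  one-• : ∀ {B : Set} ⦃ _ : DecEq B ⦄ (f : Comb B) → f ≋ 1# • f
  one-• f = byScalars (ν 0F) (1# ⊡ ν 0F) (f ∷ []) λ where (x ∷ []) → sym (*-identityˡ x)

  quadratic-from-product : ∀ {B : Set} ⦃ _ : DecEq B ⦄ (X : Lin B B) {a a′} (f : Comb B) → a + a′ ≈ 1# - s →
    f ◁ (X ⊹ a) ◁ (X ⊹ a′) ≋ (s + a * a′) • f → QuadraticAt X f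
  quadratic-from-product {B} X {a} {a′} f a+a′ eq = begin
    f ◁ X ◁ X
      ≈⟨ byScalars (ν 0F) (((ν 0F ⊞ a ⊡ ν 1F) ⊞ a′ ⊡ (ν 1F ⊞ a ⊡ ν 2F)) ⊞ (- (a + a′)) ⊡ ν 1F ⊞ (- (a * a′)) ⊡ ν 2F)
           (f ◁ X ◁ X ∷ f ◁ X ∷ f ∷ [])
           (λ where (x ∷ y ∷ z ∷ []) → solve 5 (λ a a′ x y z →
                      x := ((x :+ a :* y) :+ a′ :* (y :+ a :* z)) :+ (:- (a :+ a′)) :* y :+ (:- (a :* a′)) :* z) refl a a′ x y z) ⟩
    ((f ◁ X ◁ X ⊕ a • f ◁ X) ⊕ a′ • (f ◁ X ⊕ a • f)) ⊕ (- (a + a′)) • f ◁ X ⊕ (- (a * a′)) • f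
      ≈⟨ ⊕-cong (⊕-cong (≋-trans (⊕-cong (≋-sym (map-⊕• X (f ◁ X) a f)) ≋-refl) eq) (•-cong (-‿cong a+a′) ≋-refl)) ≋-refl ⟩
    (s + a * a′) • f ⊕ (- (1# - s)) • f ◁ X ⊕ (- (a * a′)) • f
      ≈⟨ byScalars ((s + a * a′) ⊡ ν 1F ⊞ (- (1# - s)) ⊡ ν 0F ⊞ (- (a * a′)) ⊡ ν 1F) ((s - 1#) ⊡ ν 0F ⊞ s ⊡ ν 1F)
           (f ◁ X ∷ f ∷ [])
           (λ where (x ∷ y ∷ []) → solve 4 (λ s p x y →
                      (s :+ p) :* y :+ (:- (:1 :- s)) :* x :+ (:- p) :* y := (s :- :1) :* x :+ s :* y) refl s (a * a′) x y) ⟩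
    (s - 1#) • f ◁ X ⊕ s • f ∎
    where open SetoidReasoning (≋-setoid B)

  -- Walking to the exchanged tableau and back multiplies by the product of two values of `γᶜ`,
  -- which is the scalar that the quadratic relation requires.
  𝐭-quadratic-⟨⟩ : ∀ T i → QuadraticAt (𝐭 i) ⟨ T ⟩
  𝐭-quadratic-⟨⟩ T i = quadratic-from-product (𝐭 i) ⟨ T ⟩ (ratio-+ (zᶜ-≉0 x) (zᶜ-≉0 y) (z-distinct T i)) (begin
    ⟨ T ⟩ ◁ (𝐭 i ⊹ a) ◁ (𝐭 i ⊹ a′)       ≈⟨ cong (𝐭 i ⊹ a′) (≋-trans (cong (𝐭 i ⊹ a) (one-• ⟨ T ⟩)) (proj₁ first)) ⟩
    (k₁ • ⟨ T₁ ⟩) ◁ (𝐭 i ⊹ a′)           ≈⟨ ⊹-cong (𝐭 i) (ratio-cong z-swap z-swap′) _ ⟩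
    (k₁ • ⟨ T₁ ⟩) ◁ (𝐭 i ⊹ _)            ≈⟨ proj₁ second ⟩
    (k₁ * γᶜ x₁ y₁) • ⟨ exchanged i T₁ ⟩  ≈⟨ same-state (proj₂ second) returned (product (exchange-cases i T)) (swap-involutive i (cells T)) ⟩
    (s + a * a′) • ⟨ T ⟩                 ∎)
    where
    open SetoidReasoning (≋-setoid (Tab lam))
    x = pos T (inject₁ i)
    y = pos T (Fin.suc i)
    a = ratio (zᶜ x) (zᶜ y)
    a′ = ratio (zᶜ y) (zᶜ x)
    k₁ = 1# * γᶜ x y
    T₁ = exchanged i T
    x₁ = lookup (swap i (cells T)) (inject₁ i)
    y₁ = lookup (swap i (cells T)) (Fin.suc i)
    first = walk {1#} {T} {cells T} i (inj₂ ≡.refl)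
    second = walk {k₁} {T₁} i (proj₂ first)
    z-swap : zᶜ y ≈ zᶜ x₁
    z-swap = reflexive (≡.cong zᶜ (≡.sym (lookup-swap-inject₁ i (cells T))))
    z-swap′ : zᶜ x ≈ zᶜ y₁
    z-swap′ = reflexive (≡.cong zᶜ (≡.sym (lookup-swap-suc i (cells T))))
    returned : State (s + a * a′) T (cells T)
    returned = inj₂ ≡.refl
    product : Exchange i T → k₁ * γᶜ x₁ y₁ ≈ s + a * a′
    product (aligned al γ≈0) = trans (*-congʳ (trans (*-congˡ γ≈0) (zeroʳ _))) (trans (zeroˡ _) (sym (aligned-product T i al)))
    product (swaps r≢ c≢ eq) with adjacent T (toℕ-suc-inject₁ T i)
    ... | sameRow r≡ _ = contradiction r≡ r≢
    ... | sameCol c≡ _ = contradiction c≡ c≢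
    -- From the higher position the first step carries the full scalar and the step back 1; from the
    -- lower position it is the other way round.
    ... | higher r> c< = trans (*-cong (trans (*-identityˡ _) (γ-higher T i r> c≢))
            (trans (reflexive (≡.cong₂ γᶜ p₁ p₂)) (γ-lower T₁ i (≡.subst₂ (λ u v → proj₂ u ℕ.< proj₂ v) p₁ p₂ r<₁)
              (≡.subst₂ (λ u v → proj₁ u ≢ proj₁ v) p₁ p₂ c≢₁)))) (*-identityʳ _)
      where
      p₁ : x₁ ≡ pos T₁ (inject₁ i)
      p₁ = ≡.cong (λ u → lookup u (inject₁ i)) (≡.sym eq)
      p₂ : y₁ ≡ pos T₁ (Fin.suc i)
      p₂ = ≡.cong (λ u → lookup u (Fin.suc i)) (≡.sym eq)
      r<₁ : proj₂ x₁ ℕ.< proj₂ y₁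
      r<₁ = ≡.subst₂ (λ u v → proj₂ u ℕ.< proj₂ v) (≡.sym (lookup-swap-inject₁ i (cells T))) (≡.sym (lookup-swap-suc i (cells T))) r>
      c≢₁ : proj₁ x₁ ≢ proj₁ y₁
      c≢₁ = ≡.subst₂ (λ u v → proj₁ u ≢ proj₁ v) (≡.sym (lookup-swap-inject₁ i (cells T))) (≡.sym (lookup-swap-suc i (cells T))) (≡.≢-sym c≢)
    ... | lower r< c< = trans (*-cong (trans (*-identityˡ _) (γ-lower T i r< c≢))
            (trans (reflexive (≡.cong₂ γᶜ p₁ p₂)) (γ-higher T₁ i (≡.subst₂ (λ u v → proj₂ u ℕ.< proj₂ v) p₂ p₁ r>₁)
              (≡.subst₂ (λ u v → proj₁ u ≢ proj₁ v) p₁ p₂ c≢₁))))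
            (trans (*-identityˡ _) (+-congˡ (trans (*-comm _ _) (*-cong (ratio-cong back₂ back₁) (ratio-cong back₁ back₂)))))
      where
      p₁ : x₁ ≡ pos T₁ (inject₁ i)
      p₁ = ≡.cong (λ u → lookup u (inject₁ i)) (≡.sym eq)
      p₂ : y₁ ≡ pos T₁ (Fin.suc i)
      p₂ = ≡.cong (λ u → lookup u (Fin.suc i)) (≡.sym eq)
      back₁ : zᶜ (pos T₁ (inject₁ i)) ≈ zᶜ y
      back₁ = reflexive (≡.cong zᶜ (≡.trans (≡.sym p₁) (lookup-swap-inject₁ i (cells T))))
      back₂ : zᶜ (pos T₁ (Fin.suc i)) ≈ zᶜ x
      back₂ = reflexive (≡.cong zᶜ (≡.trans (≡.sym p₂) (lookup-swap-suc i (cells T))))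
      r>₁ : proj₂ y₁ ℕ.< proj₂ x₁
      r>₁ = ≡.subst₂ (λ u v → proj₂ u ℕ.< proj₂ v) (≡.sym (lookup-swap-suc i (cells T))) (≡.sym (lookup-swap-inject₁ i (cells T))) r<
      c≢₁ : proj₁ x₁ ≢ proj₁ y₁
      c≢₁ = ≡.subst₂ (λ u v → proj₁ u ≢ proj₁ v) (≡.sym (lookup-swap-inject₁ i (cells T))) (≡.sym (lookup-swap-suc i (cells T))) (≡.≢-sym c≢)

  walk³ : ∀ T i j l →
    let u₀ = cells T ; u₁ = swap i u₀ ; u₂ = swap j u₁
        z = λ (u : Vec Cell (suc n)) i → ratio (zᶜ (lookup u (inject₁ i))) (zᶜ (lookup u (Fin.suc i)))
        g = λ (u : Vec Cell (suc n)) i → γᶜ (lookup u (inject₁ i)) (lookup u (Fin.suc i)) in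
    ∃ λ T′ → State (1# * g u₀ i * g u₁ j * g u₂ l) T′ (swap l u₂)
           × ⟨ T ⟩ ◁ (𝐭 i ⊹ z u₀ i) ◁ (𝐭 j ⊹ z u₁ j) ◁ (𝐭 l ⊹ z u₂ l) ≋ (1# * g u₀ i * g u₁ j * g u₂ l) • ⟨ T′ ⟩
  walk³ T i j l = _ , proj₂ third ,
      ≋-trans (cong (𝐭 l ⊹ _) (≋-trans (cong (𝐭 j ⊹ _) (≋-trans (cong (𝐭 i ⊹ _) (one-• ⟨ T ⟩)) (proj₁ first))) (proj₁ second))) (proj₁ third)
    where
    first = walk {1#} {T} {cells T} i (inj₂ ≡.refl)
    second = walk {T = exchanged i T} j (proj₂ first)
    third = walk {T = exchanged j (exchanged i T)} l (proj₂ second)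

  -- Both words of three intertwiners lead to the same cells with the same scalar, which is the
  -- Yang-Baxter equation at a tableau; the braid relation follows from it.
  𝐭-braid-⟨⟩ : ∀ T i j → toℕ j ≡ suc (toℕ i) → BraidAt (𝐭 i) (𝐭 j) ⟨ T ⟩
  𝐭-braid-⟨⟩ T i j j≡ = YangBaxter.yb⇒braid (𝐭 i) (𝐭 j) (ratio-yb (zᶜ-≉0 x) (zᶜ-≉0 y) (z-distinct T i)
    (λ eq → next-adjacent-CT-≢ T i≡ j≡′ (zᶜ-injective {x} {w} eq))
    (λ eq → z-distinct T j (trans (reflexive (≡.cong zᶜ (≡.sym y≡))) eq)))
    ⟨ T ⟩ (𝐭-quadratic-⟨⟩ T i) (𝐭-quadratic-⟨⟩ T j) (begin
      ⟨ T ⟩ ◁ (𝐭 i ⊹ ratio (zᶜ x) (zᶜ y)) ◁ (𝐭 j ⊹ ratio (zᶜ x) (zᶜ w)) ◁ (𝐭 i ⊹ ratio (zᶜ y) (zᶜ w))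
        ≡⟨ ≡.cong₂ (λ p r → ⟨ T ⟩ ◁ (𝐭 i ⊹ ratio (zᶜ x) (zᶜ y)) ◁ (𝐭 j ⊹ p) ◁ (𝐭 i ⊹ r))
             (≡.cong₂ (λ a b → ratio (zᶜ a) (zᶜ b)) (≡.sym i-mid) (≡.sym i-last)) (≡.cong₂ (λ a b → ratio (zᶜ a) (zᶜ b)) (≡.sym ij-first) (≡.sym ij-mid)) ⟩
      ⟨ T ⟩ ◁ (𝐭 i ⊹ _) ◁ (𝐭 j ⊹ _) ◁ (𝐭 i ⊹ _)     ≈⟨ proj₂ (proj₂ left) ⟩
      _ • ⟨ proj₁ left ⟩                              ≈⟨ same-state (proj₁ (proj₂ left)) (proj₁ (proj₂ right)) coefficients (swap-braid i j (cells T) j≡) ⟩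
      _ • ⟨ proj₁ right ⟩                             ≈⟨ proj₂ (proj₂ right) ⟨
      ⟨ T ⟩ ◁ (𝐭 j ⊹ _) ◁ (𝐭 i ⊹ _) ◁ (𝐭 j ⊹ _)
        ≡⟨ ≡.cong₂ (λ p r → ⟨ T ⟩ ◁ (𝐭 j ⊹ ratio (zᶜ (pos T (inject₁ j))) (zᶜ w)) ◁ (𝐭 i ⊹ p) ◁ (𝐭 j ⊹ r))
             (≡.cong₂ (λ a b → ratio (zᶜ a) (zᶜ b)) j-first j-mid) (≡.cong₂ (λ a b → ratio (zᶜ a) (zᶜ b)) ji-mid ji-last) ⟩
      ⟨ T ⟩ ◁ (𝐭 j ⊹ ratio (zᶜ (pos T (inject₁ j))) (zᶜ w)) ◁ (𝐭 i ⊹ ratio (zᶜ x) (zᶜ w)) ◁ (𝐭 j ⊹ ratio (zᶜ x) (zᶜ y))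
        ≡⟨ ≡.cong (λ a → ⟨ T ⟩ ◁ (𝐭 j ⊹ ratio (zᶜ a) (zᶜ w)) ◁ (𝐭 i ⊹ ratio (zᶜ x) (zᶜ w)) ◁ (𝐭 j ⊹ ratio (zᶜ x) (zᶜ y))) (≡.sym y≡) ⟩
      ⟨ T ⟩ ◁ (𝐭 j ⊹ ratio (zᶜ y) (zᶜ w)) ◁ (𝐭 i ⊹ ratio (zᶜ x) (zᶜ w)) ◁ (𝐭 j ⊹ ratio (zᶜ x) (zᶜ y)) ∎)
    where
    open SetoidReasoning (≋-setoid (Tab lam))
    u = cells T
    x = pos T (inject₁ i)
    y = pos T (Fin.suc i)
    w = pos T (Fin.suc j)
    i≡ : toℕ (Fin.suc i) ≡ suc (toℕ (inject₁ i))
    i≡ = toℕ-suc-inject₁ T i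
    j≡′ : toℕ (Fin.suc j) ≡ suc (toℕ (Fin.suc i))
    j≡′ = ≡.cong suc j≡
    y≡ : y ≡ pos T (inject₁ j)
    y≡ = ≡.cong (lookup u) (≡.sym (adjacent-inject₁ i j j≡))
    left = walk³ T i j i
    right = walk³ T j i j
    open ThreeCells i j j≡ u
    coefficients : 1# * γᶜ x y * γᶜ (lookup (swap i u) (inject₁ j)) (lookup (swap i u) (Fin.suc j))
        * γᶜ (lookup (swap j (swap i u)) (inject₁ i)) (lookup (swap j (swap i u)) (Fin.suc i)) ≈
      1# * γᶜ (lookup u (inject₁ j)) w * γᶜ (lookup (swap j u) (inject₁ i)) (lookup (swap j u) (Fin.suc i))
        * γᶜ (lookup (swap i (swap j u)) (inject₁ j)) (lookup (swap i (swap j u)) (Fin.suc j))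
    -- On either route each pair among the three cells is exchanged exactly once.
    coefficients rewrite i-mid | i-last | ij-first | ij-mid | ≡.sym y≡ | j-first | j-mid | ji-mid | ji-last =
      solve 3 (λ a b d → :1 :* a :* b :* d := :1 :* d :* b :* a) refl (γᶜ x y) (γᶜ x w) (γᶜ y w)

  walk² : ∀ T i j →
    let u₀ = cells T ; u₁ = swap i u₀
        z = λ (u : Vec Cell (suc n)) i → ratio (zᶜ (lookup u (inject₁ i))) (zᶜ (lookup u (Fin.suc i)))
        g = λ (u : Vec Cell (suc n)) i → γᶜ (lookup u (inject₁ i)) (lookup u (Fin.suc i)) in
    ∃ λ T′ → State (1# * g u₀ i * g u₁ j) T′ (swap j u₁)
           × ⟨ T ⟩ ◁ (𝐭 i ⊹ z u₀ i) ◁ (𝐭 j ⊹ z u₁ j) ≋ (1# * g u₀ i * g u₁ j) • ⟨ T′ ⟩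
  walk² T i j = _ , proj₂ second ,
      ≋-trans (cong (𝐭 j ⊹ _) (≋-trans (cong (𝐭 i ⊹ _) (one-• ⟨ T ⟩)) (proj₁ first))) (proj₁ second)
    where
    first = walk {1#} {T} {cells T} i (inj₂ ≡.refl)
    second = walk {T = exchanged i T} j (proj₂ first)

  -- The intertwiners commute because neither changes the cells that the other sees; the added
  -- scalars are then stripped one after the other.
  𝐭-far-⟨⟩ : ∀ T i j → suc (toℕ i) ℕ.< toℕ j → ⟨ T ⟩ ◁ 𝐭 i ◁ 𝐭 j ≋ ⟨ T ⟩ ◁ 𝐭 j ◁ 𝐭 i
  𝐭-far-⟨⟩ T i j lt = ⊹-intertwine⁻¹ {X = 𝐭 i} {𝐭 i} {𝐭 j} (r u i)
    (≋-sym (⊹-intertwine⁻¹ {X = 𝐭 j} {𝐭 j} {𝐭 i ⊹ r u i} (r u j) (begin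
      ⟨ T ⟩ ◁ (𝐭 j ⊹ r u j) ◁ (𝐭 i ⊹ r u i)          ≡⟨ ≡.cong (λ p → ⟨ T ⟩ ◁ (𝐭 j ⊹ r u j) ◁ (𝐭 i ⊹ p)) (≡.sym (same-r i j i≢ i≢′ i⁺≢ i⁺≢′)) ⟩
      ⟨ T ⟩ ◁ (𝐭 j ⊹ r u j) ◁ (𝐭 i ⊹ r (swap j u) i)  ≈⟨ proj₂ (proj₂ right) ⟩
      _ • ⟨ proj₁ right ⟩                             ≈⟨ same-state (proj₁ (proj₂ right)) (proj₁ (proj₂ left)) coefficients (swap-far i j u lt) ⟩
      _ • ⟨ proj₁ left ⟩                              ≈⟨ proj₂ (proj₂ left) ⟨
      ⟨ T ⟩ ◁ (𝐭 i ⊹ r u i) ◁ (𝐭 j ⊹ r (swap i u) j)  ≡⟨ ≡.cong (λ p → ⟨ T ⟩ ◁ (𝐭 i ⊹ r u i) ◁ (𝐭 j ⊹ p)) (same-r j i (≡.≢-sym i≢) (≡.≢-sym i⁺≢) (≡.≢-sym i≢′) (≡.≢-sym i⁺≢′)) ⟩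
      ⟨ T ⟩ ◁ (𝐭 i ⊹ r u i) ◁ (𝐭 j ⊹ r u j)          ∎)))
    where
    open SetoidReasoning (≋-setoid (Tab lam))
    u = cells T
    r : Vec Cell (suc n) → Fin n → Carrier
    r u i = ratio (zᶜ (lookup u (inject₁ i))) (zᶜ (lookup u (Fin.suc i)))
    g : Vec Cell (suc n) → Fin n → Carrier
    g u i = γᶜ (lookup u (inject₁ i)) (lookup u (Fin.suc i))
    left = walk² T i j
    right = walk² T j i
    apart : ∀ {a b : Fin (suc n)} → toℕ a ℕ.< toℕ b → a ≢ b
    apart lt eq = ℕ.<⇒≢ lt (≡.cong toℕ eq)
    i< : toℕ (inject₁ i) ℕ.< toℕ j
    i< = ≡.subst (ℕ._< toℕ j) (≡.sym (Fin.toℕ-inject₁ i)) (ℕ.<-trans (ℕ.n<1+n _) lt)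
    i≢ : inject₁ i ≢ inject₁ j
    i≢ = apart (≡.subst (toℕ (inject₁ i) ℕ.<_) (≡.sym (Fin.toℕ-inject₁ j)) i<)
    i≢′ : inject₁ i ≢ Fin.suc j
    i≢′ = apart (ℕ.m<n⇒m<1+n i<)
    i⁺≢ : Fin.suc i ≢ inject₁ j
    i⁺≢ = apart (≡.subst (suc (toℕ i) ℕ.<_) (≡.sym (Fin.toℕ-inject₁ j)) lt)
    i⁺≢′ : Fin.suc i ≢ Fin.suc j
    i⁺≢′ = apart (ℕ.m<n⇒m<1+n lt)
    same-r : ∀ i j → inject₁ i ≢ inject₁ j → inject₁ i ≢ Fin.suc j → Fin.suc i ≢ inject₁ j → Fin.suc i ≢ Fin.suc j →
             r (swap j u) i ≡ r u i
    same-r i j p₁ p₂ p₃ p₄ = ≡.cong₂ (λ x y → ratio (zᶜ x) (zᶜ y)) (lookup-swap-other j u p₁ p₂) (lookup-swap-other j u p₃ p₄)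
    same-g : ∀ i j → inject₁ i ≢ inject₁ j → inject₁ i ≢ Fin.suc j → Fin.suc i ≢ inject₁ j → Fin.suc i ≢ Fin.suc j →
             g (swap j u) i ≡ g u i
    same-g i j p₁ p₂ p₃ p₄ = ≡.cong₂ γᶜ (lookup-swap-other j u p₁ p₂) (lookup-swap-other j u p₃ p₄)
    coefficients : 1# * g u j * g (swap j u) i ≈ 1# * g u i * g (swap i u) j
    coefficients = trans (*-congˡ (reflexive (same-g i j i≢ i≢′ i⁺≢ i⁺≢′)))
      (trans (solve 2 (λ a b → :1 :* a :* b := :1 :* b :* a) refl (g u j) (g u i))
        (*-congˡ (reflexive (≡.sym (same-g j i (≡.≢-sym i≢) (≡.≢-sym i⁺≢) (≡.≢-sym i≢′) (≡.≢-sym i⁺≢′))))))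

-- Divided differences of monomials.

module DividedDifferences {c ℓ k ℓk} {C : Field c ℓ} (𝕂 : RationalFunctionField C k ℓk)
                          {n : ℕ} (lam : Partition (suc n)) where
  open RationalFunctionField 𝕂 using (K; q; s)
  open Field K
  open Macdonald 𝕂 lam hiding (_⊕_; _•_)
  open LinearMaps commutativeRing
  open IntegerSolver commutativeRing
  open Swaps
  open Increments
  open Seminormal 𝕂 lam
  private module Lists = Combinations commutativeRing

  -- Multiplication by a variable, kept as a map on lists so that it coincides with the definitions
  -- by computation.
  relabel : {B D : Set} ⦃ _ : DecEq B ⦄ ⦃ _ : DecEq D ⦄ → (B → D) → Lin B D
  relabel {B} {D} h = record
    { fun   = List.map (map₂ h)
    ; cong  = λ {f} {g} p → ≋-trans (as-linear f) (≋-trans (cong lin p) (≋-sym (as-linear g)))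
    ; map-⊕ = λ f g → ≋-trans (as-linear (f ⊕ g)) (≋-trans (map-⊕ lin f g) (≋-sym (⊕-cong (as-linear f) (as-linear g))))
    ; map-• = λ k f → ≋-trans (as-linear (k • f)) (≋-trans (map-• lin k f) (≋-sym (•-cong refl (as-linear f)))) }
    where
    lin : Lin B D
    lin = linearᴸ (λ b → ⟨ h b ⟩)
    as-linear : ∀ f → List.map (map₂ h) f ≋ f ◁ lin
    as-linear []            = ≋-refl
    as-linear ((k , b) ∷ f) = ≋-trans (∷-⊕ k (h b) _) (≋-trans (⊕-cong ≋-refl (as-linear f))
      (≋-sym (⊕-lists (•-lists refl ≋-refl) ≋-refl)))

  module Quotient (i : Fin n) where
    p p′ : Fin (suc n)
    p = inject₁ i
    p′ = Fin.suc i
    open Replace p p′ inject₁≢suc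

    -- (x^α y^β - x^β y^α) / (x - y), where at d e stands for x^d y^e.
    quotient : (ℕ → ℕ → Monomial) → ℕ → ℕ → Poly
    quotient at α β = applyUpTo (λ k →   1# , at (α ∸ 1 ∸ k) (β ℕ.+ k)) (α ∸ β)
                  ++ applyUpTo (λ k → - 1# , at (β ∸ 1 ∸ k) (α ℕ.+ k)) (β ∸ α)

    ∂-quotient : ∀ a → ∂[ i ] a ≡ quotient (at₂ a) (lookup a p) (lookup a p′)
    ∂-quotient a = ≡.cong₂ _++_ (List.map-upTo _ (lookup a p ∸ lookup a p′)) (List.map-upTo _ (lookup a p′ ∸ lookup a p))

    applyUpTo-cong : ∀ {A : Set k} {f g : ℕ → A} m → (∀ j → j ℕ.< m → f j ≡ g j) → applyUpTo f m ≡ applyUpTo g m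
    applyUpTo-cong zero    h = ≡.refl
    applyUpTo-cong (suc m) h = ≡.cong₂ _∷_ (h 0 (ℕ.s≤s ℕ.z≤n)) (applyUpTo-cong m λ j lt → h (suc j) (ℕ.s≤s lt))

    quotient-cong : ∀ {at at′} α β → (∀ d e → at d e ≡ at′ d e) → quotient at α β ≡ quotient at′ α β
    quotient-cong α β h = ≡.cong₂ _++_
      (applyUpTo-cong (α ∸ β) λ k _ → ≡.cong (1# ,_) (h _ _)) (applyUpTo-cong (β ∸ α) λ k _ → ≡.cong (- 1# ,_) (h _ _))

    map-quotient : ∀ (h : Monomial → Monomial) at α β →
      List.map (map₂ h) (quotient at α β) ≡ quotient (λ d e → h (at d e)) α β
    map-quotient h at α β = ≡.trans (List.map-++ (map₂ h) (applyUpTo _ (α ∸ β)) _)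
      (≡.cong₂ _++_ (List.map-applyUpTo _ (map₂ h) (α ∸ β)) (List.map-applyUpTo _ (map₂ h) (β ∸ α)))

    private
      drop-last : ∀ (L : Poly) b → (L ++ List.[ (- 1# , b) ]) ++ ⟨ b ⟩ ≋ L
      drop-last L b = ≋-trans (≋-reflexive (List.++-assoc L _ _))
        (≋-trans (⊕-lists {f = L} ≋-refl (⊕-lists {f = (- 1# , b) ∷ []} (∷-⊕ (- 1#) b []) ≋-refl))
          (≋-trans (byScalars (ν 0F ⊞ ((- 1#) ⊡ ν 1F ⊞ 𝟘 ⊞ ν 1F)) (ν 0F) (L ∷ ⟨ b ⟩ ∷ [])
            λ where (x ∷ y ∷ []) → solve 2 (λ x y → x :+ ((:- :1) :* y :+ :0 :+ y) := x) refl x y) ≋-refl))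

      move-head : ∀ (L : Poly) b → (1# , b) ∷ L ≋ L ++ ⟨ b ⟩
      move-head L b = ≋-trans (⊕-lists {f = ⟨ b ⟩} {g = L} ≋-refl ≋-refl)
        (≋-trans (byScalars (ν 0F ⊞ ν 1F) (ν 1F ⊞ ν 0F) (⟨ b ⟩ ∷ L ∷ []) λ where (x ∷ y ∷ []) → +-comm x y)
          (≋-sym (⊕-lists ≋-refl ≋-refl)))

    -- x^(α+1) y^β - x^β y^(α+1) equals y (x^α y^β - x^β y^α) + (x - y) x^α y^β. On lists the extra
    -- monomial is either the new first term or cancels the old last one.
    quotient-sucˡ : ∀ at α β → quotient at (suc α) β ≋ quotient (λ d e → at d (suc e)) α β ++ ⟨ at α β ⟩
    quotient-sucˡ at α β with ℕ.≤-total β α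
    ... | inj₁ β≤α with ℕ.m≤n⇒∃[o]m+o≡n β≤α
    ...   | m , ≡.refl = ≋-trans (≋-reflexive lhs) (≋-trans (move-head L _) (≋-reflexive rhs))
      where
      L : Poly
      L = applyUpTo (λ k → 1# , at (β ℕ.+ m ∸ 1 ∸ k) (suc (β ℕ.+ k))) m
      lhs : quotient at (suc (β ℕ.+ m)) β ≡ (1# , at (β ℕ.+ m) β) ∷ L
      lhs rewrite ℕ.m≤n⇒m∸n≡0 (ℕ.m≤n⇒m≤1+n (ℕ.m≤m+n β m)) | ℕ.+-∸-assoc 1 (ℕ.m≤m+n β m) | ℕ.m+n∸m≡n β m =
        ≡.trans (List.++-identityʳ _) (≡.cong₂ _∷_ (≡.cong (λ e → 1# , at (β ℕ.+ m) e) (ℕ.+-identityʳ β))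
          (applyUpTo-cong m λ k _ → ≡.cong (1# ,_) (≡.cong₂ at (≡.sym (ℕ.∸-+-assoc (β ℕ.+ m) 1 k)) (ℕ.+-suc β k))))
      rhs : L ++ ⟨ at (β ℕ.+ m) β ⟩ ≡ quotient (λ d e → at d (suc e)) (β ℕ.+ m) β ++ ⟨ at (β ℕ.+ m) β ⟩
      rhs rewrite ℕ.m≤n⇒m∸n≡0 (ℕ.m≤m+n β m) | ℕ.m+n∸m≡n β m = ≡.cong (_++ _) (≡.sym (List.++-identityʳ L))
    quotient-sucˡ at α β | inj₂ α≤β with ℕ.m≤n⇒∃[o]m+o≡n α≤β
    ... | zero , ≡.refl rewrite ℕ.+-identityʳ α | ℕ.n∸n≡0 α | ℕ.m+n∸n≡m 1 α | ℕ.m≤n⇒m∸n≡0 (ℕ.n≤1+n α) | ℕ.+-identityʳ α = ≋-refl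
    -- For α < β all terms are negative, and the last of them cancels against the extra monomial.
    ... | suc m , ≡.refl = ≋-trans (≋-reflexive lhs) (≋-trans (≋-sym (drop-last L _)) (≋-reflexive rhs))
      where
      β′ = α ℕ.+ suc m
      L : Poly
      L = applyUpTo (λ k → - 1# , at (β′ ∸ 1 ∸ k) (suc (α ℕ.+ k))) m
      lhs : quotient at (suc α) β′ ≡ L
      lhs rewrite ℕ.+-suc α m | ℕ.m≤n⇒m∸n≡0 (ℕ.m≤m+n α m) | ℕ.m+n∸m≡n α m = ≡.refl
      last-term : at α β′ ≡ at (β′ ∸ 1 ∸ m) (suc (α ℕ.+ m))
      last-term = ≡.cong₂ at (≡.sym (≡.trans (≡.cong (λ b → b ∸ 1 ∸ m) (ℕ.+-suc α m)) (ℕ.m+n∸n≡m α m))) (ℕ.+-suc α m)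
      rhs : (L ++ List.[ (- 1# , at α β′) ]) ++ ⟨ at α β′ ⟩ ≡ quotient (λ d e → at d (suc e)) α β′ ++ ⟨ at α β′ ⟩
      rhs = ≡.cong (_++ ⟨ at α β′ ⟩) (≡.trans (≡.cong (λ b → L ++ List.[ (- 1# , b) ]) last-term)
        (≡.trans (List.applyUpTo-∷ʳ (λ k → - 1# , at (β′ ∸ 1 ∸ k) (suc (α ℕ.+ k))) m)
          (≡.cong₂ (λ m₁ m₂ → applyUpTo (λ k → 1# , at (α ∸ 1 ∸ k) (suc (β′ ℕ.+ k))) m₁ ++ applyUpTo (λ k → - 1# , at (β′ ∸ 1 ∸ k) (suc (α ℕ.+ k))) m₂)
            (≡.sym (ℕ.m≤n⇒m∸n≡0 (ℕ.m≤m+n α (suc m)))) (≡.sym (ℕ.m+n∸m≡n α (suc m))))))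

    -- x^α y^(β+1) - x^(β+1) y^α + (x - y) x^α y^β equals x (x^α y^β - x^β y^α).
    quotient-sucʳ : ∀ at α β → quotient at α (suc β) ++ ⟨ at α β ⟩ ≋ quotient (λ d e → at (suc d) e) α β
    quotient-sucʳ at α β with ℕ.≤-total α β
    ... | inj₁ α≤β with ℕ.m≤n⇒∃[o]m+o≡n α≤β
    ...   | m , ≡.refl = ≋-trans (≋-reflexive lhs) (≋-trans (drop-last L _) (≋-reflexive rhs))
      where
      L : Poly
      L = applyUpTo (λ k → - 1# , at (α ℕ.+ m ∸ k) (α ℕ.+ k)) m
      lhs : quotient at α (suc (α ℕ.+ m)) ++ ⟨ at α (α ℕ.+ m) ⟩ ≡ (L ++ List.[ (- 1# , at α (α ℕ.+ m)) ]) ++ ⟨ at α (α ℕ.+ m) ⟩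
      lhs rewrite ℕ.m≤n⇒m∸n≡0 (ℕ.m≤n⇒m≤1+n (ℕ.m≤m+n α m)) | ℕ.+-∸-assoc 1 (ℕ.m≤m+n α m) | ℕ.m+n∸m≡n α m =
        ≡.cong (_++ _) (≡.trans (≡.sym (List.applyUpTo-∷ʳ (λ k → - 1# , at (α ℕ.+ m ∸ k) (α ℕ.+ k)) m))
          (≡.cong (λ d → L ++ List.[ (- 1# , at d (α ℕ.+ m)) ]) (ℕ.m+n∸n≡m α m)))
      rhs : L ≡ quotient (λ d e → at (suc d) e) α (α ℕ.+ m)
      rhs rewrite ℕ.m≤n⇒m∸n≡0 (ℕ.m≤m+n α m) | ℕ.m+n∸m≡n α m =
        applyUpTo-cong m λ k k<m → ≡.cong (λ d → - 1# , at d (α ℕ.+ k)) (shift (ℕ.≤-trans k<m (ℕ.m≤n+m m α)))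
        where
        shift : ∀ {b k} → k ℕ.< b → b ∸ k ≡ suc (b ∸ 1 ∸ k)
        shift {suc b} {k} (ℕ.s≤s k≤b) = ℕ.+-∸-assoc 1 k≤b
    quotient-sucʳ at α β | inj₂ β≤α with ℕ.m≤n⇒∃[o]m+o≡n β≤α
    ... | zero , ≡.refl rewrite ℕ.+-identityʳ β | ℕ.n∸n≡0 β | ℕ.m≤n⇒m∸n≡0 (ℕ.n≤1+n β) | ℕ.m+n∸n≡m 1 β | ℕ.+-identityʳ β = drop-last [] _
    ... | suc m , ≡.refl = ≋-trans (≋-reflexive lhs) (≋-trans (≋-sym (move-head L _)) (≋-reflexive rhs))
      where
      α′ = β ℕ.+ suc m
      L : Poly
      L = applyUpTo (λ k → 1# , at (α′ ∸ 1 ∸ k) (suc (β ℕ.+ k))) m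
      lhs : quotient at α′ (suc β) ++ ⟨ at α′ β ⟩ ≡ L ++ ⟨ at α′ β ⟩
      lhs rewrite ℕ.+-suc β m | ℕ.m≤n⇒m∸n≡0 (ℕ.m≤m+n β m) | ℕ.m+n∸m≡n β m = 
        ≡.cong (_++ ⟨ at (suc (β ℕ.+ m)) β ⟩) (List.++-identityʳ (applyUpTo (λ k → 1# , at (β ℕ.+ m ∸ k) (suc (β ℕ.+ k))) m))
      rhs : (1# , at α′ β) ∷ L ≡ quotient (λ d e → at (suc d) e) α′ β
      rhs rewrite ℕ.m≤n⇒m∸n≡0 (ℕ.m≤m+n β (suc m)) | ℕ.m+n∸m≡n β (suc m) | ℕ.+-suc β m =
        ≡.sym (≡.trans (List.++-identityʳ _) (≡.cong₂ _∷_ (≡.cong (λ e → 1# , at (suc (β ℕ.+ m)) e) (ℕ.+-identityʳ β))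
          (applyUpTo-cong m λ k k<m → ≡.cong (1# ,_) (≡.cong₂ at (shift (ℕ.≤-trans k<m (ℕ.m≤n+m m β))) (ℕ.+-suc β k)))))
        where
        shift : ∀ {b k} → k ℕ.< b → suc (b ∸ suc k) ≡ b ∸ k
        shift {suc b} {k} (ℕ.s≤s k≤b) = ≡.sym (ℕ.+-∸-assoc 1 k≤b)

    -- The twisted Leibniz rule for a product with the first variable; `∂-inc-suc` is that for the
    -- second.
    ∂-inc-inject₁ : ∀ a → ∂[ i ] (inc p a) ≋ ∂[ i ] a ◁ relabel (inc p′) ⊕ ⟨ a ⟩
    ∂-inc-inject₁ a = begin
      ∂[ i ] (inc p a)                                      ≡⟨ ∂-quotient (inc p a) ⟩
      quotient (at₂ (inc p a)) (lookup (inc p a) p) (lookup (inc p a) p′)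
        ≡⟨ ≡.cong₂ (quotient (at₂ (inc p a))) (Vec.lookup∘updateAt p a) (Vec.lookup∘updateAt′ p′ p (≡.≢-sym inject₁≢suc) a) ⟩
      quotient (at₂ (inc p a)) (suc α) β                    ≡⟨ quotient-cong (suc α) β (at-inc-fst a) ⟩
      quotient (at₂ a) (suc α) β                            ≈⟨ quotient-sucˡ (at₂ a) α β ⟩
      quotient (λ d e → at₂ a d (suc e)) α β ++ ⟨ at₂ a α β ⟩ ≡⟨ ≡.cong₂ (λ f b → f ++ ⟨ b ⟩) (quotient-cong α β λ d e → ≡.sym (inc-snd-at a d e)) (at-lookup a) ⟩
      quotient (λ d e → inc p′ (at₂ a d e)) α β ++ ⟨ a ⟩    ≡⟨ ≡.cong (_++ ⟨ a ⟩) (map-quotient (inc p′) (at₂ a) α β) ⟨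
      List.map (map₂ (inc p′)) (quotient (at₂ a) α β) ++ ⟨ a ⟩ ≡⟨ ≡.cong (λ f → List.map (map₂ (inc p′)) f ++ ⟨ a ⟩) (∂-quotient a) ⟨
      List.map (map₂ (inc p′)) (∂[ i ] a) ++ ⟨ a ⟩          ≈⟨ ⊕-lists ≋-refl ≋-refl ⟩
      ∂[ i ] a ◁ relabel (inc p′) ⊕ ⟨ a ⟩                   ∎
      where
      open SetoidReasoning (≋-setoid Monomial)
      α = lookup a p
      β = lookup a p′

    ∂-inc-suc : ∀ a → ∂[ i ] (inc p′ a) ⊕ ⟨ a ⟩ ≋ ∂[ i ] a ◁ relabel (inc p)
    ∂-inc-suc a = begin
      ∂[ i ] (inc p′ a) ⊕ ⟨ a ⟩                             ≈⟨ ⊕-lists ≋-refl ≋-refl ⟨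
      ∂[ i ] (inc p′ a) ++ ⟨ a ⟩                            ≡⟨ ≡.cong (_++ ⟨ a ⟩) (∂-quotient (inc p′ a)) ⟩
      quotient (at₂ (inc p′ a)) (lookup (inc p′ a) p) (lookup (inc p′ a) p′) ++ ⟨ a ⟩
        ≡⟨ ≡.cong₂ (λ d e → quotient (at₂ (inc p′ a)) d e ++ ⟨ a ⟩) (Vec.lookup∘updateAt′ p p′ inject₁≢suc a) (Vec.lookup∘updateAt p′ a) ⟩
      quotient (at₂ (inc p′ a)) α (suc β) ++ ⟨ a ⟩          ≡⟨ ≡.cong₂ (λ f b → f ++ ⟨ b ⟩) (quotient-cong α (suc β) (at-inc-snd a)) (≡.sym (at-lookup a)) ⟩
      quotient (at₂ a) α (suc β) ++ ⟨ at₂ a α β ⟩           ≈⟨ quotient-sucʳ (at₂ a) α β ⟩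
      quotient (λ d e → at₂ a (suc d) e) α β                ≡⟨ quotient-cong α β (λ d e → ≡.sym (inc-fst-at a d e)) ⟩
      quotient (λ d e → inc p (at₂ a d e)) α β              ≡⟨ map-quotient (inc p) (at₂ a) α β ⟨
      List.map (map₂ (inc p)) (quotient (at₂ a) α β)        ≡⟨ ≡.cong (List.map (map₂ (inc p))) (∂-quotient a) ⟨
      ∂[ i ] a ◁ relabel (inc p)                            ∎
      where
      open SetoidReasoning (≋-setoid Monomial)
      α = lookup a p
      β = lookup a p′

    ∂-inc-other : ∀ j a → j ≢ p → j ≢ p′ → ∂[ i ] (inc j a) ≡ ∂[ i ] a ◁ relabel (inc j)
    ∂-inc-other j a j≢p j≢p′ = begin
      ∂[ i ] (inc j a)                                      ≡⟨ ∂-quotient (inc j a) ⟩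
      quotient (at₂ (inc j a)) (lookup (inc j a) p) (lookup (inc j a) p′)
        ≡⟨ ≡.cong₂ (quotient (at₂ (inc j a))) (Vec.lookup∘updateAt′ p j (≡.≢-sym j≢p) a) (Vec.lookup∘updateAt′ p′ j (≡.≢-sym j≢p′) a) ⟩
      quotient (at₂ (inc j a)) α β                          ≡⟨ quotient-cong α β (λ d e → at-inc-other j a d e j≢p j≢p′) ⟩
      quotient (λ d e → inc j (at₂ a d e)) α β              ≡⟨ map-quotient (inc j) (at₂ a) α β ⟨
      List.map (map₂ (inc j)) (quotient (at₂ a) α β)        ≡⟨ ≡.cong (List.map (map₂ (inc j))) (∂-quotient a) ⟨
      ∂[ i ] a ◁ relabel (inc j)                            ∎
      where
      open ≡.≡-Reasoning
      α = lookup a p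
      β = lookup a p′

-- The folds in the definitions as ordered products indexed by natural numbers.

segment : ℕ → ℕ → List ℕ
segment a zero    = []
segment a (suc m) = a ∷ segment (suc a) m

module Segments where

  segment-++ : ∀ a l m → segment a (l ℕ.+ m) ≡ segment a l ++ segment (a ℕ.+ l) m
  segment-++ a zero    m = ≡.cong (λ b → segment b m) (≡.sym (ℕ.+-identityʳ a))
  segment-++ a (suc l) m = ≡.cong (a ∷_) (≡.trans (segment-++ (suc a) l m)
    (≡.cong (λ b → segment (suc a) l ++ segment b m) (≡.sym (ℕ.+-suc a l))))

  map-toℕ-allFin : ∀ n → List.map toℕ (allFin n) ≡ segment 0 n
  map-toℕ-allFin n = ≡.trans (List.map-tabulate id toℕ) (go n 0)
    where
    go : ∀ n a → List.tabulate {n = n} (λ k → a ℕ.+ toℕ k) ≡ segment a n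
    go zero    a = ≡.refl
    go (suc n) a = ≡.cong₂ _∷_ (ℕ.+-identityʳ a)
      (≡.trans (List.tabulate-cong (λ k → ℕ.+-suc a (toℕ k))) (go n (suc a)))

  module _ {P : ℕ → Set} (P? : ∀ k → Dec (P k)) where
    map-filter : ∀ {n} (L : List (Fin n)) → List.map toℕ (filter (λ j → P? (toℕ j)) L) ≡ filter P? (List.map toℕ L)
    map-filter []      = ≡.refl
    map-filter (j ∷ L) with P? (toℕ j)
    ... | yes _ = ≡.cong (toℕ j ∷_) (map-filter L)
    ... | no  _ = map-filter L

    filter-segment-all : ∀ a m → (∀ k → a ℕ.≤ k → k ℕ.< a ℕ.+ m → P k) → filter P? (segment a m) ≡ segment a m
    filter-segment-all a zero    h = ≡.refl
    filter-segment-all a (suc m) h with P? a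
    ... | yes _ = ≡.cong (a ∷_) (filter-segment-all (suc a) m λ k le lt →
                    h k (ℕ.<⇒≤ le) (≡.subst (k ℕ.<_) (≡.sym (ℕ.+-suc a m)) lt))
    ... | no ¬p = contradiction (h a ℕ.≤-refl (ℕ.m<m+n a (ℕ.s≤s ℕ.z≤n))) ¬p

    filter-segment-none : ∀ a m → (∀ k → a ℕ.≤ k → k ℕ.< a ℕ.+ m → ¬ P k) → filter P? (segment a m) ≡ []
    filter-segment-none a zero    h = ≡.refl
    filter-segment-none a (suc m) h with P? a
    ... | yes p = contradiction p (h a ℕ.≤-refl (ℕ.m<m+n a (ℕ.s≤s ℕ.z≤n)))
    ... | no _  = filter-segment-none (suc a) m λ k le lt →
                    h k (ℕ.<⇒≤ le) (≡.subst (k ℕ.<_) (≡.sym (ℕ.+-suc a m)) lt)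

  below-segment : ∀ i r → filter (ℕ._<? i) (segment 0 (i ℕ.+ r)) ≡ segment 0 i
  below-segment i r = ≡.trans (≡.cong (filter (ℕ._<? i)) (segment-++ 0 i r))
    (≡.trans (List.filter-++ (ℕ._<? i) (segment 0 i) (segment i r))
      (≡.trans (≡.cong₂ _++_ (filter-segment-all (ℕ._<? i) 0 i λ k _ lt → lt)
                             (filter-segment-none (ℕ._<? i) i r λ k le _ → ℕ.≤⇒≯ le))
        (List.++-identityʳ _)))

  above-segment : ∀ i r → filter (i ℕ.≤?_) (segment 0 (i ℕ.+ r)) ≡ segment i r
  above-segment i r = ≡.trans (≡.cong (filter (i ℕ.≤?_)) (segment-++ 0 i r))
    (≡.trans (List.filter-++ (i ℕ.≤?_) (segment 0 i) (segment i r))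
      (≡.cong₂ _++_ (filter-segment-none (i ℕ.≤?_) 0 i λ k _ lt → ℕ.<⇒≱ lt)
                    (filter-segment-all (i ℕ.≤?_) i r λ k le _ → le)))

-- Lets products run over natural numbers without bounds on the index. The default is the identity
-- wherever operators are extended, so commutation relations persist out of range.
extend : ∀ {a} {A : Set a} {n} → A → (Fin n → A) → ℕ → A
extend {n = n} x F j with j ℕ.<? n
... | yes lt = F (fromℕ< lt)
... | no  _  = x

module _ {a} {A : Set a} {n} (x : A) (F : Fin n → A) where
  extend-toℕ : ∀ i → extend x F (toℕ i) ≡ F i
  extend-toℕ i with toℕ i ℕ.<? n
  ... | yes lt = ≡.cong F (Fin.fromℕ<-toℕ i lt)
  ... | no ≮   = contradiction (Fin.toℕ<n i) ≮

  extend-elim : ∀ {p} (P : ℕ → A → Set p) → (∀ i → P (toℕ i) (F i)) → (∀ j → n ℕ.≤ j → P j x) → ∀ j → P j (extend x F j)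
  extend-elim P h h₀ j with j ℕ.<? n
  ... | yes lt = ≡.subst (λ j → P j (F (fromℕ< lt))) (Fin.toℕ-fromℕ< lt) (h (fromℕ< lt))
  ... | no ≮   = h₀ j (ℕ.≮⇒≥ ≮)

module Products {c ℓ} (Mon : Monoid c ℓ) where
  open Monoid Mon
  open Intertwining Mon

  product : (ℕ → Carrier) → List ℕ → Carrier
  product t []      = ε
  product t (k ∷ L) = t k ∙ product t L

  product-++ : ∀ t L L′ → product t (L ++ L′) ≈ product t L ∙ product t L′
  product-++ t []      L′ = sym (identityˡ _)
  product-++ t (k ∷ L) L′ = trans (∙-congˡ (product-++ t L L′)) (sym (assoc _ _ _))

  product-segment : ∀ t a m → product t (segment a m) ≈ up t a m
  product-segment t a zero    = refl
  product-segment t a (suc m) = ∙-congˡ (product-segment t (suc a) m)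

  product-reverse-segment : ∀ t a m → product t (reverse (segment a m)) ≈ down t a m
  product-reverse-segment t a zero    = refl
  product-reverse-segment t a (suc m) = trans (reflexive (≡.cong (product t) (List.unfold-reverse a (segment (suc a) m))))
    (trans (product-++ t (reverse (segment (suc a) m)) (a ∷ []))
      (∙-cong (product-reverse-segment t (suc a) m) (identityʳ _)))

module Folds {c ℓ} (R : CommutativeRing c ℓ) {B : Set} ⦃ _ : DecEq B ⦄ where
  open LinearMaps R
  open Products (End B)
  open Intertwining (End B) using (up; down)
  open Segments

  module _ {n} (F : Fin n → Lin B B) where
    private
      t : ℕ → Lin B B
      t = extend idᴸ F

    foldl-product : ∀ f L → foldl (λ g j → g ◁ F j) f L ≋ f ◁ product t (List.map toℕ L)
    foldl-product f []      = ≋-refl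
    foldl-product f (j ∷ L) = ≋-trans (foldl-product (f ◁ F j) L)
      (cong (product t (List.map toℕ L)) (≋-reflexive (≡.cong (f ◁_) (≡.sym (extend-toℕ idᴸ F j)))))

    foldl-allFin : ∀ f → foldl (λ g j → g ◁ F j) f (allFin n) ≋ f ◁ up t 0 n
    foldl-allFin f = ≋-trans (foldl-product f (allFin n))
      (≋-trans (≋-reflexive (≡.cong (λ L → f ◁ product t L) (map-toℕ-allFin n))) (on (product-segment t 0 n) f))

    private
      foldl-reverse : ∀ f L a m → List.map toℕ L ≡ segment a m → foldl (λ g j → g ◁ F j) f (reverse L) ≋ f ◁ down t a m
      foldl-reverse f L a m eq = ≋-trans (foldl-product f (reverse L))
        (≋-trans (≋-reflexive (≡.cong (λ L → f ◁ product t L)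
                   (≡.trans (List.reverse-map toℕ L) (≡.cong reverse eq))))
          (on (product-reverse-segment t a m) f))

    module _ (i r : ℕ) (i+r≡n : i ℕ.+ r ≡ n) where

      foldl-below : ∀ f → foldl (λ g j → g ◁ F j) f (reverse (filter (λ j → toℕ j ℕ.<? i) (allFin n))) ≋ f ◁ down t 0 i
      foldl-below f = foldl-reverse f (filter (λ j → toℕ j ℕ.<? i) (allFin n)) 0 i (≡.trans (map-filter (ℕ._<? i) (allFin n))
        (≡.trans (≡.cong (filter (ℕ._<? i)) (≡.trans (map-toℕ-allFin n) (≡.cong (segment 0) (≡.sym i+r≡n)))) (below-segment i r)))

      foldl-notBelow : ∀ f → foldl (λ g j → g ◁ F j) f (reverse (filter (λ j → i ℕ.≤? toℕ j) (allFin n))) ≋ f ◁ down t i r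
      foldl-notBelow f = foldl-reverse f (filter (λ j → i ℕ.≤? toℕ j) (allFin n)) i r (≡.trans (map-filter (i ℕ.≤?_) (allFin n))
        (≡.trans (≡.cong (filter (i ℕ.≤?_)) (≡.trans (map-toℕ-allFin n) (≡.cong (segment 0) (≡.sym i+r≡n)))) (above-segment i r)))

-- The operators T_i and the variables on M.

module Operators {c ℓ k ℓk} {C : Field c ℓ} (𝕂 : RationalFunctionField C k ℓk)
                 {n : ℕ} (lam : Partition (suc n)) where
  open RationalFunctionField 𝕂 using (K; s)
  open Field K
  open Macdonald 𝕂 lam hiding (_⊕_; _•_)
  open LinearMaps commutativeRing
  open IntegerSolver commutativeRing
  open Swaps
  open Increments
  open HeckeOperators K s
  open Seminormal 𝕂 lam
  open SeminormalRelations 𝕂 lam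
  open DividedDifferences 𝕂 lam
  open SetoidReasoning (≋-setoid (Monomial × Tab lam))
  private module Lists = Combinations commutativeRing

  private
    𝕄 : Set
    𝕄 = Monomial × Tab lam

  -- The underlying function is `g` itself and not merely equal to it on vectors, so that a fold of
  -- `g` is literally a fold of the linear map.
  with-function : ∀ {B D : Set} ⦃ _ : DecEq B ⦄ ⦃ _ : DecEq D ⦄ (g : Comb B → Comb D) (F : Lin B D) →
                  (∀ f → g f ≋ f ◁ F) → Lin B D
  with-function g F eq = record
    { fun   = g
    ; cong  = λ {f} {f′} p → ≋-trans (eq f) (≋-trans (cong F p) (≋-sym (eq f′)))
    ; map-⊕ = λ f f′ → ≋-trans (eq _) (≋-trans (map-⊕ F f f′) (≋-sym (⊕-cong (eq f) (eq f′))))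
    ; map-• = λ k f → ≋-trans (eq _) (≋-trans (map-• F k f) (≋-sym (•-cong refl (eq f)))) }

  module _ {B : Set} ⦃ _ : DecEq B ⦄ where
    opaque
      scale-cong : ∀ a {f g : Comb B} → f ≋ g → a • f ≋ a • g
      scale-cong a p = •-cong refl p

      scale-⊕ : ∀ a (f g : Comb B) → a • (f ⊕ g) ≋ a • f ⊕ a • g
      scale-⊕ a f g = byScalars (a ⊡ (ν 0F ⊞ ν 1F)) (a ⊡ ν 0F ⊞ a ⊡ ν 1F) (f ∷ g ∷ [])
        λ where (x ∷ y ∷ []) → distribˡ a x y

      scale-• : ∀ a k (f : Comb B) → a • k • f ≋ k • a • f
      scale-• a k f = byScalars (a ⊡ k ⊡ ν 0F) (k ⊡ a ⊡ ν 0F) (f ∷ [])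
        λ where (x ∷ []) → solve 3 (λ a k x → a :* (k :* x) := k :* (a :* x)) refl a k x

    scale : Carrier → Lin B B
    scale a = record { fun = a •_ ; cong = scale-cong a ; map-⊕ = scale-⊕ a ; map-• = scale-• a }

  -- X and 𝐓ᴸ are opaque, so that an argument f can be inferred from f ◁ X j.
  opaque
    X : Fin (suc n) → Lin 𝕄 𝕄
    X j = relabel (map₁ (inc j))

    X-fun : ∀ j f → List.map (map₂ (map₁ (inc j))) f ≡ f ◁ X j
    X-fun j f = ≡.refl

  R : Fin (suc n) → Lin Monomial Monomial
  R j = relabel (inc j)

  tensor : Tab lam → Lin Monomial 𝕄
  tensor T = linearᴸ λ a → linear (λ T → ⟨ a , T ⟩) ⟨ T ⟩

  tensor-⟨⟩ : ∀ T a → ⟨ a ⟩ ◁ tensor T ≋ ⟨ a , T ⟩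
  tensor-⟨⟩ T a = ≋-trans (linear-⟨⟩ (λ a → linear (λ T → ⟨ a , T ⟩) ⟨ T ⟩) a) (linear-⟨⟩ (λ T → ⟨ a , T ⟩) T)

  opaque
    inj : Monomial → Lin (Tab lam) 𝕄
    inj a = linearᴸ λ T → ⟨ a , T ⟩

    inj-⟨⟩ : ∀ a T → ⟨ T ⟩ ◁ inj a ≋ ⟨ a , T ⟩
    inj-⟨⟩ a T = linear-⟨⟩ (λ T → ⟨ a , T ⟩) T

    ⊗-inj : ∀ a u → ⟨ a ⟩ ⊗ u ≋ u ◁ inj a
    ⊗-inj a u = linear-⟨⟩ (λ a → linear (λ T → ⟨ a , T ⟩) u) a

  opaque
    constant : Lin (Tab lam) 𝕄
    constant = inj (replicate (suc n) 0)

    constant-inj : ∀ u → u ◁ inj (replicate (suc n) 0) ≡ u ◁ constant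
    constant-inj u = ≡.refl

    constant-⟨⟩ : ∀ T → ⟨ T ⟩ ◁ constant ≋ ⟨ replicate (suc n) 0 , T ⟩
    constant-⟨⟩ T = inj-⟨⟩ (replicate (suc n) 0) T

  opaque
    unfolding X
    tensor-X : ∀ T j f → f ◁ R j ◁ tensor T ≋ f ◁ tensor T ◁ X j
    tensor-X T j = on (basis-ext {F = R j ⨾ tensor T} {tensor T ⨾ X j} λ a →
      ≋-trans (tensor-⟨⟩ T (inc j a)) (≋-sym (cong (X j) (tensor-⟨⟩ T a))))

  opaque
    unfolding X
    inj-X : ∀ a j u → u ◁ inj (inc j a) ≋ u ◁ inj a ◁ X j
    inj-X a j = on (basis-ext {F = inj (inc j a)} {inj a ⨾ X j} λ T →
      ≋-trans (inj-⟨⟩ (inc j a) T) (≋-sym (cong (X j) (inj-⟨⟩ a T))))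

  R-comm : ∀ i j f → f ◁ R i ◁ R j ≋ f ◁ R j ◁ R i
  R-comm i j = on (basis-ext {F = R i ⨾ R j} {R j ⨾ R i} λ a → ≋-reflexive (≡.cong ⟨_⟩ (inc-comm j i a)))

  opaque
    unfolding X
    X-comm : ∀ i j f → f ◁ X i ◁ X j ≋ f ◁ X j ◁ X i
    X-comm i j = on (basis-ext {F = X i ⨾ X j} {X j ⨾ X i} λ (a , T) → ≋-reflexive (≡.cong (λ a → ⟨ a , T ⟩) (inc-comm j i a)))

  𝐓-image : Fin n → 𝕄 → M
  𝐓-image i (a , T) = (1# - s) Lists.• (x[ Fin.suc i ]· ∂[ i ] a ⊗ ⟨ T ⟩) Lists.⊕ ⟨ a s[ i ] ⟩ ⊗ (T T[ i ])

  opaque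
    𝐓ᴸ : Fin n → Lin 𝕄 𝕄
    𝐓ᴸ i = linearᴸ (𝐓-image i)

    𝐓-fun : ∀ i f → 𝐓 i f ≡ f ◁ 𝐓ᴸ i
    𝐓-fun i f = ≡.refl

    𝐓-⟨⟩ : ∀ i a T → ⟨ a , T ⟩ ◁ 𝐓ᴸ i ≋ (1# - s) • ∂[ i ] a ◁ R (Fin.suc i) ◁ tensor T ⊕ (T T[ i ]) ◁ inj (swap i a)
    𝐓-⟨⟩ i a T = ≋-trans (linear-⟨⟩ (𝐓-image i) (a , T))
      (⊕-lists (•-lists refl ≋-refl) (≋-trans (⊗-inj (a s[ i ]) (T T[ i ])) (≋-reflexive (≡.cong (λ b → (T T[ i ]) ◁ inj b) (s[]-swap i a)))))

  module _ (i : Fin n) where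
    open Quotient i using (∂-inc-inject₁; ∂-inc-suc; ∂-inc-other; ∂-quotient; quotient)
    private
      p p′ : Fin (suc n)
      p = inject₁ i
      p′ = Fin.suc i
      θ : Carrier
      θ = 1# - s

    opaque
      unfolding X
      -- The additional monomial in the twisted Leibniz rule contributes the summand 1 - s.
      X-inject₁ : ∀ f → f ◁ X p ◁ 𝐓ᴸ i ≋ f ◁ (𝐓ᴸ i ⊹ θ) ◁ X p′
      X-inject₁ = on (basis-ext {F = X p ⨾ 𝐓ᴸ i} {(𝐓ᴸ i ⊹ θ) ⨾ X p′} λ (a , T) → begin
        ⟨ inc p a , T ⟩ ◁ 𝐓ᴸ i
          ≈⟨ 𝐓-⟨⟩ i (inc p a) T ⟩
        θ • ∂[ i ] (inc p a) ◁ R p′ ◁ tensor T ⊕ (T T[ i ]) ◁ inj (swap i (inc p a))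
          ≈⟨ ⊕-cong (•-cong refl (poly a T)) (≋-trans (≋-reflexive (≡.cong (λ b → (T T[ i ]) ◁ inj b) (swap-inc-inject₁ i a))) (inj-X _ p′ (T T[ i ]))) ⟩
        θ • (∂[ i ] a ◁ R p′ ◁ tensor T ◁ X p′ ⊕ ⟨ a , T ⟩ ◁ X p′) ⊕ (T T[ i ]) ◁ inj (swap i a) ◁ X p′
          ≈⟨ byScalars (θ ⊡ (ν 0F ⊞ ν 1F) ⊞ ν 2F) ((θ ⊡ ν 0F ⊞ ν 2F) ⊞ θ ⊡ ν 1F)
               (∂[ i ] a ◁ R p′ ◁ tensor T ◁ X p′ ∷ ⟨ a , T ⟩ ◁ X p′ ∷ (T T[ i ]) ◁ inj (swap i a) ◁ X p′ ∷ [])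
               (λ where (x ∷ y ∷ z ∷ []) → solve 4 (λ θ x y z → θ :* (x :+ y) :+ z := (θ :* x :+ z) :+ θ :* y) refl θ x y z) ⟩
        (θ • ∂[ i ] a ◁ R p′ ◁ tensor T ◁ X p′ ⊕ (T T[ i ]) ◁ inj (swap i a) ◁ X p′) ⊕ θ • ⟨ a , T ⟩ ◁ X p′
          ≈⟨ ⊕-cong (pull a T) ≋-refl ⟨
        ⟨ a , T ⟩ ◁ 𝐓ᴸ i ◁ X p′ ⊕ θ • ⟨ a , T ⟩ ◁ X p′
          ≈⟨ map-⊕• (X p′) _ θ _ ⟨
        ⟨ a , T ⟩ ◁ (𝐓ᴸ i ⊹ θ) ◁ X p′ ∎)
        where
        pull : ∀ a T → ⟨ a , T ⟩ ◁ 𝐓ᴸ i ◁ X p′ ≋ θ • ∂[ i ] a ◁ R p′ ◁ tensor T ◁ X p′ ⊕ (T T[ i ]) ◁ inj (swap i a) ◁ X p′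
        pull a T = ≋-trans (cong (X p′) (𝐓-⟨⟩ i a T)) (≋-trans (map-⊕ (X p′) _ _) (⊕-cong (map-• (X p′) θ _) ≋-refl))
        poly : ∀ a T → ∂[ i ] (inc p a) ◁ R p′ ◁ tensor T ≋ ∂[ i ] a ◁ R p′ ◁ tensor T ◁ X p′ ⊕ ⟨ a , T ⟩ ◁ X p′
        poly a T = begin
          ∂[ i ] (inc p a) ◁ R p′ ◁ tensor T                      ≈⟨ tensor-X T p′ (∂[ i ] (inc p a)) ⟩
          ∂[ i ] (inc p a) ◁ tensor T ◁ X p′                      ≈⟨ cong (X p′) (cong (tensor T) (∂-inc-inject₁ a)) ⟩
          (∂[ i ] a ◁ R p′ ⊕ ⟨ a ⟩) ◁ tensor T ◁ X p′             ≈⟨ cong (X p′) (map-⊕ (tensor T) _ _) ⟩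
          (∂[ i ] a ◁ R p′ ◁ tensor T ⊕ ⟨ a ⟩ ◁ tensor T) ◁ X p′  ≈⟨ map-⊕ (X p′) _ _ ⟩
          ∂[ i ] a ◁ R p′ ◁ tensor T ◁ X p′ ⊕ ⟨ a ⟩ ◁ tensor T ◁ X p′ ≈⟨ ⊕-cong ≋-refl (cong (X p′) (tensor-⟨⟩ T a)) ⟩
          ∂[ i ] a ◁ R p′ ◁ tensor T ◁ X p′ ⊕ ⟨ a , T ⟩ ◁ X p′    ∎

      X-suc : ∀ f → f ◁ X p′ ◁ (𝐓ᴸ i ⊹ θ) ≋ f ◁ 𝐓ᴸ i ◁ X p
      X-suc = on (basis-ext {F = X p′ ⨾ (𝐓ᴸ i ⊹ θ)} {𝐓ᴸ i ⨾ X p} λ (a , T) → begin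
        ⟨ inc p′ a , T ⟩ ◁ 𝐓ᴸ i ⊕ θ • ⟨ inc p′ a , T ⟩
          ≈⟨ ⊕-cong (𝐓-⟨⟩ i (inc p′ a) T) ≋-refl ⟩
        (θ • ∂[ i ] (inc p′ a) ◁ R p′ ◁ tensor T ⊕ (T T[ i ]) ◁ inj (swap i (inc p′ a))) ⊕ θ • ⟨ inc p′ a , T ⟩
          ≈⟨ byScalars ((θ ⊡ ν 0F ⊞ ν 1F) ⊞ θ ⊡ ν 2F) (θ ⊡ (ν 0F ⊞ ν 2F) ⊞ ν 1F)
               (∂[ i ] (inc p′ a) ◁ R p′ ◁ tensor T ∷ (T T[ i ]) ◁ inj (swap i (inc p′ a)) ∷ ⟨ inc p′ a , T ⟩ ∷ [])
               (λ where (x ∷ y ∷ z ∷ []) → solve 4 (λ θ x y z → (θ :* x :+ y) :+ θ :* z := θ :* (x :+ z) :+ y) refl θ x y z) ⟩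
        θ • (∂[ i ] (inc p′ a) ◁ R p′ ◁ tensor T ⊕ ⟨ inc p′ a , T ⟩) ⊕ (T T[ i ]) ◁ inj (swap i (inc p′ a))
          ≈⟨ ⊕-cong (•-cong refl (poly a T)) (≋-trans (≋-reflexive (≡.cong (λ b → (T T[ i ]) ◁ inj b) (swap-inc-suc i a))) (inj-X _ p (T T[ i ]))) ⟩
        θ • ∂[ i ] a ◁ R p′ ◁ tensor T ◁ X p ⊕ (T T[ i ]) ◁ inj (swap i a) ◁ X p
          ≈⟨ ≋-trans (cong (X p) (𝐓-⟨⟩ i a T)) (≋-trans (map-⊕ (X p) _ _) (⊕-cong (map-• (X p) θ _) ≋-refl)) ⟨
        ⟨ a , T ⟩ ◁ 𝐓ᴸ i ◁ X p ∎)
        where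
        poly : ∀ a T → ∂[ i ] (inc p′ a) ◁ R p′ ◁ tensor T ⊕ ⟨ inc p′ a , T ⟩ ≋ ∂[ i ] a ◁ R p′ ◁ tensor T ◁ X p
        poly a T = begin
          ∂[ i ] (inc p′ a) ◁ R p′ ◁ tensor T ⊕ ⟨ inc p′ a , T ⟩          ≈⟨ ⊕-cong ≋-refl (tensor-⟨⟩ T (inc p′ a)) ⟨
          ∂[ i ] (inc p′ a) ◁ R p′ ◁ tensor T ⊕ ⟨ a ⟩ ◁ R p′ ◁ tensor T   ≈⟨ map-⊕ (tensor T) _ _ ⟨
          (∂[ i ] (inc p′ a) ◁ R p′ ⊕ ⟨ a ⟩ ◁ R p′) ◁ tensor T            ≈⟨ cong (tensor T) (map-⊕ (R p′) _ _) ⟨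
          (∂[ i ] (inc p′ a) ⊕ ⟨ a ⟩) ◁ R p′ ◁ tensor T                   ≈⟨ cong (tensor T) (cong (R p′) (∂-inc-suc a)) ⟩
          ∂[ i ] a ◁ R p ◁ R p′ ◁ tensor T                                ≈⟨ cong (tensor T) (R-comm p p′ (∂[ i ] a)) ⟩
          ∂[ i ] a ◁ R p′ ◁ R p ◁ tensor T                                ≈⟨ tensor-X T p (∂[ i ] a ◁ R p′) ⟩
          ∂[ i ] a ◁ R p′ ◁ tensor T ◁ X p                                ∎

      X-other : ∀ j → j ≢ p → j ≢ p′ → ∀ f → f ◁ X j ◁ 𝐓ᴸ i ≋ f ◁ 𝐓ᴸ i ◁ X j
      X-other j j≢p j≢p′ = on (basis-ext {F = X j ⨾ 𝐓ᴸ i} {𝐓ᴸ i ⨾ X j} λ (a , T) → begin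
        ⟨ inc j a , T ⟩ ◁ 𝐓ᴸ i
          ≈⟨ 𝐓-⟨⟩ i (inc j a) T ⟩
        θ • ∂[ i ] (inc j a) ◁ R p′ ◁ tensor T ⊕ (T T[ i ]) ◁ inj (swap i (inc j a))
          ≈⟨ ⊕-cong (•-cong refl (poly a T)) (≋-trans (≋-reflexive (≡.cong (λ b → (T T[ i ]) ◁ inj b) (swap-inc-other i j a j≢p j≢p′))) (inj-X _ j (T T[ i ]))) ⟩
        θ • ∂[ i ] a ◁ R p′ ◁ tensor T ◁ X j ⊕ (T T[ i ]) ◁ inj (swap i a) ◁ X j
          ≈⟨ ≋-trans (cong (X j) (𝐓-⟨⟩ i a T)) (≋-trans (map-⊕ (X j) _ _) (⊕-cong (map-• (X j) θ _) ≋-refl)) ⟨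
        ⟨ a , T ⟩ ◁ 𝐓ᴸ i ◁ X j ∎)
        where
        poly : ∀ a T → ∂[ i ] (inc j a) ◁ R p′ ◁ tensor T ≋ ∂[ i ] a ◁ R p′ ◁ tensor T ◁ X j
        poly a T = begin
          ∂[ i ] (inc j a) ◁ R p′ ◁ tensor T           ≡⟨ ≡.cong (λ f → f ◁ R p′ ◁ tensor T) (∂-inc-other j a j≢p j≢p′) ⟩
          ∂[ i ] a ◁ R j ◁ R p′ ◁ tensor T             ≈⟨ cong (tensor T) (R-comm j p′ (∂[ i ] a)) ⟩
          ∂[ i ] a ◁ R p′ ◁ R j ◁ tensor T             ≈⟨ tensor-X T j (∂[ i ] a ◁ R p′) ⟩
          ∂[ i ] a ◁ R p′ ◁ tensor T ◁ X j             ∎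

    constant-𝐓 : ∀ u → u ◁ constant ◁ 𝐓ᴸ i ≋ u ◁ 𝐭 i ◁ constant
    constant-𝐓 = on (basis-ext {F = constant ⨾ 𝐓ᴸ i} {𝐭 i ⨾ constant} λ T → begin
      ⟨ T ⟩ ◁ constant ◁ 𝐓ᴸ i                       ≈⟨ cong (𝐓ᴸ i) (constant-⟨⟩ T) ⟩
      ⟨ 𝟎 , T ⟩ ◁ 𝐓ᴸ i                               ≈⟨ 𝐓-⟨⟩ i 𝟎 T ⟩
      θ • ∂[ i ] 𝟎 ◁ R p′ ◁ tensor T ⊕ (T T[ i ]) ◁ inj (swap i 𝟎)
        ≡⟨ ≡.cong₂ (λ d b → θ • d ◁ R p′ ◁ tensor T ⊕ (T T[ i ]) ◁ inj b) ∂𝟎 (swap-replicate i) ⟩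
      θ • [] ⊕ (T T[ i ]) ◁ inj 𝟎                    ≡⟨ ≡.cong (λ g → θ • [] ⊕ g) (constant-inj (T T[ i ])) ⟩
      θ • [] ⊕ (T T[ i ]) ◁ constant                 ≈⟨ byScalars (θ ⊡ 𝟘 ⊞ ν 0F) (ν 0F) ((T T[ i ]) ◁ constant ∷ [])
                                                          (λ where (x ∷ []) → solve 2 (λ θ x → θ :* :0 :+ x := x) refl θ x) ⟩
      (T T[ i ]) ◁ constant                          ≈⟨ cong constant (𝐭-⟨⟩ i T) ⟨
      ⟨ T ⟩ ◁ 𝐭 i ◁ constant                         ∎)
      where
      𝟎 : Monomial
      𝟎 = replicate (suc n) 0
      ∂𝟎 : ∂[ i ] 𝟎 ≡ []
      ∂𝟎 = ≡.trans (∂-quotient 𝟎)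
        (≡.cong₂ (quotient (λ d e → Vec._[_]≔_ (Vec._[_]≔_ 𝟎 p d) p′ e)) (Vec.lookup-replicate p 0) (Vec.lookup-replicate p′ 0))
      swap-replicate : ∀ {m} (i : Fin m) → swap i (replicate (suc m) 0) ≡ replicate (suc m) 0
      swap-replicate Fin.zero    = ≡.refl
      swap-replicate (Fin.suc i) = ≡.cong (0 ∷_) (swap-replicate i)

  inc-induction : ∀ {m} {ℓ} (P : Vec ℕ m → Set ℓ) → P (replicate m 0) → (∀ j a → P a → P (inc j a)) → ∀ a → P a
  inc-induction P z h []          = z
  inc-induction P z h (zero ∷ a)  = inc-induction (λ a → P (0 ∷ a)) z (λ j a → h (Fin.suc j) (0 ∷ a)) a
  inc-induction P z h (suc x ∷ a) = h Fin.zero (x ∷ a) (inc-induction P z h (x ∷ a))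

  opaque
    unfolding X
    -- The principle behind all relations on M: they are checked on constants, where they are
    -- relations on V_λ, and are then carried across multiplication by one variable at a time.
    monomial-ext : ∀ {F G : Lin 𝕄 𝕄} → (∀ T → ⟨ T ⟩ ◁ constant ◁ F ≋ ⟨ T ⟩ ◁ constant ◁ G) →
      (∀ f j → f ◁ F ≋ f ◁ G → f ◁ X j ◁ F ≋ f ◁ X j ◁ G) → F ≐ G
    monomial-ext {F} {G} base extend-by-x = basis-ext λ (a , T) → inc-induction (λ a → ⟨ a , T ⟩ ◁ F ≋ ⟨ a , T ⟩ ◁ G)
      (≋-trans (≋-sym (cong F (constant-⟨⟩ T))) (≋-trans (base T) (cong G (constant-⟨⟩ T)))) (λ j a → extend-by-x ⟨ a , T ⟩ j) a

module FinFamily {c ℓ} (Mon : Monoid c ℓ) {n} (F : Fin n → Monoid.Carrier Mon) where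
  open Monoid Mon
  open Intertwining Mon

  private
    t : ℕ → Carrier
    t = extend ε F

    commutes-with-ε : ∀ x → x ∙ ε ≈ ε ∙ x
    commutes-with-ε x = trans (identityʳ x) (sym (identityˡ x))

  extend-at : ∀ k (lt : k ℕ.< n) → t k ≡ F (fromℕ< lt)
  extend-at k lt = ≡.trans (≡.cong t (≡.sym (Fin.toℕ-fromℕ< lt))) (extend-toℕ ε F (fromℕ< lt))

  isBraidFamily : (∀ i j → suc (toℕ i) ℕ.< toℕ j → F i ∙ F j ≈ F j ∙ F i) →
    (∀ i j → toℕ j ≡ suc (toℕ i) → F i ∙ (F j ∙ F i) ≈ F j ∙ (F i ∙ F j)) → IsBraidFamily n t
  isBraidFamily far braid = record
    { far   = λ i j → extend-elim ε F (λ i x → suc i ℕ.< j → x ∙ t j ≈ t j ∙ x)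
        (λ i → extend-elim ε F (λ j y → suc (toℕ i) ℕ.< j → F i ∙ y ≈ y ∙ F i) (λ j → far i j) (λ _ _ _ → commutes-with-ε (F i)) j)
        (λ _ _ _ → sym (commutes-with-ε (t j))) i
    ; braid = λ i lt → ≡.subst₂ (λ x y → x ∙ (y ∙ x) ≈ y ∙ (x ∙ y))
        (≡.sym (extend-at i (ℕ.<-trans (ℕ.n<1+n i) lt))) (≡.sym (extend-at (suc i) lt))
        (braid _ _ (≡.trans (Fin.toℕ-fromℕ< lt) (≡.cong suc (≡.sym (Fin.toℕ-fromℕ< (ℕ.<-trans (ℕ.n<1+n i) lt)))))) }

-- The Hecke algebra relations on M.

module HeckeRelations {c ℓ k ℓk} {C : Field c ℓ} (𝕂 : RationalFunctionField C k ℓk)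
                      {n : ℕ} (lam : Partition (suc n)) where
  open RationalFunctionField 𝕂 using (K; s)
  open Field K
  open Macdonald 𝕂 lam using (Monomial; ⟨_⟩)
  open LinearMaps commutativeRing
  open IntegerSolver commutativeRing
  open Swaps
  open HeckeOperators K s
  open Seminormal 𝕂 lam using (DecEq-Tab; DecEq-𝕄)
  open SeminormalRelations 𝕂 lam using (𝐭; 𝐭-quadratic-⟨⟩; 𝐭-braid-⟨⟩; 𝐭-far-⟨⟩)
  open Operators 𝕂 lam

  private
    𝕄 : Set
    𝕄 = Monomial × Tab lam
    θ : Carrier
    θ = 1# - s

  module _ {B : Set} ⦃ _ : DecEq B ⦄ where
    quadratic⇒ : ∀ (F : Lin B B) {f} → QuadraticAt F f → f ◁ F ◁ (F ⊹ θ) ≋ s • f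
    quadratic⇒ F {f} quad = ≋-trans (⊕-cong quad ≋-refl)
      (byScalars (((s - 1#) ⊡ ν 0F ⊞ s ⊡ ν 1F) ⊞ θ ⊡ ν 0F) (s ⊡ ν 1F) (f ◁ F ∷ f ∷ [])
        λ where (x ∷ y ∷ []) → solve 3 (λ s x y → ((s :- :1) :* x :+ s :* y) :+ (:1 :- s) :* x := s :* y) refl s x y)

    quadratic⇐ : ∀ (F : Lin B B) {f} → f ◁ F ◁ (F ⊹ θ) ≋ s • f → QuadraticAt F f
    quadratic⇐ F {f} eq = ≋-trans
      (byScalars (ν 0F) ((s - 1#) ⊡ ν 1F ⊞ (ν 0F ⊞ θ ⊡ ν 1F)) (f ◁ F ◁ F ∷ f ◁ F ∷ [])
        λ where (x ∷ y ∷ []) → solve 3 (λ s x y → x := (s :- :1) :* y :+ (x :+ (:1 :- s) :* y)) refl s x y)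
      (⊕-cong ≋-refl eq)

    ⊹-self : ∀ (F : Lin B B) a f → f ◁ (F ⊹ a) ◁ F ≋ f ◁ F ◁ (F ⊹ a)
    ⊹-self F a f = map-⊕• F (f ◁ F) a f

  𝐭-quadratic : ∀ i u → u ◁ 𝐭 i ◁ (𝐭 i ⊹ θ) ≋ s • u
  𝐭-quadratic i = on (basis-ext {F = 𝐭 i ⨾ (𝐭 i ⊹ θ)} {scale s} λ T → quadratic⇒ (𝐭 i) (𝐭-quadratic-⟨⟩ T i))

  𝐭-far : ∀ i j → suc (toℕ i) ℕ.< toℕ j → 𝐭 i ⨾ 𝐭 j ≐ 𝐭 j ⨾ 𝐭 i
  𝐭-far i j lt = basis-ext λ T → 𝐭-far-⟨⟩ T i j lt

  𝐭-braid : ∀ i j → toℕ j ≡ suc (toℕ i) → 𝐭 i ⨾ (𝐭 j ⨾ 𝐭 i) ≐ 𝐭 j ⨾ (𝐭 i ⨾ 𝐭 j)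
  𝐭-braid i j j≡ = basis-ext λ T → 𝐭-braid-⟨⟩ T i j j≡

  -- Past either of its two variables, T_i (T_i + 1 - s) passes unchanged: one exchange relation
  -- adds 1 - s to a factor and the other removes it from the next.
  𝐓-quadratic : ∀ i f → f ◁ 𝐓ᴸ i ◁ (𝐓ᴸ i ⊹ θ) ≋ s • f
  𝐓-quadratic i = on (monomial-ext {F = 𝐓ᴸ i ⨾ (𝐓ᴸ i ⊹ θ)} {scale s} base multiply)
    where
    open SetoidReasoning (≋-setoid 𝕄)
    Tᵢ = 𝐓ᴸ i
    p p′ : Fin (suc n)
    p = inject₁ i
    p′ = Fin.suc i
    base : ∀ T → ⟨ T ⟩ ◁ constant ◁ Tᵢ ◁ (Tᵢ ⊹ θ) ≋ s • ⟨ T ⟩ ◁ constant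
    base T = begin
      ⟨ T ⟩ ◁ constant ◁ Tᵢ ◁ (Tᵢ ⊹ θ)        ≈⟨ cong (Tᵢ ⊹ θ) (constant-𝐓 i ⟨ T ⟩) ⟩
      ⟨ T ⟩ ◁ 𝐭 i ◁ constant ◁ (Tᵢ ⊹ θ)       ≈⟨ ⊕-cong (constant-𝐓 i (⟨ T ⟩ ◁ 𝐭 i)) (≋-sym (map-• constant θ _)) ⟩
      ⟨ T ⟩ ◁ 𝐭 i ◁ 𝐭 i ◁ constant ⊕ (θ • ⟨ T ⟩ ◁ 𝐭 i) ◁ constant ≈⟨ map-⊕ constant _ _ ⟨
      ⟨ T ⟩ ◁ 𝐭 i ◁ (𝐭 i ⊹ θ) ◁ constant      ≈⟨ cong constant (𝐭-quadratic i ⟨ T ⟩) ⟩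
      (s • ⟨ T ⟩) ◁ constant                   ≈⟨ map-• constant s _ ⟩
      s • ⟨ T ⟩ ◁ constant                     ∎
    multiply : ∀ f j → f ◁ Tᵢ ◁ (Tᵢ ⊹ θ) ≋ s • f → f ◁ X j ◁ Tᵢ ◁ (Tᵢ ⊹ θ) ≋ s • f ◁ X j
    multiply f j hyp with j Fin.≟ p | j Fin.≟ p′
    ... | yes ≡.refl | _ = begin
      f ◁ X p ◁ Tᵢ ◁ (Tᵢ ⊹ θ)          ≈⟨ cong (Tᵢ ⊹ θ) (X-inject₁ i f) ⟩
      f ◁ (Tᵢ ⊹ θ) ◁ X p′ ◁ (Tᵢ ⊹ θ)   ≈⟨ X-suc i (f ◁ (Tᵢ ⊹ θ)) ⟩
      f ◁ (Tᵢ ⊹ θ) ◁ Tᵢ ◁ X p          ≈⟨ cong (X p) (⊹-self Tᵢ θ f) ⟩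
      f ◁ Tᵢ ◁ (Tᵢ ⊹ θ) ◁ X p          ≈⟨ cong (X p) hyp ⟩
      (s • f) ◁ X p                    ≈⟨ map-• (X p) s f ⟩
      s • f ◁ X p                      ∎
    ... | no _ | yes ≡.refl = begin
      f ◁ X p′ ◁ Tᵢ ◁ (Tᵢ ⊹ θ)         ≈⟨ ⊹-self Tᵢ θ (f ◁ X p′) ⟨
      f ◁ X p′ ◁ (Tᵢ ⊹ θ) ◁ Tᵢ         ≈⟨ cong Tᵢ (X-suc i f) ⟩
      f ◁ Tᵢ ◁ X p ◁ Tᵢ                ≈⟨ X-inject₁ i (f ◁ Tᵢ) ⟩
      f ◁ Tᵢ ◁ (Tᵢ ⊹ θ) ◁ X p′         ≈⟨ cong (X p′) hyp ⟩
      (s • f) ◁ X p′                   ≈⟨ map-• (X p′) s f ⟩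
      s • f ◁ X p′                     ∎
    ... | no j≢p | no j≢p′ = begin
      f ◁ X j ◁ Tᵢ ◁ (Tᵢ ⊹ θ)          ≈⟨ cong (Tᵢ ⊹ θ) (X-other i j j≢p j≢p′ f) ⟩
      f ◁ Tᵢ ◁ X j ◁ (Tᵢ ⊹ θ)          ≈⟨ ⊹-intertwine {X = Tᵢ} {Tᵢ} {X j} θ (≋-sym (X-other i j j≢p j≢p′ (f ◁ Tᵢ))) ⟨
      f ◁ Tᵢ ◁ (Tᵢ ⊹ θ) ◁ X j          ≈⟨ cong (X j) hyp ⟩
      (s • f) ◁ X j                    ≈⟨ map-• (X j) s f ⟩
      s • f ◁ X j                      ∎

  𝐓-quadraticAt : ∀ i f → QuadraticAt (𝐓ᴸ i) f
  𝐓-quadraticAt i f = quadratic⇐ (𝐓ᴸ i) (𝐓-quadratic i f)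

  Disjoint : Fin n → Fin n → Set
  Disjoint i j = (inject₁ i ≢ inject₁ j × inject₁ i ≢ Fin.suc j) × (Fin.suc i ≢ inject₁ j × Fin.suc i ≢ Fin.suc j)

  private
    -- A variable is touched by at most one of the two operators. The case where it is touched by
    -- the second one is the mirror image.
    far-multiply : ∀ i j k f → Disjoint i j → k ≢ inject₁ j → k ≢ Fin.suc j → f ◁ 𝐓ᴸ i ◁ 𝐓ᴸ j ≋ f ◁ 𝐓ᴸ j ◁ 𝐓ᴸ i →
      f ◁ X k ◁ 𝐓ᴸ i ◁ 𝐓ᴸ j ≋ f ◁ X k ◁ 𝐓ᴸ j ◁ 𝐓ᴸ i
    far-multiply i j k f ((d₁ , d₂) , (d₃ , d₄)) k≢ k≢′ hyp with k Fin.≟ inject₁ i | k Fin.≟ Fin.suc i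
    ... | yes ≡.refl | _ = begin
      f ◁ X p ◁ Tᵢ ◁ Tⱼ             ≈⟨ cong Tⱼ (X-inject₁ i f) ⟩
      f ◁ (Tᵢ ⊹ θ) ◁ X p′ ◁ Tⱼ      ≈⟨ X-other j p′ d₃ d₄ (f ◁ (Tᵢ ⊹ θ)) ⟩
      f ◁ (Tᵢ ⊹ θ) ◁ Tⱼ ◁ X p′      ≈⟨ cong (X p′) (⊹-intertwine {X = Tᵢ} {Tᵢ} {Tⱼ} θ hyp) ⟩
      f ◁ Tⱼ ◁ (Tᵢ ⊹ θ) ◁ X p′      ≈⟨ X-inject₁ i (f ◁ Tⱼ) ⟨
      f ◁ Tⱼ ◁ X p ◁ Tᵢ             ≈⟨ cong Tᵢ (X-other j p k≢ k≢′ f) ⟨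
      f ◁ X p ◁ Tⱼ ◁ Tᵢ             ∎
      where
      open SetoidReasoning (≋-setoid 𝕄)
      Tᵢ = 𝐓ᴸ i
      Tⱼ = 𝐓ᴸ j
      p = inject₁ i
      p′ = Fin.suc i
    ... | no _ | yes ≡.refl = ⊹-intertwine⁻¹ {X = Tᵢ} {Tᵢ} {Tⱼ} θ (begin
      f ◁ X p′ ◁ (Tᵢ ⊹ θ) ◁ Tⱼ      ≈⟨ cong Tⱼ (X-suc i f) ⟩
      f ◁ Tᵢ ◁ X p ◁ Tⱼ             ≈⟨ X-other j p d₁ d₂ (f ◁ Tᵢ) ⟩
      f ◁ Tᵢ ◁ Tⱼ ◁ X p             ≈⟨ cong (X p) hyp ⟩
      f ◁ Tⱼ ◁ Tᵢ ◁ X p             ≈⟨ X-suc i (f ◁ Tⱼ) ⟨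
      f ◁ Tⱼ ◁ X p′ ◁ (Tᵢ ⊹ θ)      ≈⟨ cong (Tᵢ ⊹ θ) (X-other j p′ k≢ k≢′ f) ⟨
      f ◁ X p′ ◁ Tⱼ ◁ (Tᵢ ⊹ θ)      ∎)
      where
      open SetoidReasoning (≋-setoid 𝕄)
      Tᵢ = 𝐓ᴸ i
      Tⱼ = 𝐓ᴸ j
      p = inject₁ i
      p′ = Fin.suc i
    ... | no k≢i | no k≢i′ = begin
      f ◁ X k ◁ Tᵢ ◁ Tⱼ             ≈⟨ cong Tⱼ (X-other i k k≢i k≢i′ f) ⟩
      f ◁ Tᵢ ◁ X k ◁ Tⱼ             ≈⟨ X-other j k k≢ k≢′ (f ◁ Tᵢ) ⟩
      f ◁ Tᵢ ◁ Tⱼ ◁ X k             ≈⟨ cong (X k) hyp ⟩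
      f ◁ Tⱼ ◁ Tᵢ ◁ X k             ≈⟨ X-other i k k≢i k≢i′ (f ◁ Tⱼ) ⟨
      f ◁ Tⱼ ◁ X k ◁ Tᵢ             ≈⟨ cong Tᵢ (X-other j k k≢ k≢′ f) ⟨
      f ◁ X k ◁ Tⱼ ◁ Tᵢ             ∎
      where
      open SetoidReasoning (≋-setoid 𝕄)
      Tᵢ = 𝐓ᴸ i
      Tⱼ = 𝐓ᴸ j

  𝐓-far : ∀ i j → suc (toℕ i) ℕ.< toℕ j → 𝐓ᴸ i ⨾ 𝐓ᴸ j ≐ 𝐓ᴸ j ⨾ 𝐓ᴸ i
  𝐓-far i j lt = monomial-ext {F = 𝐓ᴸ i ⨾ 𝐓ᴸ j} {𝐓ᴸ j ⨾ 𝐓ᴸ i} base multiply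
    where
    open SetoidReasoning (≋-setoid 𝕄)
    disjoint = far-≢ i j lt
    disjoint′ : Disjoint j i
    disjoint′ with disjoint
    ... | (a , b) , (d , e) = (≡.≢-sym a , ≡.≢-sym d) , (≡.≢-sym b , ≡.≢-sym e)
    base : ∀ T → ⟨ T ⟩ ◁ constant ◁ 𝐓ᴸ i ◁ 𝐓ᴸ j ≋ ⟨ T ⟩ ◁ constant ◁ 𝐓ᴸ j ◁ 𝐓ᴸ i
    base T = begin
      ⟨ T ⟩ ◁ constant ◁ 𝐓ᴸ i ◁ 𝐓ᴸ j    ≈⟨ cong (𝐓ᴸ j) (constant-𝐓 i ⟨ T ⟩) ⟩
      ⟨ T ⟩ ◁ 𝐭 i ◁ constant ◁ 𝐓ᴸ j     ≈⟨ constant-𝐓 j (⟨ T ⟩ ◁ 𝐭 i) ⟩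
      ⟨ T ⟩ ◁ 𝐭 i ◁ 𝐭 j ◁ constant      ≈⟨ cong constant (𝐭-far-⟨⟩ T i j lt) ⟩
      ⟨ T ⟩ ◁ 𝐭 j ◁ 𝐭 i ◁ constant      ≈⟨ constant-𝐓 i (⟨ T ⟩ ◁ 𝐭 j) ⟨
      ⟨ T ⟩ ◁ 𝐭 j ◁ constant ◁ 𝐓ᴸ i     ≈⟨ cong (𝐓ᴸ i) (constant-𝐓 j ⟨ T ⟩) ⟨
      ⟨ T ⟩ ◁ constant ◁ 𝐓ᴸ j ◁ 𝐓ᴸ i    ∎
    multiply : ∀ f k → f ◁ 𝐓ᴸ i ◁ 𝐓ᴸ j ≋ f ◁ 𝐓ᴸ j ◁ 𝐓ᴸ i → f ◁ X k ◁ 𝐓ᴸ i ◁ 𝐓ᴸ j ≋ f ◁ X k ◁ 𝐓ᴸ j ◁ 𝐓ᴸ i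
    multiply f k hyp with k Fin.≟ inject₁ j | k Fin.≟ Fin.suc j
    ... | yes ≡.refl | _ = ≋-sym (far-multiply j i k f disjoint′
            (≡.≢-sym (proj₁ (proj₁ disjoint))) (≡.≢-sym (proj₁ (proj₂ disjoint))) (≋-sym hyp))
    ... | no _ | yes ≡.refl = ≋-sym (far-multiply j i k f disjoint′
            (≡.≢-sym (proj₂ (proj₁ disjoint))) (≡.≢-sym (proj₂ (proj₂ disjoint))) (≋-sym hyp))
    ... | no k≢ | no k≢′ = far-multiply i j k f disjoint k≢ k≢′ hyp

  -- Moving one of the three variables through the two braid words gives Yang-Baxter words with
  -- parameters 0 and 1 - s, and each triple that arises satisfies the scalar condition.
  𝐓-braid : ∀ i j → toℕ j ≡ suc (toℕ i) → ∀ f → BraidAt (𝐓ᴸ i) (𝐓ᴸ j) f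
  𝐓-braid i j j≡ = on (monomial-ext {F = 𝐓ᴸ i ⨾ (𝐓ᴸ j ⨾ 𝐓ᴸ i)} {𝐓ᴸ j ⨾ (𝐓ᴸ i ⨾ 𝐓ᴸ j)} base multiply)
    where
    open SetoidReasoning (≋-setoid 𝕄)
    open Neighbours i j j≡
    Tᵢ = 𝐓ᴸ i
    Tⱼ = 𝐓ᴸ j
    X₀ = X (inject₁ i)
    X₁ = X (Fin.suc i)
    X₂ = X (Fin.suc j)
    X₀-i : ∀ f → f ◁ X₀ ◁ Tᵢ ≋ f ◁ (Tᵢ ⊹ θ) ◁ X₁
    X₀-i = X-inject₁ i
    X₁-i : ∀ f → f ◁ X₁ ◁ (Tᵢ ⊹ θ) ≋ f ◁ Tᵢ ◁ X₀
    X₁-i = X-suc i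
    X₂-i : ∀ f → f ◁ X₂ ◁ Tᵢ ≋ f ◁ Tᵢ ◁ X₂
    X₂-i = X-other i (Fin.suc j) last≢ last≢′
    X₀-j : ∀ f → f ◁ X₀ ◁ Tⱼ ≋ f ◁ Tⱼ ◁ X₀
    X₀-j = X-other j (inject₁ i) first≢ first≢′
    X₁-j : ∀ f → f ◁ X₁ ◁ Tⱼ ≋ f ◁ (Tⱼ ⊹ θ) ◁ X₂
    X₁-j f = ≋-trans (≋-reflexive (≡.cong (λ p → f ◁ X p ◁ Tⱼ) (≡.sym mid))) (X-inject₁ j f)
    X₂-j : ∀ f → f ◁ X₂ ◁ (Tⱼ ⊹ θ) ≋ f ◁ Tⱼ ◁ X₁
    X₂-j f = ≋-trans (X-suc j f) (≋-reflexive (≡.cong (λ p → f ◁ Tⱼ ◁ X p) mid))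
    base : ∀ T → BraidAt Tᵢ Tⱼ (⟨ T ⟩ ◁ constant)
    base T = begin
      ⟨ T ⟩ ◁ constant ◁ Tᵢ ◁ Tⱼ ◁ Tᵢ       ≈⟨ three i j i ⟩
      ⟨ T ⟩ ◁ 𝐭 i ◁ 𝐭 j ◁ 𝐭 i ◁ constant    ≈⟨ cong constant (𝐭-braid-⟨⟩ T i j j≡) ⟩
      ⟨ T ⟩ ◁ 𝐭 j ◁ 𝐭 i ◁ 𝐭 j ◁ constant    ≈⟨ three j i j ⟨
      ⟨ T ⟩ ◁ constant ◁ Tⱼ ◁ Tᵢ ◁ Tⱼ       ∎
      where
      three : ∀ i j l → ⟨ T ⟩ ◁ constant ◁ 𝐓ᴸ i ◁ 𝐓ᴸ j ◁ 𝐓ᴸ l ≋ ⟨ T ⟩ ◁ 𝐭 i ◁ 𝐭 j ◁ 𝐭 l ◁ constant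
      three i j l = ≋-trans (cong (𝐓ᴸ l) (cong (𝐓ᴸ j) (constant-𝐓 i ⟨ T ⟩)))
        (≋-trans (cong (𝐓ᴸ l) (constant-𝐓 j _)) (constant-𝐓 l _))
    module YB f {a b d} (yb : b * (s - 1#) + a * b + b * d ≈ a * d) =
      YangBaxter Tᵢ Tⱼ yb f (𝐓-quadraticAt i f) (𝐓-quadraticAt j f)
    -- Multiplying the Yang–Baxter equation at f by x_k gives that at f x_k, with
    -- other parameters.
    multiply : ∀ f k → BraidAt Tᵢ Tⱼ f → BraidAt Tᵢ Tⱼ (f ◁ X k)
    multiply f k hyp with k Fin.≟ inject₁ i | k Fin.≟ Fin.suc i | k Fin.≟ Fin.suc j
    ... | yes ≡.refl | _ | _ = begin
      f ◁ X₀ ◁ Tᵢ ◁ Tⱼ ◁ Tᵢ                       ≈⟨ cong Tᵢ (cong Tⱼ (X₀-i f)) ⟩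
      f ◁ (Tᵢ ⊹ θ) ◁ X₁ ◁ Tⱼ ◁ Tᵢ                 ≈⟨ cong Tᵢ (X₁-j _) ⟩
      f ◁ (Tᵢ ⊹ θ) ◁ (Tⱼ ⊹ θ) ◁ X₂ ◁ Tᵢ           ≈⟨ X₂-i _ ⟩
      f ◁ (Tᵢ ⊹ θ) ◁ (Tⱼ ⊹ θ) ◁ Tᵢ ◁ X₂           ≈⟨ cong X₂ (⊹-0 Tᵢ _) ⟨
      f ◁ (Tᵢ ⊹ θ) ◁ (Tⱼ ⊹ θ) ◁ (Tᵢ ⊹ 0#) ◁ X₂    ≈⟨ cong X₂ (YB.braid⇒yb f θθ0 hyp) ⟩
      f ◁ (Tⱼ ⊹ 0#) ◁ (Tᵢ ⊹ θ) ◁ (Tⱼ ⊹ θ) ◁ X₂    ≈⟨ cong X₂ (cong (Tⱼ ⊹ θ) (cong (Tᵢ ⊹ θ) (⊹-0 Tⱼ f))) ⟩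
      f ◁ Tⱼ ◁ (Tᵢ ⊹ θ) ◁ (Tⱼ ⊹ θ) ◁ X₂           ≈⟨ X₁-j _ ⟨
      f ◁ Tⱼ ◁ (Tᵢ ⊹ θ) ◁ X₁ ◁ Tⱼ                 ≈⟨ cong Tⱼ (X₀-i _) ⟨
      f ◁ Tⱼ ◁ X₀ ◁ Tᵢ ◁ Tⱼ                       ≈⟨ cong Tⱼ (cong Tᵢ (X₀-j f)) ⟨
      f ◁ X₀ ◁ Tⱼ ◁ Tᵢ ◁ Tⱼ                       ∎
      where
      θθ0 : θ * (s - 1#) + θ * θ + θ * 0# ≈ θ * 0#
      θθ0 = solve 1 (λ s → (:1 :- s) :* (s :- :1) :+ (:1 :- s) :* (:1 :- s) :+ (:1 :- s) :* :0 := (:1 :- s) :* :0) refl s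
    ... | no _ | yes ≡.refl | _ = YB.yb⇒braid (f ◁ X₁) θ00 (begin
      f ◁ X₁ ◁ (Tᵢ ⊹ θ) ◁ (Tⱼ ⊹ 0#) ◁ (Tᵢ ⊹ 0#)   ≈⟨ ≋-trans (⊹-0 Tᵢ _) (cong Tᵢ (⊹-0 Tⱼ _)) ⟩
      f ◁ X₁ ◁ (Tᵢ ⊹ θ) ◁ Tⱼ ◁ Tᵢ                 ≈⟨ cong Tᵢ (cong Tⱼ (X₁-i f)) ⟩
      f ◁ Tᵢ ◁ X₀ ◁ Tⱼ ◁ Tᵢ                       ≈⟨ cong Tᵢ (X₀-j _) ⟩
      f ◁ Tᵢ ◁ Tⱼ ◁ X₀ ◁ Tᵢ                       ≈⟨ X₀-i _ ⟩
      f ◁ Tᵢ ◁ Tⱼ ◁ (Tᵢ ⊹ θ) ◁ X₁                 ≈⟨ cong X₁ (cong (Tᵢ ⊹ θ) (≋-trans (⊹-0 Tⱼ _) (cong Tⱼ (⊹-0 Tᵢ f)))) ⟨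
      f ◁ (Tᵢ ⊹ 0#) ◁ (Tⱼ ⊹ 0#) ◁ (Tᵢ ⊹ θ) ◁ X₁   ≈⟨ cong X₁ (YB.braid⇒yb f 00θ hyp) ⟩
      f ◁ (Tⱼ ⊹ θ) ◁ (Tᵢ ⊹ 0#) ◁ (Tⱼ ⊹ 0#) ◁ X₁   ≈⟨ cong X₁ (≋-trans (⊹-0 Tⱼ _) (cong Tⱼ (⊹-0 Tᵢ _))) ⟩
      f ◁ (Tⱼ ⊹ θ) ◁ Tᵢ ◁ Tⱼ ◁ X₁                 ≈⟨ X₂-j _ ⟨
      f ◁ (Tⱼ ⊹ θ) ◁ Tᵢ ◁ X₂ ◁ (Tⱼ ⊹ θ)           ≈⟨ cong (Tⱼ ⊹ θ) (X₂-i _) ⟨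
      f ◁ (Tⱼ ⊹ θ) ◁ X₂ ◁ Tᵢ ◁ (Tⱼ ⊹ θ)           ≈⟨ cong (Tⱼ ⊹ θ) (cong Tᵢ (X₁-j f)) ⟨
      f ◁ X₁ ◁ Tⱼ ◁ Tᵢ ◁ (Tⱼ ⊹ θ)                 ≈⟨ cong (Tⱼ ⊹ θ) (≋-trans (⊹-0 Tᵢ _) (cong Tᵢ (⊹-0 Tⱼ _))) ⟨
      f ◁ X₁ ◁ (Tⱼ ⊹ 0#) ◁ (Tᵢ ⊹ 0#) ◁ (Tⱼ ⊹ θ)   ∎)
      where
      θ00 : 0# * (s - 1#) + θ * 0# + 0# * 0# ≈ θ * 0#
      θ00 = solve 1 (λ s → :0 :* (s :- :1) :+ (:1 :- s) :* :0 :+ :0 :* :0 := (:1 :- s) :* :0) refl s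
      00θ : 0# * (s - 1#) + 0# * 0# + 0# * θ ≈ 0# * θ
      00θ = solve 1 (λ s → :0 :* (s :- :1) :+ :0 :* :0 :+ :0 :* (:1 :- s) := :0 :* (:1 :- s)) refl s
    ... | no _ | no _ | yes ≡.refl = YB.yb⇒braid (f ◁ X₂) 0θθ (begin
      f ◁ X₂ ◁ (Tᵢ ⊹ 0#) ◁ (Tⱼ ⊹ θ) ◁ (Tᵢ ⊹ θ)    ≈⟨ cong (Tᵢ ⊹ θ) (cong (Tⱼ ⊹ θ) (⊹-0 Tᵢ _)) ⟩
      f ◁ X₂ ◁ Tᵢ ◁ (Tⱼ ⊹ θ) ◁ (Tᵢ ⊹ θ)           ≈⟨ cong (Tᵢ ⊹ θ) (cong (Tⱼ ⊹ θ) (X₂-i f)) ⟩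
      f ◁ Tᵢ ◁ X₂ ◁ (Tⱼ ⊹ θ) ◁ (Tᵢ ⊹ θ)           ≈⟨ cong (Tᵢ ⊹ θ) (X₂-j _) ⟩
      f ◁ Tᵢ ◁ Tⱼ ◁ X₁ ◁ (Tᵢ ⊹ θ)                 ≈⟨ X₁-i _ ⟩
      f ◁ Tᵢ ◁ Tⱼ ◁ Tᵢ ◁ X₀                       ≈⟨ cong X₀ hyp ⟩
      f ◁ Tⱼ ◁ Tᵢ ◁ Tⱼ ◁ X₀                       ≈⟨ X₀-j _ ⟨
      f ◁ Tⱼ ◁ Tᵢ ◁ X₀ ◁ Tⱼ                       ≈⟨ cong Tⱼ (X₁-i _) ⟨
      f ◁ Tⱼ ◁ X₁ ◁ (Tᵢ ⊹ θ) ◁ Tⱼ                 ≈⟨ cong Tⱼ (cong (Tᵢ ⊹ θ) (X₂-j f)) ⟨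
      f ◁ X₂ ◁ (Tⱼ ⊹ θ) ◁ (Tᵢ ⊹ θ) ◁ Tⱼ           ≈⟨ ⊹-0 Tⱼ _ ⟨
      f ◁ X₂ ◁ (Tⱼ ⊹ θ) ◁ (Tᵢ ⊹ θ) ◁ (Tⱼ ⊹ 0#)    ∎)
      where
      0θθ : θ * (s - 1#) + 0# * θ + θ * θ ≈ 0# * θ
      0θθ = solve 1 (λ s → (:1 :- s) :* (s :- :1) :+ :0 :* (:1 :- s) :+ (:1 :- s) :* (:1 :- s) := :0 :* (:1 :- s)) refl s
    ... | no k≢₀ | no k≢₁ | no k≢₂ = ≋-trans (three i j i Xᵢ Xⱼ Xᵢ) (≋-trans (cong (X k) hyp) (≋-sym (three j i j Xⱼ Xᵢ Xⱼ)))
      where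
      Commutes : Fin n → Set _
      Commutes i = ∀ f → f ◁ X k ◁ 𝐓ᴸ i ≋ f ◁ 𝐓ᴸ i ◁ X k
      Xᵢ : Commutes i
      Xᵢ = X-other i k k≢₀ k≢₁
      Xⱼ : Commutes j
      Xⱼ = X-other j k (λ eq → k≢₁ (≡.trans eq mid)) k≢₂
      three : ∀ i j l → Commutes i → Commutes j → Commutes l →
        f ◁ X k ◁ 𝐓ᴸ i ◁ 𝐓ᴸ j ◁ 𝐓ᴸ l ≋ f ◁ 𝐓ᴸ i ◁ 𝐓ᴸ j ◁ 𝐓ᴸ l ◁ X k
      three i j l p r t = ≋-trans (cong (𝐓ᴸ l) (≋-trans (cong (𝐓ᴸ j) (p _)) (r _))) (t _)

module ExtendFacts {a} {A : Set a} {n} (x : A) (F : Fin n → A) where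

  extend-out : ∀ k → n ℕ.≤ k → extend x F k ≡ x
  extend-out k le with k ℕ.<? n
  ... | yes lt = contradiction lt (ℕ.≤⇒≯ le)
  ... | no _   = ≡.refl

by-toℕ : ∀ {p n} (P : ℕ → Set p) → (∀ (i : Fin n) → P (toℕ i)) → ∀ k → k ℕ.< n → P k
by-toℕ P h k lt = ≡.subst P (Fin.toℕ-fromℕ< lt) (h (fromℕ< lt))

-- The operator w, and the double affine relations on M.

module DoubleAffineAction {c ℓ k ℓk} {C : Field c ℓ} (𝕂 : RationalFunctionField C k ℓk)
                          {n : ℕ} (lam : Partition (suc n)) where
  open RationalFunctionField 𝕂 using (K; q; s)
  open Field K
  open Macdonald 𝕂 lam using (Monomial; M; ⟨_⟩; Comb; _⊗_; _T[_]; linear; 𝐓⁻¹; 𝐰)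
  open LinearMaps commutativeRing
  open IntegerSolver commutativeRing
  open Scalars 𝕂
  open Swaps
  open Increments
  open HeckeOperators K s
  open Seminormal 𝕂 lam using (DecEq-Tab; DecEq-𝕄)
  open SeminormalRelations 𝕂 lam using (𝐭; one-•)
  open Operators 𝕂 lam
  open HeckeRelations 𝕂 lam
  private module Lists = Combinations commutativeRing

  private
    𝕄 : Set
    𝕄 = Monomial × Tab lam
    θ : Carrier
    θ = 1# - s
    module E = Monoid (End 𝕄)
    module Eᵀ = Monoid (End (Tab lam))

  private
    t₀ : ℕ → Lin (Tab lam) (Tab lam)
    t₀ = extend idᴸ 𝐭

  𝐭-family : Intertwining.IsBraidFamily (End (Tab lam)) n t₀
  𝐭-family = FinFamily.isBraidFamily (End (Tab lam)) 𝐭 𝐭-far (λ i j j≡ → 𝐭-braid i j j≡)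

  word : Lin (Tab lam) (Tab lam)
  word = Intertwining.up (End (Tab lam)) t₀ 0 n

  -- w acts on V_λ by a Coxeter word, which lowers the index of a generator by `up-shift`.
  word-𝐭 : ∀ i j → toℕ j ≡ suc (toℕ i) → 𝐭 j ⨾ word ≐ word ⨾ 𝐭 i
  word-𝐭 i j j≡ = ≡.subst₂ (λ x y → x ⨾ word ≐ word ⨾ y)
    (≡.trans (≡.cong t₀ (≡.sym j≡)) (extend-toℕ idᴸ 𝐭 j)) (extend-toℕ idᴸ 𝐭 i)
    (Intertwining.IsBraidFamily.up-shift 𝐭-family (toℕ i) 0 n ℕ.z≤n (≡.subst (ℕ._< n) j≡ (Fin.toℕ<n j)) ℕ.≤-refl)

  opaque
    unfolding 𝐭
    foldl-word : ∀ u → foldl (λ u i → linear _T[ i ] u) u (allFin n) ≋ u ◁ word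
    foldl-word u = Folds.foldl-allFin commutativeRing 𝐭 u

  𝐰-image : 𝕄 → M
  𝐰-image (a , T) = (q ^ head a) Lists.• (⟨ rotate a (λ e → e) ⟩ ⊗ foldl (λ u i → linear _T[ i ] u) ⟨ T ⟩ (allFin n))

  opaque
    𝐰ᴸ : Lin 𝕄 𝕄
    𝐰ᴸ = linearᴸ 𝐰-image

    𝐰-fun : ∀ f → 𝐰 f ≡ f ◁ 𝐰ᴸ
    𝐰-fun f = ≡.refl

    𝐰-⟨⟩ : ∀ a T → ⟨ a , T ⟩ ◁ 𝐰ᴸ ≋ (q ^ head a) • ⟨ T ⟩ ◁ word ◁ inj (rotate a (λ e → e))
    𝐰-⟨⟩ a T = ≋-trans (linear-⟨⟩ 𝐰-image (a , T)) (•-lists refl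
      (≋-trans (⊗-inj (rotate a (λ e → e)) (foldl (λ u i → linear _T[ i ] u) ⟨ T ⟩ (allFin n))) (cong (inj (rotate a (λ e → e))) (foldl-word ⟨ T ⟩))))

  X-⟨⟩ : ∀ j a T → ⟨ a , T ⟩ ◁ X j ≡ ⟨ inc j a , T ⟩
  X-⟨⟩ j a T = ≡.sym (X-fun j ⟨ a , T ⟩)

  𝐰-X : ∀ i f → f ◁ X (Fin.suc i) ◁ 𝐰ᴸ ≋ f ◁ 𝐰ᴸ ◁ X (inject₁ i)
  𝐰-X i = on (basis-ext {F = X (Fin.suc i) ⨾ 𝐰ᴸ} {𝐰ᴸ ⨾ X (inject₁ i)} λ (a , T) → image a T)
    where
    open SetoidReasoning (≋-setoid 𝕄)
    image : ∀ a T → ⟨ a , T ⟩ ◁ X (Fin.suc i) ◁ 𝐰ᴸ ≋ ⟨ a , T ⟩ ◁ 𝐰ᴸ ◁ X (inject₁ i)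
    image (x ∷ a) T = begin
      ⟨ x ∷ a , T ⟩ ◁ X (Fin.suc i) ◁ 𝐰ᴸ                   ≡⟨ ≡.cong (_◁ 𝐰ᴸ) (X-⟨⟩ (Fin.suc i) (x ∷ a) T) ⟩
      ⟨ x ∷ inc i a , T ⟩ ◁ 𝐰ᴸ                              ≈⟨ 𝐰-⟨⟩ (x ∷ inc i a) T ⟩
      (q ^ x) • ⟨ T ⟩ ◁ word ◁ inj (inc i a ∷ʳ x)           ≡⟨ ≡.cong (λ b → (q ^ x) • ⟨ T ⟩ ◁ word ◁ inj b) (inc-∷ʳ i a x) ⟩
      (q ^ x) • ⟨ T ⟩ ◁ word ◁ inj (inc (inject₁ i) (a ∷ʳ x)) ≈⟨ •-cong refl (inj-X (a ∷ʳ x) (inject₁ i) (⟨ T ⟩ ◁ word)) ⟩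
      (q ^ x) • ⟨ T ⟩ ◁ word ◁ inj (a ∷ʳ x) ◁ X (inject₁ i) ≈⟨ map-• (X (inject₁ i)) _ _ ⟨
      ((q ^ x) • ⟨ T ⟩ ◁ word ◁ inj (a ∷ʳ x)) ◁ X (inject₁ i) ≈⟨ cong (X (inject₁ i)) (𝐰-⟨⟩ (x ∷ a) T) ⟨
      ⟨ x ∷ a , T ⟩ ◁ 𝐰ᴸ ◁ X (inject₁ i)                   ∎

  𝐰-X₀ : ∀ f → f ◁ X Fin.zero ◁ 𝐰ᴸ ≋ q • f ◁ 𝐰ᴸ ◁ X (fromℕ n)
  𝐰-X₀ = on (basis-ext {F = X Fin.zero ⨾ 𝐰ᴸ} {𝐰ᴸ ⨾ X (fromℕ n) ⨾ scale q} λ (a , T) → image a T)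
    where
    open SetoidReasoning (≋-setoid 𝕄)
    image : ∀ a T → ⟨ a , T ⟩ ◁ X Fin.zero ◁ 𝐰ᴸ ≋ q • ⟨ a , T ⟩ ◁ 𝐰ᴸ ◁ X (fromℕ n)
    image (x ∷ a) T = begin
      ⟨ x ∷ a , T ⟩ ◁ X Fin.zero ◁ 𝐰ᴸ                      ≡⟨ ≡.cong (_◁ 𝐰ᴸ) (X-⟨⟩ Fin.zero (x ∷ a) T) ⟩
      ⟨ suc x ∷ a , T ⟩ ◁ 𝐰ᴸ                                ≈⟨ 𝐰-⟨⟩ (suc x ∷ a) T ⟩
      (q * q ^ x) • ⟨ T ⟩ ◁ word ◁ inj (a ∷ʳ suc x)         ≡⟨ ≡.cong (λ b → (q * q ^ x) • ⟨ T ⟩ ◁ word ◁ inj b) (∷ʳ-suc a x) ⟩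
      (q * q ^ x) • ⟨ T ⟩ ◁ word ◁ inj (inc (fromℕ n) (a ∷ʳ x)) ≈⟨ •-cong refl (inj-X (a ∷ʳ x) (fromℕ n) (⟨ T ⟩ ◁ word)) ⟩
      (q * q ^ x) • ⟨ T ⟩ ◁ word ◁ inj (a ∷ʳ x) ◁ X (fromℕ n)
        ≈⟨ byScalars ((q * q ^ x) ⊡ ν 0F) (q ⊡ (q ^ x) ⊡ ν 0F) (⟨ T ⟩ ◁ word ◁ inj (a ∷ʳ x) ◁ X (fromℕ n) ∷ [])
             (λ where (y ∷ []) → *-assoc q (q ^ x) y) ⟩
      q • (q ^ x) • ⟨ T ⟩ ◁ word ◁ inj (a ∷ʳ x) ◁ X (fromℕ n) ≈⟨ •-cong refl (map-• (X (fromℕ n)) _ _) ⟨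
      q • ((q ^ x) • ⟨ T ⟩ ◁ word ◁ inj (a ∷ʳ x)) ◁ X (fromℕ n) ≈⟨ •-cong refl (cong (X (fromℕ n)) (𝐰-⟨⟩ (x ∷ a) T)) ⟨
      q • ⟨ x ∷ a , T ⟩ ◁ 𝐰ᴸ ◁ X (fromℕ n)                 ∎

  constant-𝐰 : ∀ u → u ◁ constant ◁ 𝐰ᴸ ≋ u ◁ word ◁ constant
  constant-𝐰 = on (basis-ext {F = constant ⨾ 𝐰ᴸ} {word ⨾ constant} λ T → begin
    ⟨ T ⟩ ◁ constant ◁ 𝐰ᴸ                                  ≈⟨ cong 𝐰ᴸ (constant-⟨⟩ T) ⟩
    ⟨ replicate (suc n) 0 , T ⟩ ◁ 𝐰ᴸ                        ≈⟨ 𝐰-⟨⟩ (replicate (suc n) 0) T ⟩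
    1# • ⟨ T ⟩ ◁ word ◁ inj (replicate n 0 ∷ʳ 0)            ≡⟨ ≡.cong (λ b → 1# • ⟨ T ⟩ ◁ word ◁ inj b) (replicate-∷ʳ n) ⟩
    1# • ⟨ T ⟩ ◁ word ◁ inj (replicate (suc n) 0)           ≡⟨ ≡.cong (1# •_) (constant-inj (⟨ T ⟩ ◁ word)) ⟩
    1# • ⟨ T ⟩ ◁ word ◁ constant                            ≈⟨ one-• _ ⟨
    ⟨ T ⟩ ◁ word ◁ constant                                 ∎)
    where open SetoidReasoning (≋-setoid 𝕄)

  𝐰-𝐓 : ∀ i j → toℕ j ≡ suc (toℕ i) → 𝐓ᴸ j ⨾ 𝐰ᴸ ≐ 𝐰ᴸ ⨾ 𝐓ᴸ i
  𝐰-𝐓 i j j≡ = monomial-ext {F = 𝐓ᴸ j ⨾ 𝐰ᴸ} {𝐰ᴸ ⨾ 𝐓ᴸ i} base multiply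
    where
    open SetoidReasoning (≋-setoid 𝕄)
    open Neighbours i j j≡
    Tᵢ = 𝐓ᴸ i
    Tⱼ = 𝐓ᴸ j
    base : ∀ T → ⟨ T ⟩ ◁ constant ◁ Tⱼ ◁ 𝐰ᴸ ≋ ⟨ T ⟩ ◁ constant ◁ 𝐰ᴸ ◁ Tᵢ
    base T = begin
      ⟨ T ⟩ ◁ constant ◁ Tⱼ ◁ 𝐰ᴸ          ≈⟨ cong 𝐰ᴸ (constant-𝐓 j ⟨ T ⟩) ⟩
      ⟨ T ⟩ ◁ 𝐭 j ◁ constant ◁ 𝐰ᴸ         ≈⟨ constant-𝐰 (⟨ T ⟩ ◁ 𝐭 j) ⟩
      ⟨ T ⟩ ◁ 𝐭 j ◁ word ◁ constant       ≈⟨ cong constant (on (word-𝐭 i j j≡) ⟨ T ⟩) ⟩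
      ⟨ T ⟩ ◁ word ◁ 𝐭 i ◁ constant       ≈⟨ constant-𝐓 i (⟨ T ⟩ ◁ word) ⟨
      ⟨ T ⟩ ◁ word ◁ constant ◁ Tᵢ        ≈⟨ cong Tᵢ (constant-𝐰 ⟨ T ⟩) ⟨
      ⟨ T ⟩ ◁ constant ◁ 𝐰ᴸ ◁ Tᵢ          ∎
    last≢i : fromℕ n ≢ inject₁ i
    last≢i eq = ℕ.<⇒≢ (Fin.toℕ<n i) (≡.trans (≡.sym (Fin.toℕ-inject₁ i)) (≡.trans (≡.cong toℕ (≡.sym eq)) (Fin.toℕ-fromℕ n)))
    last≢i′ : fromℕ n ≢ Fin.suc i
    last≢i′ eq = ℕ.<⇒≢ (≡.subst (ℕ._< n) j≡ (Fin.toℕ<n j)) (≡.trans (≡.cong toℕ (≡.sym eq)) (Fin.toℕ-fromℕ n))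
    multiply : ∀ f k → f ◁ Tⱼ ◁ 𝐰ᴸ ≋ f ◁ 𝐰ᴸ ◁ Tᵢ → f ◁ X k ◁ Tⱼ ◁ 𝐰ᴸ ≋ f ◁ X k ◁ 𝐰ᴸ ◁ Tᵢ
    -- w turns the first variable into q times the last one, which T_i does not involve since i + 1
    -- is still the index of a generator.
    multiply f Fin.zero hyp = begin
      f ◁ X Fin.zero ◁ Tⱼ ◁ 𝐰ᴸ                ≈⟨ cong 𝐰ᴸ (X-other j Fin.zero (λ eq → Fin.0≢1+n (≡.trans eq mid)) Fin.0≢1+n f) ⟩
      f ◁ Tⱼ ◁ X Fin.zero ◁ 𝐰ᴸ                ≈⟨ 𝐰-X₀ (f ◁ Tⱼ) ⟩
      q • f ◁ Tⱼ ◁ 𝐰ᴸ ◁ X (fromℕ n)           ≈⟨ •-cong refl (cong (X (fromℕ n)) hyp) ⟩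
      q • f ◁ 𝐰ᴸ ◁ Tᵢ ◁ X (fromℕ n)           ≈⟨ •-cong refl (X-other i (fromℕ n) last≢i last≢i′ (f ◁ 𝐰ᴸ)) ⟨
      q • f ◁ 𝐰ᴸ ◁ X (fromℕ n) ◁ Tᵢ           ≈⟨ map-• Tᵢ q _ ⟨
      (q • f ◁ 𝐰ᴸ ◁ X (fromℕ n)) ◁ Tᵢ         ≈⟨ cong Tᵢ (𝐰-X₀ f) ⟨
      f ◁ X Fin.zero ◁ 𝐰ᴸ ◁ Tᵢ                ∎
    multiply f (Fin.suc k) hyp with k Fin.≟ i | k Fin.≟ j
    ... | yes ≡.refl | _ = begin
      f ◁ X (Fin.suc i) ◁ Tⱼ ◁ 𝐰ᴸ             ≡⟨ ≡.cong (λ p → f ◁ X p ◁ Tⱼ ◁ 𝐰ᴸ) (≡.sym mid) ⟩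
      f ◁ X (inject₁ j) ◁ Tⱼ ◁ 𝐰ᴸ             ≈⟨ cong 𝐰ᴸ (X-inject₁ j f) ⟩
      f ◁ (Tⱼ ⊹ θ) ◁ X (Fin.suc j) ◁ 𝐰ᴸ       ≈⟨ 𝐰-X j (f ◁ (Tⱼ ⊹ θ)) ⟩
      f ◁ (Tⱼ ⊹ θ) ◁ 𝐰ᴸ ◁ X (inject₁ j)       ≈⟨ cong (X (inject₁ j)) (⊹-intertwine {X = Tⱼ} {Tᵢ} {𝐰ᴸ} θ hyp) ⟩
      f ◁ 𝐰ᴸ ◁ (Tᵢ ⊹ θ) ◁ X (inject₁ j)       ≡⟨ ≡.cong (λ p → f ◁ 𝐰ᴸ ◁ (Tᵢ ⊹ θ) ◁ X p) mid ⟩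
      f ◁ 𝐰ᴸ ◁ (Tᵢ ⊹ θ) ◁ X (Fin.suc i)       ≈⟨ X-inject₁ i (f ◁ 𝐰ᴸ) ⟨
      f ◁ 𝐰ᴸ ◁ X (inject₁ i) ◁ Tᵢ             ≈⟨ cong Tᵢ (𝐰-X i f) ⟨
      f ◁ X (Fin.suc i) ◁ 𝐰ᴸ ◁ Tᵢ             ∎
    ... | no _ | yes ≡.refl = ⊹-intertwine⁻¹ {X = Tⱼ} {Tᵢ} {𝐰ᴸ} θ (begin
      f ◁ X (Fin.suc j) ◁ (Tⱼ ⊹ θ) ◁ 𝐰ᴸ       ≈⟨ cong 𝐰ᴸ (X-suc j f) ⟩
      f ◁ Tⱼ ◁ X (inject₁ j) ◁ 𝐰ᴸ             ≡⟨ ≡.cong (λ p → f ◁ Tⱼ ◁ X p ◁ 𝐰ᴸ) mid ⟩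
      f ◁ Tⱼ ◁ X (Fin.suc i) ◁ 𝐰ᴸ             ≈⟨ 𝐰-X i (f ◁ Tⱼ) ⟩
      f ◁ Tⱼ ◁ 𝐰ᴸ ◁ X (inject₁ i)             ≈⟨ cong (X (inject₁ i)) hyp ⟩
      f ◁ 𝐰ᴸ ◁ Tᵢ ◁ X (inject₁ i)             ≈⟨ X-suc i (f ◁ 𝐰ᴸ) ⟨
      f ◁ 𝐰ᴸ ◁ X (Fin.suc i) ◁ (Tᵢ ⊹ θ)       ≡⟨ ≡.cong (λ p → f ◁ 𝐰ᴸ ◁ X p ◁ (Tᵢ ⊹ θ)) (≡.sym mid) ⟩
      f ◁ 𝐰ᴸ ◁ X (inject₁ j) ◁ (Tᵢ ⊹ θ)       ≈⟨ cong (Tᵢ ⊹ θ) (𝐰-X j f) ⟨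
      f ◁ X (Fin.suc j) ◁ 𝐰ᴸ ◁ (Tᵢ ⊹ θ)       ∎)
    ... | no k≢i | no k≢j = begin
      f ◁ X (Fin.suc k) ◁ Tⱼ ◁ 𝐰ᴸ             ≈⟨ cong 𝐰ᴸ (X-other j (Fin.suc k) (λ eq → k≢i (Fin.suc-injective (≡.trans eq mid))) (λ eq → k≢j (Fin.suc-injective eq)) f) ⟩
      f ◁ Tⱼ ◁ X (Fin.suc k) ◁ 𝐰ᴸ             ≈⟨ 𝐰-X k (f ◁ Tⱼ) ⟩
      f ◁ Tⱼ ◁ 𝐰ᴸ ◁ X (inject₁ k)             ≈⟨ cong (X (inject₁ k)) hyp ⟩
      f ◁ 𝐰ᴸ ◁ Tᵢ ◁ X (inject₁ k)             ≈⟨ X-other i (inject₁ k) (λ eq → k≢i (Fin.inject₁-injective eq))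
                                                   (λ eq → k≢j (Fin.inject₁-injective (≡.trans eq (≡.sym mid)))) (f ◁ 𝐰ᴸ) ⟨
      f ◁ 𝐰ᴸ ◁ X (inject₁ k) ◁ Tᵢ             ≈⟨ cong Tᵢ (𝐰-X k f) ⟨
      f ◁ X (Fin.suc k) ◁ 𝐰ᴸ ◁ Tᵢ             ∎

  opaque
    𝐓⁻¹ᴸ : Fin n → Lin 𝕄 𝕄
    𝐓⁻¹ᴸ i = with-function (𝐓⁻¹ i) ((𝐓ᴸ i ⊹ θ) ⨾ scale (s ⁻¹)) λ f →
      •-lists refl (⊕-lists (≋-reflexive (𝐓-fun i f)) (•-lists refl ≋-refl))

    𝐓⁻¹-⊹ : ∀ i f → f ◁ 𝐓⁻¹ᴸ i ≋ s ⁻¹ • f ◁ (𝐓ᴸ i ⊹ θ)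
    𝐓⁻¹-⊹ i f = •-lists refl (⊕-lists (≋-reflexive (𝐓-fun i f)) (•-lists refl ≋-refl))

  s⁻¹•s• : ∀ {B : Set} ⦃ _ : DecEq B ⦄ (f : Comb B) → s ⁻¹ • s • f ≋ f
  s⁻¹•s• f = byScalars (s ⁻¹ ⊡ s ⊡ ν 0F) (ν 0F) (f ∷ []) λ where
    (x ∷ []) → trans (solve 3 (λ a b x → a :* (b :* x) := (b :* a) :* x) refl (s ⁻¹) s x)
      (trans (*-congʳ (⁻¹-inverse s≉0)) (*-identityˡ x))

  𝐓-𝐓⁻¹ : ∀ i → 𝐓ᴸ i ⨾ 𝐓⁻¹ᴸ i ≐ idᴸ
  𝐓-𝐓⁻¹ i = everywhere λ f → ≋-trans (𝐓⁻¹-⊹ i (f ◁ 𝐓ᴸ i)) (≋-trans (•-cong refl (𝐓-quadratic i f)) (s⁻¹•s• f))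

  𝐓⁻¹-𝐓 : ∀ i → 𝐓⁻¹ᴸ i ⨾ 𝐓ᴸ i ≐ idᴸ
  𝐓⁻¹-𝐓 i = everywhere λ f → ≋-trans (cong (𝐓ᴸ i) (𝐓⁻¹-⊹ i f)) (≋-trans (map-• (𝐓ᴸ i) _ _)
    (≋-trans (•-cong refl (≋-trans (⊹-self (𝐓ᴸ i) θ f) (𝐓-quadratic i f))) (s⁻¹•s• f)))

  t t′ x : ℕ → Lin 𝕄 𝕄
  t  = extend idᴸ 𝐓ᴸ
  t′ = extend idᴸ 𝐓⁻¹ᴸ
  x  = extend idᴸ X

  x-inject₁ : ∀ (i : Fin n) → x (toℕ i) ≡ X (inject₁ i)
  x-inject₁ i = ≡.trans (≡.cong x (≡.sym (Fin.toℕ-inject₁ i))) (extend-toℕ idᴸ X (inject₁ i))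

  x-last : x n ≡ X (fromℕ n)
  x-last = ≡.trans (≡.cong x (≡.sym (Fin.toℕ-fromℕ n))) (extend-toℕ idᴸ X (fromℕ n))

  private
    open ExtendFacts
    commutes-with-id : ∀ (F : Lin 𝕄 𝕄) → F E.∙ idᴸ E.≈ idᴸ E.∙ F
    commutes-with-id F = everywhere λ f → ≋-refl

    inverse-family : ∀ (F G : Fin n → Lin 𝕄 𝕄) → (∀ i → F i E.∙ G i E.≈ idᴸ) → ∀ k → Dec (k ℕ.< n) →
                     extend idᴸ F k E.∙ extend idᴸ G k E.≈ idᴸ
    inverse-family F G h k (yes lt) = by-toℕ (λ k → extend idᴸ F k E.∙ extend idᴸ G k E.≈ idᴸ)
      (λ i → ≡.subst₂ (λ P Q → P E.∙ Q E.≈ idᴸ) (≡.sym (extend-toℕ idᴸ F i)) (≡.sym (extend-toℕ idᴸ G i)) (h i)) k lt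
    inverse-family F G h k (no ≮)   = ≡.subst₂ (λ P Q → P E.∙ Q E.≈ idᴸ) (≡.sym (extend-out idᴸ F k (ℕ.≮⇒≥ ≮)))
      (≡.sym (extend-out idᴸ G k (ℕ.≮⇒≥ ≮))) (everywhere λ f → ≋-refl)

  private
    scale-central : ∀ a F → scale a E.∙ F E.≈ F E.∙ scale a
    scale-central a F = everywhere λ f → map-• F a f
    x-t : ∀ i → x (toℕ i) E.∙ t (toℕ i) E.≈ scale s E.∙ (t′ (toℕ i) E.∙ x (suc (toℕ i)))
    x-t i = ≡.subst₂ (λ P Q → P E.∙ Q E.≈ scale s E.∙ (t′ (toℕ i) E.∙ x (suc (toℕ i)))) (≡.sym (x-inject₁ i)) (≡.sym (extend-toℕ idᴸ 𝐓ᴸ i))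
      (≡.subst₂ (λ P Q → X (inject₁ i) E.∙ 𝐓ᴸ i E.≈ scale s E.∙ (P E.∙ Q)) (≡.sym (extend-toℕ idᴸ 𝐓⁻¹ᴸ i)) (≡.sym (extend-toℕ idᴸ X (Fin.suc i)))
        (everywhere λ f → ≋-trans (X-inject₁ i f) (cong (X (Fin.suc i)) (≋-sym (scaled-inverse f)))))
      where
      scaled-inverse : ∀ f → (s • f) ◁ 𝐓⁻¹ᴸ i ≋ f ◁ (𝐓ᴸ i ⊹ θ)
      scaled-inverse f = ≋-trans (𝐓⁻¹-⊹ i (s • f)) (≋-trans (•-cong refl (map-• (𝐓ᴸ i ⊹ θ) s f)) (s⁻¹•s• _))
    x-far : ∀ i j → Dec (i ℕ.< n) → Dec (j ℕ.< suc n) → i ≢ j → suc i ≢ j → x j E.∙ t i E.≈ t i E.∙ x j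
    x-far i j (no i≮) _       _ _ = ≡.subst (λ P → x j E.∙ P E.≈ P E.∙ x j) (≡.sym (extend-out idᴸ 𝐓ᴸ i (ℕ.≮⇒≥ i≮))) (commutes-with-id (x j))
    x-far i j (yes _) (no j≮) _ _ = ≡.subst (λ P → P E.∙ t i E.≈ t i E.∙ P) (≡.sym (extend-out idᴸ X j (ℕ.≮⇒≥ j≮))) (E.sym (commutes-with-id (t i)))
    x-far i j (yes i<) (yes j<) i≢j si≢j = ≡.subst₂ (λ P Q → P E.∙ Q E.≈ Q E.∙ P)
      (≡.sym (FinFamily.extend-at (End 𝕄) X j j<)) (≡.sym (FinFamily.extend-at (End 𝕄) 𝐓ᴸ i i<))
      (everywhere (X-other (fromℕ< i<) (fromℕ< j<)
        (λ eq → i≢j (≡.sym (≡.trans (≡.sym (Fin.toℕ-fromℕ< j<)) (≡.trans (≡.cong toℕ eq) (≡.trans (Fin.toℕ-inject₁ (fromℕ< i<)) (Fin.toℕ-fromℕ< i<))))))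
        (λ eq → si≢j (≡.sym (≡.trans (≡.sym (Fin.toℕ-fromℕ< j<)) (≡.trans (≡.cong toℕ eq) (≡.cong suc (Fin.toℕ-fromℕ< i<))))))))
    x-x : ∀ i j → x i E.∙ x j E.≈ x j E.∙ x i
    x-x i j = extend-elim idᴸ X (λ i P → P E.∙ x j E.≈ x j E.∙ P)
      (λ i → extend-elim idᴸ X (λ j P → X i E.∙ P E.≈ P E.∙ X i) (λ j → everywhere (X-comm i j)) (λ _ _ → commutes-with-id (X i)) j)
      (λ _ _ → E.sym (commutes-with-id (x j))) i
    w-t : ∀ k → suc k ℕ.< n → t (suc k) E.∙ 𝐰ᴸ E.≈ 𝐰ᴸ E.∙ t k
    w-t k lt = ≡.subst₂ (λ P Q → P E.∙ 𝐰ᴸ E.≈ 𝐰ᴸ E.∙ Q)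
      (≡.sym (FinFamily.extend-at (End 𝕄) 𝐓ᴸ (suc k) lt)) (≡.sym (FinFamily.extend-at (End 𝕄) 𝐓ᴸ k (ℕ.<-trans (ℕ.n<1+n k) lt)))
      (𝐰-𝐓 _ _ (≡.trans (Fin.toℕ-fromℕ< lt) (≡.cong suc (≡.sym (Fin.toℕ-fromℕ< (ℕ.<-trans (ℕ.n<1+n k) lt))))))
    w-x : ∀ i → x (suc (toℕ i)) E.∙ 𝐰ᴸ E.≈ 𝐰ᴸ E.∙ x (toℕ i)
    w-x i = ≡.subst₂ (λ P Q → P E.∙ 𝐰ᴸ E.≈ 𝐰ᴸ E.∙ Q) (≡.sym (extend-toℕ idᴸ X (Fin.suc i))) (≡.sym (x-inject₁ i)) (everywhere (𝐰-X i))
    w-x₀ : x 0 E.∙ 𝐰ᴸ E.≈ scale q E.∙ (𝐰ᴸ E.∙ x n)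
    w-x₀ = ≡.subst₂ (λ P Q → P E.∙ 𝐰ᴸ E.≈ scale q E.∙ (𝐰ᴸ E.∙ Q)) (≡.sym (extend-toℕ idᴸ X Fin.zero)) (≡.sym x-last)
      (everywhere λ f → ≋-trans (𝐰-X₀ f) (≋-sym (≋-trans (cong (X (fromℕ n)) (map-• 𝐰ᴸ q f)) (map-• (X (fromℕ n)) q _))))
    t-family : Intertwining.IsBraidFamily (End 𝕄) n t
    t-family = FinFamily.isBraidFamily (End 𝕄) 𝐓ᴸ 𝐓-far (λ i j j≡ → everywhere (𝐓-braid i j j≡))

  private
    t∙t′ : ∀ k → t k E.∙ t′ k E.≈ E.ε
    t∙t′ k = inverse-family 𝐓ᴸ 𝐓⁻¹ᴸ 𝐓-𝐓⁻¹ k (k ℕ.<? n)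
    t′∙t : ∀ k → t′ k E.∙ t k E.≈ E.ε
    t′∙t k = inverse-family 𝐓⁻¹ᴸ 𝐓ᴸ 𝐓⁻¹-𝐓 k (k ℕ.<? n)
    σ∙σ′ : scale s E.∙ scale (s ⁻¹) E.≈ E.ε
    σ∙σ′ = everywhere s⁻¹•s•
    x-t′ : ∀ k → k ℕ.< n → x k E.∙ t k E.≈ scale s E.∙ (t′ k E.∙ x (suc k))
    x-t′ = by-toℕ (λ k → x k E.∙ t k E.≈ scale s E.∙ (t′ k E.∙ x (suc k))) x-t
    x-far′ : ∀ i j → i ≢ j → suc i ≢ j → x j E.∙ t i E.≈ t i E.∙ x j
    x-far′ i j = x-far i j (i ℕ.<? n) (j ℕ.<? suc n)
    w-x′ : ∀ k → k ℕ.< n → x (suc k) E.∙ 𝐰ᴸ E.≈ 𝐰ᴸ E.∙ x k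
    w-x′ = by-toℕ (λ k → x (suc k) E.∙ 𝐰ᴸ E.≈ 𝐰ᴸ E.∙ x k) w-x

  relations : DoubleAffine.Relations (End 𝕄) n t t′ x 𝐰ᴸ (scale s) (scale (s ⁻¹)) (scale q)
  relations = record
    { t-family  = t-family
    ; t∙t′      = t∙t′
    ; t′∙t      = t′∙t
    ; σ-central = scale-central s
    ; σ∙σ′      = σ∙σ′
    ; κ-central = scale-central q
    ; x-t       = x-t′
    ; x-far     = x-far′
    ; x-x       = x-x
    ; w-t       = w-t
    ; w-x       = w-x′
    ; w-x₀      = w-x₀ }

-- How Ξ_j moves past T_i and Φ, eigenvectors, and their independence.

module Eigenvectors {c ℓ k ℓk} {C : Field c ℓ} (𝕂 : RationalFunctionField C k ℓk)
                    {n₀ : ℕ} (lam : Partition (suc (suc n₀))) where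
  private
    n : ℕ
    n = suc n₀
  open RationalFunctionField 𝕂 using (K; q; s)
  open Field K
  open Macdonald 𝕂 lam using (Monomial; M; ⟨_⟩; Comb; linear; 𝐓; 𝐓⁻¹; 𝐰; Ξ; Φ)
  open LinearMaps commutativeRing
  open IntegerSolver commutativeRing
  open FieldFacts K
  open Ratio s
  open Scalars 𝕂
  open Increments
  open HeckeOperators K s
  open Seminormal 𝕂 lam
  open SeminormalRelations 𝕂 lam
  open Operators 𝕂 lam
  open HeckeRelations 𝕂 lam
  open DoubleAffineAction 𝕂 lam
  private
    𝕄 : Set
    𝕄 = Monomial × Tab lam
    θ : Carrier
    θ = 1# - s
    module E = Monoid (End 𝕄)
  open Intertwining (End 𝕄)
  module H = DoubleAffine.Relations relations
  private module Lists = Combinations commutativeRing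

  opaque
    unfolding 𝐓⁻¹ᴸ
    foldl-𝐓⁻¹ : ∀ f → foldl (λ g j → 𝐓⁻¹ j g) f (allFin n) ≋ f ◁ up t′ 0 n
    foldl-𝐓⁻¹ f = Folds.foldl-allFin commutativeRing 𝐓⁻¹ᴸ f

    foldl-𝐓⁻¹-below : ∀ i r → i ℕ.+ r ≡ n → ∀ f →
      foldl (λ g j → 𝐓⁻¹ j g) f (reverse (filter (λ j → toℕ j ℕ.<? i) (allFin n))) ≋ f ◁ down t′ 0 i
    foldl-𝐓⁻¹-below i r eq f = Folds.foldl-below commutativeRing 𝐓⁻¹ᴸ i r eq f

  opaque
    unfolding 𝐓ᴸ
    foldl-𝐓-notBelow : ∀ i r → i ℕ.+ r ≡ n → ∀ f →
      foldl (λ g j → 𝐓 j g) f (reverse (filter (λ j → i ℕ.≤? toℕ j) (allFin n))) ≋ f ◁ down t i r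
    foldl-𝐓-notBelow i r eq f = Folds.foldl-notBelow commutativeRing 𝐓ᴸ i r eq f

  opaque
    Φᴸ : Lin 𝕄 𝕄
    Φᴸ = H.Φ

    Φ-factors : Φᴸ ≡ up t′ 0 n E.∙ x n
    Φ-factors = ≡.refl

  Φ-fun : ∀ f → Φ f ≋ f ◁ Φᴸ
  Φ-fun f = begin
    Φ f                                                     ≡⟨ X-fun (fromℕ n) (foldl (λ g j → 𝐓⁻¹ j g) f (allFin n)) ⟩
    foldl (λ g j → 𝐓⁻¹ j g) f (allFin n) ◁ X (fromℕ n)      ≈⟨ cong (X (fromℕ n)) (foldl-𝐓⁻¹ f) ⟩
    f ◁ up t′ 0 n ◁ X (fromℕ n)                             ≡⟨ ≡.cong (f ◁ up t′ 0 n ◁_) x-last ⟨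
    f ◁ (up t′ 0 n E.∙ x n)                                 ≡⟨ ≡.cong (f ◁_) Φ-factors ⟨
    f ◁ Φᴸ                                                  ∎
    where open SetoidReasoning (≋-setoid 𝕄)

  complement : ∀ {m} (i : Fin (suc m)) → toℕ i ℕ.+ (m ∸ toℕ i) ≡ m
  complement i = ℕ.m+[n∸m]≡n (ℕ.≤-pred (Fin.toℕ<n i))

  opaque
    ξ : Fin (suc n) → Lin 𝕄 𝕄
    ξ i = H.e (toℕ i) (n ∸ toℕ i) E.∙ scale (s ^ᶻ (toℕ i ℤ.⊖ n))

    ξ-factors : ∀ i → ξ i ≡ H.e (toℕ i) (n ∸ toℕ i) E.∙ scale (s ^ᶻ (toℕ i ℤ.⊖ n))
    ξ-factors i = ≡.refl

  ξ-e : ∀ i r → toℕ i ℕ.+ r ≡ n → ∀ f → f ◁ ξ i ≋ s ^ᶻ (toℕ i ℤ.⊖ n) • f ◁ H.e (toℕ i) r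
  ξ-e i r eq f = ≋-reflexive (≡.trans (≡.cong (f ◁_) (ξ-factors i))
    (≡.cong (λ r → s ^ᶻ (toℕ i ℤ.⊖ n) • f ◁ H.e (toℕ i) r)
      (ℕ.+-cancelˡ-≡ (toℕ i) _ _ (≡.trans (complement i) (≡.sym eq)))))

  Ξ-fun : ∀ i f → Ξ i f ≋ f ◁ ξ i
  Ξ-fun i f = ≋-trans (•-lists refl inner) (≋-sym (ξ-e i (n ∸ toℕ i) (complement i) f))
    where
    eq : toℕ i ℕ.+ (n ∸ toℕ i) ≡ n
    eq = complement i
    inner : foldl (λ g j → 𝐓 j g) (𝐰 (foldl (λ g j → 𝐓⁻¹ j g) f (reverse (filter (λ j → toℕ j ℕ.<? toℕ i) (allFin n)))))
              (reverse (filter (λ j → toℕ i ℕ.≤? toℕ j) (allFin n))) ≋ f ◁ H.e (toℕ i) (n ∸ toℕ i)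
    inner = ≋-trans (foldl-𝐓-notBelow (toℕ i) (n ∸ toℕ i) eq (𝐰 g))
      (cong (down t (toℕ i) (n ∸ toℕ i)) (≋-trans (≋-reflexive (𝐰-fun g)) (cong 𝐰ᴸ (foldl-𝐓⁻¹-below (toℕ i) (n ∸ toℕ i) eq f))))
      where
      g : M
      g = foldl (λ g j → 𝐓⁻¹ j g) f (reverse (filter (λ j → toℕ j ℕ.<? toℕ i) (allFin n)))

  t-𝐓 : ∀ i → t (toℕ i) ≡ 𝐓ᴸ i
  t-𝐓 = extend-toℕ idᴸ 𝐓ᴸ

  private
    power-suc : ∀ m → s ^ᶻ (suc m ℤ.⊖ n) ≈ s * s ^ᶻ (m ℤ.⊖ n)
    power-suc m = trans (reflexive (≡.cong (s ^ᶻ_) (≡.sym (ℤ.distribʳ-⊖-+-pos 1 m n))))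
      (trans (^ᶻ-+ (+ 1) (m ℤ.⊖ n)) (*-congʳ (*-identityʳ s)))

    toℕ-suc-+ : ∀ (i : Fin n) → toℕ i ℕ.+ suc (n₀ ∸ toℕ i) ≡ n
    toℕ-suc-+ i = ≡.trans (ℕ.+-suc (toℕ i) _) (≡.cong suc (complement i))

  ξ-inject₁ : ∀ i f → f ◁ ξ (inject₁ i) ≋ s ^ᶻ (toℕ i ℤ.⊖ n) • f ◁ H.e (toℕ i) (suc (n₀ ∸ toℕ i))
  ξ-inject₁ i f = ≋-trans (ξ-e (inject₁ i) (suc (n₀ ∸ toℕ i)) (≡.trans (≡.cong (ℕ._+ suc (n₀ ∸ toℕ i)) (Fin.toℕ-inject₁ i)) (toℕ-suc-+ i)) f)
    (≋-reflexive (≡.cong (λ m → s ^ᶻ (m ℤ.⊖ n) • f ◁ H.e m (suc (n₀ ∸ toℕ i))) (Fin.toℕ-inject₁ i)))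

  ξ-suc : ∀ i f → f ◁ ξ (Fin.suc i) ≋ (s * s ^ᶻ (toℕ i ℤ.⊖ n)) • f ◁ H.e (suc (toℕ i)) (n₀ ∸ toℕ i)
  ξ-suc i f = ≋-trans (ξ-e (Fin.suc i) (n₀ ∸ toℕ i) (≡.cong suc (complement i)) f) (•-cong (power-suc (toℕ i)) ≋-refl)

  -- `t-e-t` with the normalising powers of s, which differ by one factor s between neighbouring
  -- indices.
  𝐓-ξ-𝐓 : ∀ i f → f ◁ 𝐓ᴸ i ◁ ξ (Fin.suc i) ◁ 𝐓ᴸ i ≋ s • f ◁ ξ (inject₁ i)
  𝐓-ξ-𝐓 i f = begin
    f ◁ 𝐓ᴸ i ◁ ξ (Fin.suc i) ◁ 𝐓ᴸ i                 ≈⟨ cong (𝐓ᴸ i) (ξ-suc i (f ◁ 𝐓ᴸ i)) ⟩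
    ((s * a) • f ◁ 𝐓ᴸ i ◁ H.e (suc m) r) ◁ 𝐓ᴸ i      ≈⟨ map-• (𝐓ᴸ i) _ _ ⟩
    (s * a) • f ◁ 𝐓ᴸ i ◁ H.e (suc m) r ◁ 𝐓ᴸ i        ≡⟨ ≡.cong (λ T → (s * a) • f ◁ T ◁ H.e (suc m) r ◁ T) (t-𝐓 i) ⟨
    (s * a) • f ◁ t m ◁ H.e (suc m) r ◁ t m          ≈⟨ •-cong refl (on (H.t-e-t m r) f) ⟩
    (s * a) • f ◁ H.e m (suc r)                      ≈⟨ byScalars ((s * a) ⊡ ν 0F) (s ⊡ a ⊡ ν 0F) (f ◁ H.e m (suc r) ∷ []) (λ where (y ∷ []) → *-assoc s a y) ⟩
    s • a • f ◁ H.e m (suc r)                        ≈⟨ •-cong refl (ξ-inject₁ i f) ⟨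
    s • f ◁ ξ (inject₁ i)                            ∎
    where
    open SetoidReasoning (≋-setoid 𝕄)
    m = toℕ i
    r = n₀ ∸ toℕ i
    a = s ^ᶻ (toℕ i ℤ.⊖ n)

  𝐓-ξ : ∀ i j → j ≢ inject₁ i → j ≢ Fin.suc i → ∀ f → f ◁ 𝐓ᴸ i ◁ ξ j ≋ f ◁ ξ j ◁ 𝐓ᴸ i
  𝐓-ξ i j j≢ j≢′ f = begin
    f ◁ 𝐓ᴸ i ◁ ξ j                     ≈⟨ ξ-e j r (complement j) (f ◁ 𝐓ᴸ i) ⟩
    a • f ◁ 𝐓ᴸ i ◁ H.e (toℕ j) r       ≡⟨ ≡.cong (λ T → a • f ◁ T ◁ H.e (toℕ j) r) (t-𝐓 i) ⟨
    a • f ◁ t (toℕ i) ◁ H.e (toℕ j) r  ≈⟨ •-cong refl (on (H.t-e (toℕ i) (toℕ j) r (complement j) (Fin.toℕ<n i)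
                                             (λ eq → j≢ (Fin.toℕ-injective (≡.trans (≡.sym eq) (≡.sym (Fin.toℕ-inject₁ i)))))
                                             (λ eq → j≢′ (Fin.toℕ-injective (≡.sym eq)))) f) ⟩
    a • f ◁ H.e (toℕ j) r ◁ t (toℕ i)  ≡⟨ ≡.cong (λ T → a • f ◁ H.e (toℕ j) r ◁ T) (t-𝐓 i) ⟩
    a • f ◁ H.e (toℕ j) r ◁ 𝐓ᴸ i       ≈⟨ map-• (𝐓ᴸ i) a _ ⟨
    (a • f ◁ H.e (toℕ j) r) ◁ 𝐓ᴸ i     ≈⟨ cong (𝐓ᴸ i) (ξ-e j r (complement j) f) ⟨
    f ◁ ξ j ◁ 𝐓ᴸ i                     ∎
    where
    open SetoidReasoning (≋-setoid 𝕄)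
    r = n ∸ toℕ j
    a = s ^ᶻ (toℕ j ℤ.⊖ n)

  opaque
    unfolding Φᴸ
    Φ-e′ : ∀ i r → i ℕ.+ r ≡ n₀ → ∀ f → f ◁ Φᴸ ◁ H.e i (suc r) ≋ s • f ◁ H.e (suc i) r ◁ Φᴸ
    Φ-e′ i r eq f = ≋-trans (on (DoubleAffine.Φ-e (End 𝕄) relations i r eq) f)
      (≋-trans (cong Φᴸ (map-• (H.e (suc i) r) s f)) (map-• Φᴸ s _))

    Φ-e-last′ : ∀ f → f ◁ Φᴸ ◁ H.e n 0 ≋ q • f ◁ H.σ′^ n ◁ H.e 0 n ◁ Φᴸ
    Φ-e-last′ f = ≋-trans (on H.Φ-e-last f)
      (≋-trans (cong Φᴸ (map-• (H.e 0 n) q _)) (map-• Φᴸ q _))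

    Φ-𝐓 : ∀ i j → toℕ j ≡ suc (toℕ i) → ∀ f → f ◁ 𝐓ᴸ j ◁ Φᴸ ≋ f ◁ Φᴸ ◁ 𝐓ᴸ i
    Φ-𝐓 i j j≡ f = ≡.subst₂ (λ F G → f ◁ F ◁ Φᴸ ≋ f ◁ Φᴸ ◁ G)
      (≡.trans (≡.cong t (≡.sym j≡)) (t-𝐓 j)) (t-𝐓 i) (on (H.Φ-t (toℕ i) (≡.subst (ℕ._< n) j≡ (Fin.toℕ<n j))) f)

    Φ-Φ-𝐓 : ∀ f → f ◁ 𝐓ᴸ Fin.zero ◁ Φᴸ ◁ Φᴸ ≋ f ◁ Φᴸ ◁ Φᴸ ◁ 𝐓ᴸ (fromℕ n₀)
    Φ-Φ-𝐓 f = ≡.subst₂ (λ F G → f ◁ F ◁ Φᴸ ◁ Φᴸ ≋ f ◁ Φᴸ ◁ Φᴸ ◁ G)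
      (t-𝐓 Fin.zero) (≡.trans (≡.cong t (≡.sym (Fin.toℕ-fromℕ n₀))) (t-𝐓 (fromℕ n₀))) (on (DoubleAffine.Φ-Φ-t (End 𝕄) relations) f)

  Φ-ξ : ∀ i f → f ◁ Φᴸ ◁ ξ (inject₁ i) ≋ f ◁ ξ (Fin.suc i) ◁ Φᴸ
  Φ-ξ i f = begin
    f ◁ Φᴸ ◁ ξ (inject₁ i)                       ≈⟨ ξ-inject₁ i (f ◁ Φᴸ) ⟩
    a • f ◁ Φᴸ ◁ H.e m (suc r)                   ≈⟨ •-cong refl (Φ-e′ m r (complement i) f) ⟩
    a • s • f ◁ H.e (suc m) r ◁ Φᴸ               ≈⟨ byScalars (a ⊡ s ⊡ ν 0F) ((s * a) ⊡ ν 0F) (f ◁ H.e (suc m) r ◁ Φᴸ ∷ [])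
                                                      (λ where (y ∷ []) → solve 3 (λ a s y → a :* (s :* y) := (s :* a) :* y) refl a s y) ⟩
    (s * a) • f ◁ H.e (suc m) r ◁ Φᴸ             ≈⟨ map-• Φᴸ (s * a) _ ⟨
    ((s * a) • f ◁ H.e (suc m) r) ◁ Φᴸ           ≈⟨ cong Φᴸ (ξ-suc i f) ⟨
    f ◁ ξ (Fin.suc i) ◁ Φᴸ                       ∎
    where
    open SetoidReasoning (≋-setoid 𝕄)
    m = toℕ i
    r = n₀ ∸ toℕ i
    a = s ^ᶻ (toℕ i ℤ.⊖ n)

  private
    σ′^-• : ∀ m f → f ◁ H.σ′^ m ≋ s ^ᶻ (0 ℤ.⊖ m) • f
    σ′^-• zero    f = one-• f
    σ′^-• (suc m) f = ≋-trans (σ′^-• m (s ⁻¹ • f)) (byScalars (s ^ᶻ (0 ℤ.⊖ m) ⊡ s ⁻¹ ⊡ ν 0F) ((s ⁻¹) ^ suc m ⊡ ν 0F) (f ∷ [])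
      λ where (y ∷ []) → trans (sym (*-assoc _ _ y)) (*-congʳ (trans (*-comm _ _) (*-congˡ (negative m)))))
      where
      negative : ∀ m → s ^ᶻ (0 ℤ.⊖ m) ≈ (s ⁻¹) ^ m
      negative zero    = refl
      negative (suc m) = refl

  -- The N - 1 factors 1/s that arise when the last variable is moved down to the first are exactly
  -- the normalising scalar of Ξ_1, while that of Ξ_N is 1.
  Φ-ξ-last : ∀ f → f ◁ Φᴸ ◁ ξ (fromℕ n) ≋ q • f ◁ ξ Fin.zero ◁ Φᴸ
  Φ-ξ-last f = begin
    f ◁ Φᴸ ◁ ξ (fromℕ n)                             ≈⟨ ξ-e (fromℕ n) 0 (≡.trans (ℕ.+-identityʳ _) (Fin.toℕ-fromℕ n)) (f ◁ Φᴸ) ⟩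
    s ^ᶻ (toℕ (fromℕ n) ℤ.⊖ n) • f ◁ Φᴸ ◁ H.e (toℕ (fromℕ n)) 0
      ≡⟨ ≡.cong (λ m → s ^ᶻ (m ℤ.⊖ n) • f ◁ Φᴸ ◁ H.e m 0) (Fin.toℕ-fromℕ n) ⟩
    s ^ᶻ (n ℤ.⊖ n) • f ◁ Φᴸ ◁ H.e n 0                ≡⟨ ≡.cong (λ i → s ^ᶻ i • f ◁ Φᴸ ◁ H.e n 0) (ℤ.n⊖n≡0 n) ⟩
    1# • f ◁ Φᴸ ◁ H.e n 0                            ≈⟨ one-• _ ⟨
    f ◁ Φᴸ ◁ H.e n 0                                 ≈⟨ Φ-e-last′ f ⟩
    q • f ◁ H.σ′^ n ◁ H.e 0 n ◁ Φᴸ                   ≈⟨ •-cong refl (cong Φᴸ (cong (H.e 0 n) (σ′^-• n f))) ⟩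
    q • (s ^ᶻ (0 ℤ.⊖ n) • f) ◁ H.e 0 n ◁ Φᴸ          ≈⟨ •-cong refl (cong Φᴸ (map-• (H.e 0 n) _ f)) ⟩
    q • (s ^ᶻ (0 ℤ.⊖ n) • f ◁ H.e 0 n) ◁ Φᴸ          ≈⟨ •-cong refl (cong Φᴸ (ξ-e Fin.zero n ≡.refl f)) ⟨
    q • f ◁ ξ Fin.zero ◁ Φᴸ                          ∎
    where open SetoidReasoning (≋-setoid 𝕄)

  Eigen : (Fin (suc n) → Carrier) → M → Set ℓk
  Eigen ζ f = ∀ j → f ◁ ξ j ≋ ζ j • f

  Eigen-resp : ∀ {ζ ζ′ f g} → (∀ j → ζ j ≈ ζ′ j) → f ≋ g → Eigen ζ f → Eigen ζ′ g
  Eigen-resp p eq h j = ≋-trans (cong (ξ j) (≋-sym eq)) (≋-trans (h j) (•-cong (p j) eq))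

  Eigen-Φ : ∀ {ζ ζ′ f} → (∀ i → ζ′ (inject₁ i) ≈ ζ (Fin.suc i)) → ζ′ (fromℕ n) ≈ q * ζ Fin.zero → Eigen ζ f → Eigen ζ′ (f ◁ Φᴸ)
  Eigen-Φ {ζ} {ζ′} {f} p p₀ h j with view j
  ... | ‵inject₁ i = ≋-trans (Φ-ξ i f) (≋-trans (cong Φᴸ (h (Fin.suc i))) (≋-trans (map-• Φᴸ _ f) (•-cong (sym (p i)) ≋-refl)))
  ... | ‵fromℕ     = ≋-trans (Φ-ξ-last f) (≋-trans (•-cong refl (≋-trans (cong Φᴸ (h Fin.zero)) (map-• Φᴸ _ f)))
    (byScalars (q ⊡ ζ Fin.zero ⊡ ν 0F) (ζ′ (fromℕ n) ⊡ ν 0F) (f ◁ Φᴸ ∷ [])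
      λ where (y ∷ []) → trans (sym (*-assoc q _ y)) (*-congʳ (sym p₀))))

  s•-injective : ∀ {f g : M} → s • f ≋ s • g → f ≋ g
  s•-injective {f} {g} eq = ≋-trans (≋-sym (s⁻¹•s• f)) (≋-trans (•-cong refl eq) (s⁻¹•s• g))

  module _ {ζ : Fin (suc n) → Carrier} {f} (i : Fin n) (h : Eigen ζ f) where
    private
      p p′ : Fin (suc n)
      p = inject₁ i
      p′ = Fin.suc i
      z z′ r : Carrier
      z = ζ p
      z′ = ζ p′
      r = ratio z z′
      Tᵢ = 𝐓ᴸ i

    module _ (z≉0 : ¬ z ≈ 0#) (z≉z′ : ¬ z ≈ z′) where
      open SetoidReasoning (≋-setoid 𝕄)

      -- After multiplication by s, Ξ_i becomes T_iΞ_{i+1}T_i; the quadratic relation reduces the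
      -- square, and both eigenvalues of `f` enter.
      Eigen-⊹-inject₁ : f ◁ (Tᵢ ⊹ r) ◁ ξ p ≋ z′ • f ◁ (Tᵢ ⊹ r)
      Eigen-⊹-inject₁ = s•-injective (begin
        s • f ◁ (Tᵢ ⊹ r) ◁ ξ p
          ≈⟨ 𝐓-ξ-𝐓 i (f ◁ (Tᵢ ⊹ r)) ⟨
        f ◁ (Tᵢ ⊹ r) ◁ Tᵢ ◁ ξ p′ ◁ Tᵢ
          ≈⟨ cong Tᵢ (cong (ξ p′) (≋-trans (map-⊕• Tᵢ (f ◁ Tᵢ) r f) (≋-trans (⊕-cong (𝐓-quadraticAt i f) ≋-refl) collect))) ⟩
        ((s - 1# + r) • f ◁ Tᵢ ⊕ s • f) ◁ ξ p′ ◁ Tᵢ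
          ≈⟨ cong Tᵢ (≋-trans (map-⊕• (ξ p′) _ s f) (⊕-cong (map-• (ξ p′) _ _) (•-cong refl (h p′)))) ⟩
        ((s - 1# + r) • f ◁ Tᵢ ◁ ξ p′ ⊕ s • z′ • f) ◁ Tᵢ
          ≈⟨ ≋-trans (map-⊕• Tᵢ _ s _) (⊕-cong (map-• Tᵢ _ _) (•-cong refl (map-• Tᵢ z′ f))) ⟩
        (s - 1# + r) • f ◁ Tᵢ ◁ ξ p′ ◁ Tᵢ ⊕ s • z′ • f ◁ Tᵢ
          ≈⟨ ⊕-cong (•-cong refl (≋-trans (𝐓-ξ-𝐓 i f) (•-cong refl (h p)))) ≋-refl ⟩
        (s - 1# + r) • s • z • f ⊕ s • z′ • f ◁ Tᵢ
          ≈⟨ byScalars ((s - 1# + r) ⊡ s ⊡ z ⊡ ν 0F ⊞ s ⊡ z′ ⊡ ν 1F) (s ⊡ z′ ⊡ (ν 1F ⊞ r ⊡ ν 0F)) (f ∷ f ◁ Tᵢ ∷ []) scalar ⟩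
        s • z′ • f ◁ (Tᵢ ⊹ r) ∎)
        where
        collect : ((s - 1#) • f ◁ Tᵢ ⊕ s • f) ⊕ r • f ◁ Tᵢ ≋ (s - 1# + r) • f ◁ Tᵢ ⊕ s • f
        collect = byScalars (((s - 1#) ⊡ ν 0F ⊞ s ⊡ ν 1F) ⊞ r ⊡ ν 0F) ((s - 1# + r) ⊡ ν 0F ⊞ s ⊡ ν 1F) (f ◁ Tᵢ ∷ f ∷ [])
          λ where (x ∷ y ∷ []) → solve 4 (λ s r x y → ((s :- :1) :* x :+ s :* y) :+ r :* x := (s :- :1 :+ r) :* x :+ s :* y) refl s r x y
        -- This is `ratio-*` rearranged, and the reason for the choice of `r`.
        balance : (s - 1# + r) * z ≈ z′ * r
        balance = trans (solve 4 (λ s r z z′ → (s :- :1 :+ r) :* z := (r :* (z :- z′) :- (:1 :- s) :* z) :+ z′ :* r) refl s r z z′)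
          (trans (+-congʳ (trans (+-congʳ (ratio-* z≉0 z≉z′)) (-‿inverseʳ _))) (+-identityˡ _))
        scalar : ∀ κ → scalars ((s - 1# + r) ⊡ s ⊡ z ⊡ ν 0F ⊞ s ⊡ z′ ⊡ ν 1F) κ ≈ scalars (s ⊡ z′ ⊡ (ν 1F ⊞ r ⊡ ν 0F)) κ
        scalar (x ∷ y ∷ []) = trans
          (solve 6 (λ s m z z′ x y → m :* (s :* (z :* x)) :+ s :* (z′ :* y) := s :* ((m :* z) :* x :+ z′ :* y)) refl s (s - 1# + r) z z′ x y)
          (trans (*-congˡ (+-congʳ (*-congʳ balance)))
            (solve 5 (λ s z′ r x y → s :* ((z′ :* r) :* x :+ z′ :* y) := s :* (z′ :* (y :+ r :* x))) refl s z′ r x y))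

      Eigen-⊹-suc : f ◁ (Tᵢ ⊹ r) ◁ ξ p′ ≋ z • f ◁ (Tᵢ ⊹ r)
      Eigen-⊹-suc = begin
        f ◁ (Tᵢ ⊹ r) ◁ ξ p′                  ≈⟨ map-⊕• (ξ p′) (f ◁ Tᵢ) r f ⟩
        f ◁ Tᵢ ◁ ξ p′ ⊕ r • f ◁ ξ p′         ≈⟨ ⊕-cong slide (•-cong refl (h p′)) ⟩
        z • (f ◁ Tᵢ ⊕ θ • f) ⊕ r • z′ • f    ≈⟨ byScalars (z ⊡ (ν 0F ⊞ θ ⊡ ν 1F) ⊞ r ⊡ z′ ⊡ ν 1F) (z ⊡ (ν 0F ⊞ r ⊡ ν 1F)) (f ◁ Tᵢ ∷ f ∷ []) scalar ⟩
        z • f ◁ (Tᵢ ⊹ r)                     ∎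
        where
        slide : f ◁ Tᵢ ◁ ξ p′ ≋ z • (f ◁ Tᵢ ⊕ θ • f)
        slide = s•-injective (begin
          s • f ◁ Tᵢ ◁ ξ p′                      ≈⟨ 𝐓-quadratic i (f ◁ Tᵢ ◁ ξ p′) ⟨
          f ◁ Tᵢ ◁ ξ p′ ◁ Tᵢ ◁ (Tᵢ ⊹ θ)          ≈⟨ cong (Tᵢ ⊹ θ) (≋-trans (𝐓-ξ-𝐓 i f) (•-cong refl (h p))) ⟩
          (s • z • f) ◁ (Tᵢ ⊹ θ)                 ≈⟨ ≋-trans (map-• (Tᵢ ⊹ θ) s _) (•-cong refl (map-• (Tᵢ ⊹ θ) z f)) ⟩
          s • z • (f ◁ Tᵢ ⊕ θ • f)               ∎)
        scalar : ∀ κ → scalars (z ⊡ (ν 0F ⊞ θ ⊡ ν 1F) ⊞ r ⊡ z′ ⊡ ν 1F) κ ≈ scalars (z ⊡ (ν 0F ⊞ r ⊡ ν 1F)) κ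
        scalar (x ∷ y ∷ []) = trans
          (solve 6 (λ z z′ r m x y → z :* (x :+ m :* y) :+ r :* (z′ :* y) := z :* x :+ (m :* z :+ r :* z′) :* y) refl z z′ r θ x y)
          (trans (+-congˡ (*-congʳ (+-congʳ (sym (ratio-* z≉0 z≉z′)))))
            (solve 5 (λ z z′ r x y → z :* x :+ (r :* (z :- z′) :+ r :* z′) :* y := z :* (x :+ r :* y)) refl z z′ r x y))

      Eigen-⊹-other : ∀ j → j ≢ p → j ≢ p′ → f ◁ (Tᵢ ⊹ r) ◁ ξ j ≋ ζ j • f ◁ (Tᵢ ⊹ r)
      Eigen-⊹-other j j≢p j≢p′ = begin
        f ◁ (Tᵢ ⊹ r) ◁ ξ j          ≈⟨ ⊹-intertwine {X = Tᵢ} {Tᵢ} {ξ j} r (𝐓-ξ i j j≢p j≢p′ f) ⟩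
        f ◁ ξ j ◁ (Tᵢ ⊹ r)          ≈⟨ cong (Tᵢ ⊹ r) (h j) ⟩
        (ζ j • f) ◁ (Tᵢ ⊹ r)        ≈⟨ map-• (Tᵢ ⊹ r) (ζ j) f ⟩
        ζ j • f ◁ (Tᵢ ⊹ r)          ∎

      Eigen-⊹ : ∀ {ζ′} → ζ′ p ≈ z′ → ζ′ p′ ≈ z → (∀ j → j ≢ p → j ≢ p′ → ζ′ j ≈ ζ j) → Eigen ζ′ (f ◁ (Tᵢ ⊹ r))
      Eigen-⊹ e e′ eo j with j Fin.≟ p | j Fin.≟ p′
      ... | yes ≡.refl | _          = ≋-trans Eigen-⊹-inject₁ (•-cong (sym e) ≋-refl)
      ... | no _       | yes ≡.refl = ≋-trans Eigen-⊹-suc (•-cong (sym e′) ≋-refl)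
      ... | no j≢p     | no j≢p′    = ≋-trans (Eigen-⊹-other j j≢p j≢p′) (•-cong (sym (eo j j≢p j≢p′)) ≋-refl)

  -- A positive form of "f is nonzero": since equality of scalars is undecidable, the negative form
  -- would not let one conclude that a coefficient vanishes.
  Faithful : M → Set _
  Faithful f = ∀ a → a • f ≋ [] → a ≈ 0#

  Faithful-resp : ∀ {f g} → f ≋ g → Faithful f → Faithful g
  Faithful-resp eq h a z = h a (≋-trans (•-cong refl eq) z)

  Faithful⇒≉ : ∀ {f} → Faithful f → ¬ f ≋ []
  Faithful⇒≉ h z = 1≉0 (h 1# (≋-trans (≋-sym (one-• _)) z))

  Faithful-injective : ∀ {f} (F : Lin 𝕄 𝕄) → (∀ g → g ◁ F ≋ [] → g ≋ []) → Faithful f → Faithful (f ◁ F)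
  Faithful-injective {f} F inj h a z = h a (inj (a • f) (≋-trans (map-• F a f) z))

  Faithful-⟨⟩ : ∀ b → Faithful ⟨ b ⟩
  Faithful-⟨⟩ b a z = trans (sym (trans (coeff-• a ⟨ b ⟩ b) (trans (*-congˡ (trans (coeff-here 1# b []) (+-identityʳ 1#))) (*-identityʳ a)))) (at z b)

  -- The opposite intertwiner inverts this one up to the scalar of `ratio-product`, which is nonzero
  -- under the hypotheses.
  Faithful-⊹ : ∀ i {f z z′} → ¬ z ≈ 0# → ¬ z′ ≈ 0# → ¬ z ≈ z′ → ¬ s * z ≈ z′ → ¬ z ≈ s * z′ →
    Faithful f → Faithful (f ◁ (𝐓ᴸ i ⊹ ratio z z′))
  Faithful-⊹ i {f} {z} {z′} z≉0 z′≉0 z≉z′ sz≉z′ z≉sz′ h a eq =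
    *-cancelˡ-0 (ratio-product-≉0 z≉0 z′≉0 z≉z′ sz≉z′ z≉sz′) (trans (*-comm _ a) (h (a * m) (begin
      (a * m) • f                                        ≈⟨ byScalars ((a * m) ⊡ ν 0F) (a ⊡ m ⊡ ν 0F) (f ∷ []) (λ where (x ∷ []) → *-assoc a m x) ⟩
      a • m • f                                          ≈⟨ •-cong refl (⊹-⊹ (𝐓ᴸ i) f (ratio-+ z≉0 z′≉0 z≉z′) (𝐓-quadraticAt i f)) ⟨
      a • f ◁ (𝐓ᴸ i ⊹ ratio z z′) ◁ (𝐓ᴸ i ⊹ ratio z′ z)  ≈⟨ map-• (𝐓ᴸ i ⊹ ratio z′ z) a _ ⟨
      (a • f ◁ (𝐓ᴸ i ⊹ ratio z z′)) ◁ (𝐓ᴸ i ⊹ ratio z′ z) ≈⟨ cong (𝐓ᴸ i ⊹ ratio z′ z) eq ⟩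
      [] ◁ (𝐓ᴸ i ⊹ ratio z′ z)                           ≈⟨ map-[] (𝐓ᴸ i ⊹ ratio z′ z) ⟩
      []                                                 ∎)))
    where
    open SetoidReasoning (≋-setoid 𝕄)
    m = s + ratio z z′ * ratio z′ z

  module _ {B : Set} ⦃ _ : DecEq B ⦄ where
    open DecEq ⦃ ... ⦄
    coeff-relabel : ∀ (h : B → B) → (∀ {b b′} → h b ≡ h b′ → b ≡ b′) → ∀ f b →
      coeffᵈ (List.map (map₂ h) f) (h b) ≈ coeffᵈ f b
    coeff-relabel h injective []             b = refl
    coeff-relabel h injective ((k , b′) ∷ f) b with h b ≟ h b′ | b ≟ b′
    ... | yes _  | yes _  = +-congˡ (coeff-relabel h injective f b)
    ... | yes eq | no  ≢  = contradiction (injective eq) ≢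
    ... | no  ≢  | yes eq = contradiction (≡.cong h eq) ≢
    ... | no _   | no  _  = coeff-relabel h injective f b

  X-injective : ∀ j g → g ◁ X j ≋ [] → g ≋ []
  X-injective j g z = pointwise λ b → trans (sym (coeff-relabel (map₁ (inc j)) injective g b))
    (trans (reflexive (≡.cong (λ f → coeffᵈ f (map₁ (inc j) b)) (X-fun j g))) (at z (map₁ (inc j) b)))
    where
    inc-injective : ∀ {m} (j : Fin m) {a a′} → inc j a ≡ inc j a′ → a ≡ a′
    inc-injective Fin.zero    {x ∷ a} {x′ ∷ a′} eq = ≡.cong₂ _∷_ (ℕ.suc-injective (≡.cong head eq)) (≡.cong tail eq)
    inc-injective (Fin.suc j) {x ∷ a} {x′ ∷ a′} eq = ≡.cong₂ _∷_ (≡.cong head eq) (inc-injective j (≡.cong tail eq))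
    injective : ∀ {b b′ : 𝕄} → map₁ (inc j) b ≡ map₁ (inc j) b′ → b ≡ b′
    injective eq = ≡.cong₂ _,_ (inc-injective j (≡.cong proj₁ eq)) (≡.cong proj₂ eq)

  -- Φ is an invertible product of inverses followed by multiplication by a variable, which permutes
  -- basis elements injectively.
  Faithful-Φ : ∀ {f} → Faithful f → Faithful (f ◁ Φᴸ)
  Faithful-Φ = Faithful-injective Φᴸ λ g z → ≋-trans (≋-sym (on (up-down-inverse H.t′∙t 0 n) g))
    (≋-trans (cong (down t 0 n) (X-injective (fromℕ n) (g ◁ up t′ 0 n)
      (≋-trans (≋-reflexive (≡.sym (≡.trans (≡.cong (g ◁_) Φ-factors) (≡.cong (g ◁ up t′ 0 n ◁_) x-last)))) z))) (map-[] (down t 0 n)))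

  -- Applying Ξ_j - ζ_j for the eigenvalues ζ_j of the other members of a family
  -- isolates one of them.
  module Independence {B : Set} ⦃ _ : DecEq B ⦄ (P : B → M) (ζ : B → Fin (suc n) → Carrier)
    (eigen : ∀ b → Eigen (ζ b) (P b)) (faithful : ∀ b → Faithful (P b))
    (separated : ∀ {b b′} → b ≢ b′ → ∃ λ j → ¬ ζ b j ≈ ζ b′ j) where
    open DecEq ⦃ ... ⦄ using (_≟_)

    private
      record Isolator (b : B) (L : List B) : Set (k ⊔ ℓk) where
        field
          operator : Lin 𝕄 𝕄
          factor   : B → Carrier
          acts     : ∀ b′ → P b′ ◁ operator ≋ factor b′ • P b′
          nonzero  : ¬ factor b ≈ 0#
          kills    : ∀ {b′} → b′ ≢ b → b′ ∈ L → factor b′ ≈ 0#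

      isolator : ∀ b L → Isolator b L
      isolator b []      = record { operator = idᴸ ; factor = λ _ → 1# ; acts = λ b′ → one-• (P b′) ; nonzero = 1≉0 ; kills = λ _ () }
      isolator b (e ∷ L) with e ≟ b | isolator b L
      ... | yes ≡.refl | I = record
        { Isolator I ; kills = λ where b′≢b (here eq) → contradiction eq b′≢b
                                       b′≢b (there m) → Isolator.kills I b′≢b m }
      ... | no e≢b     | I = record
        { operator = operator ⨾ (ξ j ⊹ (- ζ e j))
        ; factor   = λ b′ → factor b′ * (ζ b′ j - ζ e j)
        ; acts     = acts′
        ; nonzero  = *-≉0 nonzero (x-y≉0 (≉-sym (proj₂ (separated e≢b))))
        ; kills    = λ where _    (here ≡.refl) → trans (*-congˡ (-‿inverseʳ _)) (zeroʳ _)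
                             b′≢b (there m)     → trans (*-congʳ (kills b′≢b m)) (zeroˡ _) }
        where
        open Isolator I
        j = proj₁ (separated e≢b)
        acts′ : ∀ b′ → P b′ ◁ operator ◁ (ξ j ⊹ (- ζ e j)) ≋ (factor b′ * (ζ b′ j - ζ e j)) • P b′
        acts′ b′ = begin
          P b′ ◁ operator ◁ (ξ j ⊹ (- ζ e j))                     ≈⟨ cong (ξ j ⊹ (- ζ e j)) (acts b′) ⟩
          (factor b′ • P b′) ◁ (ξ j ⊹ (- ζ e j))                  ≈⟨ map-• (ξ j ⊹ (- ζ e j)) _ _ ⟩
          factor b′ • (P b′ ◁ ξ j ⊕ (- ζ e j) • P b′)             ≈⟨ •-cong refl (⊕-cong (eigen b′ j) ≋-refl) ⟩
          factor b′ • (ζ b′ j • P b′ ⊕ (- ζ e j) • P b′)          ≈⟨ byScalars (factor b′ ⊡ (ζ b′ j ⊡ ν 0F ⊞ (- ζ e j) ⊡ ν 0F)) ((factor b′ * (ζ b′ j - ζ e j)) ⊡ ν 0F) (P b′ ∷ [])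
            (λ where (x ∷ []) → solve 4 (λ a b d x → a :* (b :* x :+ (:- d) :* x) := (a :* (b :- d)) :* x) refl (factor b′) (ζ b′ j) (ζ e j) x) ⟩
          (factor b′ * (ζ b′ j - ζ e j)) • P b′                   ∎
          where open SetoidReasoning (≋-setoid 𝕄)

      isolate : ∀ {b L} (I : Isolator b L) (f : Comb B) → (∀ {b′} → b′ ∈ List.map proj₂ f → b′ ∈ L) →
        linear P f ◁ Isolator.operator I ≋ (coeffᵈ f b * Isolator.factor I b) • P b
      isolate {b} I []             sub = ≋-trans (map-[] operator) (≋-sym (zero-multiple (zeroˡ _) ≋-refl))
        where open Isolator I
      isolate {b} I ((a , b′) ∷ f) sub = begin
        linear P ((a , b′) ∷ f) ◁ operator                                   ≈⟨ cong operator (⊕-lists (•-lists refl ≋-refl) ≋-refl) ⟩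
        (a • P b′ ⊕ linear P f) ◁ operator                                   ≈⟨ ≋-trans (map-⊕ operator _ _) (⊕-cong (≋-trans (map-• operator a _) (•-cong refl (acts b′))) (isolate I f (λ m → sub (there m)))) ⟩
        a • factor b′ • P b′ ⊕ (coeffᵈ f b * factor b) • P b                 ≈⟨ compare (b ≟ b′) ⟩
        (coeffᵈ ((a , b′) ∷ f) b * factor b) • P b                           ∎
        where
        open Isolator I
        open SetoidReasoning (≋-setoid 𝕄)
        compare : Dec (b ≡ b′) → a • factor b′ • P b′ ⊕ (coeffᵈ f b * factor b) • P b ≋ (coeffᵈ ((a , b′) ∷ f) b * factor b) • P b
        compare (yes ≡.refl) = ≋-trans
          (byScalars (a ⊡ factor b ⊡ ν 0F ⊞ (coeffᵈ f b * factor b) ⊡ ν 0F) (((a + coeffᵈ f b) * factor b) ⊡ ν 0F) (P b ∷ [])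
            λ where (x ∷ []) → solve 4 (λ a b d x → a :* (b :* x) :+ (d :* b) :* x := ((a :+ d) :* b) :* x) refl a (factor b) (coeffᵈ f b) x)
          (•-cong (*-congʳ (sym (coeff-here a b f))) ≋-refl)
        compare (no b≢b′) = ≋-trans (⊕-cong (•-cong refl (•-cong (kills (≡.≢-sym b≢b′) (sub (here ≡.refl))) ≋-refl)) ≋-refl)
          (≋-trans (byScalars (a ⊡ 0# ⊡ ν 0F ⊞ (coeffᵈ f b * factor b) ⊡ ν 1F) ((coeffᵈ f b * factor b) ⊡ ν 1F) (P b′ ∷ P b ∷ [])
            λ where (x ∷ y ∷ []) → solve 4 (λ a b x y → a :* (:0 :* x) :+ b :* y := b :* y) refl a (coeffᵈ f b * factor b) x y)
          (•-cong (*-congʳ (sym (coeff-there a f b≢b′))) ≋-refl))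

    independent-family : ∀ f → linear P f ≋ [] → f ≋ []
    independent-family f z = pointwise λ b → by-isolator b (isolator b (List.map proj₂ f))
      where
      by-isolator : ∀ b → Isolator b (List.map proj₂ f) → coeffᵈ f b ≈ 0#
      by-isolator b I = *-cancelˡ-0 nonzero (trans (*-comm _ _) (faithful b _
        (≋-trans (≋-sym (isolate I f id)) (≋-trans (cong operator z) (map-[] operator)))))
        where open Isolator I

-- The rank function of an exponent vector.

module Ranks where
  open Swaps

  -- j precedes l in the order that defines the rank function r_v.
  Precedes : ∀ {m} → Vec ℕ m → Fin m → Fin m → Set
  Precedes v j l = lookup v l ℕ.< lookup v j ⊎ (lookup v j ≡ lookup v l × j Fin.< l)

  -- The rank function is described as an order isomorphism instead of by counting; no cardinalities
  -- have to be followed under rotation and swaps.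
  record IsRank {m} (v : Vec ℕ m) (σ : Vec (Fin m) m) : Set where
    field
      monotone : ∀ {j l} → Precedes v j l → lookup σ j Fin.< lookup σ l
      onto     : ∀ r → ∃ λ j → lookup σ j ≡ r

    reflects : ∀ {j l} → lookup σ j Fin.< lookup σ l → Precedes v j l
    reflects {j} {l} lt with ℕ.<-cmp (lookup v j) (lookup v l) | Fin.<-cmp j l
    ... | tri> _ _ v>  | _            = inj₁ v>
    ... | tri< v< _ _  | _            = contradiction (monotone (inj₁ v<)) (ℕ.<-asym lt)
    ... | tri≈ _ v≡ _  | tri< j<l _ _ = inj₂ (v≡ , j<l)
    ... | tri≈ _ v≡ _  | tri≈ _ ≡.refl _ = contradiction lt (ℕ.<-irrefl ≡.refl)
    ... | tri≈ _ v≡ _  | tri> _ _ l<j = contradiction (monotone (inj₂ (≡.sym v≡ , l<j))) (ℕ.<-asym lt)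

    injective : ∀ {j l} → lookup σ j ≡ lookup σ l → j ≡ l
    injective {j} {l} eq with ℕ.<-cmp (lookup v j) (lookup v l) | Fin.<-cmp j l
    ... | tri> _ _ v>  | _            = contradiction (≡.cong toℕ eq) (ℕ.<⇒≢ (monotone (inj₁ v>)))
    ... | tri< v< _ _  | _            = contradiction (≡.cong toℕ (≡.sym eq)) (ℕ.<⇒≢ (monotone (inj₁ v<)))
    ... | tri≈ _ v≡ _  | tri< j<l _ _ = contradiction (≡.cong toℕ eq) (ℕ.<⇒≢ (monotone (inj₂ (v≡ , j<l))))
    ... | tri≈ _ v≡ _  | tri≈ _ j≡l _ = j≡l
    ... | tri≈ _ v≡ _  | tri> _ _ l<j = contradiction (≡.cong toℕ (≡.sym eq)) (ℕ.<⇒≢ (monotone (inj₂ (≡.sym v≡ , l<j))))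

  strictlyMonotone⇒≤ : ∀ {m} (g : Fin m → Fin m) → (∀ {a b} → a Fin.< b → g a Fin.< g b) → ∀ a → toℕ a ℕ.≤ toℕ (g a)
  strictlyMonotone⇒≤ {m} g mono a = go (toℕ a) a ≡.refl
    where
    go : ∀ l a → toℕ a ≡ l → l ℕ.≤ toℕ (g a)
    go zero    a eq = ℕ.z≤n
    go (suc l) a eq = ℕ.≤-<-trans (go l a′ (Fin.toℕ-fromℕ< l<m)) (mono (≡.subst₂ ℕ._<_ (≡.sym (Fin.toℕ-fromℕ< l<m)) (≡.sym eq) (ℕ.n<1+n l)))
      where
      l<m : l ℕ.< m
      l<m = ℕ.<-trans (ℕ.n<1+n l) (≡.subst (ℕ._< m) eq (Fin.toℕ<n a))
      a′ : Fin m
      a′ = fromℕ< l<m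

  -- One ranking composed with the inverse of another is strictly increasing, so it moves no value
  -- down; by symmetry neither is larger anywhere.
  IsRank-unique : ∀ {m} {v : Vec ℕ m} {σ σ′} → IsRank v σ → IsRank v σ′ → σ ≡ σ′
  IsRank-unique h h′ = lookup-≡ λ j → Fin.toℕ-injective (ℕ.≤-antisym (half h h′ j) (half h′ h j))
    where
    half : ∀ {m} {v : Vec ℕ m} {σ σ′} → IsRank v σ → IsRank v σ′ → ∀ j → toℕ (lookup σ j) ℕ.≤ toℕ (lookup σ′ j)
    half {m} {v} {σ} {σ′} h h′ j = ≡.subst (λ l → toℕ (lookup σ j) ℕ.≤ toℕ (lookup σ′ l)) (IsRank.injective h (at-value (lookup σ j)))
      (strictlyMonotone⇒≤ g mono (lookup σ j))
      where
      place : Fin m → Fin m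
      place r = proj₁ (IsRank.onto h r)
      at-value : ∀ r → lookup σ (place r) ≡ r
      at-value r = proj₂ (IsRank.onto h r)
      g : Fin m → Fin m
      g r = lookup σ′ (place r)
      mono : ∀ {a b} → a Fin.< b → g a Fin.< g b
      mono {a} {b} lt = IsRank.monotone h′ (IsRank.reflects h (≡.subst₂ Fin._<_ (≡.sym (at-value a)) (≡.sym (at-value b)) lt))

  IsRank-replicate : ∀ m → IsRank (replicate m 0) (Vec.allFin m)
  IsRank-replicate m = record { monotone = λ {j} {l} → mono j l ; onto = λ r → r , Vec.lookup-allFin r }
    where
    mono : ∀ j l → Precedes (replicate m 0) j l → lookup (Vec.allFin m) j Fin.< lookup (Vec.allFin m) l
    mono j l (inj₁ lt) = contradiction (≡.subst₂ ℕ._<_ (Vec.lookup-replicate l 0) (Vec.lookup-replicate j 0) lt) (ℕ.<-irrefl ≡.refl)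
    mono j l (inj₂ (_ , lt)) = ≡.subst₂ Fin._<_ (≡.sym (Vec.lookup-allFin j)) (≡.sym (Vec.lookup-allFin l)) lt

  -- Sending the first entry to the end and raising it by one keeps the order: a tie which it won by
  -- standing first becomes a strict lead, and an entry larger by exactly one now ties with it and
  -- wins by standing further left.
  IsRank-rotate : ∀ {m} {v : Vec ℕ (suc m)} {σ} → IsRank v σ → IsRank (rotate v suc) (rotate σ (λ j → j))
  IsRank-rotate {m} {v} {σ} h = record { monotone = λ {j} {l} → mono j l ; onto = onto′ }
    where
    open IsRank h
    v↓ : ∀ i → lookup (rotate v suc) (inject₁ i) ≡ lookup v (Fin.suc i)
    v↓ = lookup-rotate-inject₁ v suc
    v⊤ : lookup (rotate v suc) (fromℕ m) ≡ suc (lookup v Fin.zero)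
    v⊤ = lookup-rotate-fromℕ v suc
    σ↓ : ∀ i → lookup (rotate σ (λ j → j)) (inject₁ i) ≡ lookup σ (Fin.suc i)
    σ↓ = lookup-rotate-inject₁ σ (λ j → j)
    σ⊤ : lookup (rotate σ (λ j → j)) (fromℕ m) ≡ lookup σ Fin.zero
    σ⊤ = lookup-rotate-fromℕ σ (λ j → j)
    mono : ∀ j l → Precedes (rotate v suc) j l → lookup (rotate σ (λ j → j)) j Fin.< lookup (rotate σ (λ j → j)) l
    mono j l p with view j | view l
    mono _ _ (inj₁ lt) | ‵inject₁ i | ‵inject₁ i′ = ≡.subst₂ Fin._<_ (≡.sym (σ↓ i)) (≡.sym (σ↓ i′))
      (monotone (inj₁ (≡.subst₂ ℕ._<_ (v↓ i′) (v↓ i) lt)))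
    mono _ _ (inj₂ (eq , lt)) | ‵inject₁ i | ‵inject₁ i′ = ≡.subst₂ Fin._<_ (≡.sym (σ↓ i)) (≡.sym (σ↓ i′))
      (monotone (inj₂ (≡.trans (≡.sym (v↓ i)) (≡.trans eq (v↓ i′)) , ℕ.s≤s (≡.subst₂ ℕ._<_ (Fin.toℕ-inject₁ i) (Fin.toℕ-inject₁ i′) lt))))
    mono _ _ (inj₁ lt) | ‵inject₁ i | ‵fromℕ = ≡.subst₂ Fin._<_ (≡.sym (σ↓ i)) (≡.sym σ⊤)
      (monotone (inj₁ (ℕ.<-trans (ℕ.n<1+n _) (≡.subst₂ ℕ._<_ v⊤ (v↓ i) lt))))
    mono _ _ (inj₂ (eq , _)) | ‵inject₁ i | ‵fromℕ = ≡.subst₂ Fin._<_ (≡.sym (σ↓ i)) (≡.sym σ⊤)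
      (monotone (inj₁ (≡.subst (lookup v Fin.zero ℕ.<_) (≡.trans (≡.sym v⊤) (≡.trans (≡.sym eq) (v↓ i))) (ℕ.n<1+n _))))
    mono _ _ (inj₁ lt) | ‵fromℕ | ‵inject₁ i = ≡.subst₂ Fin._<_ (≡.sym σ⊤) (≡.sym (σ↓ i))
      (monotone (weak (ℕ.m≤n⇒m<n∨m≡n (ℕ.≤-pred (≡.subst₂ ℕ._<_ (v↓ i) v⊤ lt)))))
      where
      weak : lookup v (Fin.suc i) ℕ.< lookup v Fin.zero ⊎ lookup v (Fin.suc i) ≡ lookup v Fin.zero → Precedes v Fin.zero (Fin.suc i)
      weak (inj₁ lt) = inj₁ lt
      weak (inj₂ eq) = inj₂ (≡.sym eq , ℕ.s≤s ℕ.z≤n)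
    mono _ _ (inj₂ (_ , lt)) | ‵fromℕ | ‵inject₁ i = contradiction
      (≡.subst₂ ℕ._<_ (Fin.toℕ-fromℕ m) (Fin.toℕ-inject₁ i) lt) (ℕ.<-asym (Fin.toℕ<n i))
    mono _ _ (inj₁ lt) | ‵fromℕ | ‵fromℕ = contradiction lt (ℕ.<-irrefl ≡.refl)
    mono _ _ (inj₂ (_ , lt)) | ‵fromℕ | ‵fromℕ = contradiction lt (ℕ.<-irrefl ≡.refl)
    onto′ : ∀ r → ∃ λ j → lookup (rotate σ (λ j → j)) j ≡ r
    onto′ r with onto r
    ... | Fin.zero  , eq = fromℕ m , ≡.trans σ⊤ eq
    ... | Fin.suc i , eq = inject₁ i , ≡.trans (σ↓ i) eq

  module _ {m} (i : Fin m) where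
    private
      p p′ : Fin (suc m)
      p = inject₁ i
      p′ = Fin.suc i
      τ : Fin (suc m) → Fin (suc m)
      τ = transpose p p′

    τ-involutive : ∀ j → τ (τ j) ≡ j
    τ-involutive j with transpose-cases p p′ j
    ... | inj₂ (inj₂ (j≢ , j≢′ , eq)) = ≡.trans (≡.cong τ eq) eq
    ... | inj₁ (j≡p , eq) = ≡.trans (≡.cong τ eq) (≡.trans τp′ (≡.sym j≡p))
      where
      τp′ : τ p′ ≡ p
      τp′ with transpose-cases p p′ p′
      ... | inj₁ (p′≡p , _) = contradiction (≡.sym p′≡p) inject₁≢suc
      ... | inj₂ (inj₁ (_ , eq)) = eq
      ... | inj₂ (inj₂ (_ , p′≢ , _)) = contradiction ≡.refl p′≢
    ... | inj₂ (inj₁ (j≡p′ , eq)) = ≡.trans (≡.cong τ eq) (≡.trans τp (≡.sym j≡p′))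
      where
      τp : τ p ≡ p′
      τp with transpose-cases p p′ p
      ... | inj₁ (_ , eq) = eq
      ... | inj₂ (inj₁ (p≡p′ , _)) = contradiction p≡p′ inject₁≢suc
      ... | inj₂ (inj₂ (p≢ , _ , _)) = contradiction ≡.refl p≢

    -- The only pair whose left-to-right order is reversed has distinct entries, so position never
    -- decides between them.
    IsRank-swap : ∀ {v : Vec ℕ (suc m)} {σ} → lookup v p ≢ lookup v p′ → IsRank v σ → IsRank (swap i v) (swap i σ)
    IsRank-swap {v} {σ} v≢ h = record { monotone = λ {j} {l} → mono j l ; onto = onto′ }
      where
      open IsRank h
      mono : ∀ j l → Precedes (swap i v) j l → lookup (swap i σ) j Fin.< lookup (swap i σ) l
      mono j l pr = ≡.subst₂ Fin._<_ (≡.sym (lookup-swap i σ j)) (≡.sym (lookup-swap i σ l)) (monotone (moved pr))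
        where
        moved : Precedes (swap i v) j l → Precedes v (τ j) (τ l)
        moved (inj₁ lt) = inj₁ (≡.subst₂ ℕ._<_ (lookup-swap i v l) (lookup-swap i v j) lt)
        moved (inj₂ (eq , lt)) with transpose-adjacent i (τ j) (τ l) (≡.subst₂ Fin._<_ (≡.sym (τ-involutive j)) (≡.sym (τ-involutive l)) lt)
        ... | inj₁ lt′ = inj₂ (≡.trans (≡.sym (lookup-swap i v j)) (≡.trans eq (lookup-swap i v l)) , lt′)
        ... | inj₂ (a , b) = contradiction
          (≡.trans (≡.sym (lookup-swap-suc i v)) (≡.trans (≡.cong (lookup (swap i v)) (≡.trans (≡.sym b) (τ-involutive l)))
            (≡.trans (≡.sym eq) (≡.trans (≡.cong (lookup (swap i v)) (≡.trans (≡.sym (τ-involutive j)) a)) (lookup-swap-inject₁ i v))))) v≢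
      onto′ : ∀ r → ∃ λ j → lookup (swap i σ) j ≡ r
      onto′ r with onto r
      ... | j , eq = τ j , ≡.trans (lookup-swap i σ (τ j)) (≡.trans (≡.cong (lookup σ) (τ-involutive j)) eq)

    -- A place whose rank lay strictly in between would have the same entry and stand strictly
    -- between two neighbours.
    IsRank-adjacent : ∀ {v : Vec ℕ (suc m)} {σ} → lookup v p ≡ lookup v p′ → IsRank v σ →
      ∃ λ r → lookup σ p ≡ inject₁ r × lookup σ p′ ≡ Fin.suc r
    IsRank-adjacent {v} {σ} v≡ h = r , Fin.toℕ-injective (≡.trans (≡.sym (Fin.toℕ-fromℕ< a<m)) (≡.sym (Fin.toℕ-inject₁ r)))
                                     , Fin.toℕ-injective (≡.trans next (≡.cong suc (≡.sym (Fin.toℕ-fromℕ< a<m))))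
      where
      open IsRank h
      p<p′ : p Fin.< p′
      p<p′ = ≡.subst (ℕ._< suc (toℕ i)) (≡.sym (Fin.toℕ-inject₁ i)) (ℕ.n<1+n _)
      a = toℕ (lookup σ p)
      b = toℕ (lookup σ p′)
      a<b : a ℕ.< b
      a<b = monotone (inj₂ (v≡ , p<p′))
      a<m : a ℕ.< m
      a<m = ℕ.<-≤-trans a<b (ℕ.≤-pred (Fin.toℕ<n (lookup σ p′)))
      r : Fin m
      r = fromℕ< a<m
      between : suc a ℕ.< b → ⊥
      between lt with onto (fromℕ< (ℕ.<-trans lt (Fin.toℕ<n (lookup σ p′))))
      ... | j , eq = squeeze (reflects below) (reflects above)
        where
        value : toℕ (lookup σ j) ≡ suc a
        value = ≡.trans (≡.cong toℕ eq) (Fin.toℕ-fromℕ< (ℕ.<-trans lt (Fin.toℕ<n (lookup σ p′))))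
        below : lookup σ p Fin.< lookup σ j
        below = ≡.subst (a ℕ.<_) (≡.sym value) (ℕ.n<1+n a)
        above : lookup σ j Fin.< lookup σ p′
        above = ≡.subst (ℕ._< b) (≡.sym value) lt
        squeeze : Precedes v p j → Precedes v j p′ → ⊥
        squeeze (inj₁ x)       (inj₁ y)       = ℕ.<⇒≢ (ℕ.<-trans y x) (≡.sym v≡)
        squeeze (inj₁ x)       (inj₂ (y , _)) = ℕ.<⇒≢ x (≡.trans y (≡.sym v≡))
        squeeze (inj₂ (x , _)) (inj₁ y)       = ℕ.<⇒≢ y (≡.trans (≡.sym v≡) x)
        squeeze (inj₂ (_ , x)) (inj₂ (_ , y)) = ℕ.<-irrefl ≡.refl
          (ℕ.<-≤-trans (≡.subst (ℕ._< toℕ j) (Fin.toℕ-inject₁ i) x) (ℕ.≤-pred y))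
      next : b ≡ suc a
      next with ℕ.m≤n⇒m<n∨m≡n a<b
      ... | inj₁ lt = ⊥-elim (between lt)
      ... | inj₂ eq = ≡.sym eq

-- Canonical derivations of exponent vectors.

module Weights where
  open Swaps
  open ℕ.+-*-Solver using (solve; _:+_; _:*_; _:=_; con)

  -- A potential which a swap of a descent v_i > v_{i+1} lowers.
  weight : ∀ {m} → Vec ℕ m → ℕ
  weight []              = 0
  weight (_∷_ {m} x v) = m ℕ.* x ℕ.+ weight v

  weight-swap : ∀ {m} i (v : Vec ℕ (suc m)) → weight (swap i v) ℕ.+ lookup v (inject₁ i) ≡ weight v ℕ.+ lookup v (Fin.suc i)
  weight-swap {suc m} Fin.zero (x ∷ y ∷ v) = solve 4 (λ m x y w →
    ((con 1 :+ m) :* y :+ (m :* x :+ w)) :+ x := ((con 1 :+ m) :* x :+ (m :* y :+ w)) :+ y) ≡.refl m x y (weight v)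
  weight-swap {m} (Fin.suc i) (x ∷ v) = ≡.trans (ℕ.+-assoc (m ℕ.* x) _ _)
    (≡.trans (≡.cong (m ℕ.* x ℕ.+_) (weight-swap i v)) (≡.sym (ℕ.+-assoc (m ℕ.* x) _ _)))

  weight-descent : ∀ {m} i (v : Vec ℕ (suc m)) → lookup v (Fin.suc i) ℕ.< lookup v (inject₁ i) → weight (swap i v) ℕ.< weight v
  weight-descent i v lt = ℕ.+-cancelʳ-< (lookup v (inject₁ i)) _ _
    (≡.subst (ℕ._< weight v ℕ.+ lookup v (inject₁ i)) (≡.sym (weight-swap i v)) (ℕ.+-monoʳ-< (weight v) lt))

  sum-∷ʳ : ∀ {m} (v : Vec ℕ m) z → Vec.sum (v ∷ʳ z) ≡ z ℕ.+ Vec.sum v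
  sum-∷ʳ []      z = ≡.refl
  sum-∷ʳ (x ∷ v) z = ≡.trans (≡.cong (x ℕ.+_) (sum-∷ʳ v z))
    (solve 3 (λ x z v → x :+ (z :+ v) := z :+ (x :+ v)) ≡.refl x z (Vec.sum v))

  sum-rotate : ∀ {m} (v : Vec ℕ (suc m)) → Vec.sum (rotate v suc) ≡ suc (Vec.sum v)
  sum-rotate (x ∷ v) = sum-∷ʳ v (suc x)

  sum-swap : ∀ {m} i (v : Vec ℕ (suc m)) → Vec.sum (swap i v) ≡ Vec.sum v
  sum-swap Fin.zero    (x ∷ y ∷ v) = solve 3 (λ x y v → y :+ (x :+ v) := x :+ (y :+ v)) ≡.refl x y (Vec.sum v)
  sum-swap (Fin.suc i) (x ∷ v)     = ≡.cong (x ℕ.+_) (sum-swap i v)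

  last-nonzero : ∀ {m} (v : Vec ℕ m) → v ≡ replicate m 0 ⊎
    ∃ λ j → 0 ℕ.< lookup v j × (∀ l → j Fin.< l → lookup v l ≡ 0)
  last-nonzero []      = inj₁ ≡.refl
  last-nonzero (x ∷ v) with last-nonzero v
  last-nonzero (x ∷ v)     | inj₂ (j , pos , zeros) = inj₂ (Fin.suc j , pos , λ { (Fin.suc l) lt → zeros l (ℕ.≤-pred lt) })
  last-nonzero (zero ∷ v)  | inj₁ eq = inj₁ (≡.cong (0 ∷_) eq)
  last-nonzero {suc m} (suc x ∷ v) | inj₁ eq = inj₂ (Fin.zero , ℕ.s≤s ℕ.z≤n ,
    λ { (Fin.suc l) lt → ≡.trans (≡.cong (λ v → lookup v l) eq) (Vec.lookup-replicate l 0) })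

  unrotate : ∀ {m} (v : Vec ℕ (suc m)) → 0 ℕ.< lookup v (fromℕ m) → ∃ λ u → v ≡ rotate u suc
  unrotate v pos with Vec.initLast v
  ... | u , z , ≡.refl with z | ≡.subst (0 ℕ.<_) (lookup-∷ʳ-fromℕ u z) pos
  ...   | suc z′ | _ = z′ ∷ u , ≡.refl

  -- The last nonzero entry, required by the type of `j` not to stand at the final place, so that it
  -- has a zero as right neighbour.
  LastAt : ∀ {m} → Fin m → Vec ℕ (suc m) → Set
  LastAt j v = 0 ℕ.< lookup v (inject₁ j) × (∀ l → toℕ j ℕ.< toℕ l → lookup v l ≡ 0)

  -- Every v is reached from 0 by v ↦ v Ψ, which makes the last entry positive, and by
  -- swaps that move the last nonzero entry one place to the left, in only one way.
  data Canonical {m} (v : Vec ℕ (suc m)) : Set where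
    root    : v ≡ replicate (suc m) 0 → Canonical v
    rotated : ∀ u → v ≡ rotate u suc → Canonical u → Canonical v
    swapped : ∀ j → LastAt j v → Canonical (swap j v) → Canonical v

  LastAt-unique : ∀ {m} {v : Vec ℕ (suc m)} {j l} → LastAt j v → LastAt l v → j ≡ l
  LastAt-unique {j = j} {l} (pos , zeros) (pos′ , zeros′) with Fin.<-cmp j l
  ... | tri≈ _ j≡l _ = j≡l
  ... | tri< j<l _ _ = contradiction (≡.sym (zeros (inject₁ l) (≡.subst (toℕ j ℕ.<_) (≡.sym (Fin.toℕ-inject₁ l)) j<l))) (ℕ.<⇒≢ pos′)
  ... | tri> _ _ l<j = contradiction (≡.sym (zeros′ (inject₁ j) (≡.subst (toℕ l ℕ.<_) (≡.sym (Fin.toℕ-inject₁ j)) l<j))) (ℕ.<⇒≢ pos)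

  LastAt-rotate : ∀ {m} {u : Vec ℕ (suc m)} {j} → ¬ LastAt j (rotate u suc)
  LastAt-rotate {m} {u} {j} (_ , zeros) = ℕ.1+n≢0 (≡.trans (≡.sym (lookup-rotate-fromℕ u suc))
    (zeros (fromℕ m) (≡.subst (toℕ j ℕ.<_) (≡.sym (Fin.toℕ-fromℕ m)) (Fin.toℕ<n j))))

  LastAt-replicate : ∀ {m} {j : Fin m} → ¬ LastAt j (replicate (suc m) 0)
  LastAt-replicate {j = j} (pos , _) = ℕ.<⇒≢ pos (≡.sym (Vec.lookup-replicate (inject₁ j) 0))

  rotate≢replicate : ∀ {m} {u : Vec ℕ (suc m)} → rotate u suc ≢ replicate (suc m) 0
  rotate≢replicate {m} {u} eq = ℕ.1+n≢0 (≡.trans (≡.sym (lookup-rotate-fromℕ u suc))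
    (≡.trans (≡.cong (λ v → lookup v (fromℕ m)) eq) (Vec.lookup-replicate (fromℕ m) 0)))

  LastAt-next : ∀ {m} (v : Vec ℕ (suc m)) {j} → LastAt j v → lookup v (Fin.suc j) ≡ 0
  LastAt-next v {j} (_ , zeros) = zeros (Fin.suc j) (ℕ.n<1+n _)

  LastAt-descent : ∀ {m} (v : Vec ℕ (suc m)) {j} → LastAt j v → lookup v (Fin.suc j) ℕ.< lookup v (inject₁ j)
  LastAt-descent v {j} at@(pos , _) = ≡.subst (ℕ._< lookup v (inject₁ j)) (≡.sym (LastAt-next v at)) pos

  -- Undoing a rotation lowers the sum of the entries; a swap keeps the sum and lowers the weight.
  canonical : ∀ {m} (v : Vec ℕ (suc m)) → Canonical v
  canonical {m} v = go (Vec.sum v) (suc (weight v)) v ≡.refl ℕ.≤-refl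
    where
    go : ∀ d w (v : Vec ℕ (suc m)) → Vec.sum v ≡ d → weight v ℕ.< w → Canonical v
    go d (suc w) v sum≡ lt with last-nonzero v
    ... | inj₁ eq = root eq
    ... | inj₂ (j , pos , zeros) with view j
    go d (suc w) v sum≡ lt | inj₂ (_ , pos , zeros) | ‵fromℕ with unrotate v pos
    go zero    (suc w) _ sum≡ lt | inj₂ (_ , pos , zeros) | ‵fromℕ | u , ≡.refl =
      contradiction (≡.trans (≡.sym (sum-rotate u)) sum≡) ℕ.1+n≢0
    go (suc d) (suc w) _ sum≡ lt | inj₂ (_ , pos , zeros) | ‵fromℕ | u , ≡.refl =
      rotated u ≡.refl (go d (suc (weight u)) u (ℕ.suc-injective (≡.trans (≡.sym (sum-rotate u)) sum≡)) ℕ.≤-refl)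
    go d (suc w) v sum≡ lt | inj₂ (_ , pos , zeros) | ‵inject₁ j =
      swapped j at (go d w (swap j v) (≡.trans (sum-swap j v) sum≡) (ℕ.<-≤-trans (weight-descent j v (LastAt-descent v at)) (ℕ.≤-pred lt)))
      where
      at : LastAt j v
      at = pos , λ l lt → zeros l (≡.subst (ℕ._< toℕ l) (≡.sym (Fin.toℕ-inject₁ j)) lt)

  open Ranks

  rankᶜ : ∀ {m} {v : Vec ℕ (suc m)} → Canonical v → Vec (Fin (suc m)) (suc m)
  rankᶜ (root _)        = Vec.allFin _
  rankᶜ (rotated _ _ c) = rotate (rankᶜ c) (λ j → j)
  rankᶜ (swapped j _ c) = swap j (rankᶜ c)

  IsRank-rankᶜ : ∀ {m} {v : Vec ℕ (suc m)} (c : Canonical v) → IsRank v (rankᶜ c)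
  IsRank-rankᶜ (root ≡.refl)        = IsRank-replicate _
  IsRank-rankᶜ (rotated u ≡.refl c) = IsRank-rotate (IsRank-rankᶜ c)
  IsRank-rankᶜ {v = v} (swapped j at c) = ≡.subst (λ v → IsRank v (swap j (rankᶜ c))) (swap-involutive j v)
    (IsRank-swap j (λ eq → ℕ.<⇒≢ (LastAt-descent v at) (≡.trans (≡.sym (lookup-swap-inject₁ j v)) (≡.trans eq (lookup-swap-suc j v)))) (IsRank-rankᶜ c))

  opaque
    -- Computed along the canonical derivation, which moves the ranks in the same way as the σ of a
    -- datum; uniqueness then frees it from that derivation.
    rank : ∀ {m} → Vec ℕ (suc m) → Vec (Fin (suc m)) (suc m)
    rank v = rankᶜ (canonical v)

    isRank : ∀ {m} (v : Vec ℕ (suc m)) → IsRank v (rank v)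
    isRank v = IsRank-rankᶜ (canonical v)

  rank-replicate : ∀ m → rank (replicate (suc m) 0) ≡ Vec.allFin (suc m)
  rank-replicate m = IsRank-unique (isRank _) (IsRank-replicate (suc m))

  rank-rotate : ∀ {m} (v : Vec ℕ (suc m)) → rank (rotate v suc) ≡ rotate (rank v) (λ j → j)
  rank-rotate v = IsRank-unique (isRank _) (IsRank-rotate (isRank v))

  rank-swap : ∀ {m} i (v : Vec ℕ (suc m)) → lookup v (inject₁ i) ≢ lookup v (Fin.suc i) → rank (swap i v) ≡ swap i (rank v)
  rank-swap i v v≢ = IsRank-unique (isRank _) (IsRank-swap i v≢ (isRank v))

-- Canonical polynomials and the effect of an intertwiner on them.

module Polynomials {c ℓ k ℓk} {C : Field c ℓ} (𝕂 : RationalFunctionField C k ℓk)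
                   {n₀ : ℕ} (lam : Partition (suc (suc n₀))) where
  private
    n : ℕ
    n = suc n₀
  open RationalFunctionField 𝕂 using (K; q; s)
  open Field K
  open Macdonald 𝕂 lam using (Monomial; M; ⟨_⟩)
  open LinearMaps commutativeRing
  open IntegerSolver commutativeRing
  open FieldFacts K
  open Ratio s
  open Scalars 𝕂
  open Tableaux lam
  open Swaps
  open Ranks
  open Weights
  open HeckeOperators K s
  open Seminormal 𝕂 lam
  open SeminormalRelations 𝕂 lam
  open Operators 𝕂 lam
  open HeckeRelations 𝕂 lam
  open Eigenvectors 𝕂 lam
  private
    𝕄 : Set
    𝕄 = Monomial × Tab lam
    N : ℕ
    N = suc n

  -- The spectral vector of the vertex with first and third components T and v.
  spec : Monomial → Tab lam → Fin N → Carrier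
  spec v T j = char (lookup v j) (CTᵀ T (lookup (rank v) j))

  spec-≉0 : ∀ v T j → ¬ spec v T j ≈ 0#
  spec-≉0 v T j = char-≉0 (lookup v j) (CTᵀ T (lookup (rank v) j))

  spec-≉ : ∀ v T {a b} → lookup v a ≢ lookup v b → ¬ spec v T a ≈ spec v T b
  spec-≉ v T {a} {b} v≢ eq = v≢ (proj₁ (char-injective {lookup v a} {CTᵀ T (lookup (rank v) a)} {lookup v b} {CTᵀ T (lookup (rank v) b)} eq))

  private
    spec-at : ∀ v T j {x r} → lookup v j ≡ x → lookup (rank v) j ≡ r → spec v T j ≡ char x (CTᵀ T r)
    spec-at v T j ≡.refl ≡.refl = ≡.refl

  spec-root : ∀ T j → spec (replicate N 0) T j ≈ zᶜ (pos T j)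
  spec-root T j = trans (reflexive (spec-at (replicate N 0) T j (Vec.lookup-replicate j 0)
    (≡.trans (≡.cong (λ r → lookup r j) (rank-replicate n)) (Vec.lookup-allFin j)))) (*-identityˡ _)

  spec-rotate-inject₁ : ∀ u T i → spec (rotate u suc) T (inject₁ i) ≡ spec u T (Fin.suc i)
  spec-rotate-inject₁ u T i = spec-at (rotate u suc) T (inject₁ i) (lookup-rotate-inject₁ u suc i)
    (≡.trans (≡.cong (λ r → lookup r (inject₁ i)) (rank-rotate u)) (lookup-rotate-inject₁ (rank u) (λ j → j) i))

  spec-rotate-last : ∀ u T → spec (rotate u suc) T (fromℕ n) ≈ q * spec u T Fin.zero
  spec-rotate-last u T = trans (reflexive (spec-at (rotate u suc) T (fromℕ n) (lookup-rotate-fromℕ u suc)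
    (≡.trans (≡.cong (λ r → lookup r (fromℕ n)) (rank-rotate u)) (lookup-rotate-fromℕ (rank u) (λ j → j))))) (*-assoc q _ _)

  module _ (i : Fin n) (v : Monomial) (T : Tab lam) (v≢ : lookup v (inject₁ i) ≢ lookup v (Fin.suc i)) where
    private
      rank-at : ∀ j {r} → lookup (swap i (rank v)) j ≡ r → lookup (rank (swap i v)) j ≡ r
      rank-at j eq = ≡.trans (≡.cong (λ r → lookup r j) (rank-swap i v v≢)) eq

    spec-swap-fst : spec (swap i v) T (inject₁ i) ≡ spec v T (Fin.suc i)
    spec-swap-fst = spec-at (swap i v) T (inject₁ i) (lookup-swap-inject₁ i v) (rank-at _ (lookup-swap-inject₁ i (rank v)))

    spec-swap-snd : spec (swap i v) T (Fin.suc i) ≡ spec v T (inject₁ i)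
    spec-swap-snd = spec-at (swap i v) T (Fin.suc i) (lookup-swap-suc i v) (rank-at _ (lookup-swap-suc i (rank v)))

    spec-swap-other : ∀ j → j ≢ inject₁ i → j ≢ Fin.suc i → spec (swap i v) T j ≡ spec v T j
    spec-swap-other j p p′ = spec-at (swap i v) T j (lookup-swap-other i v p p′) (rank-at j (lookup-swap-other i (rank v) p p′))

  τ : Fin n → Monomial → Tab lam → Lin 𝕄 𝕄
  τ i v T = 𝐓ᴸ i ⊹ ratio (spec v T (inject₁ i)) (spec v T (Fin.suc i))

  Pᶜ : ∀ {v} → Canonical v → Tab lam → M
  Pᶜ (root _)            T = ⟨ T ⟩ ◁ constant
  Pᶜ (rotated u _ c)     T = Pᶜ c T ◁ Φᴸ
  Pᶜ {v} (swapped j _ c) T = Pᶜ c T ◁ τ j (swap j v) T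

  -- The constructors exclude each other: the vector is zero, or its final entry is positive, or its
  -- last nonzero entry stands earlier.
  Pᶜ-unique : ∀ {v} (c c′ : Canonical v) T → Pᶜ c T ≡ Pᶜ c′ T
  Pᶜ-unique (root _)             (root _)              T = ≡.refl
  Pᶜ-unique (root eq)            (rotated u eq′ _)     T = contradiction (≡.trans (≡.sym eq′) eq) (rotate≢replicate {u = u})
  Pᶜ-unique (root ≡.refl)        (swapped j la _)      T = contradiction la LastAt-replicate
  Pᶜ-unique (rotated u eq _)     (root eq′)            T = contradiction (≡.trans (≡.sym eq) eq′) (rotate≢replicate {u = u})
  Pᶜ-unique (rotated u eq c)     (rotated u′ eq′ c′)   T with rotate-injective {u = u} {u′} (≡.trans (≡.sym eq) eq′)
  ... | ≡.refl = ≡.cong (_◁ Φᴸ) (Pᶜ-unique c c′ T)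
  Pᶜ-unique (rotated u ≡.refl _) (swapped j la _)      T = contradiction la (LastAt-rotate {u = u})
  Pᶜ-unique (swapped j la _)     (root ≡.refl)         T = contradiction la LastAt-replicate
  Pᶜ-unique (swapped j la _)     (rotated u ≡.refl _)  T = contradiction la (LastAt-rotate {u = u})
  Pᶜ-unique {v} (swapped j la c) (swapped j′ la′ c′)   T with LastAt-unique {v = v} la la′
  ... | ≡.refl = ≡.cong (_◁ τ j (swap j v) T) (Pᶜ-unique c c′ T)

  opaque
    P : Monomial → Tab lam → M
    P v T = Pᶜ (canonical v) T

    P-canonical : ∀ {v} (c : Canonical v) T → P v T ≡ Pᶜ c T
    P-canonical c T = Pᶜ-unique (canonical _) c T

  P-root : ∀ T → P (replicate N 0) T ≡ ⟨ T ⟩ ◁ constant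
  P-root T = P-canonical (root ≡.refl) T

  P-rotate : ∀ u T → P (rotate u suc) T ≡ P u T ◁ Φᴸ
  P-rotate u T = ≡.trans (P-canonical (rotated u ≡.refl (canonical u)) T) (≡.cong (_◁ Φᴸ) (≡.sym (P-canonical (canonical u) T)))

  P-swap : ∀ {j v} T → LastAt j v → P v T ≡ P (swap j v) T ◁ τ j (swap j v) T
  P-swap {j} {v} T la = ≡.trans (P-canonical (swapped j la (canonical (swap j v))) T)
    (≡.cong (_◁ τ j (swap j v) T) (≡.sym (P-canonical (canonical (swap j v)) T)))

  γ : Fin n → Tab lam → Carrier
  γ r T = γᶜ (pos T (inject₁ r)) (pos T (Fin.suc r))

  -- T_i + ratio ζ_i ζ_{i+1} sends P v T to a multiple of P v′ T′.
  data Move (i : Fin n) (v : Monomial) (T : Tab lam) : Carrier → Monomial → Tab lam → Set k where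
    ascent : lookup v (inject₁ i) ℕ.< lookup v (Fin.suc i) → Move i v T 1# (swap i v) T
    level  : ∀ r → lookup v (inject₁ i) ≡ lookup v (Fin.suc i) →
             lookup (rank v) (inject₁ i) ≡ inject₁ r → lookup (rank v) (Fin.suc i) ≡ Fin.suc r →
             Move i v T (γ r T) v (exchanged r T)

  record Swapped (i : Fin n) (v : Monomial) (T : Tab lam) (v′ : Monomial) (T′ : Tab lam) : Set k where
    field
      fst   : spec v′ T′ (inject₁ i) ≡ spec v T (Fin.suc i)
      snd   : spec v′ T′ (Fin.suc i) ≡ spec v T (inject₁ i)
      other : ∀ {j} → j ≢ inject₁ i → j ≢ Fin.suc i → spec v′ T′ j ≡ spec v T j

  -- The first alternative covers level moves whose exchange is not standard.
  Move-spec : ∀ {i v T g v′ T′} → Move i v T g v′ T′ → g ≈ 0# ⊎ Swapped i v T v′ T′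
  Move-spec {i} {v} {T} (ascent lt) = inj₂ record
    { fst = spec-swap-fst i v T (ℕ.<⇒≢ lt) ; snd = spec-swap-snd i v T (ℕ.<⇒≢ lt) ; other = λ {j} → spec-swap-other i v T (ℕ.<⇒≢ lt) j }
  Move-spec {i} {v} {T} (level r v≡ p≡ p′≡) with exchange-cases r T
  ... | aligned _ γ≈0 = inj₁ γ≈0
  ... | swaps _ _ eq  = inj₂ record
    { fst   = ≡.trans (spec-at v T′ (inject₁ i) v≡ p≡) (≡.trans (≡.cong (char (lookup v (Fin.suc i))) (content (lookup-swap-inject₁ r (cells T))))
                (≡.sym (spec-at v T (Fin.suc i) ≡.refl p′≡)))
    ; snd   = ≡.trans (spec-at v T′ (Fin.suc i) (≡.sym v≡) p′≡) (≡.trans (≡.cong (char (lookup v (inject₁ i))) (content (lookup-swap-suc r (cells T))))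
                (≡.sym (spec-at v T (inject₁ i) ≡.refl p≡)))
    ; other = λ {j} j≢ j≢′ → ≡.cong (char (lookup v j)) (content (lookup-swap-other r (cells T)
                (λ e → j≢ (IsRank.injective (isRank v) (≡.trans e (≡.sym p≡))))
                (λ e → j≢′ (IsRank.injective (isRank v) (≡.trans e (≡.sym p′≡)))))) }
    where
    T′ = exchanged r T
    content : ∀ {a b} → lookup (swap r (cells T)) a ≡ pos T b → CTᵀ T′ a ≡ CTᵀ T b
    content {a} e = ≡.cong ct (≡.trans (≡.cong (λ u → lookup u a) eq) e)

  -- In an ascent the powers of q differ; in a level move the contents of consecutive entries do.
  Move-distinct : ∀ {i v T g v′ T′} → Move i v T g v′ T′ → ¬ spec v T (inject₁ i) ≈ spec v T (Fin.suc i)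
  Move-distinct {i} {v} {T} (ascent lt)         = spec-≉ v T (ℕ.<⇒≢ lt)
  Move-distinct {i} {v} {T} (level r v≡ p≡ p′≡) eq = adjacent-CT-≢ T (toℕ-suc-inject₁ T r) (proj₂
    (char-injective {lookup v (Fin.suc i)} {CTᵀ T (inject₁ r)} {lookup v (Fin.suc i)} {CTᵀ T (Fin.suc r)}
      (trans (reflexive (≡.sym (spec-at v T (inject₁ i) v≡ p≡))) (trans eq (reflexive (spec-at v T (Fin.suc i) ≡.refl p′≡))))))

  private
    -- With a vanishing coefficient the parameters of the intertwiner do not have to match the
    -- spectral vector, because both sides are zero.
    advance : ∀ j {g w w′ T z z′} → g ≈ 0# ⊎ (spec w T (inject₁ j) ≡ z × spec w T (Fin.suc j) ≡ z′) →
      P w T ◁ τ j w T ≋ P w′ T → (g • P w T) ◁ (𝐓ᴸ j ⊹ ratio z z′) ≋ g • P w′ T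
    advance j {g} (inj₁ g≈0) _ = ≋-trans (zero-multiple g≈0 (map-• (𝐓ᴸ j ⊹ _) g _)) (≋-sym (zero-multiple g≈0 ≋-refl))
    advance j {g} (inj₂ (≡.refl , ≡.refl)) eq = ≋-trans (map-• (𝐓ᴸ j ⊹ _) g _) (•-cong refl eq)

    ⊹-far : ∀ i j a b f → f ◁ 𝐓ᴸ i ◁ 𝐓ᴸ j ≋ f ◁ 𝐓ᴸ j ◁ 𝐓ᴸ i →
      f ◁ (𝐓ᴸ i ⊹ a) ◁ (𝐓ᴸ j ⊹ b) ≋ f ◁ (𝐓ᴸ j ⊹ b) ◁ (𝐓ᴸ i ⊹ a)
    ⊹-far i j a b f eq = ≋-sym (⊹-intertwine {X = 𝐓ᴸ j} {𝐓ᴸ j} {𝐓ᴸ i ⊹ a} b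
      (≋-sym (⊹-intertwine {X = 𝐓ᴸ i} {𝐓ᴸ i} {𝐓ᴸ j} a eq)))

    yang-baxter : ∀ i j → toℕ j ≡ suc (toℕ i) → ∀ {x y z} f → ¬ x ≈ 0# → ¬ y ≈ 0# → ¬ x ≈ y → ¬ x ≈ z → ¬ y ≈ z →
      f ◁ (𝐓ᴸ i ⊹ ratio x y) ◁ (𝐓ᴸ j ⊹ ratio x z) ◁ (𝐓ᴸ i ⊹ ratio y z)
        ≋ f ◁ (𝐓ᴸ j ⊹ ratio y z) ◁ (𝐓ᴸ i ⊹ ratio x z) ◁ (𝐓ᴸ j ⊹ ratio x y)
    yang-baxter i j j≡ f x≉0 y≉0 x≉y x≉z y≉z = YangBaxter.braid⇒yb (𝐓ᴸ i) (𝐓ᴸ j) (ratio-yb x≉0 y≉0 x≉y x≉z y≉z)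
      f (𝐓-quadraticAt i f) (𝐓-quadraticAt j f) (𝐓-braid i j j≡ f)

    -- Two applications of Φ multiply both spectral values by q, which must not change the
    -- intertwiner.
    ratio-scale : ∀ a {z z′} → ¬ a ≈ 0# → ¬ z ≈ 0# → ¬ z ≈ z′ → ratio (a * z) (a * z′) ≈ ratio z z′
    ratio-scale a {z} {z′} a≉0 z≉0 z≉z′ = ratio-unique (*-≉0 a≉0 z≉0) (λ eq → z≉z′ (*-cancelˡ a≉0 eq))
      (trans (solve 4 (λ a r z z′ → r :* (a :* z :- a :* z′) := a :* (r :* (z :- z′))) refl a (ratio z z′) z z′)
        (trans (*-congˡ (ratio-* z≉0 z≉z′)) (solve 3 (λ a p z → a :* (p :* z) := p :* (a :* z)) refl a (1# - s) z)))

    τ-≡ : ∀ i {v T w T′} → spec v T (inject₁ i) ≡ spec w T′ (inject₁ i) → spec v T (Fin.suc i) ≡ spec w T′ (Fin.suc i) → τ i v T ≡ τ i w T′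
    τ-≡ i = ≡.cong₂ (λ z z′ → 𝐓ᴸ i ⊹ ratio z z′)

  -- The moves of v Ψ come from those of v, shifted by one place.
  Move-rotate : ∀ {i u T g v′ T′} → Move (inject₁ i) (rotate u suc) T g v′ T′ →
    ∃ λ u′ → v′ ≡ rotate u′ suc × Move (Fin.suc i) u T g u′ T′
  Move-rotate {i} {u} (ascent lt) = swap (Fin.suc i) u , swap-rotate i u suc ,
    ascent (≡.subst₂ ℕ._<_ (lookup-rotate-inject₁ u suc (inject₁ i)) (lookup-rotate-inject₁ u suc (Fin.suc i)) lt)
  Move-rotate {i} {u} (level r v≡ p≡ p′≡) = u , ≡.refl , level r
    (≡.trans (≡.sym (lookup-rotate-inject₁ u suc (inject₁ i))) (≡.trans v≡ (lookup-rotate-inject₁ u suc (Fin.suc i))))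
    (≡.trans (≡.sym (rank-at (inject₁ i))) p≡) (≡.trans (≡.sym (rank-at (Fin.suc i))) p′≡)
    where
    rank-at : ∀ j → lookup (rank (rotate u suc)) (inject₁ j) ≡ lookup (rank u) (Fin.suc j)
    rank-at j = ≡.trans (≡.cong (λ r → lookup r (inject₁ j)) (rank-rotate u)) (lookup-rotate-inject₁ (rank u) (λ j → j) j)

  module _ {A : Set} (f : A → A) (u : Vec A N) where
    twice-fst : lookup (rotate (rotate u f) f) (inject₁ (fromℕ n₀)) ≡ f (lookup u Fin.zero)
    twice-fst = ≡.trans (lookup-rotate-inject₁ (rotate u f) f (fromℕ n₀)) (lookup-rotate-fromℕ u f)

    twice-snd : lookup (rotate (rotate u f) f) (fromℕ n) ≡ f (lookup u (Fin.suc Fin.zero))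
    twice-snd = ≡.trans (lookup-rotate-fromℕ (rotate u f) f) (≡.cong f (lookup-rotate-inject₁ u f Fin.zero))

  Move-rotate² : ∀ {u T g v′ T′} → Move (fromℕ n₀) (rotate (rotate u suc) suc) T g v′ T′ →
    ∃ λ u′ → v′ ≡ rotate (rotate u′ suc) suc × Move Fin.zero u T g u′ T′
  Move-rotate² {u} (ascent lt) = swap Fin.zero u , swap-rotate-rotate u suc ,
    ascent (ℕ.≤-pred (≡.subst₂ ℕ._<_ (twice-fst suc u) (twice-snd suc u) lt))
  Move-rotate² {u} (level r v≡ p≡ p′≡) = u , ≡.refl , level r
    (ℕ.suc-injective (≡.trans (≡.sym (twice-fst suc u)) (≡.trans v≡ (twice-snd suc u))))
    (≡.trans (≡.sym (≡.trans (≡.cong (λ r → lookup r (inject₁ (fromℕ n₀))) rank²) (twice-fst (λ j → j) (rank u)))) p≡)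
    (≡.trans (≡.sym (≡.trans (≡.cong (λ r → lookup r (fromℕ n)) rank²) (twice-snd (λ j → j) (rank u)))) p′≡)
    where
    rank² : rank (rotate (rotate u suc) suc) ≡ rotate (rotate (rank u) (λ j → j)) (λ j → j)
    rank² = ≡.trans (rank-rotate (rotate u suc)) (≡.cong (λ r → rotate r (λ j → j)) (rank-rotate u))

  Claim : Monomial → Set _
  Claim v = ∀ {i T g v′ T′} → Move i v T g v′ T′ → P v T ◁ τ i v T ≋ g • P v′ T′

  private
    -- The zero vector has no ascents, and its ranks are the identity, so a level move is the
    -- seminormal action on constants.
    claim-root : Claim (replicate N 0)
    claim-root {i} (ascent lt) = contradiction
      (≡.subst₂ ℕ._<_ (Vec.lookup-replicate (inject₁ i) 0) (Vec.lookup-replicate (Fin.suc i) 0) lt) (ℕ.<-irrefl ≡.refl)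
    claim-root {i} {T} (level r _ p≡ _) with Fin.inject₁-injective
      (≡.trans (≡.sym (≡.trans (≡.cong (λ r → lookup r (inject₁ i)) (rank-replicate n)) (Vec.lookup-allFin (inject₁ i)))) p≡)
    ... | ≡.refl = begin
      P (replicate N 0) T ◁ τ i (replicate N 0) T       ≡⟨ ≡.cong (_◁ τ i (replicate N 0) T) (P-root T) ⟩
      ⟨ T ⟩ ◁ constant ◁ τ i (replicate N 0) T          ≈⟨ ⊹-cong (𝐓ᴸ i) (ratio-cong (spec-root T (inject₁ i)) (spec-root T (Fin.suc i))) _ ⟩
      ⟨ T ⟩ ◁ constant ◁ (𝐓ᴸ i ⊹ a)                     ≈⟨ ⊕-cong (constant-𝐓 i ⟨ T ⟩) ≋-refl ⟩
      ⟨ T ⟩ ◁ 𝐭 i ◁ constant ⊕ a • ⟨ T ⟩ ◁ constant     ≈⟨ ≋-trans (map-⊕ constant (⟨ T ⟩ ◁ 𝐭 i) (a • ⟨ T ⟩)) (⊕-cong ≋-refl (map-• constant a ⟨ T ⟩)) ⟨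
      ⟨ T ⟩ ◁ (𝐭 i ⊹ a) ◁ constant                      ≈⟨ cong constant (intertwine T i) ⟩
      (γ i T • ⟨ exchanged i T ⟩) ◁ constant            ≈⟨ map-• constant _ _ ⟩
      γ i T • ⟨ exchanged i T ⟩ ◁ constant              ≡⟨ ≡.cong (γ i T •_) (≡.sym (P-root (exchanged i T))) ⟩
      γ i T • P (replicate N 0) (exchanged i T)         ∎
      where
      open SetoidReasoning (≋-setoid 𝕄)
      a = ratio (zᶜ (pos T (inject₁ i))) (zᶜ (pos T (Fin.suc i)))

    claim-rotate : ∀ {u i T g v′ T′} → Claim u → Move (inject₁ i) (rotate u suc) T g v′ T′ →
      P (rotate u suc) T ◁ τ (inject₁ i) (rotate u suc) T ≋ g • P v′ T′
    claim-rotate {u} {i} {T} {g} {_} {T′} claim move with Move-rotate move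
    ... | u′ , ≡.refl , move′ = begin
      P (rotate u suc) T ◁ τ (inject₁ i) (rotate u suc) T
        ≡⟨ ≡.cong₂ _◁_ (P-rotate u T) (≡.cong₂ (λ z z′ → 𝐓ᴸ (inject₁ i) ⊹ ratio z z′) (spec-rotate-inject₁ u T (inject₁ i)) (spec-rotate-inject₁ u T (Fin.suc i))) ⟩
      P u T ◁ Φᴸ ◁ (𝐓ᴸ (inject₁ i) ⊹ _)      ≈⟨ ⊹-intertwine {X = 𝐓ᴸ (Fin.suc i)} {𝐓ᴸ (inject₁ i)} {Φᴸ} _
                                                 (Φ-𝐓 (inject₁ i) (Fin.suc i) (≡.cong suc (≡.sym (Fin.toℕ-inject₁ i))) (P u T)) ⟨
      P u T ◁ τ (Fin.suc i) u T ◁ Φᴸ         ≈⟨ cong Φᴸ (claim move′) ⟩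
      (g • P u′ T′) ◁ Φᴸ                     ≈⟨ map-• Φᴸ g _ ⟩
      g • P u′ T′ ◁ Φᴸ                       ≡⟨ ≡.cong (g •_) (P-rotate u′ T′) ⟨
      g • P (rotate u′ suc) T′               ∎
      where open SetoidReasoning (≋-setoid 𝕄)

    -- The generator at the last two places passes through two applications of Φ and becomes the one
    -- at the first two places, where the claim for `u` applies.
    claim-rotate² : ∀ {u T g v′ T′} → Claim u → Move (fromℕ n₀) (rotate (rotate u suc) suc) T g v′ T′ →
      P (rotate (rotate u suc) suc) T ◁ τ (fromℕ n₀) (rotate (rotate u suc) suc) T ≋ g • P v′ T′
    claim-rotate² {u} {T} {g} {_} {T′} claim move with Move-rotate² move
    ... | u′ , ≡.refl , move′ = begin
      P (rotate (rotate u suc) suc) T ◁ τ (fromℕ n₀) (rotate (rotate u suc) suc) T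
        ≡⟨ ≡.cong (_◁ τ (fromℕ n₀) (rotate (rotate u suc) suc) T) (≡.trans (P-rotate (rotate u suc) T) (≡.cong (_◁ Φᴸ) (P-rotate u T))) ⟩
      P u T ◁ Φᴸ ◁ Φᴸ ◁ τ (fromℕ n₀) (rotate (rotate u suc) suc) T
        ≈⟨ ⊹-cong (𝐓ᴸ (fromℕ n₀)) same-ratio _ ⟩
      P u T ◁ Φᴸ ◁ Φᴸ ◁ (𝐓ᴸ (fromℕ n₀) ⊹ r)
        ≈⟨ ⊹-intertwine {X = 𝐓ᴸ Fin.zero} {𝐓ᴸ (fromℕ n₀)} {Φᴸ ⨾ Φᴸ} r (Φ-Φ-𝐓 (P u T)) ⟨
      P u T ◁ τ Fin.zero u T ◁ Φᴸ ◁ Φᴸ       ≈⟨ cong Φᴸ (cong Φᴸ (claim move′)) ⟩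
      (g • P u′ T′) ◁ Φᴸ ◁ Φᴸ                ≈⟨ ≋-trans (cong Φᴸ (map-• Φᴸ g _)) (map-• Φᴸ g _) ⟩
      g • P u′ T′ ◁ Φᴸ ◁ Φᴸ                  ≡⟨ ≡.cong (g •_) (≡.trans (P-rotate (rotate u′ suc) T′) (≡.cong (_◁ Φᴸ) (P-rotate u′ T′))) ⟨
      g • P (rotate (rotate u′ suc) suc) T′  ∎
      where
      open SetoidReasoning (≋-setoid 𝕄)
      r = ratio (spec u T Fin.zero) (spec u T (Fin.suc Fin.zero))
      w = rotate u suc
      same-ratio : ratio (spec (rotate w suc) T (inject₁ (fromℕ n₀))) (spec (rotate w suc) T (fromℕ n)) ≈ r
      same-ratio = trans (ratio-cong
          (trans (reflexive (spec-rotate-inject₁ w T (fromℕ n₀))) (spec-rotate-last u T))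
          (trans (spec-rotate-last w T) (*-congˡ (reflexive (spec-rotate-inject₁ u T Fin.zero)))))
        (ratio-scale q q≉0 (spec-≉0 u T Fin.zero) (Move-distinct move′))

    -- v_{N-1} = 0 < v_N; the vector with these entries swapped is built from v.
    claim-rotate-zero : ∀ {u T g v′ T′} → lookup u (fromℕ n) ≡ 0 → Move (fromℕ n₀) (rotate u suc) T g v′ T′ →
      P (rotate u suc) T ◁ τ (fromℕ n₀) (rotate u suc) T ≋ g • P v′ T′
    claim-rotate-zero {u} u≡0 (level r v≡ _ _) = contradiction
      (≡.trans (≡.sym (lookup-rotate-fromℕ u suc)) (≡.trans (≡.sym v≡) (≡.trans (lookup-rotate-inject₁ u suc (fromℕ n₀)) u≡0))) ℕ.1+n≢0
    claim-rotate-zero {u} {T} u≡0 (ascent lt) = ≋-trans (≋-reflexive (≡.sym (≡.trans (P-swap T la)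
      (≡.cong (λ v → P v T ◁ τ (fromℕ n₀) v T) (swap-involutive (fromℕ n₀) v))))) (one-• _)
      where
      v = rotate u suc
      la : LastAt (fromℕ n₀) (swap (fromℕ n₀) v)
      la = ≡.subst (0 ℕ.<_) (≡.sym (lookup-swap-inject₁ (fromℕ n₀) v)) (ℕ.≤-<-trans ℕ.z≤n lt) , zeros
        where
        zeros : ∀ l → toℕ (fromℕ n₀) ℕ.< toℕ l → lookup (swap (fromℕ n₀) v) l ≡ 0
        zeros l lt′ with Fin.toℕ-injective {i = l} {fromℕ n} (ℕ.≤-antisym
            (≡.subst (toℕ l ℕ.≤_) (≡.sym (Fin.toℕ-fromℕ n)) (ℕ.≤-pred (Fin.toℕ<n l)))
            (≡.subst (ℕ._≤ toℕ l) (≡.sym (≡.trans (Fin.toℕ-fromℕ n) (≡.cong suc (≡.sym (Fin.toℕ-fromℕ n₀))))) lt′))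
        ... | ≡.refl = ≡.trans (lookup-swap-suc (fromℕ n₀) v) (≡.trans (lookup-rotate-inject₁ u suc (fromℕ n₀)) u≡0)

    Move-far : ∀ {i j v T g v′ T′} → Disjoint i j → swap i (swap j v) ≡ swap j (swap i v) → lookup v (inject₁ j) ≢ lookup v (Fin.suc j) →
      Move i v T g v′ T′ → Move i (swap j v) T g (swap j v′) T′
    Move-far {i} {j} {v} {T} ((d₁ , d₂) , (d₃ , d₄)) comm v≢ (ascent lt) = ≡.subst (λ v′ → Move i (swap j v) T 1# v′ T) comm
      (ascent (≡.subst₂ ℕ._<_ (≡.sym (lookup-swap-other j v d₁ d₂)) (≡.sym (lookup-swap-other j v d₃ d₄)) lt))
    Move-far {i} {j} {v} {T} ((d₁ , d₂) , (d₃ , d₄)) comm v≢ (level r v≡ p≡ p′≡) = level r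
      (≡.trans (lookup-swap-other j v d₁ d₂) (≡.trans v≡ (≡.sym (lookup-swap-other j v d₃ d₄))))
      (≡.trans (≡.cong (λ r → lookup r (inject₁ i)) (rank-swap j v v≢)) (≡.trans (lookup-swap-other j (rank v) d₁ d₂) p≡))
      (≡.trans (≡.cong (λ r → lookup r (Fin.suc i)) (rank-swap j v v≢)) (≡.trans (lookup-swap-other j (rank v) d₃ d₄) p′≡))

    -- P v ends with the intertwiner at `j`, which commutes with the one at `i`; the move is
    -- therefore made on `swap j v`, where the claim is known.
    claim-far : ∀ {i j v T g v′ T′} → Disjoint i j → swap i (swap j v) ≡ swap j (swap i v) →
      (∀ f → f ◁ 𝐓ᴸ i ◁ 𝐓ᴸ j ≋ f ◁ 𝐓ᴸ j ◁ 𝐓ᴸ i) → LastAt j v → LastAt j v′ → Claim (swap j v) →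
      Move i v T g v′ T′ → P v T ◁ τ i v T ≋ g • P v′ T′
    claim-far {i} {j} {v} {T} {g} {v′} {T′} dis@((d₁ , d₂) , (d₃ , d₄)) comm 𝐓-comm la la′ claim move = begin
      P v T ◁ τ i v T                     ≡⟨ ≡.cong₂ _◁_ (P-swap T la) (τ-≡ i {v} {T} {u} {T} (≡.sym (spec-swap-other j v T v≢ (inject₁ i) d₁ d₂)) (≡.sym (spec-swap-other j v T v≢ (Fin.suc i) d₃ d₄))) ⟩
      P u T ◁ τ j u T ◁ τ i u T           ≈⟨ ⊹-far i j _ _ (P u T) (𝐓-comm (P u T)) ⟨
      P u T ◁ τ i u T ◁ τ j u T           ≈⟨ cong (τ j u T) (claim (Move-far dis comm v≢ move)) ⟩
      (g • P (swap j v′) T′) ◁ τ j u T    ≈⟨ advance j (specs (Move-spec (Move-far dis comm v≢ move))) (≋-reflexive (≡.sym (P-swap T′ la′))) ⟩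
      g • P v′ T′                         ∎
      where
      open SetoidReasoning (≋-setoid 𝕄)
      u = swap j v
      v≢ : lookup v (inject₁ j) ≢ lookup v (Fin.suc j)
      v≢ eq = ℕ.<⇒≢ (LastAt-descent v la) (≡.sym eq)
      specs : g ≈ 0# ⊎ Swapped i u T (swap j v′) T′ →
        g ≈ 0# ⊎ (spec (swap j v′) T′ (inject₁ j) ≡ spec u T (inject₁ j) × spec (swap j v′) T′ (Fin.suc j) ≡ spec u T (Fin.suc j))
      specs (inj₁ g≈0) = inj₁ g≈0
      specs (inj₂ sw)  = inj₂ (Swapped.other sw (≡.≢-sym d₁) (≡.≢-sym d₃) , Swapped.other sw (≡.≢-sym d₂) (≡.≢-sym d₄))

    IH : Monomial → Set _
    IH v = ∀ w → Vec.sum w ≡ Vec.sum v → weight w ℕ.< weight v → Claim w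

    -- The ascent moves the last nonzero entry onto a zero on its left, so the target is built from
    -- `v` by this very swap.
    claim-left-zero : ∀ {i j v T g v′ T′} → toℕ j ≡ suc (toℕ i) → LastAt j v → lookup v (inject₁ i) ≡ 0 →
      Move i v T g v′ T′ → P v T ◁ τ i v T ≋ g • P v′ T′
    claim-left-zero {i} {j} {v} j≡ (pos , _) v₀≡0 (level r v≡ _ _) = contradiction
      (≡.trans (≡.sym v₀≡0) (≡.trans v≡ (≡.cong (lookup v) (≡.sym (adjacent-inject₁ i j j≡))))) (ℕ.<⇒≢ pos)
    claim-left-zero {i} {j} {v} {T} j≡ la@(pos , zeros) v₀≡0 (ascent lt) = ≋-trans (≋-reflexive (≡.sym (≡.trans (P-swap T la′)
      (≡.cong (λ v → P v T ◁ τ i v T) (swap-involutive i v))))) (one-• _)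
      where
      la′ : LastAt i (swap i v)
      la′ = ≡.subst (0 ℕ.<_) (≡.sym (lookup-swap-inject₁ i v)) (ℕ.≤-<-trans ℕ.z≤n lt) , zeros′
        where
        zeros′ : ∀ l → toℕ i ℕ.< toℕ l → lookup (swap i v) l ≡ 0
        zeros′ l i<l with l Fin.≟ Fin.suc i
        ... | yes ≡.refl = ≡.trans (lookup-swap-suc i v) v₀≡0
        ... | no  l≢     = ≡.trans (lookup-swap-other i v
          (λ eq → ℕ.<⇒≢ i<l (≡.sym (≡.trans (≡.cong toℕ eq) (Fin.toℕ-inject₁ i)))) l≢)
          (zeros l (≡.subst (ℕ._< toℕ l) (≡.sym j≡) (ℕ.≤∧≢⇒< i<l (λ eq → l≢ (Fin.toℕ-injective (≡.sym eq))))))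

    -- On the three places involved, `v`, `u` and `t` read (a, b, 0), (a, 0, b) and (0, a, b) with a
    -- and b positive.
    module Left {i j : Fin n} {v : Monomial} {T : Tab lam} (j≡ : toℕ j ≡ suc (toℕ i)) (la : LastAt j v) (v₀>0 : 0 ℕ.< lookup v (inject₁ i)) where
      open Neighbours i j j≡
      u t : Monomial
      u = swap j v
      t = swap i u
      open ThreeCells i j j≡ v using (j-first; j-mid; ji-first; ji-mid; ji-last)
      v-descends : lookup v (inject₁ j) ≢ lookup v (Fin.suc j)
      v-descends eq = ℕ.<⇒≢ (LastAt-descent v la) (≡.sym eq)
      t₀≡0 : lookup t (inject₁ i) ≡ 0
      t₀≡0 = ≡.trans ji-first (LastAt-next v la)
      u-descends : lookup u (Fin.suc i) ℕ.< lookup u (inject₁ i)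
      u-descends = ≡.subst₂ ℕ._<_ (≡.sym (≡.trans j-mid (LastAt-next v la))) (≡.sym j-first) v₀>0
      v₁>0 : 0 ℕ.< lookup v (Fin.suc i)
      v₁>0 = ≡.subst (λ p → 0 ℕ.< lookup v p) mid (proj₁ la)
      t₁ : lookup t (Fin.suc i) ≡ lookup v (inject₁ i)
      t₁ = ≡.trans (≡.cong (lookup t) (≡.sym mid)) ji-mid
      weight-u : weight u ℕ.< weight v
      weight-u = weight-descent j v (LastAt-descent v la)
      weight-t : weight t ℕ.< weight v
      weight-t = ℕ.<-trans (weight-descent i u u-descends) weight-u
      sum-t : Vec.sum t ≡ Vec.sum v
      sum-t = ≡.trans (sum-swap i u) (sum-swap j v)
      swap-i-t : swap i t ≡ u
      swap-i-t = swap-involutive i u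
      swap-j-u : swap j u ≡ v
      swap-j-u = swap-involutive j v
      x y z : Carrier
      x = spec t T (inject₁ i)
      y = spec v T (inject₁ i)
      z = spec v T (Fin.suc i)
      u≢ : lookup u (inject₁ i) ≢ lookup u (Fin.suc i)
      u≢ eq = ℕ.<⇒≢ u-descends (≡.sym eq)
      spec-t-mid : spec t T (inject₁ j) ≡ y
      spec-t-mid = ≡.trans (≡.cong (spec t T) mid) (≡.trans (spec-swap-snd i u T u≢) (spec-swap-other j v T v-descends (inject₁ i) first≢ first≢′))
      spec-t-last : spec t T (Fin.suc j) ≡ z
      spec-t-last = ≡.trans (spec-swap-other i u T u≢ (Fin.suc j) last≢ last≢′)
        (≡.trans (spec-swap-snd j v T v-descends) (≡.cong (spec v T) mid))
      spec-u-mid : spec u T (inject₁ j) ≡ x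
      spec-u-mid = ≡.trans (≡.cong (spec u T) mid) (≡.sym (spec-swap-fst i u T u≢))
      spec-u-last : spec u T (Fin.suc j) ≡ z
      spec-u-last = ≡.trans (spec-swap-snd j v T v-descends) (≡.cong (spec v T) mid)

      -- The move of a and b made at `j` in `t`, before the zero has passed to their right, together
      -- with the way back to its target by two swaps.
      record Transferred (g : Carrier) (v′ : Monomial) (T′ : Tab lam) : Set (k ⊔ ℓk) where
        field
          t′        : Monomial
          move      : Move j t T g t′ T′
          rebuilt   : swap j (swap i t′) ≡ v′
          first     : lookup t′ (inject₁ i) ≡ 0
          second    : 0 ℕ.< lookup t′ (Fin.suc i)
          sum-t′    : Vec.sum t′ ≡ Vec.sum v
          weight-t′ : weight t′ ℕ.< weight v
          la′       : LastAt j v′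

      transfer : ∀ {g v′ T′} → Move i v T g v′ T′ → Transferred g v′ T′
      transfer (ascent lt) = record
        { t′        = swap j t
        ; move      = ascent (≡.subst₂ ℕ._<_ (≡.sym ji-mid) (≡.sym ji-last) lt)
        ; rebuilt   = ≡.trans (≡.sym (swap-braid i j t j≡)) (≡.cong (swap i) (≡.trans (≡.cong (swap j) swap-i-t) swap-j-u))
        ; first     = ≡.trans (ThreeCells.j-first i j j≡ t) t₀≡0
        ; second    = ≡.subst (0 ℕ.<_) (≡.sym (≡.trans (ThreeCells.j-mid i j j≡ t) ji-last)) v₁>0
        ; sum-t′    = ≡.trans (sum-swap j t) sum-t
        ; weight-t′ = weight-t′
        ; la′       = ≡.subst (0 ℕ.<_) (≡.sym (≡.trans (≡.cong (lookup (swap i v)) mid) (lookup-swap-suc i v))) v₀>0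
                    , λ l j<l → ≡.trans (lookup-swap-other i v (beyond l j<l (ℕ.<-trans (ℕ.≤-reflexive (≡.trans (≡.cong suc (Fin.toℕ-inject₁ i)) (≡.sym j≡)))))
                        (beyond l j<l (ℕ.≤-<-trans (ℕ.≤-reflexive (≡.sym j≡))))) (proj₂ la l j<l) }
        where
        beyond : ∀ l {p} → toℕ j ℕ.< toℕ l → (toℕ j ℕ.< toℕ l → toℕ p ℕ.< toℕ l) → l ≢ p
        beyond l j<l h ≡.refl = ℕ.<-irrefl ≡.refl (h j<l)
        a b : ℕ
        a = lookup v (inject₁ i)
        b = lookup v (Fin.suc i)
        -- `v` reads (a, b, 0) and `swap j t` reads (0, b, a), so the weights differ by 2a.
        sum-of-weights : (weight (swap j t) ℕ.+ a) ℕ.+ a ≡ weight v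
        sum-of-weights = begin
          (weight (swap j t) ℕ.+ a) ℕ.+ a            ≡⟨ ≡.cong (λ e → (weight (swap j t) ℕ.+ e) ℕ.+ a) ji-mid ⟨
          (weight (swap j t) ℕ.+ lookup t (inject₁ j)) ℕ.+ a ≡⟨ ≡.cong (ℕ._+ a) (weight-swap j t) ⟩
          (weight t ℕ.+ lookup t (Fin.suc j)) ℕ.+ a  ≡⟨ ≡.cong (λ e → (weight t ℕ.+ e) ℕ.+ a) ji-last ⟩
          (weight t ℕ.+ b) ℕ.+ a                     ≡⟨ ℕ.+-comm (weight t ℕ.+ b) a ⟩
          a ℕ.+ (weight t ℕ.+ b)                     ≡⟨ ℕ.+-assoc a (weight t) b ⟨
          (a ℕ.+ weight t) ℕ.+ b                     ≡⟨ ≡.cong (ℕ._+ b) (ℕ.+-comm a (weight t)) ⟩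
          (weight t ℕ.+ a) ℕ.+ b                     ≡⟨ ≡.cong (λ e → (weight t ℕ.+ e) ℕ.+ b) j-first ⟨
          (weight t ℕ.+ lookup u (inject₁ i)) ℕ.+ b  ≡⟨ ≡.cong (ℕ._+ b) (weight-swap i u) ⟩
          (weight u ℕ.+ lookup u (Fin.suc i)) ℕ.+ b  ≡⟨ ≡.cong (λ e → (weight u ℕ.+ e) ℕ.+ b) (≡.trans j-mid (LastAt-next v la)) ⟩
          (weight u ℕ.+ 0) ℕ.+ b                     ≡⟨ ≡.cong (ℕ._+ b) (ℕ.+-identityʳ (weight u)) ⟩
          weight u ℕ.+ b                             ≡⟨ ≡.cong (λ p → weight u ℕ.+ lookup v p) mid ⟨
          weight u ℕ.+ lookup v (inject₁ j)          ≡⟨ weight-swap j v ⟩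
          weight v ℕ.+ lookup v (Fin.suc j)          ≡⟨ ≡.cong (weight v ℕ.+_) (LastAt-next v la) ⟩
          weight v ℕ.+ 0                             ≡⟨ ℕ.+-identityʳ (weight v) ⟩
          weight v                                   ∎
          where open ≡.≡-Reasoning
        weight-t′ : weight (swap j t) ℕ.< weight v
        weight-t′ = ≡.subst (weight (swap j t) ℕ.<_) sum-of-weights
          (ℕ.<-≤-trans (ℕ.m<m+n _ v₀>0) (ℕ.m≤m+n _ a))
      transfer (level r v≡ p≡ p′≡) = record
        { t′        = t
        ; move      = level r (≡.trans ji-mid (≡.trans v≡ (≡.sym ji-last)))
            (≡.trans (rank-at (inject₁ j)) (≡.trans (ThreeCells.ji-mid i j j≡ (rank v)) p≡))
            (≡.trans (rank-at (Fin.suc j)) (≡.trans (ThreeCells.ji-last i j j≡ (rank v)) p′≡))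
        ; rebuilt   = ≡.trans (≡.cong (swap j) swap-i-t) swap-j-u
        ; first     = t₀≡0
        ; second    = ≡.subst (0 ℕ.<_) (≡.sym t₁) v₀>0
        ; sum-t′    = sum-t
        ; weight-t′ = weight-t
        ; la′       = la }
        where
        rank-at : ∀ p → lookup (rank t) p ≡ lookup (swap i (swap j (rank v))) p
        rank-at p = ≡.cong (λ r → lookup r p) (≡.trans (rank-swap i u u≢) (≡.cong (swap i) (rank-swap j v v-descends)))

      -- P v comes from P t by intertwiners at `i` and `j`, and a third one at `i` is applied.
      -- Yang-Baxter turns this word into `j`, `i`, `j`: the first letter is the transferred move,
      -- the second is an ascent from the lighter vector `t′`, and the third is the canonical step
      -- to `v′`.
      claim-left : ∀ {g v′ T′} → IH v → Move i v T g v′ T′ → P v T ◁ τ i v T ≋ g • P v′ T′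
      claim-left {g} {v′} {T′} ih m = begin
        P v T ◁ τ i v T
          ≡⟨ ≡.cong (_◁ τ i v T) (P-swap T la) ⟩
        P u T ◁ τ j u T ◁ τ i v T
          ≈⟨ cong (τ i v T) (cong (τ j u T) from-t) ⟨
        P t T ◁ τ i t T ◁ τ j u T ◁ τ i v T
          ≡⟨ ≡.cong₂ (λ F G → P t T ◁ F ◁ G ◁ τ i v T) (≡.cong (λ z → 𝐓ᴸ i ⊹ ratio x z) (≡.trans (≡.cong (spec t T) (≡.sym mid)) spec-t-mid))
               (≡.cong₂ (λ z z′ → 𝐓ᴸ j ⊹ ratio z z′) spec-u-mid spec-u-last) ⟩
        P t T ◁ (𝐓ᴸ i ⊹ ratio x y) ◁ (𝐓ᴸ j ⊹ ratio x z) ◁ (𝐓ᴸ i ⊹ ratio y z)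
          ≈⟨ yang-baxter i j j≡ (P t T) (spec-≉0 t T (inject₁ i)) (spec-≉0 v T (inject₁ i)) x≉y x≉z y≉z ⟩
        P t T ◁ (𝐓ᴸ j ⊹ ratio y z) ◁ (𝐓ᴸ i ⊹ ratio x z) ◁ (𝐓ᴸ j ⊹ ratio x y)
          ≡⟨ ≡.cong (λ F → P t T ◁ F ◁ (𝐓ᴸ i ⊹ ratio x z) ◁ (𝐓ᴸ j ⊹ ratio x y))
               (≡.cong₂ (λ z z′ → 𝐓ᴸ j ⊹ ratio z z′) (≡.sym spec-t-mid) (≡.sym spec-t-last)) ⟩
        P t T ◁ τ j t T ◁ (𝐓ᴸ i ⊹ ratio x z) ◁ (𝐓ᴸ j ⊹ ratio x y)
          ≈⟨ cong (𝐓ᴸ j ⊹ ratio x y) (cong (𝐓ᴸ i ⊹ ratio x z) (ih t sum-t weight-t move)) ⟩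
        (g • P t′ T′) ◁ (𝐓ᴸ i ⊹ ratio x z) ◁ (𝐓ᴸ j ⊹ ratio x y)
          ≈⟨ cong (𝐓ᴸ j ⊹ ratio x y) (advance i (specs₁ (Move-spec move)) to-u′) ⟩
        (g • P u′ T′) ◁ (𝐓ᴸ j ⊹ ratio x y)
          ≈⟨ advance j (specs₂ (Move-spec move)) to-v′ ⟩
        g • P v′ T′ ∎
        where
        open SetoidReasoning (≋-setoid 𝕄)
        open Transferred (transfer m)
        u′ : Monomial
        u′ = swap i t′
        t′-ascends : lookup t′ (inject₁ i) ℕ.< lookup t′ (Fin.suc i)
        t′-ascends = ≡.subst (ℕ._< lookup t′ (Fin.suc i)) (≡.sym first) second
        from-t : P t T ◁ τ i t T ≋ P u T
        from-t = ≋-trans (ih t sum-t weight-t (ascent (≡.subst₂ ℕ._<_ (≡.sym t₀≡0) (≡.sym t₁) v₀>0)))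
          (≋-trans (≋-sym (one-• _)) (≋-reflexive (≡.cong (λ w → P w T) swap-i-t)))
        to-u′ : P t′ T′ ◁ τ i t′ T′ ≋ P u′ T′
        to-u′ = ≋-trans (ih t′ sum-t′ weight-t′ (ascent t′-ascends)) (≋-sym (one-• _))
        swap-j-v′ : swap j v′ ≡ u′
        swap-j-v′ = ≡.trans (≡.cong (swap j) (≡.sym rebuilt)) (swap-involutive j u′)
        to-v′ : P u′ T′ ◁ τ j u′ T′ ≋ P v′ T′
        to-v′ = ≋-reflexive (≡.sym (≡.trans (P-swap T′ la′) (≡.cong (λ w → P w T′ ◁ τ j w T′) swap-j-v′)))
        specs₁ : g ≈ 0# ⊎ Swapped j t T t′ T′ → g ≈ 0# ⊎ (spec t′ T′ (inject₁ i) ≡ x × spec t′ T′ (Fin.suc i) ≡ z)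
        specs₁ (inj₁ g≈0) = inj₁ g≈0
        specs₁ (inj₂ sw)  = inj₂ (Swapped.other sw first≢ first≢′ ,
          ≡.trans (≡.cong (spec t′ T′) (≡.sym mid)) (≡.trans (Swapped.fst sw) spec-t-last))
        specs₂ : g ≈ 0# ⊎ Swapped j t T t′ T′ → g ≈ 0# ⊎ (spec u′ T′ (inject₁ j) ≡ x × spec u′ T′ (Fin.suc j) ≡ y)
        specs₂ (inj₁ g≈0) = inj₁ g≈0
        specs₂ (inj₂ sw)  = inj₂
          ( ≡.trans (≡.cong (spec u′ T′) mid) (≡.trans (spec-swap-snd i t′ T′ (ℕ.<⇒≢ t′-ascends)) (Swapped.other sw first≢ first≢′))
          , ≡.trans (spec-swap-other i t′ T′ (ℕ.<⇒≢ t′-ascends) (Fin.suc j) last≢ last≢′) (≡.trans (Swapped.snd sw) spec-t-mid))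
        x≉y : ¬ x ≈ y
        x≉y eq = spec-≉ t T {inject₁ i} {inject₁ j} (λ e → ℕ.<⇒≢ v₀>0 (≡.trans (≡.sym t₀≡0) (≡.trans e ji-mid)))
          (trans eq (reflexive (≡.sym spec-t-mid)))
        x≉z : ¬ x ≈ z
        x≉z eq = spec-≉ t T {inject₁ i} {Fin.suc j} (λ e → ℕ.<⇒≢ v₁>0 (≡.trans (≡.sym t₀≡0) (≡.trans e ji-last)))
          (trans eq (reflexive (≡.sym spec-t-last)))
        y≉z : ¬ y ≈ z
        y≉z = Move-distinct m

    -- Here `v` reads (b, 0, 0), so only a level move of the two zeros is possible. With `u` = (0,
    -- b, 0) and `t` = (0, 0, b), Yang-Baxter makes this move first, on `t`; the other two letters
    -- are canonical steps.
    claim-right : ∀ {i j v T g v′ T′} → toℕ i ≡ suc (toℕ j) → LastAt j v → IH v → Move i v T g v′ T′ → P v T ◁ τ i v T ≋ g • P v′ T′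
    claim-right {i} {j} {v} i≡ la ih (ascent lt) = contradiction
      (≡.subst (lookup v (inject₁ i) ℕ.<_) (proj₂ la (Fin.suc i) (≡.subst (toℕ j ℕ.<_) (≡.cong suc (≡.sym i≡)) (ℕ.m<n⇒m<1+n (ℕ.n<1+n _)))) lt) (λ ())
    claim-right {i} {j} {v} {T} {g} {_} {T′} i≡ la ih m@(level r v≡ p≡ p′≡) = begin
      P v T ◁ τ i v T
        ≡⟨ ≡.cong (_◁ τ i v T) (≡.trans (P-swap T la) (≡.cong (_◁ τ j u T) (P-swap T la-u))) ⟩
      P t T ◁ τ i t T ◁ τ j u T ◁ τ i v T
        ≡⟨ ≡.cong₂ (λ F G → P t T ◁ F ◁ G ◁ τ i v T) (≡.cong₂ (λ z z′ → 𝐓ᴸ i ⊹ ratio z z′) spec-t-mid spec-t-last)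
             (≡.cong₂ (λ z z′ → 𝐓ᴸ j ⊹ ratio z z′) spec-u-first spec-u-mid) ⟩
      P t T ◁ (𝐓ᴸ i ⊹ ratio y z) ◁ (𝐓ᴸ j ⊹ ratio x z) ◁ (𝐓ᴸ i ⊹ ratio x y)
        ≈⟨ yang-baxter j i i≡ (P t T) (spec-≉0 v T (inject₁ i)) (spec-≉0 v T (Fin.suc i)) (Move-distinct m) x≉z y≉z ⟨
      P t T ◁ (𝐓ᴸ j ⊹ ratio x y) ◁ (𝐓ᴸ i ⊹ ratio x z) ◁ (𝐓ᴸ j ⊹ ratio y z)
        ≡⟨ ≡.cong (λ F → P t T ◁ F ◁ (𝐓ᴸ i ⊹ ratio x z) ◁ (𝐓ᴸ j ⊹ ratio y z))
             (≡.cong₂ (λ z z′ → 𝐓ᴸ j ⊹ ratio z z′) (≡.sym spec-t-first) (≡.trans (≡.sym spec-t-mid) (≡.cong (spec t T) mid))) ⟩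
      P t T ◁ τ j t T ◁ (𝐓ᴸ i ⊹ ratio x z) ◁ (𝐓ᴸ j ⊹ ratio y z)
        ≈⟨ cong (𝐓ᴸ j ⊹ ratio y z) (cong (𝐓ᴸ i ⊹ ratio x z) (ih t sum-t weight-t move)) ⟩
      (g • P t T′) ◁ (𝐓ᴸ i ⊹ ratio x z) ◁ (𝐓ᴸ j ⊹ ratio y z)
        ≈⟨ cong (𝐓ᴸ j ⊹ ratio y z) (advance i (specs₁ (Move-spec move)) (≋-reflexive (≡.sym (P-swap T′ la-u)))) ⟩
      (g • P u T′) ◁ (𝐓ᴸ j ⊹ ratio y z)
        ≈⟨ advance j (specs₂ (Move-spec move)) (≋-reflexive (≡.sym (P-swap T′ la))) ⟩
      g • P v T′ ∎
      where
      open Neighbours j i i≡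
      open SetoidReasoning (≋-setoid 𝕄)
      u t : Monomial
      u = swap j v
      t = swap i u
      open ThreeCells j i i≡ v using (i-mid; ij-first; ij-mid; ij-last)
      v-descends : lookup v (inject₁ j) ≢ lookup v (Fin.suc j)
      v-descends eq = ℕ.<⇒≢ (LastAt-descent v la) (≡.sym eq)
      v₂≡0 : lookup v (Fin.suc i) ≡ 0
      v₂≡0 = proj₂ la (Fin.suc i) (≡.subst (toℕ j ℕ.<_) (≡.cong suc (≡.sym i≡)) (ℕ.m<n⇒m<1+n (ℕ.n<1+n _)))
      la-u : LastAt i u
      la-u = ≡.subst (0 ℕ.<_) (≡.sym i-mid) (proj₁ la) , λ l i<l → ≡.trans
        (lookup-swap-other j v
          (λ { ≡.refl → ℕ.<-asym (≡.subst₂ ℕ._<_ i≡ (Fin.toℕ-inject₁ j) i<l) (ℕ.n<1+n _) })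
          (λ { ≡.refl → ℕ.<-irrefl i≡ i<l }))
        (proj₂ la l (ℕ.<-trans (ℕ.≤-reflexive (≡.sym i≡)) i<l))
      u≢ : lookup u (inject₁ i) ≢ lookup u (Fin.suc i)
      u≢ eq = ℕ.<⇒≢ (LastAt-descent u la-u) (≡.sym eq)
      sum-t : Vec.sum t ≡ Vec.sum v
      sum-t = ≡.trans (sum-swap i u) (sum-swap j v)
      weight-t : weight t ℕ.< weight v
      weight-t = ℕ.<-trans (weight-descent i u (LastAt-descent u la-u)) (weight-descent j v (LastAt-descent v la))
      x y z : Carrier
      x = spec v T (inject₁ i)
      y = spec v T (Fin.suc i)
      z = spec v T (inject₁ j)
      spec-u-first : spec u T (inject₁ j) ≡ x
      spec-u-first = ≡.trans (spec-swap-fst j v T v-descends) (≡.cong (spec v T) (≡.sym mid))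
      spec-u-mid : spec u T (Fin.suc j) ≡ z
      spec-u-mid = spec-swap-snd j v T v-descends
      spec-t-first : spec t T (inject₁ j) ≡ x
      spec-t-first = ≡.trans (spec-swap-other i u T u≢ (inject₁ j) first≢ first≢′) spec-u-first
      spec-t-mid : spec t T (inject₁ i) ≡ y
      spec-t-mid = ≡.trans (spec-swap-fst i u T u≢) (spec-swap-other j v T v-descends (Fin.suc i) last≢ last≢′)
      spec-t-last : spec t T (Fin.suc i) ≡ z
      spec-t-last = ≡.trans (spec-swap-snd i u T u≢) (≡.trans (≡.cong (spec u T) mid) spec-u-mid)
      rank-at : ∀ p → lookup (rank t) p ≡ lookup (swap i (swap j (rank v))) p
      rank-at p = ≡.cong (λ r → lookup r p) (≡.trans (rank-swap i u u≢) (≡.cong (swap i) (rank-swap j v v-descends)))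
      t₀≡0 : lookup t (inject₁ j) ≡ 0
      t₀≡0 = ≡.trans ij-first (LastAt-next v la)
      t₁≡0 : lookup t (Fin.suc j) ≡ 0
      t₁≡0 = ≡.trans ij-mid v₂≡0
      t₂ : lookup t (Fin.suc i) ≡ lookup v (inject₁ j)
      t₂ = ij-last
      move : Move j t T g t T′
      move = level r (≡.trans t₀≡0 (≡.sym t₁≡0))
        (≡.trans (rank-at (inject₁ j)) (≡.trans (ThreeCells.ij-first j i i≡ (rank v)) (≡.trans (≡.cong (lookup (rank v)) (≡.sym mid)) p≡)))
        (≡.trans (rank-at (Fin.suc j)) (≡.trans (ThreeCells.ij-mid j i i≡ (rank v)) p′≡))
      t≢ : lookup t (inject₁ i) ≢ lookup t (Fin.suc i)
      t≢ e = ℕ.<⇒≢ (proj₁ la) (≡.trans (≡.sym (≡.trans (≡.cong (lookup t) mid) t₁≡0)) (≡.trans e t₂))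
      specs₁ : g ≈ 0# ⊎ Swapped j t T t T′ → g ≈ 0# ⊎ (spec t T′ (inject₁ i) ≡ x × spec t T′ (Fin.suc i) ≡ z)
      specs₁ (inj₁ g≈0) = inj₁ g≈0
      specs₁ (inj₂ sw)  = inj₂ (≡.trans (≡.cong (spec t T′) mid) (≡.trans (Swapped.snd sw) spec-t-first) ,
        ≡.trans (Swapped.other sw last≢ last≢′) spec-t-last)
      specs₂ : g ≈ 0# ⊎ Swapped j t T t T′ → g ≈ 0# ⊎ (spec u T′ (inject₁ j) ≡ y × spec u T′ (Fin.suc j) ≡ z)
      specs₂ (inj₁ g≈0) = inj₁ g≈0
      specs₂ (inj₂ sw)  = inj₂
        ( ≡.trans (≡.sym (spec-swap-other i u T′ u≢ (inject₁ j) first≢ first≢′)) (≡.trans (Swapped.fst sw) (≡.trans (≡.cong (spec t T) (≡.sym mid)) spec-t-mid))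
        , ≡.trans (≡.cong (spec u T′) (≡.sym mid)) (≡.trans (≡.sym (spec-swap-snd i u T′ u≢)) (≡.trans (Swapped.other sw last≢ last≢′) spec-t-last)))
      x≉z : ¬ x ≈ z
      x≉z eq = spec-≉ t T {inject₁ j} {Fin.suc i} (λ e → ℕ.<⇒≢ (proj₁ la) (≡.trans (≡.sym t₀≡0) (≡.trans e t₂)))
        (trans (reflexive spec-t-first) (trans eq (reflexive (≡.sym spec-t-last))))
      y≉z : ¬ y ≈ z
      y≉z eq = spec-≉ t T t≢ (trans (reflexive spec-t-mid) (trans eq (reflexive (≡.sym spec-t-last))))

    -- The cases compare `i` with the place of the last canonical swap. They cannot coincide,
    -- because `v` has a descent at `j` and moves start at ascents or ties.
    claim-swapped : ∀ {i j v T g v′ T′} → LastAt j v → IH v → Move i v T g v′ T′ → P v T ◁ τ i v T ≋ g • P v′ T′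
    claim-swapped {i} {j} {v} {T} {g} {v′} {T′} la ih m with ℕ.<-cmp (suc (toℕ i)) (toℕ j)
    ... | tri< far _ _ = claim-far (far-≢ i j far) (swap-far i j v far) (on (𝐓-far i j far)) la (la′ m) (ih (swap j v) (sum-swap j v) (weight-descent j v (LastAt-descent v la))) m
      where
      la′ : Move i v T g v′ T′ → LastAt j v′
      la′ (level _ _ _ _) = la
      la′ (ascent _) = ≡.subst (0 ℕ.<_) (≡.sym (lookup-swap-other i v (≡.≢-sym (proj₁ (proj₁ (far-≢ i j far)))) (≡.≢-sym (proj₁ (proj₂ (far-≢ i j far)))))) (proj₁ la)
        , λ l j<l → ≡.trans (lookup-swap-other i v
            (λ { ≡.refl → ℕ.<-asym j<l (≡.subst (ℕ._< toℕ j) (≡.sym (Fin.toℕ-inject₁ i)) (ℕ.<-trans (ℕ.n<1+n _) far)) })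
            (λ { ≡.refl → ℕ.<-asym j<l far })) (proj₂ la l j<l)
    ... | tri≈ _ near _ = left (lookup v (inject₁ i)) ≡.refl
      where
      left : ∀ a → lookup v (inject₁ i) ≡ a → P v T ◁ τ i v T ≋ g • P v′ T′
      left zero    eq = claim-left-zero (≡.sym near) la eq m
      left (suc a) eq = Left.claim-left (≡.sym near) la (≡.subst (0 ℕ.<_) (≡.sym eq) (ℕ.s≤s ℕ.z≤n)) ih m
    ... | tri> _ _ (ℕ.s≤s j≤i) with ℕ.m≤n⇒m<n∨m≡n j≤i
    ...   | inj₂ eq = impossible m
      where
      i≡j : j ≡ i
      i≡j = Fin.toℕ-injective eq
      impossible : Move i v T g v′ T′ → P v T ◁ τ i v T ≋ g • P v′ T′
      impossible (ascent lt)     = contradiction (≡.subst (λ i → lookup v (inject₁ i) ℕ.< lookup v (Fin.suc i)) (≡.sym i≡j) lt) (ℕ.<-asym (LastAt-descent v la))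
      impossible (level _ v≡ _ _) = contradiction (≡.subst (λ i → lookup v (inject₁ i) ≡ lookup v (Fin.suc i)) (≡.sym i≡j) v≡) (λ e → ℕ.<⇒≢ (LastAt-descent v la) (≡.sym e))
    ...   | inj₁ j<i with ℕ.m≤n⇒m<n∨m≡n j<i
    ...     | inj₂ eq  = claim-right (≡.sym eq) la ih m
    ...     | inj₁ far = claim-far disjoint (≡.sym (swap-far j i v far)) (λ f → ≋-sym (on (𝐓-far j i far) f)) la (la′ m) (ih (swap j v) (sum-swap j v) (weight-descent j v (LastAt-descent v la))) m
      where
      disjoint : Disjoint i j
      disjoint with far-≢ j i far
      ... | (a , b) , (d , e) = (≡.≢-sym a , ≡.≢-sym d) , (≡.≢-sym b , ≡.≢-sym e)
      la′ : Move i v T g v′ T′ → LastAt j v′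
      la′ (level _ _ _ _) = la
      la′ (ascent lt) = contradiction (≡.subst (lookup v (inject₁ i) ℕ.<_) (proj₂ la (Fin.suc i) (ℕ.m<n⇒m<1+n j<i)) lt) (λ ())

    claim-step : ∀ v → (∀ u → Vec.sum u ℕ.< Vec.sum v → Claim u) → IH v → Claim v
    claim-step v ih-sum ih m with canonical v
    ... | root ≡.refl    = claim-root m
    ... | swapped j la _ = claim-swapped la ih m
    claim-step _ ih-sum ih {i} m | rotated u ≡.refl _ with view i
    ... | ‵inject₁ i = claim-rotate (ih-sum u (ℕ.≤-reflexive (≡.sym (sum-rotate u)))) m
    -- The last two entries are the final entry of `u` and the raised first entry of `u`. If the
    -- former is positive, `u` is itself a rotation.
    ... | ‵fromℕ with lookup u (fromℕ n) in eq
    ...   | zero  = claim-rotate-zero {u} eq m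
    ...   | suc a with unrotate u (≡.subst (0 ℕ.<_) (≡.sym eq) (ℕ.s≤s ℕ.z≤n))
    ...     | t , ≡.refl = claim-rotate² (ih-sum t (ℕ.<-trans (ℕ.≤-reflexive (≡.sym (sum-rotate t))) (ℕ.≤-reflexive (≡.sym (sum-rotate (rotate t suc)))))) m

  -- Lexicographic induction on the sum of the entries and then on the weight.
  claim : ∀ v → Claim v
  claim v = go (suc (Vec.sum v)) (suc (weight v)) v ℕ.≤-refl ℕ.≤-refl
    where
    go : ∀ d w v → Vec.sum v ℕ.< d → weight v ℕ.< w → Claim v
    go (suc d) (suc w) v s< w< = claim-step v (λ u lt → go d (suc (weight u)) u (ℕ.<-≤-trans lt (ℕ.≤-pred s<)) ℕ.≤-refl)
      (λ u eq lt → go (suc d) w u (≡.subst (ℕ._< suc d) (≡.sym eq) s<) (ℕ.<-≤-trans lt (ℕ.≤-pred w<)))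

-- The canonical polynomials are eigenvectors and form a basis.

module Basis {c ℓ k ℓk} {C : Field c ℓ} (𝕂 : RationalFunctionField C k ℓk)
             {n₀ : ℕ} (lam : Partition (suc (suc n₀))) where
  private
    n : ℕ
    n = suc n₀
  open RationalFunctionField 𝕂 using (K; s)
  open Field K
  open Macdonald 𝕂 lam using (Monomial; M; ⟨_⟩; linear)
  open LinearMaps commutativeRing
  open IntegerSolver commutativeRing
  open FieldFacts K
  open Ratio s
  open Scalars 𝕂
  open Tableaux lam
  open Swaps
  open Ranks
  open Weights
  open HeckeOperators K s
  open Seminormal 𝕂 lam
  open SeminormalRelations 𝕂 lam
  open Operators 𝕂 lam
  open HeckeRelations 𝕂 lam
  open DoubleAffineAction 𝕂 lam
  open Eigenvectors 𝕂 lam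
  open Polynomials 𝕂 lam
  private
    𝕄 : Set
    𝕄 = Monomial × Tab lam
    N : ℕ
    N = suc n
    θ : Carrier
    θ = 1# - s
    module E = Monoid (End 𝕄)
  open Intertwining (End 𝕄) using (up; down; down-up-inverse)

  -- The largest entry has content 0, which matches the trivial action of Ξ_N on constants.
  corner-entry : ∀ T → pos T (fromℕ n) ≡ (0 , 0)
  corner-entry T with pos-surjective T (southwest-closed (pos-inShape T (fromℕ n)) ℕ.z≤n ℕ.z≤n)
  ... | m , eq with m Fin.≟ fromℕ n
  ...   | yes ≡.refl = eq
  ...   | no m≢ = contradiction (southwest T (ℕ.≤-trans (ℕ.≤-reflexive (≡.cong proj₁ eq)) ℕ.z≤n)
                                             (ℕ.≤-trans (ℕ.≤-reflexive (≡.cong proj₂ eq)) ℕ.z≤n) m≢)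
                    (ℕ.≤⇒≯ (≡.subst (toℕ m ℕ.≤_) (≡.sym (Fin.toℕ-fromℕ n)) (ℕ.≤-pred (Fin.toℕ<n m))))

  private
    Restricts : Lin 𝕄 𝕄 → Set _
    Restricts F = ∃ λ (G : Lin (Tab lam) (Tab lam)) → ∀ u → u ◁ constant ◁ F ≋ u ◁ G ◁ constant

    restricts-∙ : ∀ {F F′} → Restricts F → Restricts F′ → Restricts (F E.∙ F′)
    restricts-∙ {F} {F′} (G , h) (G′ , h′) = G ⨾ G′ , λ u → ≋-trans (cong F′ (h u)) (h′ (u ◁ G))

    restricts-t′ : ∀ j → Restricts (t′ j)
    restricts-t′ = extend-elim idᴸ 𝐓⁻¹ᴸ (λ _ → Restricts)
      (λ i → (𝐭 i ⊹ θ) ⨾ scale (s ⁻¹) , λ u → begin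
        u ◁ constant ◁ 𝐓⁻¹ᴸ i                            ≈⟨ 𝐓⁻¹-⊹ i (u ◁ constant) ⟩
        s ⁻¹ • (u ◁ constant ◁ 𝐓ᴸ i ⊕ θ • u ◁ constant)  ≈⟨ •-cong refl (⊕-cong (constant-𝐓 i u) (≋-sym (map-• constant θ u))) ⟩
        s ⁻¹ • (u ◁ 𝐭 i ◁ constant ⊕ (θ • u) ◁ constant) ≈⟨ •-cong refl (map-⊕ constant (u ◁ 𝐭 i) (θ • u)) ⟨
        s ⁻¹ • u ◁ (𝐭 i ⊹ θ) ◁ constant                  ≈⟨ map-• constant (s ⁻¹) _ ⟨
        (s ⁻¹ • u ◁ (𝐭 i ⊹ θ)) ◁ constant                ∎)
      (λ _ _ → idᴸ , λ u → ≋-refl)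
      where open SetoidReasoning (≋-setoid 𝕄)

    restricts-down : ∀ a m → Restricts (down t′ a m)
    restricts-down a zero    = idᴸ , λ u → ≋-refl
    restricts-down a (suc m) = restricts-∙ {down t′ (suc a) m} {t′ a} (restricts-down (suc a) m) (restricts-t′ a)

    constant-up : ∀ a m u → u ◁ constant ◁ up t a m ≋ u ◁ Intertwining.up (End (Tab lam)) (extend idᴸ 𝐭) a m ◁ constant
    constant-up a zero    u = ≋-refl
    constant-up a (suc m) u = ≋-trans (cong (up t (suc a) m) (one a u)) (constant-up (suc a) m (u ◁ extend idᴸ 𝐭 a))
      where
      one : ∀ a u → u ◁ constant ◁ t a ≋ u ◁ extend idᴸ 𝐭 a ◁ constant
      one a u with a ℕ.<? n
      ... | yes lt = constant-𝐓 (fromℕ< lt) u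
      ... | no  _  = ≋-refl

  -- On constants w acts as the product of all T_i, and Ξ_N first applies the inverse of that
  -- product. The inverses keep constants constant, so the cancellation can be carried out inside M.
  constant-ξ-last : ∀ u → u ◁ constant ◁ ξ (fromℕ n) ≋ u ◁ constant
  constant-ξ-last u with restricts-down 0 n
  ... | G , h = begin
    u ◁ constant ◁ ξ (fromℕ n)                              ≈⟨ ξ-e (fromℕ n) 0 (≡.trans (ℕ.+-identityʳ _) (Fin.toℕ-fromℕ n)) (u ◁ constant) ⟩
    s ^ᶻ (toℕ (fromℕ n) ℤ.⊖ n) • u ◁ constant ◁ H.e (toℕ (fromℕ n)) 0
      ≡⟨ ≡.cong (λ m → s ^ᶻ (m ℤ.⊖ n) • u ◁ constant ◁ H.e m 0) (Fin.toℕ-fromℕ n) ⟩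
    s ^ᶻ (n ℤ.⊖ n) • u ◁ constant ◁ H.e n 0                 ≡⟨ ≡.cong (λ i → s ^ᶻ i • u ◁ constant ◁ H.e n 0) (ℤ.n⊖n≡0 n) ⟩
    1# • u ◁ constant ◁ down t′ 0 n ◁ 𝐰ᴸ                    ≈⟨ one-• _ ⟨
    u ◁ constant ◁ down t′ 0 n ◁ 𝐰ᴸ                         ≈⟨ cong 𝐰ᴸ (h u) ⟩
    u ◁ G ◁ constant ◁ 𝐰ᴸ                                   ≈⟨ constant-𝐰 (u ◁ G) ⟩
    u ◁ G ◁ word ◁ constant                                 ≈⟨ constant-up 0 n (u ◁ G) ⟨
    u ◁ G ◁ constant ◁ up t 0 n                             ≈⟨ cong (up t 0 n) (h u) ⟨
    u ◁ constant ◁ down t′ 0 n ◁ up t 0 n                   ≈⟨ on (down-up-inverse H.t′∙t 0 n) (u ◁ constant) ⟩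
    u ◁ constant                                            ∎
    where open SetoidReasoning (≋-setoid 𝕄)

  -- Descending from Ξ_N by T_iΞ_{i+1}T_i = sΞ_i. The hypothesis is needed for all tableaux at once,
  -- since the intertwined vector is a multiple of the exchanged tableau.
  Eigen-constant : ∀ T → Eigen (λ j → zᶜ (pos T j)) (⟨ T ⟩ ◁ constant)
  Eigen-constant T j = >-weakInduction (λ j → ∀ T → ⟨ T ⟩ ◁ constant ◁ ξ j ≋ zᶜ (pos T j) • ⟨ T ⟩ ◁ constant) last below j T
    where
    open SetoidReasoning (≋-setoid 𝕄)
    last : ∀ T → ⟨ T ⟩ ◁ constant ◁ ξ (fromℕ n) ≋ zᶜ (pos T (fromℕ n)) • ⟨ T ⟩ ◁ constant
    last T = ≋-trans (constant-ξ-last ⟨ T ⟩) (≋-trans (one-• _) (≋-reflexive (≡.cong (λ x → zᶜ x • ⟨ T ⟩ ◁ constant) (≡.sym (corner-entry T)))))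
    below : ∀ i → (∀ T → ⟨ T ⟩ ◁ constant ◁ ξ (Fin.suc i) ≋ zᶜ (pos T (Fin.suc i)) • ⟨ T ⟩ ◁ constant) →
            ∀ T → ⟨ T ⟩ ◁ constant ◁ ξ (inject₁ i) ≋ zᶜ (pos T (inject₁ i)) • ⟨ T ⟩ ◁ constant
    below i h T = s•-injective (begin
      s • f ◁ ξ (inject₁ i)                    ≈⟨ 𝐓-ξ-𝐓 i f ⟨
      f ◁ Tᵢ ◁ ξ p′ ◁ Tᵢ                       ≈⟨ cong Tᵢ (cong (ξ p′) split) ⟩
      (g ⊕ (- a) • f) ◁ ξ p′ ◁ Tᵢ              ≈⟨ cong Tᵢ (≋-trans (map-⊕• (ξ p′) g (- a) f) (⊕-cong g-ξ (•-cong refl (h T)))) ⟩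
      (z • g ⊕ (- a) • z′ • f) ◁ Tᵢ            ≈⟨ ≋-trans (map-⊕• Tᵢ _ (- a) _) (⊕-cong (map-• Tᵢ z g) (•-cong refl (map-• Tᵢ z′ f))) ⟩
      z • g ◁ Tᵢ ⊕ (- a) • z′ • f ◁ Tᵢ         ≈⟨ ⊕-cong (•-cong refl g-T) (•-cong refl (•-cong refl split)) ⟩
      z • ((s + a * a′) • f ⊕ (- a′) • g) ⊕ (- a) • z′ • (g ⊕ (- a) • f)
        ≈⟨ byScalars (z ⊡ ((s + a * a′) ⊡ ν 0F ⊞ (- a′) ⊡ ν 1F) ⊞ (- a) ⊡ z′ ⊡ (ν 1F ⊞ (- a) ⊡ ν 0F)) (s ⊡ z ⊡ ν 0F) (f ∷ g ∷ []) scalar ⟩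
      s • z • f                                ∎)
      where
      p′ = Fin.suc i
      Tᵢ = 𝐓ᴸ i
      f = ⟨ T ⟩ ◁ constant
      cᵢ = pos T (inject₁ i)
      cⱼ = pos T p′
      z = zᶜ cᵢ
      z′ = zᶜ cⱼ
      a = ratio z z′
      a′ = ratio z′ z
      T′ = exchanged i T
      γ′ = γᶜ cᵢ cⱼ
      g = f ◁ (Tᵢ ⊹ a)
      split : f ◁ Tᵢ ≋ g ⊕ (- a) • f
      split = byScalars (ν 0F) ((ν 0F ⊞ a ⊡ ν 1F) ⊞ (- a) ⊡ ν 1F) (f ◁ Tᵢ ∷ f ∷ [])
        λ where (x ∷ y ∷ []) → solve 3 (λ a x y → x := (x :+ a :* y) :+ (:- a) :* y) refl a x y
      g-T : g ◁ Tᵢ ≋ (s + a * a′) • f ⊕ (- a′) • g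
      g-T = ≋-trans (byScalars (ν 0F) ((ν 0F ⊞ a′ ⊡ ν 1F) ⊞ (- a′) ⊡ ν 1F) (g ◁ Tᵢ ∷ g ∷ [])
          λ where (x ∷ y ∷ []) → solve 3 (λ a x y → x := (x :+ a :* y) :+ (:- a) :* y) refl a′ x y)
        (⊕-cong (⊹-⊹ Tᵢ f (ratio-+ (zᶜ-≉0 cᵢ) (zᶜ-≉0 cⱼ) (z-distinct T i)) (𝐓-quadraticAt i f)) ≋-refl)
      g-image : g ≋ γ′ • ⟨ T′ ⟩ ◁ constant
      g-image = ≋-trans (⊕-cong (constant-𝐓 i ⟨ T ⟩) (≋-sym (map-• constant a ⟨ T ⟩)))
        (≋-trans (≋-sym (map-⊕ constant (⟨ T ⟩ ◁ 𝐭 i) (a • ⟨ T ⟩))) (≋-trans (cong constant (intertwine T i)) (map-• constant γ′ _)))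
      g-ξ : g ◁ ξ p′ ≋ z • g
      g-ξ = ≋-trans (cong (ξ p′) g-image) (≋-trans (map-• (ξ p′) γ′ _) (≋-trans (•-cong refl (h T′))
        (≋-trans (byScalars (γ′ ⊡ zᶜ (pos T′ p′) ⊡ ν 0F) (z ⊡ γ′ ⊡ ν 0F) (⟨ T′ ⟩ ◁ constant ∷ [])
          λ where (u ∷ []) → trans (sym (*-assoc γ′ _ u)) (trans (*-congʳ (weighted (exchange-cases i T))) (*-assoc z γ′ u)))
          (•-cong refl (≋-sym g-image)))))
        where
        weighted : Exchange i T → γ′ * zᶜ (pos T′ p′) ≈ z * γ′
        weighted (aligned _ γ≈0) = trans (*-congʳ γ≈0) (trans (zeroˡ _) (sym (trans (*-congˡ γ≈0) (zeroʳ _))))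
        weighted (swaps _ _ eq)  = trans (*-comm _ _) (*-congʳ (reflexive (≡.cong zᶜ
          (≡.trans (≡.cong (λ u → lookup u p′) eq) (lookup-swap-suc i (cells T))))))
      -- The coefficient of `g` in the result is a multiple of this and disappears.
      balance : z * a′ + a * z′ ≈ 0#
      balance = *-cancelˡ-0 (x-y≉0 (z-distinct T i)) (trans
        (solve 4 (λ z z′ a a′ → (z :- z′) :* (z :* a′ :+ a :* z′) := z′ :* (a :* (z :- z′)) :- z :* (a′ :* (z′ :- z))) refl z z′ a a′)
        (trans (+-cong (*-congˡ (ratio-* (zᶜ-≉0 cᵢ) (z-distinct T i))) (-‿cong (*-congˡ (ratio-* (zᶜ-≉0 cⱼ) (≉-sym (z-distinct T i))))))
          (solve 3 (λ m z z′ → z′ :* (m :* z) :- z :* (m :* z′) := :0) refl θ z z′)))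
      scalar : ∀ κ → scalars (z ⊡ ((s + a * a′) ⊡ ν 0F ⊞ (- a′) ⊡ ν 1F) ⊞ (- a) ⊡ z′ ⊡ (ν 1F ⊞ (- a) ⊡ ν 0F)) κ ≈ scalars (s ⊡ z ⊡ ν 0F) κ
      scalar (u ∷ w ∷ []) = trans
        (solve 7 (λ s z z′ a a′ u w → z :* ((s :+ a :* a′) :* u :+ (:- a′) :* w) :+ (:- a) :* (z′ :* (w :+ (:- a) :* u)) :=
          s :* (z :* u) :+ (z :* a′ :+ a :* z′) :* (a :* u :- w)) refl s z z′ a a′ u w)
        (trans (+-congˡ (trans (*-congʳ balance) (zeroˡ _))) (+-identityʳ _))

  private
    swapped-≢ : ∀ {j : Fin n} {v : Monomial} → LastAt j v → lookup (swap j v) (inject₁ j) ≢ lookup (swap j v) (Fin.suc j)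
    swapped-≢ {j} {v} la eq = ℕ.<⇒≢ (LastAt-descent v {j} la)
      (≡.trans (≡.sym (lookup-swap-inject₁ j v)) (≡.trans eq (lookup-swap-suc j v)))

    v-≢ : ∀ {j : Fin n} {v : Monomial} → LastAt j v → lookup v (inject₁ j) ≢ lookup v (Fin.suc j)
    v-≢ {j} {v} la eq = ℕ.<⇒≢ (LastAt-descent v {j} la) (≡.sym eq)

    Eigen-Pᶜ : ∀ {v} (cn : Canonical v) T → Eigen (spec v T) (Pᶜ cn T)
    Eigen-Pᶜ (root ≡.refl)         T = Eigen-resp (λ j → sym (spec-root T j)) ≋-refl (Eigen-constant T)
    Eigen-Pᶜ (rotated u ≡.refl cn) T = Eigen-Φ (λ i → reflexive (spec-rotate-inject₁ u T i)) (spec-rotate-last u T) (Eigen-Pᶜ cn T)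
    Eigen-Pᶜ {v} (swapped j la cn) T = Eigen-⊹ j (Eigen-Pᶜ cn T) (spec-≉0 (swap j v) T (inject₁ j)) (spec-≉ (swap j v) T (swapped-≢ {j} {v} la))
      (reflexive (≡.sym (spec-swap-snd j v T (v-≢ {j} {v} la)))) (reflexive (≡.sym (spec-swap-fst j v T (v-≢ {j} {v} la))))
      (λ i p p′ → reflexive (≡.sym (spec-swap-other j v T (v-≢ {j} {v} la) i p p′)))

    -- At a canonical swap the two spectral values have different powers of q, so they differ
    -- neither by 1 nor by a factor s, and the intertwiner is invertible.
    Faithful-Pᶜ : ∀ {v} (cn : Canonical v) T → Faithful (Pᶜ cn T)
    Faithful-Pᶜ (root _)         T = Faithful-resp (≋-sym (constant-⟨⟩ T)) (Faithful-⟨⟩ _)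
    Faithful-Pᶜ (rotated u _ cn) T = Faithful-Φ (Faithful-Pᶜ cn T)
    Faithful-Pᶜ {v} (swapped j la cn) T = Faithful-⊹ j (spec-≉0 u T (inject₁ j)) (spec-≉0 u T (Fin.suc j)) (spec-≉ u T ≢)
      (λ eq → ≢ (proj₁ (char-injective {lookup u (inject₁ j)} {+ 1 ℤ.+ ct₀} {lookup u (Fin.suc j)} {ct₁} (trans (sym (char-suc (lookup u (inject₁ j)) ct₀)) eq))))
      (λ eq → ≢ (proj₁ (char-injective {lookup u (inject₁ j)} {ct₀} {lookup u (Fin.suc j)} {+ 1 ℤ.+ ct₁} (trans eq (char-suc (lookup u (Fin.suc j)) ct₁)))))
      (Faithful-Pᶜ cn T)
      where
      u = swap j v
      ≢ = swapped-≢ {j} {v} la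
      ct₀ = CTᵀ T (lookup (rank u) (inject₁ j))
      ct₁ = CTᵀ T (lookup (rank u) (Fin.suc j))

  Eigen-P : ∀ v T → Eigen (spec v T) (P v T)
  Eigen-P v T = Eigen-resp (λ _ → refl) (≋-reflexive (≡.sym (P-canonical (canonical v) T))) (Eigen-Pᶜ (canonical v) T)

  Faithful-P : ∀ v T → Faithful (P v T)
  Faithful-P v T = Faithful-resp (≋-reflexive (≡.sym (P-canonical (canonical v) T))) (Faithful-Pᶜ (canonical v) T)

  Pᴮ : 𝕄 → M
  Pᴮ (v , T) = P v T

  -- Different exponent vectors show in the powers of q. For equal ones the ranks agree and take
  -- every value, so an entry with different contents occurs at some place.
  spec-separates : ∀ {b b′} → b ≢ b′ → ∃ λ j → ¬ spec (proj₁ b) (proj₂ b) j ≈ spec (proj₁ b′) (proj₂ b′) j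
  spec-separates {v , T} {v′ , T′} b≢ with Fin.all? (λ j → lookup v j ℕ.≟ lookup v′ j)
  ... | no ¬same with Fin.¬∀⟶∃¬ N (λ j → lookup v j ≡ lookup v′ j) (λ j → lookup v j ℕ.≟ lookup v′ j) ¬same
  ...   | j , v≢ = j , λ eq → v≢ (proj₁ (char-injective {lookup v j} {CTᵀ T (lookup (rank v) j)} {lookup v′ j} {CTᵀ T′ (lookup (rank v′) j)} eq))
  spec-separates {v , T} {v′ , T′} b≢ | yes same with lookup-≡ {u = v} {v′} same
  ... | ≡.refl with Fin.all? (λ j → CTᵀ T j ℤ.≟ CTᵀ T′ j)
  ...   | yes same′ = contradiction (≡.cong (v ,_) (content-determines T T′ same′)) b≢
  ...   | no ¬same with Fin.¬∀⟶∃¬ N (λ j → CTᵀ T j ≡ CTᵀ T′ j) (λ j → CTᵀ T j ℤ.≟ CTᵀ T′ j) ¬same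
  ...     | r , ct≢ with IsRank.onto (isRank v) r
  ...       | j , ≡.refl = j , λ eq → ct≢ (proj₂ (char-injective {lookup v j} {CTᵀ T (lookup (rank v) j)} {lookup v j} {CTᵀ T′ (lookup (rank v) j)} eq))

  P-independent : ∀ f → linear Pᴮ f ≋ [] → f ≋ []
  P-independent = Independence.independent-family Pᴮ (λ (v , T) → spec v T) (λ (v , T) → Eigen-P v T) (λ (v , T) → Faithful-P v T) spec-separates

  Spanned : M → Set _
  Spanned f = ∃ λ g → linear Pᴮ g ≋ f

  Spanned-resp : ∀ {f f′} → f ≋ f′ → Spanned f → Spanned f′
  Spanned-resp eq (g , h) = g , ≋-trans h eq

  Spanned-P : ∀ v T → Spanned (P v T)
  Spanned-P v T = ⟨ v , T ⟩ , linear-⟨⟩ Pᴮ (v , T)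

  Spanned-⊕ : ∀ {f f′} → Spanned f → Spanned f′ → Spanned (f ⊕ f′)
  Spanned-⊕ (g , h) (g′ , h′) = g ⊕ g′ , ≋-trans (map-⊕ (linearᴸ Pᴮ) g g′) (⊕-cong h h′)

  Spanned-• : ∀ a {f} → Spanned f → Spanned (a • f)
  Spanned-• a (g , h) = a • g , ≋-trans (map-• (linearᴸ Pᴮ) a g) (•-cong refl h)

  Spanned-linear : ∀ {B : Set} (φ : B → M) → (∀ b → Spanned (φ b)) → ∀ f → Spanned (linear φ f)
  Spanned-linear φ h []            = [] , ≋-refl
  Spanned-linear φ h ((a , b) ∷ f) = Spanned-resp (≋-sym (⊕-lists (•-lists refl ≋-refl) ≋-refl)) (Spanned-⊕ (Spanned-• a (h b)) (Spanned-linear φ h f))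

  Preserves : Lin 𝕄 𝕄 → Set _
  Preserves F = ∀ {f} → Spanned f → Spanned (f ◁ F)

  -- By linearity, stability of the span has to be checked on the canonical polynomials only.
  preserves : ∀ F → (∀ v T → Spanned (P v T ◁ F)) → Preserves F
  preserves F h (g , eq) = Spanned-resp (≋-trans (through g) (cong F eq)) (Spanned-linear (λ (v , T) → P v T ◁ F) (λ (v , T) → h v T) g)
    where
    through : ∀ g → linear (λ (v , T) → P v T ◁ F) g ≋ linear Pᴮ g ◁ F
    through g = on (basis-ext {F = linearᴸ (λ (v , T) → P v T ◁ F)} {linearᴸ Pᴮ ⨾ F}
      λ (v , T) → ≋-trans (linear-⟨⟩ (λ (v , T) → P v T ◁ F) (v , T)) (≋-sym (cong F (linear-⟨⟩ Pᴮ (v , T))))) g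

  private
    move-𝐓 : ∀ {i v T g v′ T′} → Move i v T g v′ T′ → Spanned (P v T ◁ 𝐓ᴸ i)
    move-𝐓 {i} {v} {T} {g} {v′} {T′} m = Spanned-resp
      (≋-trans (⊕-cong (≋-sym (claim v m)) ≋-refl)
        (byScalars ((ν 0F ⊞ a ⊡ ν 1F) ⊞ (- a) ⊡ ν 1F) (ν 0F) (P v T ◁ 𝐓ᴸ i ∷ P v T ∷ [])
          λ where (x ∷ y ∷ []) → solve 3 (λ a x y → (x :+ a :* y) :+ (:- a) :* y := x) refl a x y))
      (Spanned-⊕ (Spanned-• g (Spanned-P v′ T′)) (Spanned-• (- a) (Spanned-P v T)))
      where a = ratio (spec v T (inject₁ i)) (spec v T (Fin.suc i))

  preserves-𝐓 : ∀ i → Preserves (𝐓ᴸ i)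
  preserves-𝐓 i = preserves (𝐓ᴸ i) by-order
    where
    by-order : ∀ v T → Spanned (P v T ◁ 𝐓ᴸ i)
    by-order v T with ℕ.<-cmp (lookup v (inject₁ i)) (lookup v (Fin.suc i))
    ... | tri< lt _ _ = move-𝐓 (ascent lt)
    ... | tri≈ _ eq _ with IsRank-adjacent i eq (isRank v)
    ...   | r , p≡ , p′≡ = move-𝐓 (level r eq p≡ p′≡)
    -- At a descent `v` is the target of an ascent from `u`; the quadratic relation expresses the
    -- image through P u and its own image.
    by-order v T | tri> _ _ gt = Spanned-resp
      (begin
        (s - 1# + a) • P u T ◁ 𝐓ᴸ i ⊕ s • P u T
          ≈⟨ byScalars ((s - 1# + a) ⊡ ν 0F ⊞ s ⊡ ν 1F) (((s - 1#) ⊡ ν 0F ⊞ s ⊡ ν 1F) ⊞ a ⊡ ν 0F) (P u T ◁ 𝐓ᴸ i ∷ P u T ∷ [])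
               (λ where (x ∷ y ∷ []) → solve 4 (λ s a x y → (s :- :1 :+ a) :* x :+ s :* y := ((s :- :1) :* x :+ s :* y) :+ a :* x) refl s a x y) ⟩
        ((s - 1#) • P u T ◁ 𝐓ᴸ i ⊕ s • P u T) ⊕ a • P u T ◁ 𝐓ᴸ i  ≈⟨ ⊕-cong (𝐓-quadraticAt i (P u T)) ≋-refl ⟨
        P u T ◁ 𝐓ᴸ i ◁ 𝐓ᴸ i ⊕ a • P u T ◁ 𝐓ᴸ i                  ≈⟨ map-⊕• (𝐓ᴸ i) _ a _ ⟨
        P u T ◁ τ i u T ◁ 𝐓ᴸ i                                    ≈⟨ cong (𝐓ᴸ i) (≋-trans (claim u up-move) (≋-sym (one-• _))) ⟩
        P (swap i u) T ◁ 𝐓ᴸ i                                     ≡⟨ ≡.cong (λ v → P v T ◁ 𝐓ᴸ i) (swap-involutive i v) ⟩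
        P v T ◁ 𝐓ᴸ i                                              ∎)
      (Spanned-⊕ (Spanned-• _ (move-𝐓 up-move)) (Spanned-• s (Spanned-P u T)))
      where
      open SetoidReasoning (≋-setoid 𝕄)
      u = swap i v
      a = ratio (spec u T (inject₁ i)) (spec u T (Fin.suc i))
      up-move : Move i u T 1# (swap i u) T
      up-move = ascent (≡.subst₂ ℕ._<_ (≡.sym (lookup-swap-inject₁ i v)) (≡.sym (lookup-swap-suc i v)) gt)

  preserves-𝐓⁻¹ : ∀ i → Preserves (𝐓⁻¹ᴸ i)
  preserves-𝐓⁻¹ i h = Spanned-resp (≋-sym (𝐓⁻¹-⊹ i _)) (Spanned-• (s ⁻¹) (Spanned-⊕ (preserves-𝐓 i h) (Spanned-• θ h)))

  preserves-Φ : Preserves Φᴸ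
  preserves-Φ = preserves Φᴸ λ v T → Spanned-resp (≋-reflexive (P-rotate v T)) (Spanned-P (rotate v suc) T)

  preserves-down : ∀ a m → Preserves (down t a m)
  preserves-down a zero    h = h
  preserves-down a (suc m) h = extend-elim idᴸ 𝐓ᴸ (λ _ F → Preserves F) preserves-𝐓 (λ _ _ h → h) a (preserves-down (suc a) m h)

  -- Undoing the inverses in Φ leaves the last variable. The others follow downwards, x_i being T_i
  -- + 1 - s, then x_{i+1}, then the inverse of T_i.
  preserves-X : ∀ j → Preserves (X j)
  preserves-X = >-weakInduction (λ j → Preserves (X j))
    (λ {f} h → Spanned-resp (begin
      f ◁ down t 0 n ◁ Φᴸ                    ≡⟨ ≡.cong (f ◁ down t 0 n ◁_) Φ-factors ⟩
      f ◁ down t 0 n ◁ up t′ 0 n ◁ x n       ≈⟨ cong (x n) (on (down-up-inverse H.t∙t′ 0 n) f) ⟩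
      f ◁ x n                                ≡⟨ ≡.cong (f ◁_) x-last ⟩
      f ◁ X (fromℕ n)                        ∎) (preserves-Φ (preserves-down 0 n h)))
    (λ i h′ {f} h → Spanned-resp (begin
      f ◁ (𝐓ᴸ i ⊹ θ) ◁ X (Fin.suc i) ◁ 𝐓⁻¹ᴸ i ≈⟨ cong (𝐓⁻¹ᴸ i) (X-inject₁ i f) ⟨
      f ◁ X (inject₁ i) ◁ 𝐓ᴸ i ◁ 𝐓⁻¹ᴸ i       ≈⟨ on (𝐓-𝐓⁻¹ i) (f ◁ X (inject₁ i)) ⟩
      f ◁ X (inject₁ i)                       ∎) (preserves-𝐓⁻¹ i (h′ (Spanned-⊕ (preserves-𝐓 i h) (Spanned-• θ h)))))
    where open SetoidReasoning (≋-setoid 𝕄)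

  P-spans : ∀ f → Spanned f
  P-spans f = Spanned-resp (on (basis-ext {F = linearᴸ ⟨_⟩} {idᴸ} (linear-⟨⟩ ⟨_⟩)) f) (Spanned-linear ⟨_⟩ monomial f)
    where
    monomial : ∀ b → Spanned ⟨ b ⟩
    monomial (a , T) = inc-induction (λ a → Spanned ⟨ a , T ⟩)
      (Spanned-resp (≋-trans (≋-reflexive (P-root T)) (constant-⟨⟩ T)) (Spanned-P (replicate N 0) T))
      (λ j a h → Spanned-resp (≋-reflexive (X-⟨⟩ j a T)) (preserves-X j h)) a

-- The column by column tableau, and the content condition on jumps.

module ColumnOrder {n : ℕ} (lam : Partition (suc n)) where
  open Tableaux lam
  private
    N : ℕ
    N = suc n

  -- The order in which the column by column tableau fills the cells.
  infix 4 _≺_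
  _≺_ : Cell → Cell → Set
  (c , r) ≺ (c′ , r′) = c ℕ.< c′ ⊎ (c ≡ c′ × r ℕ.< r′)

  ≺-trans : ∀ {x y z} → x ≺ y → y ≺ z → x ≺ z
  ≺-trans (inj₁ lt)            (inj₁ lt′)            = inj₁ (ℕ.<-trans lt lt′)
  ≺-trans (inj₁ lt)            (inj₂ (≡.refl , _))   = inj₁ lt
  ≺-trans (inj₂ (≡.refl , _))  (inj₁ lt)             = inj₁ lt
  ≺-trans (inj₂ (≡.refl , lt)) (inj₂ (≡.refl , lt′)) = inj₂ (≡.refl , ℕ.<-trans lt lt′)

  ≺-asym : ∀ {x y} → x ≺ y → ¬ y ≺ x
  ≺-asym (inj₁ lt)            (inj₁ lt′)         = ℕ.<-asym lt lt′
  ≺-asym (inj₁ lt)            (inj₂ (≡.refl , _)) = ℕ.<-irrefl ≡.refl lt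
  ≺-asym (inj₂ (≡.refl , _))  (inj₁ lt)          = ℕ.<-irrefl ≡.refl lt
  ≺-asym (inj₂ (≡.refl , lt)) (inj₂ (_ , lt′))   = ℕ.<-asym lt lt′

  ColumnByColumn-unique : ∀ {T T′} → ColumnByColumn T → ColumnByColumn T′ → T ≡ T′
  ColumnByColumn-unique {T} {T′} h h′ = Tab-≡ (WF.All.wfRec >-wellFounded _ (λ k → pos T k ≡ pos T′ k) agree)
    where
    -- An entry above k sits in the same cell of both tableaux, so the entry which the second
    -- one puts into the cell of k in the first one is below k.
    later : ∀ T T′ k → (∀ {j} → k Fin.< j → pos T j ≡ pos T′ j) → ColumnByColumn T′ → pos T k ≢ pos T′ k → pos T′ k ≺ pos T k
    later T T′ k above h′ ≢ with pos-surjective T′ (pos-inShape T k)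
    ... | m , eq with Fin.<-cmp m k
    ...   | tri< m<k _ _    = ≡.subst (pos T′ k ≺_) eq (h′ k m m<k)
    ...   | tri≈ _ ≡.refl _ = contradiction (≡.sym eq) ≢
    ...   | tri> _ _ k<m    = contradiction k<m (Fin.<-irrefl (≡.sym (pos-injective T (≡.trans (above k<m) eq))))
    agree : ∀ k → (∀ {j} → k Fin.< j → pos T j ≡ pos T′ j) → pos T k ≡ pos T′ k
    agree k above with Product.≡-dec ℕ._≟_ ℕ._≟_ (pos T k) (pos T′ k)
    ... | yes eq = eq
    ... | no  ≢  = contradiction (later T T′ k above h′ ≢)
                     (≺-asym (later T′ T k (λ lt → ≡.sym (above lt)) h (≡.≢-sym ≢)))

  toℕ-suc : ∀ (i : Fin n) → toℕ (Fin.suc i) ≡ suc (toℕ (inject₁ i))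
  toℕ-suc i = ≡.cong suc (≡.sym (Fin.toℕ-inject₁ i))

  ascents⇒ColumnByColumn : ∀ T → (∀ i → pos T (Fin.suc i) ≺ pos T (inject₁ i)) → ColumnByColumn T
  ascents⇒ColumnByColumn T h = go
    where
    go : ∀ j k → k Fin.< j → pos T j ≺ pos T k
    go j k = <-weakInduction (λ j → k Fin.< j → pos T j ≺ pos T k) (λ ()) next j
      where
      next : ∀ i → (k Fin.< inject₁ i → pos T (inject₁ i) ≺ pos T k) → k Fin.< Fin.suc i → pos T (Fin.suc i) ≺ pos T k
      next i ih (ℕ.s≤s k≤i) with ℕ.m≤n⇒m<n∨m≡n k≤i
      ... | inj₁ k<i = ≺-trans (h i) (ih (≡.subst (toℕ k ℕ.<_) (≡.sym (Fin.toℕ-inject₁ i)) k<i))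
      ... | inj₂ k≡i = ≡.subst (λ k → pos T (Fin.suc i) ≺ pos T k) (Fin.toℕ-injective (≡.trans (Fin.toℕ-inject₁ i) (≡.sym k≡i))) (h i)

  Higher : Tab lam → Fin n → Set
  Higher T i = rowᵀ T (Fin.suc i) ℕ.< rowᵀ T (inject₁ i) × colᵀ T (inject₁ i) ℕ.< colᵀ T (Fin.suc i)

  -- Of the four relative positions of consecutive entries, the three others all agree with the
  -- column order.
  columnByColumn-or-higher : ∀ T → ColumnByColumn T ⊎ ∃ (Higher T)
  columnByColumn-or-higher T with Fin.any? (λ i → (rowᵀ T (Fin.suc i) ℕ.<? rowᵀ T (inject₁ i)) ×-dec (colᵀ T (inject₁ i) ℕ.<? colᵀ T (Fin.suc i)))
  ... | yes found = inj₂ found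
  ... | no  none  = inj₁ (ascents⇒ColumnByColumn T λ i → next (adjacent T (toℕ-suc i)) (λ h → none (i , h)))
    where
    next : ∀ {i} → Adjacent T (inject₁ i) (Fin.suc i) → ¬ Higher T i → pos T (Fin.suc i) ≺ pos T (inject₁ i)
    next (sameRow _ c≡)  _ = inj₁ (ℕ.≤-reflexive (≡.sym c≡))
    next (sameCol c≡ r≡) _ = inj₂ (≡.sym c≡ , ℕ.≤-reflexive (≡.sym r≡))
    next (higher r< c<)  ¬h = contradiction (r< , c<) ¬h
    next (lower _ c<)    _ = inj₁ c<

  private
    ⊖-difference : ∀ c r c′ r′ → (c ℤ.⊖ r) ℤ.- (c′ ℤ.⊖ r′) ≡ (c ℕ.+ r′) ℤ.⊖ (c′ ℕ.+ r)
    ⊖-difference c r c′ r′ = ≡.trans (≡.cong₂ ℤ._-_ (≡.sym (ℤ.[+m]-[+n]≡m⊖n c r)) (≡.sym (ℤ.[+m]-[+n]≡m⊖n c′ r′)))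
      (≡.trans (solve 4 (λ c r c′ r′ → (c :- r) :- (c′ :- r′) := (c :+ r′) :- (c′ :+ r)) ≡.refl (+ c) (+ r) (+ c′) (+ r′))
        (ℤ.[+m]-[+n]≡m⊖n (c ℕ.+ r′) (c′ ℕ.+ r)))
      where open ℤ.+-*-Solver using (solve; _:+_; _:-_; _:=_)

    2≡⊖ : ∀ m → + 2 ≡ (2 ℕ.+ m) ℤ.⊖ m
    2≡⊖ m = ≡.sym (≡.trans (ℤ.⊖-≥ (ℕ.m≤n+m m 2)) (≡.cong +_ (ℕ.m+n∸n≡m 2 m)))

  ≤-difference : ∀ {c r c′ r′} → suc c′ ℕ.≤ c → suc r ℕ.≤ r′ → + 2 ℤ.≤ (c ℤ.⊖ r) ℤ.- (c′ ℤ.⊖ r′)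
  ≤-difference {c} {r} {c′} {r′} c< r< = ≡.subst₂ ℤ._≤_ (≡.sym (2≡⊖ (c′ ℕ.+ r))) (≡.sym (⊖-difference c r c′ r′))
    (ℤ.⊖-monoˡ-≤ (c′ ℕ.+ r) (ℕ.≤-trans (ℕ.≤-reflexive (≡.cong suc (≡.sym (ℕ.+-suc c′ r)))) (ℕ.+-mono-≤ c< r<)))

  difference-≤ : ∀ {c r c′ r′} → + 2 ℤ.≤ (c ℤ.⊖ r) ℤ.- (c′ ℤ.⊖ r′) → 2 ℕ.+ (c′ ℕ.+ r) ℕ.≤ c ℕ.+ r′
  difference-≤ {c} {r} {c′} {r′} le = ℤ.drop‿+≤+ (≡.subst (+ (2 ℕ.+ m) ℤ.≤_) cancel
    (ℤ.+-monoˡ-≤ (+ m) (≡.subst (+ 2 ℤ.≤_) (⊖-difference c r c′ r′) le)))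
    where
    open ℤ.+-*-Solver using (solve; _:+_; _:-_; _:=_)
    m = c′ ℕ.+ r
    cancel : ((c ℕ.+ r′) ℤ.⊖ m) ℤ.+ + m ≡ + (c ℕ.+ r′)
    cancel = ≡.trans (≡.cong (ℤ._+ + m) (≡.sym (ℤ.[+m]-[+n]≡m⊖n (c ℕ.+ r′) m)))
      (solve 2 (λ a b → (a :- b) :+ b := a) ≡.refl (+ (c ℕ.+ r′)) (+ m))

  -- The difference of contents is 1 in a common row and negative in a common column or with `a`
  -- higher, so only one position remains.
  content-gap⇒lower : ∀ T {a b} → toℕ b ≡ suc (toℕ a) → + 2 ℤ.≤ CTᵀ T a ℤ.- CTᵀ T b →
    rowᵀ T a ℕ.< rowᵀ T b × colᵀ T b ℕ.< colᵀ T a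
  content-gap⇒lower T {a} {b} b≡ gap with difference-≤ {colᵀ T a} {rowᵀ T a} {colᵀ T b} {rowᵀ T b} gap | adjacent T b≡
  ... | le | lower r< c<   = r< , c<
  ... | le | sameRow r≡ c≡ = contradiction (ℕ.≤-pred (ℕ.≤-trans le (ℕ.≤-reflexive (≡.cong₂ ℕ._+_ c≡ (≡.sym r≡))))) ℕ.1+n≰n
  ... | le | sameCol c≡ r≡ = contradiction (ℕ.≤-trans (ℕ.n≤1+n _) le)
      (ℕ.<⇒≱ (ℕ.m<n⇒m<1+n (ℕ.+-mono-≤-< (ℕ.≤-reflexive c≡) (ℕ.≤-reflexive (≡.sym r≡)))))
  ... | le | higher r< c<  = contradiction (ℕ.≤-trans (ℕ.m≤n+m _ 2) le) (ℕ.<⇒≱ (ℕ.+-mono-< c< r<))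

-- Paths carry canonical polynomials, and every vertex is reached.

module Paths {c ℓ k ℓk} {C : Field c ℓ} (𝕂 : RationalFunctionField C k ℓk)
             {n₀ : ℕ} (lam : Partition (suc (suc n₀))) where
  private
    n : ℕ
    n = suc n₀
    N : ℕ
    N = suc n
  open RationalFunctionField 𝕂 using (K; q; s)
  open Field K
  open Macdonald 𝕂 lam hiding (_⊕_; _•_)
  open LinearMaps commutativeRing using (_⊕_; _•_; _≋_; at; pointwise; ≋-refl; ≋-sym; ≋-trans; ≋-reflexive; •-cong; ⊕-lists; •-lists; cong)
  open FieldFacts K
  open Ratio s
  open Tableaux lam
  open ColumnOrder lam
  open Swaps
  open Ranks
  open Weights
  open Seminormal 𝕂 lam
  open SeminormalRelations 𝕂 lam using (one-•)
  open Operators 𝕂 lam using (𝐓ᴸ; 𝐓-fun; constant-⟨⟩)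
  open Eigenvectors 𝕂 lam using (Φ-fun; Ξ-fun; Φᴸ; Eigen-resp; Faithful⇒≉; Faithful-resp)
  open Polynomials 𝕂 lam hiding (τ)
  open Basis 𝕂 lam

  exchange-adjacent : ∀ {i a b} {T T′ : Tab lam} (rs : IsReverseStandard (exchangeᶠ a b (filling T))) → a ≡ inject₁ i → b ≡ Fin.suc i → cells T′ ≡ swap i (cells T) →
    mkTab (exchangeᶠ a b (filling T)) rs ≡ T′
  exchange-adjacent {i} {T = T} rs ≡.refl ≡.refl eq = Tab-≡ λ k → ≡.cong (λ u → lookup u k) (≡.trans (s[]-swap i (cells T)) (≡.sym eq))

  ·s-distinct : ∀ X i → lookup (v X) (inject₁ i) ≢ lookup (v X) (Fin.suc i) →
    X ·s[ i ] ≡ mkDatum (tab X) (ζ X s[ i ]) (v X s[ i ]) (σ X s[ i ])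
  ·s-distinct X i v≢ with lookup (v X) (inject₁ i) ℕ.≟ lookup (v X) (Fin.suc i) | isReverseStandard? (tab^ X i)
  ... | no  _  | _ = ≡.refl
  ... | yes v≡ | _ = contradiction v≡ v≢

  ·s-equal : ∀ X i → lookup (v X) (inject₁ i) ≡ lookup (v X) (Fin.suc i) → (rs : IsReverseStandard (tab^ X i)) →
    X ·s[ i ] ≡ mkDatum (mkTab (tab^ X i) rs) (ζ X s[ i ]) (v X) (σ X)
  ·s-equal X i v≡ rs with lookup (v X) (inject₁ i) ℕ.≟ lookup (v X) (Fin.suc i) | isReverseStandard? (tab^ X i)
  ... | no  v≢ | _       = contradiction v≡ v≢
  ... | yes _  | yes _   = ≡.refl
  ... | yes _  | no  ¬rs = contradiction rs ¬rs

  -- The invariant along a path. Once it holds at the end point, the polynomial depends on no other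
  -- feature of the path.
  record Traced (X : Datum) (f : M) : Set (k ⊔ ℓk) where
    field
      ranked   : IsRank (v X) (σ X)
      spectrum : ∀ j → lookup (ζ X) j ≈ spec (v X) (tab X) j
      value    : f ≋ P (v X) (tab X)
  open Traced

  private
    stepped : Fin n → Datum → M → M
    stepped i X f = Combinations._⊕_ commutativeRing (𝐓 i f)
      (Combinations._•_ commutativeRing (ratio (lookup (ζ X) (inject₁ i)) (lookup (ζ X) (Fin.suc i))) f)

    spectrum-moved : ∀ {i v₀ T v′ T′} → Swapped i v₀ T v′ T′ → ∀ (z : Vec Carrier N) → (∀ j → lookup z j ≈ spec v₀ T j) →
      ∀ j → lookup (z s[ i ]) j ≈ spec v′ T′ j
    spectrum-moved {i} {v₀} {T} {v′} {T′} sw z h j = trans (reflexive (≡.cong (λ z → lookup z j) (s[]-swap i z))) (by-cases (transpose-cases (inject₁ i) (Fin.suc i) j))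
      where
      by-cases : _ → lookup (swap i z) j ≈ spec v′ T′ j
      by-cases (inj₁ (≡.refl , _))          = trans (reflexive (lookup-swap-inject₁ i z)) (trans (h _) (reflexive (≡.sym (Swapped.fst sw))))
      by-cases (inj₂ (inj₁ (≡.refl , _)))   = trans (reflexive (lookup-swap-suc i z)) (trans (h _) (reflexive (≡.sym (Swapped.snd sw))))
      by-cases (inj₂ (inj₂ (j≢ , j≢′ , _))) = trans (reflexive (lookup-swap-other i z j≢ j≢′)) (trans (h j) (reflexive (≡.sym (Swapped.other sw j≢ j≢′))))

    -- A coefficient equal to 1 excludes the degenerate alternative of `Move-spec` and leaves no
    -- factor in the polynomial.
    traced-move : ∀ {X f i g v′ T′ σ′} → Traced X f → Move i (v X) (tab X) g v′ T′ → g ≈ 1# → IsRank v′ σ′ →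
      ∀ {Y} → Y ≡ mkDatum T′ (ζ X s[ i ]) v′ σ′ → Traced Y (stepped i X f)
    traced-move {X} {f} {i} {g} {v′} {T′} tr m g≈1 rk ≡.refl = record
      { ranked = rk ; spectrum = spectrum-moved (nonzero (Move-spec m)) (ζ X) (spectrum tr) ; value = value′ }
      where
      nonzero : g ≈ 0# ⊎ Swapped i (v X) (tab X) v′ T′ → Swapped i (v X) (tab X) v′ T′
      nonzero (inj₁ g≈0) = contradiction (trans (sym g≈1) g≈0) 1≉0
      nonzero (inj₂ sw)  = sw
      value′ : stepped i X f ≋ P v′ T′
      value′ = ≋-trans (⊕-lists (≋-trans (≋-reflexive (𝐓-fun i f)) (cong (𝐓ᴸ i) (value tr))) (•-lists (ratio-cong (spectrum tr _) (spectrum tr _)) (value tr)))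
        (≋-trans (claim (v X) m) (≋-trans (•-cong g≈1 ≋-refl) (≋-sym (one-• _))))

    -- The gap of at least 2 between the contents puts σ_i in the lower row, the direction in which
    -- the seminormal coefficient is normalised to 1.
    traced-jump : ∀ {X f i} → lookup (v X) (inject₁ i) ≡ lookup (v X) (Fin.suc i) → IsReverseStandard (tab^ X i) →
      + 2 ℤ.≤ CTᵀ (tab X) (lookup (σ X) (inject₁ i)) ℤ.- CTᵀ (tab X) (lookup (σ X) (Fin.suc i)) → Traced X f →
      (∃ λ r → lookup (σ X) (inject₁ i) ≡ inject₁ r × lookup (σ X) (Fin.suc i) ≡ Fin.suc r) → Traced (X ·s[ i ]) (stepped i X f)
    traced-jump {X} {f} {i} v≡ rs gap tr (r , p≡ , p′≡) = traced-move tr (level r v≡ (≡.trans (at-rank _) p≡) (≡.trans (at-rank _) p′≡))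
      (γ-lower (tab X) r (proj₁ lower-r) (λ e → ℕ.<⇒≢ (proj₂ lower-r) (≡.sym e))) (ranked tr)
      (≡.trans (·s-equal X i v≡ rs) (≡.cong (λ T → mkDatum T (ζ X s[ i ]) (v X) (σ X)) (same-tableau (exchange-cases r (tab X)))))
      where
      at-rank : ∀ j → lookup (rank (v X)) j ≡ lookup (σ X) j
      at-rank j = ≡.cong (λ σ → lookup σ j) (IsRank-unique (isRank (v X)) (ranked tr))
      lower-r : rowᵀ (tab X) (inject₁ r) ℕ.< rowᵀ (tab X) (Fin.suc r) × colᵀ (tab X) (Fin.suc r) ℕ.< colᵀ (tab X) (inject₁ r)
      lower-r = content-gap⇒lower (tab X) (toℕ-suc r)
        (≡.subst₂ (λ a b → + 2 ℤ.≤ CTᵀ (tab X) a ℤ.- CTᵀ (tab X) b) p≡ p′≡ gap)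
      same-tableau : Exchange r (tab X) → mkTab (tab^ X i) rs ≡ exchanged r (tab X)
      same-tableau (aligned (inj₁ r≡) _) = contradiction r≡ (ℕ.<⇒≢ (proj₁ lower-r))
      same-tableau (aligned (inj₂ c≡) _) = contradiction (≡.sym c≡) (ℕ.<⇒≢ (proj₂ lower-r))
      same-tableau (swaps _ _ eq) = exchange-adjacent {i = r} {T = tab X} rs p≡ p′≡ eq

  Invariant : Vertex → M → Set (k ⊔ ℓk)
  Invariant (datum X) f = Traced X f
  Invariant ∅         f = ⊤

  traced : ∀ {T Y} (p : Path T Y) → Invariant Y (𝐏 p)
  traced {T} [] = record
    { ranked   = IsRank-replicate N
    ; spectrum = λ j → trans (reflexive (Vec.lookup∘tabulate (λ j → s ^ᶻ CT (filling T) j) j)) (sym (spec-root T j))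
    ; value    = ≋-sym (≋-trans (≋-reflexive (P-root T)) (constant-⟨⟩ T))
    }
  traced (_▷_ {X} p affine) = record
    { ranked   = IsRank-rotate (ranked tr)
    ; spectrum = rotated-spectrum
    ; value    = ≋-trans (Φ-fun (𝐏 p)) (≋-trans (cong Φᴸ (value tr)) (≋-reflexive (≡.sym (P-rotate (v X) (tab X)))))
    }
    where
    tr = traced p
    rotated-spectrum : ∀ j → lookup (rotate (ζ X) (q *_)) j ≈ spec (rotate (v X) suc) (tab X) j
    rotated-spectrum j with view j
    ... | ‵inject₁ i = trans (reflexive (lookup-rotate-inject₁ (ζ X) (q *_) i))
                        (trans (spectrum tr (Fin.suc i)) (reflexive (≡.sym (spec-rotate-inject₁ (v X) (tab X) i))))
    ... | ‵fromℕ     = trans (reflexive (lookup-rotate-fromℕ (ζ X) (q *_)))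
                        (trans (*-congˡ (spectrum tr Fin.zero)) (sym (spec-rotate-last (v X) (tab X))))
  traced (_▷_ {X} p (step {i} lt)) = traced-move tr (ascent lt) refl (IsRank-swap i (ℕ.<⇒≢ lt) (ranked tr))
    (≡.trans (·s-distinct X i (ℕ.<⇒≢ lt)) (≡.cong₂ (mkDatum (tab X) (ζ X s[ i ])) (s[]-swap i (v X)) (s[]-swap i (σ X))))
    where tr = traced p
  traced (_▷_ {X} p (jump {i} v≡ rs gap)) = traced-jump {X} v≡ rs gap (traced p) (IsRank-adjacent i v≡ (ranked (traced p)))
  traced (p ▷ fall _) = _

  eigenfunction : ∀ z {v₀ T f} → (∀ j → lookup z j ≈ spec v₀ T j) → f ≋ P v₀ T → IsSimultaneousEigenfunction z f
  eigenfunction z {v₀} {T} {f} h eq =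
      (λ f≈0 → Faithful⇒≉ (Faithful-resp (≋-sym eq) (Faithful-P v₀ T)) (pointwise f≈0))
    , λ i → at (≋-trans (Ξ-fun i f) (≋-trans (Eigen-resp (λ j → sym (h j)) (≋-sym eq) (Eigen-P v₀ T) i) (≋-sym (•-lists refl ≋-refl))))

  module Reachability (T-lam : Tab lam) (first : ColumnByColumn T-lam) where

    Reachable : Datum → Set (k ⊔ ℓk)
    Reachable X = ∃ λ (p : Path T-lam (datum X)) → NoFall p

    -- The spectral vector is left open here, since `traced` determines it along every path.
    Reaches : Monomial → Tab lam → Set (k ⊔ ℓk)
    Reaches w T = ∃ λ z → Reachable (mkDatum T z w (rank w))

    private
      0ᴺ : Monomial
      0ᴺ = replicate N 0

    reach-jump : ∀ T T₀ i → Higher T i → cells T₀ ≡ swap i (cells T) → Reaches 0ᴺ T₀ → Reaches 0ᴺ T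
    reach-jump T T₀ i (r< , c<) eq (z , p , nf) = z s[ i ] , ≡.subst Reachable moved (p ▷ jump v≡ rs gap , nf)
      where
      X : Datum
      X = mkDatum T₀ z 0ᴺ (rank 0ᴺ)
      v≡ : lookup 0ᴺ (inject₁ i) ≡ lookup 0ᴺ (Fin.suc i)
      v≡ = ≡.trans (Vec.lookup-replicate (inject₁ i) 0) (≡.sym (Vec.lookup-replicate (Fin.suc i) 0))
      σ≡ : ∀ j → lookup (rank 0ᴺ) j ≡ j
      σ≡ j = ≡.trans (≡.cong (λ σ → lookup σ j) (rank-replicate n)) (Vec.lookup-allFin j)
      pos-p : pos T₀ (inject₁ i) ≡ pos T (Fin.suc i)
      pos-p = ≡.trans (≡.cong (λ u → lookup u (inject₁ i)) eq) (lookup-swap-inject₁ i (cells T))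
      pos-p′ : pos T₀ (Fin.suc i) ≡ pos T (inject₁ i)
      pos-p′ = ≡.trans (≡.cong (λ u → lookup u (Fin.suc i)) eq) (lookup-swap-suc i (cells T))
      r<₀ : rowᵀ T₀ (inject₁ i) ℕ.< rowᵀ T₀ (Fin.suc i)
      r<₀ = ≡.subst₂ ℕ._<_ (≡.cong proj₂ (≡.sym pos-p)) (≡.cong proj₂ (≡.sym pos-p′)) r<
      c<₀ : colᵀ T₀ (Fin.suc i) ℕ.< colᵀ T₀ (inject₁ i)
      c<₀ = ≡.subst₂ ℕ._<_ (≡.cong proj₁ (≡.sym pos-p′)) (≡.cong proj₁ (≡.sym pos-p)) c<
      gap : + 2 ℤ.≤ CTᵀ T₀ (lookup (rank 0ᴺ) (inject₁ i)) ℤ.- CTᵀ T₀ (lookup (rank 0ᴺ) (Fin.suc i))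
      gap = ≡.subst₂ (λ a b → + 2 ℤ.≤ CTᵀ T₀ a ℤ.- CTᵀ T₀ b) (≡.sym (σ≡ _)) (≡.sym (σ≡ _))
        (≤-difference {colᵀ T₀ (inject₁ i)} {rowᵀ T₀ (inject₁ i)} {colᵀ T₀ (Fin.suc i)} {rowᵀ T₀ (Fin.suc i)} c<₀ r<₀)
      rs : IsReverseStandard (tab^ X i)
      rs = ≡.subst₂ (λ a b → IsReverseStandard (exchangeᶠ a b (filling T₀))) (≡.sym (σ≡ _)) (≡.sym (σ≡ _))
        (exchange-reverseStandard (filling T₀) i (ℕ.<⇒≢ r<₀) (λ e → ℕ.<⇒≢ c<₀ (≡.sym e)) (reverseStandard T₀))
      back : cells T ≡ swap i (cells T₀)
      back = ≡.trans (≡.sym (swap-involutive i (cells T))) (≡.cong (swap i) (≡.sym eq))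
      moved : X ·s[ i ] ≡ mkDatum T (z s[ i ]) 0ᴺ (rank 0ᴺ)
      moved = ≡.trans (·s-equal X i v≡ rs) (≡.cong (λ T → mkDatum T (z s[ i ]) 0ᴺ (rank 0ᴺ))
        (exchange-adjacent {i = i} {T = T₀} rs (σ≡ (inject₁ i)) (σ≡ (Fin.suc i)) back))

    private
      rows : Tab lam → Vec ℕ N
      rows T = Vec.map proj₂ (cells T)

      map-swap : ∀ {m} i (u : Vec Cell (suc m)) → Vec.map proj₂ (swap i u) ≡ swap i (Vec.map proj₂ u)
      map-swap Fin.zero    (x ∷ y ∷ u) = ≡.refl
      map-swap (Fin.suc i) (x ∷ u)     = ≡.cong (proj₂ x ∷_) (map-swap i u)

      rows-descent : ∀ T T₀ i → Higher T i → cells T₀ ≡ swap i (cells T) → weight (rows T₀) ℕ.< weight (rows T)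
      rows-descent T T₀ i (r< , _) eq = ≡.subst (λ u → weight u ℕ.< weight (rows T)) (≡.sym (≡.trans (≡.cong (Vec.map proj₂) eq) (map-swap i (cells T))))
        (weight-descent i (rows T) (≡.subst₂ ℕ._<_ (≡.sym (Vec.lookup-map (Fin.suc i) proj₂ (cells T))) (≡.sym (Vec.lookup-map (inject₁ i) proj₂ (cells T))) r<))

      cells-exchanged : ∀ T i → Higher T i → Exchange i T → cells (exchanged i T) ≡ swap i (cells T)
      cells-exchanged T i (r< , c<) (aligned (inj₁ r≡) _) = contradiction (≡.sym r≡) (ℕ.<⇒≢ r<)
      cells-exchanged T i (r< , c<) (aligned (inj₂ c≡) _) = contradiction c≡ (ℕ.<⇒≢ c<)
      cells-exchanged T i (r< , c<) (swaps _ _ eq)        = eq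

    -- As long as some entry i stands higher than i + 1, exchanging them gives a tableau from which
    -- `T` is one jump away; this lowers the weight of the vector of rows and can stop only at the
    -- column by column tableau.
    reach-root : ∀ T → Reaches 0ᴺ T
    reach-root T = go (suc (weight (rows T))) T ℕ.≤-refl
      where
      go : ∀ d T → weight (rows T) ℕ.< d → Reaches 0ᴺ T
      next : ∀ d T → weight (rows T) ℕ.≤ d → ColumnByColumn T ⊎ ∃ (Higher T) → Reaches 0ᴺ T
      go (suc d) T (ℕ.s≤s le) = next d T le (columnByColumn-or-higher T)
      next d T le (inj₂ (i , h)) = reach-jump T T₀ i h eq (go d T₀ (ℕ.<-≤-trans (rows-descent T T₀ i h eq) le))
        where
        T₀ = exchanged i T
        eq = cells-exchanged T i h (exchange-cases i T)
      next d T le (inj₁ cc) = ζ (rootAt T-lam) , ≡.subst₂ (λ T σ → Reachable (mkDatum T (ζ (rootAt T-lam)) 0ᴺ σ)) (ColumnByColumn-unique {T-lam} {T} first cc) (≡.sym (rank-replicate n)) ([] , _)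

    -- The canonical derivation of the exponent vector, read as a sequence of arrows: rotations are
    -- affine arrows and swaps are steps.
    reach : ∀ {w} → Canonical w → ∀ T → Reaches w T
    reach (root ≡.refl)         T = reach-root T
    reach (rotated u ≡.refl cn) T = reach-rotate (reach cn T)
      where
      reach-rotate : Reaches u T → Reaches (rotate u suc) T
      reach-rotate (z , p , nf) = rotate z (q *_) ,
        ≡.subst (λ σ → Reachable (mkDatum T (rotate z (q *_)) (rotate u suc) σ)) (≡.sym (rank-rotate u)) (p ▷ affine , nf)
    reach {w} (swapped j la cn) T = reach-step (reach cn T)
      where
      u = swap j w
      lt : lookup u (inject₁ j) ℕ.< lookup u (Fin.suc j)
      lt = ≡.subst₂ ℕ._<_ (≡.sym (lookup-swap-inject₁ j w)) (≡.sym (lookup-swap-suc j w)) (LastAt-descent w la)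
      u-back : u s[ j ] ≡ w
      u-back = ≡.trans (s[]-swap j u) (swap-involutive j w)
      rank-back : rank u s[ j ] ≡ rank w
      rank-back = ≡.trans (s[]-swap j (rank u)) (≡.trans (≡.sym (rank-swap j u (ℕ.<⇒≢ lt))) (≡.cong rank (swap-involutive j w)))
      reach-step : Reaches u T → Reaches w T
      reach-step (z , p , nf) = z s[ j ] , ≡.subst Reachable
        (≡.trans (·s-distinct (mkDatum T z u (rank u)) j (ℕ.<⇒≢ lt)) (≡.cong₂ (mkDatum T (z s[ j ])) u-back rank-back))
        (p ▷ step lt , nf)

open import Data.Nat.Base using (_+_)

theorem4p1 :
  ∀ {c ℓ k ℓk} {C : Field c ℓ} (𝕂 : RationalFunctionField C k ℓk)
    {n} (lam : Partition (2 + n)) →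
  let open Macdonald 𝕂 lam in
    (∀ {root X} (p : Path root (datum X)) → NoFall p →
       IsSimultaneousEigenfunction (ζ X) (𝐏 p))
  × ∃ λ (P : Monomial × Tab lam → M) →
      (∀ {root X} (p : Path root (datum X)) → NoFall p → 𝐏 p ≈ᴹ P (v X , tab X))
    × (∀ (T-lam : Tab lam) → ColumnByColumn T-lam → ∀ w T →
         ∃ λ X → (v X ≡ w × tab X ≡ T) × ∃ λ (p : Path T-lam (datum X)) → NoFall p)
    × IsBasis P
    × (∀ b → ∃ λ z → IsSimultaneousEigenfunction z (P b))
theorem4p1 {C = C} 𝕂 lam =
    (λ {_} {X} p _ → eigenfunction (ζ X) {v X} {tab X} (Traced.spectrum (traced p)) (Traced.value (traced p)))
  , Pᴮ
  , (λ p _ → at (Traced.value (traced p)))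
  , (λ T-lam first w T → let z , p , nf = Reachability.reach T-lam first (canonical w) T in _ , (≡.refl , ≡.refl) , p , nf)
  , ((λ f h → at (P-independent f (pointwise h))) , λ g → let f , h = P-spans g in f , at h)
  , λ (w , T) → Vec.tabulate (spec w T) ,
      eigenfunction (Vec.tabulate (spec w T)) {w} {T} (λ j → Field.reflexive K (Vec.lookup∘tabulate (spec w T) j)) ≋-refl
  where
  open RationalFunctionField 𝕂 using (K)
  open Macdonald 𝕂 lam using (ζ; v; tab)
  open LinearMaps (Field.commutativeRing K)
  open Weights using (canonical)
  open Seminormal 𝕂 lam
  open Polynomials 𝕂 lam using (spec)
  open Basis 𝕂 lam using (Pᴮ; P-independent; P-spans)
  open Paths 𝕂 lam
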